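{- Let $u,v\in S_\infty$ be such that there exists an integer $p>0$ for which $\ell(us_i)>\ell(u)$ for all $i<p$ and $\ell(vs_i)>\ell(v)$ for all $i>p$. Then $$\mathfrak{S}_u(x;y)\,\mathfrak{S}_v(x;z)=\sum_{w\in S_\infty}e_{uv}^w(y;z)\,\mathfrak{S}_w(x;y).$$
   Context: **Permutations.** $\mathbb{N}=\{1,2,3,\dots\}$. $S_\infty$ is the group of bijections $\mathbb{N}\to\mathbb{N}$ fixing all but finitely many elements, with product $(uv)(i)=u(v(i))$ and identity $1$; $S_n\subset S_\infty$ is the subgroup of $u$ with $u(i)=i$ for $i>n$. $s_i$ ($i\ge 1$) is the transposition of $i$ and $i+1$; $t_{ab}=t_{ba}$ ($a\ne b$) is the transposition of $a$ and $b$. $\ell(u)$ is the number of pairs $i<j$ with $u(i)>u(j)$. **Double Schubert polynomials.** Work in the polynomial ring $\mathbb{Z}[x,y,z]$ in the variables $x_i,y_i,z_i$ ($i\in\mathbb{N}$). $s_i$ acts by the ring automorphism exchanging $x_i$ and $x_{i+1}$ and fixing all other variables. Put $\partial^{s_i}(P)=\frac{P-s_i(P)}{x_i-x_{i+1}}$, and $\partial^u=\partial^{s_{i_1}}\cdots\partial^{s_{i_m}}$ for any reduced word $u=s_{i_1}\cdots s_{i_m}$, $m=\ell(u)$ (independent of the choice). Let $w_0(n)\in S_{n+1}$ be given by $w_0(n)(i)=n+2-i$ for $i\le n+1$, and $\mathfrak{S}_{w_0(n)}(x;y)=\prod_{i,j\ge 1,\ i+j\le n+1}(x_i-y_j)$.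 For $u\in S_{n+1}$, $\mathfrak{S}_u(x;y)=\partial^{u^{ -1}w_0(n)}(\mathfrak{S}_{w_0(n)}(x;y))$ (independent of $n$). $\mathfrak{S}_v(x;z)$ is obtained by replacing each $y_j$ by $z_j$. **Code, dominant approximation.** The code of $v\in S_\infty$ is the sequence $\mathfrak{c}_i(v)=\#\{j>i\mid v(i)>v(j)\}$, $i\ge1$. $v$ is dominant if $\mathfrak{c}(v)$ is a partition (weakly decreasing). The dominant approximation $\mu_v$ is defined recursively: if $v$ is dominant, $\mu_v=v$; otherwise let $i$ be the maximal index with $\mathfrak{c}_i(v)<\mathfrak{c}_{i+1}(v)$ and put $\mu_v=\mu_{vs_i}$ (this terminates). $\lambda(v)$ is the partition conjugate to the code of $\mu_v$: $\lambda_i(v)=\#\{j\mid \mathfrak{c}_j(\mu_v)\ge i\}$. **The relation $\xrightarrow{k}$ and weights.** For $u,u'\in S_\infty$ and a positive integer $k$, write $u\xrightarrow{k}u'$ if there exist $p$ with $0\le p\le k$ and transpositions $t_{a_1b_1},\dots,t_{a_pb_p}$ such that (1) $a_i\le k<b_i$ for all $i$; (2) $a_i\ne a_j$ for $i\neq j$; (3) $\ell(ut_{a_1b_1}\cdots t_{a_ib_i})=\ell(u)+i$ for all $i$; (4) $u'=ut_{a_1b_1}\cdots t_{a_pb_p}$. If $u\xrightarrow{k}w$, let $P_k(u,w)=\{u(i)\mid i\le k,\ u(i)=w(i)\}$ and $\mathrm{weight}_{u,k}^w(y;z_j)=\prod_{i\in P_k(u,w)}(y_i-z_j)$ (empty product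 $=1$). For a partition $\lambda=(\lambda_1,\dots,\lambda_m)$ of length $m$, $\mathrm{Path}_\lambda(u,w)$ is the set of sequences $(u_0,\dots,u_m)$ in $S_\infty$ with $u=u_0\xrightarrow{\lambda_1}u_1\xrightarrow{\lambda_2}\cdots\xrightarrow{\lambda_m}u_m=w$, and for such a path $P$, $\mathrm{weight}_{P,\lambda}(y;z)=\prod_{i=1}^m\mathrm{weight}_{u_{i-1},\lambda_i}^{u_i}(y;z_i)$. **The coefficients.** $d_{u,\lambda}^w(y;z)=\sum_{P\in\mathrm{Path}_\lambda(u,w)}\mathrm{weight}_{P,\lambda}(y;z)$. For $u,v,w\in S_\infty$: if $\ell(wv^{ -1}\mu_v)=\ell(w)+\ell(v^{ -1}\mu_v)$ then $e_{uv}^w(y;z)=d_{u,\lambda(v)}^{wv^{ -1}\mu_v}(y;z)$; otherwise $e_{uv}^w(y;z)=0$. -}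

module Defs where

open import Level using (0ℓ)
open import Algebra.Bundles using (CommutativeRing)
import Algebra.Properties.Ring as RingProperties
open import Data.Bool.Base using (if_then_else_)
open import Data.Empty using (⊥-elim)
open import Data.List.Base
  using (List; []; _∷_; [_]; _++_; _∷ʳ_; length; map; foldr; foldl; filter; concatMap;
         cartesianProduct; take; upTo; deduplicate)
open import Data.List.Properties using (length-++; length-map; length-upTo; foldr-∷ʳ)
open import Data.List.Membership.Propositional using (_∈_; find; lose)
import Data.List.Membership.Setoid as SetoidMembership
import Data.List.Membership.Setoid.Properties as SetoidMembershipₚ
open import Data.List.Membership.Propositional.Properties
  using (∈-map⁺; ∈-map⁻; ∈-++⁺ˡ; ∈-++⁺ʳ; ∈-++⁻; ∈-∃++; ∈-filter⁺; ∈-filter⁻;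
         ∈-upTo⁺; ∈-upTo⁻; ∈-cartesianProduct⁺; ∈-concatMap⁺; ∈-concatMap⁻)
open import Data.List.Relation.Binary.Pointwise using (Pointwise; []; _∷_)
import Data.List.Relation.Binary.Equality.DecSetoid as ListDecSetoid
open import Data.List.Relation.Unary.All as All using (All; []; _∷_)
open import Data.List.Relation.Unary.AllPairs using ([]; _∷_)
open import Data.List.Relation.Unary.Any as Any using (here; there)
open import Data.List.Relation.Unary.Unique.Propositional using () renaming (Unique to Unique≡)
import Data.List.Relation.Unary.Unique.Propositional.Properties as Unique≡ₚ
import Data.List.Relation.Unary.Unique.DecPropositional as DecUnique
import Data.List.Relation.Unary.Unique.Setoid as SetoidUnique
open import Data.List.Relation.Unary.Unique.DecSetoid.Properties using (deduplicate-!)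
open import Data.Nat.Base
open import Data.Nat.Properties
open import Data.Product.Base using (Σ; ∃; ∃-syntax; _×_; _,_; proj₁; proj₂)
open import Data.Product.Properties using (,-injectiveˡ; ,-injectiveʳ)
open import Data.Sum.Base using (_⊎_; inj₁; inj₂)
open import Function.Base using (_∘_; id)
open import Function.Bundles using (_↔_; mk↔ₛ′; Inverse)
open import Function.Construct.Composition using (_↔-∘_)
open import Function.Construct.Identity using (↔-id)
open import Function.Construct.Symmetry using (↔-sym)
open import Relation.Binary.Bundles using (Setoid; DecSetoid)
open import Relation.Binary.Definitions using (tri<; tri≈; tri>)
open import Relation.Binary.PropositionalEquality
  using (_≡_; _≢_; refl; sym; trans; cong; cong₂; subst; setoid; module ≡-Reasoning)
open import Relation.Nullary using (¬_; Dec; yes; no; does; contradiction)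
open import Relation.Nullary.Decidable using (_×-dec_; map′)
open import Relation.Unary using (Decidable)

record Enumeration (S : Setoid 0ℓ 0ℓ) (P : Setoid.Carrier S → Set) : Set where
  open SetoidMembership S using () renaming (_∈_ to _∈ₛ_)
  open SetoidUnique S using (Unique)
  field
    elements : List (Setoid.Carrier S)
    unique   : Unique elements
    sound    : ∀ {x} → x ∈ₛ elements → P x
    complete : ∀ {x} → P x → x ∈ₛ elements

  size : ℕ
  size = length elements

open Enumeration public

enumerateFrom : (D : DecSetoid 0ℓ 0ℓ) → let S = DecSetoid.setoid D in
  ∀ {P} (xs : List (Setoid.Carrier S)) →
  (∀ {x} → SetoidMembership._∈_ S x xs → P x) →
  (∀ {x} → P x → SetoidMembership._∈_ S x xs) →
  Enumeration S P
enumerateFrom D xs sd cp = record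
  { elements = deduplicate D._≟_ xs
  ; unique   = deduplicate-! D xs
  ; sound    = λ x∈ → sd (SetoidMembershipₚ.∈-deduplicate⁻ D.setoid D._≟_ xs x∈)
  ; complete = λ px → SetoidMembershipₚ.∈-deduplicate⁺ D.setoid D._≟_
                        (λ b≈c a≈b → D.trans a≈b (D.sym b≈c)) (cp px)
  }
  where module D = DecSetoid D

enumerateFilter : ∀ {A : Set} {P : A → Set} (P? : Decidable P) {xs : List A} →
  Unique≡ xs → (∀ {x} → P x → x ∈ xs) → Enumeration (setoid A) P
enumerateFilter P? {xs} u cp = record
  { elements = filter P? xs
  ; unique   = Unique≡ₚ.filter⁺ P? u
  ; sound    = λ x∈ → proj₂ (∈-filter⁻ P? {xs = xs} x∈)
  ; complete = λ px → ∈-filter⁺ P? (cp px) px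
  }

enumerateBelow : ∀ {P : ℕ → Set} (P? : Decidable P) n → (∀ {i} → P i → i < n) →
  Enumeration (setoid ℕ) P
enumerateBelow P? n b = enumerateFilter P? (Unique≡ₚ.upTo⁺ n) (∈-upTo⁺ ∘ b)

length-⊆ : ∀ {A : Set} {xs ys : List A} → Unique≡ xs → (∀ {x} → x ∈ xs → x ∈ ys) →
  length xs ≤ length ys
length-⊆ [] _ = z≤n
length-⊆ {A} {x ∷ xs} (x∉ ∷ u) sub with ∈-∃++ (sub (here refl))
... | as , bs , refl = begin
  suc (length xs)               ≤⟨ s≤s (length-⊆ u sub′) ⟩
  suc (length (as ++ bs))       ≡⟨ cong suc (length-++ as) ⟩
  suc (length as + length bs)   ≡⟨ +-suc (length as) (length bs) ⟨
  length as + suc (length bs)   ≡⟨ length-++ as ⟨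
  length (as ++ x ∷ bs)         ∎
  where
  open ≤-Reasoning
  sub′ : ∀ {z} → z ∈ xs → z ∈ as ++ bs
  sub′ z∈ with ∈-++⁻ as (sub (there z∈))
  ... | inj₁ p           = ∈-++⁺ˡ p
  ... | inj₂ (here refl) = contradiction refl (All.lookup x∉ z∈)
  ... | inj₂ (there p)   = ∈-++⁺ʳ as p

module _ {A B : Set} {P : A → Set} {Q : B → Set}
         (E : Enumeration (setoid A) P) (F : Enumeration (setoid B) Q)
         (f : A → B) (f-inj : ∀ {x y} → f x ≡ f y → x ≡ y) (f-maps : ∀ {x} → P x → Q (f x)) where

  private
    maps : ∀ {z} → z ∈ map f (elements E) → z ∈ elements F
    maps z∈ with ∈-map⁻ f z∈
    ... | _ , x∈ , refl = complete F (f-maps (sound E x∈))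

  size-injection : size E ≤ size F
  size-injection = subst (_≤ size F) (length-map f (elements E))
    (length-⊆ (Unique≡ₚ.map⁺ f-inj (unique E)) maps)

  size-injection-< : ∀ b → Q b → (∀ {x} → P x → b ≢ f x) → size E < size F
  size-injection-< b qb new = subst (_≤ size F) (cong suc (length-map f (elements E)))
    (length-⊆ (All.tabulate fresh ∷ Unique≡ₚ.map⁺ f-inj (unique E))
      λ { (here refl) → complete F qb ; (there z∈) → maps z∈ })
    where
    fresh : ∀ {z} → z ∈ map f (elements E) → b ≢ z
    fresh z∈ with ∈-map⁻ f z∈
    ... | _ , x∈ , refl = new (sound E x∈)

size-mono : ∀ {A : Set} {P Q : A → Set}
  (E : Enumeration (setoid A) P) (F : Enumeration (setoid A) Q) →
  (∀ {x} → P x → Q x) → size E ≤ size F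
size-mono E F sub = size-injection E F id id sub

-- All indices start at 0 instead of 1: permutations act on
-- {0,1,2,…}, s i exchanges i and i+1, and x, y, z, c and λ are indexed
-- from 0.  Thus "i ≤ k" for a number k of positions becomes i < k.

-- Equality on S∞ is _≈_ below, which ignores the choice of bound.
record S∞ : Set where
  no-eta-equality
  field
    perm  : ℕ ↔ ℕ
    bound : ℕ
    fixes : ∀ {i} → bound ≤ i → Inverse.to perm i ≡ i

open S∞ public

infixl 8 _⟨$⟩_
_⟨$⟩_ : S∞ → ℕ → ℕ
u ⟨$⟩ i = Inverse.to (perm u) i

infix 4 _≈_
record _≈_ (u v : S∞) : Set where
  constructor pointwise
  field at : ∀ i → u ⟨$⟩ i ≡ v ⟨$⟩ i

open _≈_ public

infix 4 _∈S_
_∈S_ : S∞ → ℕ → Set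
u ∈S n = ∀ {i} → n ≤ i → u ⟨$⟩ i ≡ i

_≈?_ : ∀ u v → Dec (u ≈ v)
u ≈? v = map′
  (λ (h : ∀ {i} → i < bound u ⊔ bound v → u ⟨$⟩ i ≡ v ⟨$⟩ i) → pointwise (extend h))
  (λ u≈v {i} _ → at u≈v i)
  (allUpTo? (λ i → u ⟨$⟩ i ≟ v ⟨$⟩ i) (bound u ⊔ bound v))
  where
  extend : (∀ {i} → i < bound u ⊔ bound v → u ⟨$⟩ i ≡ v ⟨$⟩ i) → ∀ i → u ⟨$⟩ i ≡ v ⟨$⟩ i
  extend h i with i <? bound u ⊔ bound v
  ... | yes i< = h i<
  ... | no  i≮ = trans (fixes u (m⊔n≤o⇒m≤o (bound u) (bound v) (≮⇒≥ i≮)))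
                  (sym (fixes v (m⊔n≤o⇒n≤o (bound u) (bound v) (≮⇒≥ i≮))))

S∞-decSetoid : DecSetoid 0ℓ 0ℓ
S∞-decSetoid = record
  { Carrier = S∞
  ; _≈_     = _≈_
  ; isDecEquivalence = record
    { isEquivalence = record
      { refl  = pointwise λ _ → refl
      ; sym   = λ p → pointwise λ i → sym (at p i)
      ; trans = λ p q → pointwise λ i → trans (at p i) (at q i)
      }
    ; _≟_ = _≈?_
    }
  }

open DecSetoid S∞-decSetoid public
  using () renaming (setoid to S∞-setoid; refl to ≈-refl; sym to ≈-sym; trans to ≈-trans)

𝟙 : S∞
𝟙 .perm    = ↔-id ℕ
𝟙 .bound   = 0
𝟙 .fixes _ = refl

infixl 7 _∙_
_∙_ : S∞ → S∞ → S∞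
(u ∙ v) .perm    = perm u ↔-∘ perm v
(u ∙ v) .bound   = bound u ⊔ bound v
(u ∙ v) .fixes b = trans
  (cong (u ⟨$⟩_) (fixes v (m⊔n≤o⇒n≤o (bound u) (bound v) b)))
  (fixes u (m⊔n≤o⇒m≤o (bound u) (bound v) b))

infix 9 _⁻¹
_⁻¹ : S∞ → S∞
(u ⁻¹) .perm        = ↔-sym (perm u)
(u ⁻¹) .bound       = bound u
(u ⁻¹) .fixes {i} b = trans (cong (Inverse.from (perm u)) (sym (fixes u b)))
                            (Inverse.strictlyInverseʳ (perm u) i)

⟨$⟩-injective : ∀ u {i j} → u ⟨$⟩ i ≡ u ⟨$⟩ j → i ≡ j
⟨$⟩-injective u {i} {j} eq = trans (sym (Inverse.strictlyInverseʳ (perm u) i))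
  (trans (cong (Inverse.from (perm u)) eq) (Inverse.strictlyInverseʳ (perm u) j))

∙-congʳ : ∀ {u u′} v → u ≈ u′ → u ∙ v ≈ u′ ∙ v
∙-congʳ v p = pointwise λ i → at p (v ⟨$⟩ i)

swap : ℕ → ℕ → ℕ → ℕ
swap a b i with i ≟ a | i ≟ b
... | yes _ | _     = b
... | no  _ | yes _ = a
... | no  _ | no  _ = i

swap-left : ∀ a b → swap a b a ≡ b
swap-left a b with a ≟ a | a ≟ b
... | yes _ | _ = refl
... | no ¬p | _ = contradiction refl ¬p

swap-right : ∀ a b → swap a b b ≡ a
swap-right a b with b ≟ a | b ≟ b
... | yes b≡a | _     = b≡a
... | no _    | yes _ = refl
... | no _    | no ¬p = contradiction refl ¬p

swap-other : ∀ a b {i} → i ≢ a → i ≢ b → swap a b i ≡ i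
swap-other a b {i} i≢a i≢b with i ≟ a | i ≟ b
... | yes p | _     = contradiction p i≢a
... | no _  | yes q = contradiction q i≢b
... | no _  | no _  = refl

swap-involutive : ∀ a b i → swap a b (swap a b i) ≡ i
swap-involutive a b i with i ≟ a | i ≟ b
... | yes refl | _        = swap-right i b
... | no _     | yes refl = swap-left a i
... | no i≢a   | no i≢b   = swap-other a b i≢a i≢b

t : ℕ → ℕ → S∞
t a b .perm        = mk↔ₛ′ (swap a b) (swap a b) (swap-involutive a b) (swap-involutive a b)
t a b .bound       = suc (a ⊔ b)
t a b .fixes a⊔b<i = swap-other a b
  (λ i≡a → <⇒≢ (≤-<-trans (m≤m⊔n a b) a⊔b<i) (sym i≡a))
  (λ i≡b → <⇒≢ (≤-<-trans (m≤n⊔m a b) a⊔b<i) (sym i≡b))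

s : ℕ → S∞
s i = t i (suc i)

Inversion : S∞ → ℕ × ℕ → Set
Inversion u (i , j) = i < j × u ⟨$⟩ j < u ⟨$⟩ i

inversion-bound : ∀ u n → u ∈S n → ∀ {i j} → Inversion u (i , j) → j < n
inversion-bound u n u∈ {i} {j} (i<j , uj<ui) with j <? n
... | yes j<n = j<n
... | no  j≮n = contradiction i<j (<-asym j<i)
  where
  n≤j : n ≤ j
  n≤j = ≮⇒≥ j≮n
  j<ui : j < u ⟨$⟩ i
  j<ui = subst (_< u ⟨$⟩ i) (u∈ n≤j) uj<ui
  ui≡i : u ⟨$⟩ i ≡ i
  ui≡i = ⟨$⟩-injective u (u∈ (≤-trans n≤j (<⇒≤ j<ui)))
  j<i : j < i
  j<i = subst (j <_) ui≡i j<ui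

inversion? : ∀ u → Decidable (Inversion u)
inversion? u (i , j) = (i <? j) ×-dec (u ⟨$⟩ j <? u ⟨$⟩ i)

inversions : ∀ u → Enumeration (setoid (ℕ × ℕ)) (Inversion u)
inversions u = enumerateFilter (inversion? u)
  (Unique≡ₚ.cartesianProduct⁺ (Unique≡ₚ.upTo⁺ (bound u)) (Unique≡ₚ.upTo⁺ (bound u)))
  λ inv → let j<n = inversion-bound u (bound u) (fixes u) inv in
    ∈-cartesianProduct⁺ (∈-upTo⁺ (<-trans (proj₁ inv) j<n)) (∈-upTo⁺ j<n)

ℓ : S∞ → ℕ
ℓ u = size (inversions u)

codeSet : ∀ v i → Enumeration (setoid ℕ) (λ j → i < j × v ⟨$⟩ j < v ⟨$⟩ i)
codeSet v i = enumerateBelow (λ j → (i <? j) ×-dec (v ⟨$⟩ j <? v ⟨$⟩ i)) (bound v)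
  (inversion-bound v (bound v) (fixes v))

code : S∞ → ℕ → ℕ
code v i = size (codeSet v i)

ℓ-cong-≤ : ∀ {u v} → u ≈ v → ℓ u ≤ ℓ v
ℓ-cong-≤ {u} {v} p = size-mono (inversions u) (inversions v)
  λ { {i , j} (i<j , lt) → i<j , subst (_< v ⟨$⟩ i) (at p j) (subst (u ⟨$⟩ j <_) (at p i) lt) }

ℓ-cong : ∀ {u v} → u ≈ v → ℓ u ≡ ℓ v
ℓ-cong p = ≤-antisym (ℓ-cong-≤ p) (ℓ-cong-≤ (≈-sym p))

s-monotone : ∀ i {a b} → a < b → ¬ (a ≡ i × b ≡ suc i) → s i ⟨$⟩ a < s i ⟨$⟩ b
s-monotone i {a} {b} a<b ≢ with a ≟ i | a ≟ suc i | b ≟ i | b ≟ suc i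
... | yes p    | _        | _        | yes q    = contradiction (p , q) ≢
... | yes refl | _        | yes refl | no _     = contradiction a<b (n≮n i)
... | yes refl | _        | no _     | no b≢    = ≤∧≢⇒< a<b (b≢ ∘ sym)
... | no _     | yes refl | yes refl | _        = contradiction a<b (<-asym (n<1+n i))
... | no _     | yes refl | no _     | yes refl = contradiction a<b (n≮n (suc i))
... | no _     | yes refl | no _     | no _     = <-trans (n<1+n i) a<b
... | no _     | no _     | yes refl | _        = <-trans a<b (n<1+n i)
... | no a≢i   | no _     | no _     | yes refl = ≤∧≢⇒< (≤-pred a<b) a≢i
... | no _     | no _     | no _     | no _     = a<b

sPair : ℕ → ℕ × ℕ → ℕ × ℕ
sPair i (a , b) = s i ⟨$⟩ a , s i ⟨$⟩ b

sPair-injective : ∀ i {p q} → sPair i p ≡ sPair i q → p ≡ q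
sPair-injective i eq =
  cong₂ _,_ (⟨$⟩-injective (s i) (,-injectiveˡ eq)) (⟨$⟩-injective (s i) (,-injectiveʳ eq))

s-involutive : ∀ i j → s i ⟨$⟩ (s i ⟨$⟩ j) ≡ j
s-involutive i = swap-involutive i (suc i)

ℓ-ascent-< : ∀ u i → u ⟨$⟩ i < u ⟨$⟩ suc i → ℓ u < ℓ (u ∙ s i)
ℓ-ascent-< u i asc =
  size-injection-< (inversions u) (inversions (u ∙ s i)) (sPair i) (sPair-injective i)
    maps (i , suc i) new fresh
  where
  notPair : ∀ {a b} → Inversion u (a , b) → ¬ (a ≡ i × b ≡ suc i)
  notPair (_ , lt) (refl , refl) = <-asym lt asc
  maps : ∀ {p} → Inversion u p → Inversion (u ∙ s i) (sPair i p)
  maps {a , b} inv@(a<b , lt) = s-monotone i a<b (notPair inv) ,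
    subst (_< u ⟨$⟩ (s i ⟨$⟩ (s i ⟨$⟩ a))) (cong (u ⟨$⟩_) (sym (s-involutive i b)))
      (subst (u ⟨$⟩ b <_) (cong (u ⟨$⟩_) (sym (s-involutive i a))) lt)
  new : Inversion (u ∙ s i) (i , suc i)
  new = n<1+n i ,
    subst (_< u ⟨$⟩ (s i ⟨$⟩ i)) (cong (u ⟨$⟩_) (sym (swap-right i (suc i))))
      (subst (u ⟨$⟩ i <_) (cong (u ⟨$⟩_) (sym (swap-left i (suc i)))) asc)
  fresh : ∀ {p} → Inversion u p → (i , suc i) ≢ sPair i p
  fresh {a , b} (a<b , _) eq = <-asym a<b (subst (_< a)
    (trans (sym (swap-right i (suc i))) (trans (cong (s i ⟨$⟩_) (,-injectiveʳ eq)) (s-involutive i b)))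
    (subst (i <_)
      (trans (sym (swap-left i (suc i))) (trans (cong (s i ⟨$⟩_) (,-injectiveˡ eq)) (s-involutive i a)))
      (n<1+n i)))

ℓ-ascent-≤ : ∀ u i → ℓ (u ∙ s i) ≤ suc (ℓ u)
ℓ-ascent-≤ u i = subst (_≤ suc (ℓ u)) (length-map (sPair i) (elements I))
    (length-⊆ {ys = (suc i , i) ∷ elements (inversions u)}
      (Unique≡ₚ.map⁺ (sPair-injective i) (unique I)) maps)
  where
  I : Enumeration (setoid (ℕ × ℕ)) (Inversion (u ∙ s i))
  I = inversions (u ∙ s i)
  maps : ∀ {q} → q ∈ map (sPair i) (elements I) → q ∈ (suc i , i) ∷ elements (inversions u)
  maps q∈ with ∈-map⁻ (sPair i) q∈
  ... | (a , b) , p∈ , refl with sound I p∈ | a ≟ i ×-dec b ≟ suc i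
  ...   | _ , _      | yes (refl , refl) = here (cong₂ _,_ (swap-left i (suc i)) (swap-right i (suc i)))
  ...   | a<b , lt   | no ≢              = there (complete (inversions u) (s-monotone i a<b ≢ , lt))

ℓ-ascent : ∀ u i → u ⟨$⟩ i < u ⟨$⟩ suc i → ℓ (u ∙ s i) ≡ suc (ℓ u)
ℓ-ascent u i asc = ≤-antisym (ℓ-ascent-≤ u i) (ℓ-ascent-< u i asc)

ℓ-descent : ∀ u i → u ⟨$⟩ suc i < u ⟨$⟩ i → ℓ u ≡ suc (ℓ (u ∙ s i))
ℓ-descent u i des = trans (ℓ-cong {u} {u ∙ s i ∙ s i} (pointwise λ j → cong (u ⟨$⟩_) (sym (s-involutive i j))))
  (ℓ-ascent (u ∙ s i) i
    (subst (_< u ⟨$⟩ (s i ⟨$⟩ suc i)) (cong (u ⟨$⟩_) (sym (swap-left i (suc i))))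
      (subst (u ⟨$⟩ suc i <_) (cong (u ⟨$⟩_) (sym (swap-right i (suc i)))) des)))

wordProduct : List ℕ → S∞
wordProduct = foldr (λ i w → s i ∙ w) 𝟙

record ReducedWord (u : S∞) : Set where
  field
    word     : List ℕ
    product≈ : wordProduct word ≈ u
    reduced  : length word ≡ ℓ u

open ReducedWord public

wordProduct-∷ʳ : ∀ r i → wordProduct (r ∷ʳ i) ≈ wordProduct r ∙ s i
wordProduct-∷ʳ []      i = pointwise λ _ → refl
wordProduct-∷ʳ (j ∷ r) i = pointwise λ k → cong (s j ⟨$⟩_) (at (wordProduct-∷ʳ r i) k)

increasing-≥ : ∀ (f : ℕ → ℕ) → (∀ i → f i < f (suc i)) → ∀ i → i ≤ f i
increasing-≥ f inc zero    = z≤n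
increasing-≥ f inc (suc i) = ≤-<-trans (increasing-≥ f inc i) (inc i)

increasing-< : ∀ (f : ℕ → ℕ) → (∀ i → f i < f (suc i)) → ∀ {i j} → i < j → f i < f j
increasing-< f inc {i} {suc j} (s≤s i≤j) with m≤n⇒m<n∨m≡n i≤j
... | inj₁ i<j  = <-trans (increasing-< f inc i<j) (inc j)
... | inj₂ refl = inc i

increasing⇒𝟙 : ∀ u → (∀ i → u ⟨$⟩ i < u ⟨$⟩ suc i) → u ≈ 𝟙
increasing⇒𝟙 u inc = pointwise λ i → ≤-antisym
  (subst (u ⟨$⟩ i ≤_) (Inverse.strictlyInverseʳ (perm u) i)
    (increasing-≥ (u ⁻¹ ⟨$⟩_) inc⁻¹ (u ⟨$⟩ i)))
  (increasing-≥ (u ⟨$⟩_) inc i)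
  where
  u∘u⁻¹ : ∀ j → u ⟨$⟩ (u ⁻¹ ⟨$⟩ j) ≡ j
  u∘u⁻¹ = Inverse.strictlyInverseˡ (perm u)
  inc⁻¹ : ∀ j → u ⁻¹ ⟨$⟩ j < u ⁻¹ ⟨$⟩ suc j
  inc⁻¹ j with <-cmp (u ⁻¹ ⟨$⟩ j) (u ⁻¹ ⟨$⟩ suc j)
  ... | tri< lt _ _ = lt
  ... | tri≈ _ eq _ = contradiction (⟨$⟩-injective (u ⁻¹) eq) (<⇒≢ (n<1+n j))
  ... | tri> _ _ gt = contradiction
    (subst (_< j) (u∘u⁻¹ (suc j)) (subst (u ⟨$⟩ (u ⁻¹ ⟨$⟩ suc j) <_) (u∘u⁻¹ j)
      (increasing-< (u ⟨$⟩_) inc gt)))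
    (<-asym (n<1+n j))

descent? : ∀ u → (∃[ i ] u ⟨$⟩ suc i < u ⟨$⟩ i) ⊎ u ≈ 𝟙
descent? u with anyUpTo? (λ i → u ⟨$⟩ suc i <? u ⟨$⟩ i) (bound u)
... | yes (i , _ , des) = inj₁ (i , des)
... | no none = inj₂ (increasing⇒𝟙 u inc)
  where
  inc : ∀ i → u ⟨$⟩ i < u ⟨$⟩ suc i
  inc i with <-cmp (u ⟨$⟩ i) (u ⟨$⟩ suc i)
  ... | tri< lt _ _ = lt
  ... | tri≈ _ eq _ = contradiction (⟨$⟩-injective u eq) (<⇒≢ (n<1+n i))
  ... | tri> _ _ gt = contradiction
    (i , <-trans (n<1+n i) (inversion-bound u (bound u) (fixes u) (n<1+n i , gt)) , gt) none

reducedWord′ : ∀ n u → ℓ u ≡ n → ReducedWord u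
reducedWord′ n u ℓu≡n with descent? u
... | inj₂ u≈𝟙 = record { word = [] ; product≈ = ≈-sym u≈𝟙 ; reduced = sym (ℓ-cong u≈𝟙) }
reducedWord′ zero    u ℓu≡0 | inj₁ (i , des) with trans (sym ℓu≡0) (ℓ-descent u i des)
... | ()
reducedWord′ (suc n) u ℓu≡n | inj₁ (i , des) = record
  { word     = word r ∷ʳ i
  ; product≈ = pointwise λ k → trans (at (wordProduct-∷ʳ (word r) i) k)
      (trans (at (product≈ r) (s i ⟨$⟩ k)) (cong (u ⟨$⟩_) (s-involutive i k)))
  ; reduced  = trans (length-++ (word r))
      (trans (+-comm (length (word r)) 1) (trans (cong suc (reduced r)) (sym (ℓ-descent u i des))))
  }
  where
  r : ReducedWord (u ∙ s i)
  r = reducedWord′ n (u ∙ s i) (suc-injective (trans (sym (ℓ-descent u i des)) ℓu≡n))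

reducedWord : ∀ u → ReducedWord u
reducedWord u = reducedWord′ (ℓ u) u refl

-- ℤ[V], presented as the free commutative ring on V: ring expressions
-- modulo the congruence generated by the ring axioms.  The universal
-- property is ⟦_⟧ and ⟦⟧-cong.

infixl 6 _+ₚ_ _-ₚ_
infixl 7 _*ₚ_
infix  8 -ₚ_
infix  4 _≈ₚ_

data Poly (V : Set) : Set where
  var       : V → Poly V
  0ₚ 1ₚ     : Poly V
  _+ₚ_ _*ₚ_ : Poly V → Poly V → Poly V
  -ₚ_       : Poly V → Poly V

data _≈ₚ_ {V : Set} : Poly V → Poly V → Set where
  reflₚ       : ∀ {p} → p ≈ₚ p
  symₚ        : ∀ {p q} → p ≈ₚ q → q ≈ₚ p
  transₚ      : ∀ {p q r} → p ≈ₚ q → q ≈ₚ r → p ≈ₚ r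
  +-congₚ     : ∀ {p p′ q q′} → p ≈ₚ p′ → q ≈ₚ q′ → p +ₚ q ≈ₚ p′ +ₚ q′
  *-congₚ     : ∀ {p p′ q q′} → p ≈ₚ p′ → q ≈ₚ q′ → p *ₚ q ≈ₚ p′ *ₚ q′
  -‿congₚ     : ∀ {p p′} → p ≈ₚ p′ → -ₚ p ≈ₚ -ₚ p′
  +-assocₚ    : ∀ p q r → (p +ₚ q) +ₚ r ≈ₚ p +ₚ (q +ₚ r)
  +-commₚ     : ∀ p q → p +ₚ q ≈ₚ q +ₚ p
  +-identityₚ : ∀ p → 0ₚ +ₚ p ≈ₚ p
  +-inverseₚ  : ∀ p → (-ₚ p) +ₚ p ≈ₚ 0ₚ
  *-assocₚ    : ∀ p q r → (p *ₚ q) *ₚ r ≈ₚ p *ₚ (q *ₚ r)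
  *-commₚ     : ∀ p q → p *ₚ q ≈ₚ q *ₚ p
  *-identityₚ : ∀ p → 1ₚ *ₚ p ≈ₚ p
  distribₚ    : ∀ p q r → p *ₚ (q +ₚ r) ≈ₚ (p *ₚ q) +ₚ (p *ₚ r)

_-ₚ_ : ∀ {V} → Poly V → Poly V → Poly V
p -ₚ q = p +ₚ (-ₚ q)

polyRing : Set → CommutativeRing 0ℓ 0ℓ
polyRing V = record
  { Carrier = Poly V
  ; _≈_ = _≈ₚ_
  ; _+_ = _+ₚ_
  ; _*_ = _*ₚ_
  ; -_  = -ₚ_
  ; 0#  = 0ₚ
  ; 1#  = 1ₚ
  ; isCommutativeRing = record
    { isRing = record
      { +-isAbelianGroup = record
        { isGroup = record
          { isMonoid = record
            { isSemigroup = record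
              { isMagma = record
                { isEquivalence = record { refl = reflₚ ; sym = symₚ ; trans = transₚ }
                ; ∙-cong = +-congₚ
                }
              ; assoc = +-assocₚ
              }
            ; identity = +-identityₚ , λ p → transₚ (+-commₚ p 0ₚ) (+-identityₚ p)
            }
          ; inverse = +-inverseₚ , λ p → transₚ (+-commₚ p (-ₚ p)) (+-inverseₚ p)
          ; ⁻¹-cong = -‿congₚ
          }
        ; comm = +-commₚ
        }
      ; *-cong = *-congₚ
      ; *-assoc = *-assocₚ
      ; *-identity = *-identityₚ , λ p → transₚ (*-commₚ p 1ₚ) (*-identityₚ p)
      ; distrib = distribₚ , λ p q r → transₚ (*-commₚ (q +ₚ r) p)
          (transₚ (distribₚ p q r) (+-congₚ (*-commₚ p q) (*-commₚ p r)))
      }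
    ; *-comm = *-commₚ
    }
  }

module Evaluation (R : CommutativeRing 0ℓ 0ℓ) {V : Set} (ρ : V → CommutativeRing.Carrier R) where
  private module R = CommutativeRing R

  ⟦_⟧ : Poly V → R.Carrier
  ⟦ var a ⟧  = ρ a
  ⟦ 0ₚ ⟧     = R.0#
  ⟦ 1ₚ ⟧     = R.1#
  ⟦ p +ₚ q ⟧ = ⟦ p ⟧ R.+ ⟦ q ⟧
  ⟦ p *ₚ q ⟧ = ⟦ p ⟧ R.* ⟦ q ⟧
  ⟦ -ₚ p ⟧   = R.- ⟦ p ⟧

  ⟦⟧-cong : ∀ {p q} → p ≈ₚ q → ⟦ p ⟧ R.≈ ⟦ q ⟧
  ⟦⟧-cong reflₚ             = R.refl
  ⟦⟧-cong (symₚ e)          = R.sym (⟦⟧-cong e)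
  ⟦⟧-cong (transₚ e f)      = R.trans (⟦⟧-cong e) (⟦⟧-cong f)
  ⟦⟧-cong (+-congₚ e f)     = R.+-cong (⟦⟧-cong e) (⟦⟧-cong f)
  ⟦⟧-cong (*-congₚ e f)     = R.*-cong (⟦⟧-cong e) (⟦⟧-cong f)
  ⟦⟧-cong (-‿congₚ e)       = R.-‿cong (⟦⟧-cong e)
  ⟦⟧-cong (+-assocₚ p q r)  = R.+-assoc _ _ _
  ⟦⟧-cong (+-commₚ p q)     = R.+-comm _ _
  ⟦⟧-cong (+-identityₚ p)   = R.+-identityˡ _
  ⟦⟧-cong (+-inverseₚ p)    = R.-‿inverseˡ _
  ⟦⟧-cong (*-assocₚ p q r)  = R.*-assoc _ _ _
  ⟦⟧-cong (*-commₚ p q)     = R.*-comm _ _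
  ⟦⟧-cong (*-identityₚ p)   = R.*-identityˡ _
  ⟦⟧-cong (distribₚ p q r)  = R.distribˡ _ _ _

rename : ∀ {V W} → (V → W) → Poly V → Poly W
rename {W = W} f = Evaluation.⟦_⟧ (polyRing W) (var ∘ f)

∑ ∏ : ∀ {V} {A : Set} → List A → (A → Poly V) → Poly V
∑ as f = foldr (λ a p → f a +ₚ p) 0ₚ as
∏ as f = foldr (λ a p → f a *ₚ p) 1ₚ as

data Var : Set where
  X Y Z : ℕ → Var

ℤ[x,y,z] : Set
ℤ[x,y,z] = Poly Var

x y z : ℕ → ℤ[x,y,z]
x i = var (X i)
y i = var (Y i)
z i = var (Z i)

sVar : ℕ → Var → Var
sVar i (X j) = X (s i ⟨$⟩ j)
sVar i (Y j) = Y j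
sVar i (Z j) = Z j

act : ℕ → ℤ[x,y,z] → ℤ[x,y,z]
act i = rename (sVar i)

module _ (i : ℕ) where
  private
    module P = CommutativeRing (polyRing Var)
    module Pₚ = RingProperties P.ring
    open import Relation.Binary.Reasoning.Setoid P.setoid

    δ : ℤ[x,y,z]
    δ = x i -ₚ x (suc i)

    fixed : ∀ p → δ *ₚ 0ₚ ≈ₚ p -ₚ p
    fixed p = transₚ (P.zeroʳ δ) (symₚ (P.-‿inverseʳ p))

    interchange : ∀ a b c d → (a -ₚ b) +ₚ (c -ₚ d) ≈ₚ (a +ₚ c) -ₚ (b +ₚ d)
    interchange a b c d = begin
      (a +ₚ -ₚ b) +ₚ (c +ₚ -ₚ d)   ≈⟨ +-assocₚ a (-ₚ b) (c +ₚ -ₚ d) ⟩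
      a +ₚ (-ₚ b +ₚ (c +ₚ -ₚ d))   ≈⟨ P.+-congˡ (symₚ (+-assocₚ (-ₚ b) c (-ₚ d))) ⟩
      a +ₚ ((-ₚ b +ₚ c) +ₚ -ₚ d)   ≈⟨ P.+-congˡ (P.+-congʳ (+-commₚ (-ₚ b) c)) ⟩
      a +ₚ ((c +ₚ -ₚ b) +ₚ -ₚ d)   ≈⟨ P.+-congˡ (+-assocₚ c (-ₚ b) (-ₚ d)) ⟩
      a +ₚ (c +ₚ (-ₚ b +ₚ -ₚ d))   ≈⟨ symₚ (+-assocₚ a c _) ⟩
      (a +ₚ c) +ₚ (-ₚ b +ₚ -ₚ d)   ≈⟨ P.+-congˡ (Pₚ.-‿+-comm b d) ⟩
      (a +ₚ c) -ₚ (b +ₚ d)         ∎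

    telescope : ∀ a b c → (a -ₚ b) +ₚ (b -ₚ c) ≈ₚ a -ₚ c
    telescope a b c = begin
      (a +ₚ -ₚ b) +ₚ (b +ₚ -ₚ c)   ≈⟨ +-assocₚ a (-ₚ b) (b +ₚ -ₚ c) ⟩
      a +ₚ (-ₚ b +ₚ (b +ₚ -ₚ c))   ≈⟨ P.+-congˡ (symₚ (+-assocₚ (-ₚ b) b (-ₚ c))) ⟩
      a +ₚ ((-ₚ b +ₚ b) +ₚ -ₚ c)   ≈⟨ P.+-congˡ (P.+-congʳ (+-inverseₚ b)) ⟩
      a +ₚ (0ₚ +ₚ -ₚ c)            ≈⟨ P.+-congˡ (+-identityₚ (-ₚ c)) ⟩
      a -ₚ c                       ∎

    quotientVar : ∀ j → ∃[ q ] δ *ₚ q ≈ₚ x j -ₚ x (s i ⟨$⟩ j)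
    quotientVar j with j ≟ i | j ≟ suc i
    ... | yes refl | _        = 1ₚ , P.*-identityʳ δ
    ... | no _     | yes refl = -ₚ 1ₚ , (begin
      δ *ₚ -ₚ 1ₚ               ≈⟨ symₚ (Pₚ.-‿distribʳ-* δ 1ₚ) ⟩
      -ₚ (δ *ₚ 1ₚ)             ≈⟨ -‿congₚ (P.*-identityʳ δ) ⟩
      -ₚ (x i -ₚ x (suc i))    ≈⟨ symₚ (Pₚ.-‿+-comm (x i) (-ₚ x (suc i))) ⟩
      -ₚ x i +ₚ -ₚ -ₚ x (suc i) ≈⟨ P.+-congˡ (Pₚ.-‿involutive (x (suc i))) ⟩
      -ₚ x i +ₚ x (suc i)      ≈⟨ +-commₚ (-ₚ x i) (x (suc i)) ⟩
      x (suc i) -ₚ x i         ∎)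
    ... | no _     | no _     = 0ₚ , fixed (x j)

  -- The quotient is unique because ℤ[x,y,z] is an integral domain.
  quotient : ∀ p → ∃[ q ] (x i -ₚ x (suc i)) *ₚ q ≈ₚ p -ₚ act i p
  quotient (var (X j)) = quotientVar j
  quotient (var (Y j)) = 0ₚ , fixed (y j)
  quotient (var (Z j)) = 0ₚ , fixed (z j)
  quotient 0ₚ = 0ₚ , fixed 0ₚ
  quotient 1ₚ = 0ₚ , fixed 1ₚ
  quotient (p +ₚ q) with quotient p | quotient q
  ... | p′ , ep | q′ , eq = p′ +ₚ q′ , (begin
    δ *ₚ (p′ +ₚ q′)                    ≈⟨ distribₚ δ p′ q′ ⟩
    (δ *ₚ p′) +ₚ (δ *ₚ q′)             ≈⟨ +-congₚ ep eq ⟩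
    (p -ₚ act i p) +ₚ (q -ₚ act i q)   ≈⟨ interchange p (act i p) q (act i q) ⟩
    (p +ₚ q) -ₚ (act i p +ₚ act i q)   ∎)
  quotient (p *ₚ q) with quotient p | quotient q
  ... | p′ , ep | q′ , eq = (p′ *ₚ q) +ₚ (act i p *ₚ q′) , (begin
    δ *ₚ ((p′ *ₚ q) +ₚ (act i p *ₚ q′))
      ≈⟨ distribₚ δ (p′ *ₚ q) (act i p *ₚ q′) ⟩
    (δ *ₚ (p′ *ₚ q)) +ₚ (δ *ₚ (act i p *ₚ q′))
      ≈⟨ +-congₚ (symₚ (*-assocₚ δ p′ q)) (transₚ (P.*-congˡ (*-commₚ (act i p) q′))
           (transₚ (symₚ (*-assocₚ δ q′ (act i p))) (*-commₚ (δ *ₚ q′) (act i p)))) ⟩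
    ((δ *ₚ p′) *ₚ q) +ₚ (act i p *ₚ (δ *ₚ q′))
      ≈⟨ +-congₚ (P.*-congʳ ep) (P.*-congˡ eq) ⟩
    ((p -ₚ act i p) *ₚ q) +ₚ (act i p *ₚ (q -ₚ act i q))
      ≈⟨ +-congₚ (Pₚ.[y-z]x≈yx-zx q p (act i p)) (Pₚ.x[y-z]≈xy-xz (act i p) q (act i q)) ⟩
    ((p *ₚ q) -ₚ (act i p *ₚ q)) +ₚ ((act i p *ₚ q) -ₚ (act i p *ₚ act i q))
      ≈⟨ telescope (p *ₚ q) (act i p *ₚ q) (act i p *ₚ act i q) ⟩
    (p *ₚ q) -ₚ (act i p *ₚ act i q) ∎)
  quotient (-ₚ p) with quotient p
  ... | p′ , ep = -ₚ p′ , (begin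
    δ *ₚ -ₚ p′             ≈⟨ symₚ (Pₚ.-‿distribʳ-* δ p′) ⟩
    -ₚ (δ *ₚ p′)           ≈⟨ -‿congₚ ep ⟩
    -ₚ (p -ₚ act i p)      ≈⟨ symₚ (Pₚ.-‿+-comm p (-ₚ act i p)) ⟩
    -ₚ p -ₚ (-ₚ act i p)   ∎)

∂ : ℕ → ℤ[x,y,z] → ℤ[x,y,z]
∂ i p = proj₁ (quotient i p)

∂^ : S∞ → ℤ[x,y,z] → ℤ[x,y,z]
∂^ u p = foldr ∂ p (word (reducedWord u))

reflect : ℕ → ℕ → ℕ
reflect n i with i ≤? n
... | yes _ = n ∸ i
... | no  _ = i

reflect-involutive : ∀ n i → reflect n (reflect n i) ≡ i
reflect-involutive n i with i ≤? n
reflect-involutive n i | yes i≤n with n ∸ i ≤? n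
... | yes _ = m∸[m∸n]≡n i≤n
... | no ≰  = contradiction (m∸n≤m n i) ≰
reflect-involutive n i | no i≰n with i ≤? n
... | yes i≤n = contradiction i≤n i≰n
... | no _    = refl

reflect-fixes : ∀ n {i} → n < i → reflect n i ≡ i
reflect-fixes n {i} n<i with i ≤? n
... | yes i≤n = contradiction n<i (≤⇒≯ i≤n)
... | no _    = refl

w₀ : ℕ → S∞
w₀ n .perm  = mk↔ₛ′ (reflect n) (reflect n) (reflect-involutive n) (reflect-involutive n)
w₀ n .bound = suc n
w₀ n .fixes = reflect-fixes n

𝔖w₀ : ℕ → ℤ[x,y,z]
𝔖w₀ n = ∏ (upTo n) λ i → ∏ (upTo (n ∸ i)) λ j → x i -ₚ y j

-- 𝔖[ n ] u is 𝔖_u computed in S_{n+1}, for u ∈ S_{n+1}.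
𝔖[_] : ℕ → S∞ → ℤ[x,y,z]
𝔖[ n ] u = ∂^ (u ⁻¹ ∙ w₀ n) (𝔖w₀ n)

𝔖 : S∞ → ℤ[x,y,z]
𝔖 u = 𝔖[ bound u ] u

y↦z : Var → Var
y↦z (X i) = X i
y↦z (Y i) = Z i
y↦z (Z i) = Z i

𝔖xz : S∞ → ℤ[x,y,z]
𝔖xz v = rename y↦z (𝔖 v)

Dominant : S∞ → Set
Dominant v = ∀ i → code v (suc i) ≤ code v i

LastAscent : S∞ → ℕ → Set
LastAscent v i = code v i < code v (suc i) × (∀ j → i < j → code v (suc j) ≤ code v j)

data _⇝_ : S∞ → S∞ → Set where
  dominant : ∀ {v} → Dominant v → v ⇝ v
  step     : ∀ {v i m} → LastAscent v i → (v ∙ s i) ⇝ m → v ⇝ m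

code-ascent : ∀ v i → code v i < code v (suc i) → v ⟨$⟩ i < v ⟨$⟩ suc i
code-ascent v i c< with <-cmp (v ⟨$⟩ i) (v ⟨$⟩ suc i)
... | tri< lt _ _ = lt
... | tri≈ _ eq _ = contradiction (⟨$⟩-injective v eq) (<⇒≢ (n<1+n i))
... | tri> _ _ gt = contradiction c< (≤⇒≯ (size-mono (codeSet v (suc i)) (codeSet v i)
        λ { (i<j , lt) → <-trans (n<1+n i) i<j , <-trans lt gt }))

code-bound : ∀ v n → v ∈S n → ∀ i → 0 < code v i → i < n
code-bound v n v∈ i c> with elements (codeSet v i) in eq
... | j ∷ _ = <-trans (proj₁ inv) (inversion-bound v n v∈ inv)
  where
  inv : Inversion v (i , j)
  inv = sound (codeSet v i) (subst (j ∈_) (sym eq) (here refl))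

code-zero : ∀ v n → v ∈S n → ∀ i → n ≤ i → code v i ≡ 0
code-zero v n v∈ i n≤i with code v i in eq
... | zero  = refl
... | suc _ = contradiction (code-bound v n v∈ i (subst (0 <_) (sym eq) z<s)) (≤⇒≯ n≤i)

lastAscent? : ∀ v → Dominant v ⊎ ∃ (LastAscent v)
lastAscent? v = search (bound v)
    (λ j n≤j → subst (_≤ code v j)
      (sym (code-zero v (bound v) (fixes v) (suc j) (m≤n⇒m≤1+n n≤j))) z≤n)
  where
  search : ∀ n → (∀ j → n ≤ j → code v (suc j) ≤ code v j) → Dominant v ⊎ ∃ (LastAscent v)
  search zero    h = inj₁ λ i → h i z≤n
  search (suc n) h with code v n <? code v (suc n)
  ... | yes asc = inj₂ (n , asc , h)
  ... | no ¬asc = search n h′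
    where
    h′ : ∀ j → n ≤ j → code v (suc j) ≤ code v j
    h′ j n≤j with m≤n⇒m<n∨m≡n n≤j
    ... | inj₁ n<j  = h j n<j
    ... | inj₂ refl = ≮⇒≥ ¬asc

length-pairs : ∀ (as bs : List ℕ) → length (cartesianProduct as bs) ≡ length as * length bs
length-pairs []       bs = refl
length-pairs (a ∷ as) bs = trans (length-++ (map (a ,_) bs))
  (cong₂ _+_ (length-map (a ,_) bs) (length-pairs as bs))

ℓ-bound : ∀ v n → v ∈S n → ℓ v ≤ n * n
ℓ-bound v n v∈ = subst (ℓ v ≤_)
  (trans (length-pairs (upTo n) (upTo n)) (cong₂ _*_ (length-upTo n) (length-upTo n)))
  (length-⊆ (unique (inversions v)) λ { {i , j} p∈ →
    let inv = sound (inversions v) p∈ ; j<n = inversion-bound v n v∈ inv in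
    ∈-cartesianProduct⁺ (∈-upTo⁺ (<-trans (proj₁ inv) j<n)) (∈-upTo⁺ j<n) })

dominate : ∀ fuel n v → v ∈S n → n * n ≤ ℓ v + fuel → ∃ (v ⇝_)
dominate fuel n v v∈ enough with lastAscent? v
... | inj₁ dom = v , dominant dom
dominate fuel n v v∈ enough | inj₂ (i , asc@(c< , _)) = continue fuel enough
  where
  ℓ↑ : ℓ (v ∙ s i) ≡ suc (ℓ v)
  ℓ↑ = ℓ-ascent v i (code-ascent v i c<)
  1+i<n : suc i < n
  1+i<n = code-bound v n v∈ (suc i) (≤-<-trans z≤n c<)
  vs∈ : v ∙ s i ∈S n
  vs∈ {j} n≤j = trans (cong (v ⟨$⟩_) (swap-other i (suc i)
      (λ { refl → <⇒≱ (<-trans (n<1+n i) 1+i<n) n≤j })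
      (λ { refl → <⇒≱ 1+i<n n≤j })))
    (v∈ n≤j)
  continue : ∀ fuel → n * n ≤ ℓ v + fuel → ∃ (v ⇝_)
  continue zero h = contradiction (subst (_≤ n * n) ℓ↑ (ℓ-bound (v ∙ s i) n vs∈))
    (<⇒≱ (s≤s (subst (n * n ≤_) (+-identityʳ (ℓ v)) h)))
  continue (suc fuel) h with dominate fuel n (v ∙ s i) vs∈
    (subst (n * n ≤_) (trans (+-suc (ℓ v) fuel) (cong (_+ fuel) (sym ℓ↑))) h)
  ... | m , v⇝m = m , step asc v⇝m

dominantApproximation : ∀ v → ∃ (v ⇝_)
dominantApproximation v =
  dominate (bound v * bound v) (bound v) v (fixes v) (m≤n+m (bound v * bound v) (ℓ v))

μ : S∞ → S∞
μ v = proj₁ (dominantApproximation v)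

-- Entry i of λ(v) counts the j with c_j(μ v) ≥ i+1.  The largest part of
-- the code of the dominant permutation μ v is its first, so λ(v) has
-- c_0(μ v) nonzero parts.
columnSet : ∀ m i → Enumeration (setoid ℕ) (λ j → suc i ≤ code m j)
columnSet m i = enumerateBelow (λ j → suc i ≤? code m j) (bound m)
  (λ {j} c> → code-bound m (bound m) (fixes m) j (≤-<-trans z≤n c>))

λ[_] : S∞ → List ℕ
λ[ v ] = map (λ i → size (columnSet (μ v) i)) (upTo (code (μ v) 0))

infixl 7 _∙t_ _∙ts_
_∙t_ : S∞ → ℕ × ℕ → S∞
u ∙t (a , b) = u ∙ t a b

_∙ts_ : S∞ → List (ℕ × ℕ) → S∞
_∙ts_ = foldl _∙t_

record IsChain (k : ℕ) (u : S∞) (ts : List (ℕ × ℕ)) : Set where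
  field
    short     : length ts ≤ k
    -- With positions numbered from 0, "a ≤ k < b" reads a < k ≤ b.
    straddle  : All (λ (a , b) → a < k × k ≤ b) ts
    distinct  : Unique≡ (map proj₁ ts)
    saturated : ∀ i → i ≤ length ts → ℓ (u ∙ts take i ts) ≡ ℓ u + i

open IsChain public

infix 4 _⟶[_]_
_⟶[_]_ : S∞ → ℕ → S∞ → Set
u ⟶[ k ] u′ = ∃[ ts ] IsChain k u ts × u′ ≈ u ∙ts ts

∙ts-cong : ∀ {u u′} ts → u ≈ u′ → u ∙ts ts ≈ u′ ∙ts ts
∙ts-cong []             p = p
∙ts-cong ((a , b) ∷ ts) p = ∙ts-cong ts (∙-congʳ (t a b) p)

IsChain-resp : ∀ {k u u′ ts} → u ≈ u′ → IsChain k u ts → IsChain k u′ ts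
IsChain-resp {ts = ts} p c = record
  { short = short c ; straddle = straddle c ; distinct = distinct c
  ; saturated = λ i i≤ → trans (ℓ-cong (∙ts-cong (take i ts) (≈-sym p)))
      (trans (saturated c i i≤) (cong (_+ i) (ℓ-cong p)))
  }

⟶-resp : ∀ {k u u′ w w′} → u ≈ u′ → w ≈ w′ → u ⟶[ k ] w → u′ ⟶[ k ] w′
⟶-resp p q (ts , c , e) = ts , IsChain-resp p c , ≈-trans (≈-sym q) (≈-trans e (∙ts-cong ts p))

isChain? : ∀ k u ts → Dec (IsChain k u ts)
isChain? k u ts = map′
  (λ { (sh , st , di , sa) → record
       { short = sh ; straddle = st ; distinct = di ; saturated = λ i i≤ → sa {i} (s≤s i≤) } })
  (λ c → short c , straddle c , distinct c , λ {i} i< → saturated c i (≤-pred i<))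
  ((length ts ≤? k) ×-dec All.all? (λ (a , b) → (a <? k) ×-dec (k ≤? b)) ts
    ×-dec DecUnique.unique? _≟_ (map proj₁ ts)
    ×-dec allUpTo? (λ i → ℓ (u ∙ts take i ts) ≟ ℓ u + i) (suc (length ts)))

reach : ℕ → S∞ → ℕ
reach k u = (bound u ⊔ k) + suc (suc (ℓ u))

-- If b ≥ reach k u, then u t_ab has the inversions (a , j) for all
-- bound u ⊔ k ≤ j < reach k u, which are too many.
transposition-bound : ∀ k u {a b} → a < k → ℓ (u ∙ t a b) ≡ suc (ℓ u) → b < reach k u
transposition-bound k u {a} {b} a<k ℓ↑ with b <? reach k u
... | yes b< = b<
... | no  b≮ = contradiction
    (subst (2 + ℓ u ≤_) ℓ↑ (subst (_≤ ℓ (u ∙ t a b)) (length-upTo (2 + ℓ u)) many))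
    (<⇒≱ ≤-refl)
  where
  M : ℕ
  M = bound u ⊔ k
  reach≤b : reach k u ≤ b
  reach≤b = ≮⇒≥ b≮
  pair : ℕ → ℕ × ℕ
  pair j = a , M + j
  inv : ∀ {j} → j < 2 + ℓ u → Inversion (u ∙ t a b) (pair j)
  inv {j} j< = a<M+j , subst (_< u ⟨$⟩ (t a b ⟨$⟩ a)) (sym at-M+j) (subst (M + j <_) (sym at-a) M+j<b)
    where
    a<M+j : a < M + j
    a<M+j = ≤-trans a<k (≤-trans (m≤n⊔m (bound u) k) (m≤m+n M j))
    M+j<b : M + j < b
    M+j<b = <-≤-trans (+-monoʳ-< M j<) reach≤b
    at-a : u ⟨$⟩ (t a b ⟨$⟩ a) ≡ b
    at-a = trans (cong (u ⟨$⟩_) (swap-left a b))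
      (fixes u (≤-trans (≤-trans (m≤m⊔n (bound u) k) (m≤m+n M j)) (<⇒≤ M+j<b)))
    at-M+j : u ⟨$⟩ (t a b ⟨$⟩ (M + j)) ≡ M + j
    at-M+j = trans
      (cong (u ⟨$⟩_) (swap-other a b (λ eq → <⇒≢ a<M+j (sym eq)) (<⇒≢ M+j<b)))
      (fixes u (≤-trans (m≤m⊔n (bound u) k) (m≤m+n M j)))
  many : length (upTo (2 + ℓ u)) ≤ ℓ (u ∙ t a b)
  many = subst (_≤ ℓ (u ∙ t a b)) (length-map pair (upTo (2 + ℓ u)))
    (length-⊆ (Unique≡ₚ.map⁺ (λ eq → +-cancelˡ-≡ M _ _ (,-injectiveʳ eq)) (Unique≡ₚ.upTo⁺ (2 + ℓ u)))
      λ q∈ → let j , j∈ , eq = ∈-map⁻ pair q∈ in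
        subst (_∈ elements (inversions (u ∙ t a b))) (sym eq)
          (complete (inversions (u ∙ t a b)) (inv (∈-upTo⁻ j∈))))

candidates : ℕ → ℕ → S∞ → List (List (ℕ × ℕ))
candidates k zero    u = [ [] ]
candidates k (suc p) u = [] ∷
  concatMap (λ ab → map (ab ∷_) (candidates k p (u ∙t ab)))
            (cartesianProduct (upTo k) (upTo (reach k u)))

candidates-complete : ∀ k p u ts → length ts ≤ p →
  All (λ (a , b) → a < k × k ≤ b) ts →
  (∀ i → i ≤ length ts → ℓ (u ∙ts take i ts) ≡ ℓ u + i) →
  ts ∈ candidates k p u
candidates-complete k zero    u [] _ _ _ = here refl
candidates-complete k (suc p) u [] _ _ _ = here refl
candidates-complete k (suc p) u ((a , b) ∷ ts) (s≤s len) ((a<k , _) ∷ st) sat =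
  there (∈-concatMap⁺ _ (lose
    (∈-cartesianProduct⁺ (∈-upTo⁺ a<k) (∈-upTo⁺ (transposition-bound k u a<k ℓ↑)))
    (∈-map⁺ ((a , b) ∷_) (candidates-complete k p (u ∙ t a b) ts len st
      λ i i≤ → trans (sat (suc i) (s≤s i≤)) (trans (+-suc (ℓ u) i) (cong (_+ i) (sym ℓ↑)))))))
  where
  ℓ↑ : ℓ (u ∙ t a b) ≡ suc (ℓ u)
  ℓ↑ = trans (sat 1 (s≤s z≤n)) (+-comm (ℓ u) 1)

module Perm = SetoidMembership S∞-setoid

successors : ∀ k u → Enumeration S∞-setoid (u ⟶[ k ]_)
successors k u = enumerateFrom S∞-decSetoid (map (u ∙ts_) chains) sd cp
  where
  chains : List (List (ℕ × ℕ))
  chains = filter (isChain? k u) (candidates k k u)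
  sd : ∀ {w} → w Perm.∈ map (u ∙ts_) chains → u ⟶[ k ] w
  sd w∈ with find w∈
  ... | _ , v∈ , w≈v with ∈-map⁻ (u ∙ts_) v∈
  ...   | ts , ts∈ , refl = ts , proj₂ (∈-filter⁻ (isChain? k u) {xs = candidates k k u} ts∈) , w≈v
  cp : ∀ {w} → u ⟶[ k ] w → w Perm.∈ map (u ∙ts_) chains
  cp (ts , c , w≈) = Any.map (λ { refl → w≈ }) (∈-map⁺ (u ∙ts_)
    (∈-filter⁺ (isChain? k u)
      (candidates-complete k k u ts (short c) (straddle c) (saturated c)) c))

data IsPath (w : S∞) : List ℕ → S∞ → List S∞ → Set where
  stop : ∀ {u u₀} → u ≈ u₀ → u₀ ≈ w → IsPath w [] u (u₀ ∷ [])
  step : ∀ {k ks u u₀ u₁ us} → u ≈ u₀ → u₀ ⟶[ k ] u₁ → IsPath w ks u₁ (u₁ ∷ us) →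
         IsPath w (k ∷ ks) u (u₀ ∷ u₁ ∷ us)

path-decSetoid : DecSetoid 0ℓ 0ℓ
path-decSetoid = ListDecSetoid.≋-decSetoid S∞-decSetoid

path-setoid : Setoid 0ℓ 0ℓ
path-setoid = DecSetoid.setoid path-decSetoid

module PathMembership = SetoidMembership path-setoid

IsPath-resp : ∀ {w ks u u′ us us′} → u ≈ u′ → Pointwise _≈_ us us′ →
  IsPath w ks u us → IsPath w ks u′ us′
IsPath-resp p (q ∷ [])      (stop a b)  = stop (≈-trans (≈-sym p) (≈-trans a q)) (≈-trans (≈-sym q) b)
IsPath-resp p (q ∷ q₁ ∷ qs) (step a r P) =
  step (≈-trans (≈-sym p) (≈-trans a q)) (⟶-resp q q₁ r) (IsPath-resp q₁ (q₁ ∷ qs) P)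

paths : ∀ ks u w → Enumeration path-setoid (IsPath w ks u)
paths [] u w with u ≈? w
... | yes u≈w = enumerateFrom path-decSetoid [ [ u ] ]
  (λ { (here (p ∷ [])) → stop (≈-sym p) (≈-trans p u≈w) })
  (λ { (stop a _) → here (≈-sym a ∷ []) })
... | no  u≉w = enumerateFrom path-decSetoid []
  (λ ()) (λ { (stop a b) → ⊥-elim (u≉w (≈-trans a b)) })
paths (k ∷ ks) u w = enumerateFrom path-decSetoid (concatMap extend (elements succs)) sd cp
  where
  succs : Enumeration S∞-setoid (u ⟶[ k ]_)
  succs = successors k u
  extend : S∞ → List (List S∞)
  extend u₁ = map (u ∷_) (elements (paths ks u₁ w))
  sd : ∀ {us} → us PathMembership.∈ concatMap extend (elements succs) → IsPath w (k ∷ ks) u us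
  sd us∈ with find us∈
  ... | vs , vs∈ , us≈vs with find (∈-concatMap⁻ extend {xs = elements succs} vs∈)
  ...   | u₁ , u₁∈ , vs∈′ with ∈-map⁻ (u ∷_) vs∈′
  ...     | ws , ws∈ , refl = IsPath-resp ≈-refl (DecSetoid.sym path-decSetoid us≈vs)
            (attach (sound (paths ks u₁ w) (Any.map (λ { refl → DecSetoid.refl path-decSetoid }) ws∈)))
    where
    u⟶u₁ : u ⟶[ k ] u₁
    u⟶u₁ = sound succs (Any.map (λ { refl → ≈-refl }) u₁∈)
    attach : ∀ {ws} → IsPath w ks u₁ ws → IsPath w (k ∷ ks) u (u ∷ ws)
    attach P@(stop a _)   =
      step ≈-refl (⟶-resp ≈-refl a u⟶u₁) (IsPath-resp a (DecSetoid.refl path-decSetoid) P)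
    attach P@(step a _ _) =
      step ≈-refl (⟶-resp ≈-refl a u⟶u₁) (IsPath-resp a (DecSetoid.refl path-decSetoid) P)
  cp : ∀ {us} → IsPath w (k ∷ ks) u us → us PathMembership.∈ concatMap extend (elements succs)
  cp (step a r P)
    with find (complete succs (⟶-resp (≈-sym a) ≈-refl r))
  ... | v₁ , v₁∈ , u₁≈v₁
    with find (complete (paths ks v₁ w) (IsPath-resp u₁≈v₁ (DecSetoid.refl path-decSetoid) P))
  ...   | vs , vs∈ , us≈vs = Any.map (λ { refl → ≈-sym a ∷ us≈vs })
            (∈-concatMap⁺ extend (lose v₁∈ (∈-map⁺ (u ∷_) vs∈)))

-- P_k(u,w), listed without repetition since u is injective.
P : ℕ → S∞ → S∞ → List ℕ
P k u w = map (u ⟨$⟩_) (filter (λ i → u ⟨$⟩ i ≟ w ⟨$⟩ i) (upTo k))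

weight : ℕ → S∞ → S∞ → ℕ → ℤ[x,y,z]
weight k u w j = ∏ (P k u w) λ i → y i -ₚ z j

-- pathWeight j (λ₀ ∷ λ₁ ∷ …) uses z_j for the first step, z_{j+1} for
-- the second, and so on.
pathWeight : ℕ → List ℕ → List S∞ → ℤ[x,y,z]
pathWeight j (k ∷ ks) (u₀ ∷ u₁ ∷ us) = weight k u₀ u₁ j *ₚ pathWeight (suc j) ks (u₁ ∷ us)
pathWeight j _        _              = 1ₚ

d : S∞ → List ℕ → S∞ → ℤ[x,y,z]
d u ks w = ∑ (elements (paths ks u w)) (pathWeight 0 ks)

e : S∞ → S∞ → S∞ → ℤ[x,y,z]
e u v w = if does (ℓ (w ∙ v ⁻¹ ∙ μ v) ≟ ℓ w + ℓ (v ⁻¹ ∙ μ v))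
  then d u λ[ v ] (w ∙ v ⁻¹ ∙ μ v)
  else 0ₚ

-- p = Σ_{w ∈ S_∞} f w for a family f with finitely many nonzero members.
record _IsSumOver-S∞_ (p : ℤ[x,y,z]) (f : S∞ → ℤ[x,y,z]) : Set where
  open SetoidMembership S∞-setoid using (_∉_)
  open SetoidUnique S∞-setoid using (Unique)
  field
    support     : List S∞
    distinct-ws : Unique support
    vanishes    : ∀ w → w ∉ support → f w ≈ₚ 0ₚ
    equals      : p ≈ₚ ∑ support f

{-# OPTIONS --safe #-}
module Submission where

-- The family 𝔖_u is determined by ∂_i 𝔖_u = 𝔖_{u s_i} or 0 together with its
-- values at x = y, because a polynomial killed by all ∂_i does not involve x.
-- This gives the action of s_i on the y-variables,
-- s_i 𝔖_u = 𝔖_u + (y_i − y_{i+1}) 𝔖_{s_i u} when s_i u < u.  The Pieri sum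
-- Σ weight(u , w) 𝔖_w transforms in the same way, so by induction on ℓ(u) its
-- difference from 𝔖_u ∏_{i<k} (x_i − z_j) is symmetric in y and vanishes at y = x.
-- Iterating over the columns of the code of μ_v expands 𝔖_u(x;y) 𝔖_{μ_v}(x;z), since
-- the latter factor is a product of terms x_i − z_j.  Every letter of v⁻¹ μ_v is
-- less than p, so the corresponding divided differences commute with
-- multiplication by 𝔖_u and lower 𝔖_{μ_v} to 𝔖_v.

open import Defs
open import Algebra.Bundles using (CommutativeRing; RawRing)
import Algebra.Properties.Ring as RingProperties
import Algebra.Properties.Semiring.Mult.TCOptimised as Multiples
import Algebra.Solver.Ring as RingSolver
open import Algebra.Solver.Ring.AlmostCommutativeRing
  using (fromCommutativeRing; _-Raw-AlmostCommutative⟶_)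
open import Data.Bool.Base using (if_then_else_)
open import Data.List.Base
  using (List; []; _∷_; foldr; _++_; length; upTo; applyUpTo; map; _∷ʳ_; take; filter; deduplicate; concat; concatMap)
open import Data.List.Membership.Propositional using (_∈_; find; lose)
open import Data.List.Membership.Propositional.Properties
  using (∈-map⁺; ∈-map⁻; ∈-upTo⁺; ∈-upTo⁻; ∈-concatMap⁺)
import Data.List.Membership.Setoid as SetoidMembership
import Data.List.Membership.Setoid.Properties as SetoidMembershipₚ
open import Data.List.Properties
  using (length-++; foldr-++; length-map; length-upTo; foldl-∷ʳ; map-++)
open import Data.List.Relation.Binary.Pointwise using (Pointwise; []; _∷_)
open import Data.List.Relation.Unary.All as All using (All; []; _∷_)
import Data.List.Relation.Unary.All.Properties as Allₚ
open import Data.List.Relation.Unary.AllPairs as AllPairs using (AllPairs; []; _∷_)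
import Data.List.Relation.Unary.AllPairs.Properties as AllPairsₚ
open import Data.List.Relation.Unary.Any as Any using (here; there)
open import Data.List.Relation.Unary.Unique.DecSetoid.Properties using (deduplicate-!)
open import Data.List.Relation.Unary.Unique.Propositional using () renaming (Unique to Unique≡)
import Data.List.Relation.Unary.Unique.Propositional.Properties as Unique≡ₚ
import Data.List.Relation.Unary.Unique.Setoid as SetoidUnique
import Data.List.Relation.Unary.Unique.Setoid.Properties as SetoidUniqueₚ
open import Data.Maybe.Base using (Maybe; just; nothing)
open import Data.Nat.Base using (ℕ; zero; suc; _+_; _*_; _∸_; _⊔_; _<_; _≤_; z≤n; s≤s)
open import Data.Nat.Induction using (<-rec)
open import Data.Nat.Properties
open import Data.Product.Base using (∃-syntax; _×_; _,_; proj₁; proj₂)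
open import Data.Product.Properties using (,-injectiveˡ; ,-injectiveʳ)
open import Data.Sum.Base using (_⊎_; inj₁; inj₂; [_,_]′)
open import Data.Unit.Base using (⊤; tt)
open import Function.Base using (_∘_; id)
open import Function.Bundles using (Inverse)
open import Level using (0ℓ)
open import Relation.Binary.Bundles using (DecSetoid)
open import Relation.Binary.Definitions using (DecidableEquality; tri<; tri≈; tri>)
open import Relation.Binary.PropositionalEquality
  using (_≡_; _≢_; refl; sym; trans; cong; cong₂; subst; subst₂; module ≡-Reasoning)
import Relation.Binary.Reasoning.Setoid as SetoidReasoning
open import Relation.Nullary using (¬_; Dec; yes; no; contradiction; does)
open import Relation.Nullary.Decidable using (map′; _×-dec_)
open import Data.List.Relation.Binary.Disjoint.Setoid path-setoid using (Disjoint)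

-- The main obstacle is the relation →k. It asserts that some chain exists, and left multiplication
-- by s_i need not carry chains to chains. It is therefore replaced by `PieriBruhat`, which mentions
-- no chain: the order conditions of `Bruhat` together with the equation ℓ(u) + k = ℓ(w) +
-- #P_k(u,w). For every pair that satisfies `Bruhat` the left side is at most the right side, and
-- this inequality, `Bruhat-length`, is the recurrent tool: it limits how the positions of i and i +
-- 1 in u and w can differ when a pair is multiplied by s_i. A second obstacle is that polynomials
-- are ring expressions modulo the ring axioms, without normal forms, and that `∂` is computed from
-- the expression. Cancellation is proved by evaluation in an auxiliary ring, and the laws of `∂`
-- then follow from the uniqueness of the quotient. Symmetry in y suffices for the Pieri formula
-- because there are infinitely many variables: a polynomial symmetric in all y_i contains none of
-- them, so it equals its value at y = x, where only multiples of 𝔖_1 survive.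

-- Integer polynomials

-- A pair (m , n) stands for the integer coefficient m − n.
module IntegerCoefficients (R : CommutativeRing 0ℓ 0ℓ) where
  private
    module R = CommutativeRing R
    module Rₚ = RingProperties R.ring
    open Multiples R.semiring using (×-homo-+; ×1-homo-*) renaming (_×_ to _×ᵣ_)
    open SetoidReasoning R.setoid

    +-interchange : ∀ a b c d → (a R.+ b) R.+ (c R.+ d) R.≈ (a R.+ c) R.+ (b R.+ d)
    +-interchange a b c d = begin
      (a R.+ b) R.+ (c R.+ d)   ≈⟨ R.+-assoc a b (c R.+ d) ⟩
      a R.+ (b R.+ (c R.+ d))   ≈⟨ R.+-congˡ (R.sym (R.+-assoc b c d)) ⟩
      a R.+ ((b R.+ c) R.+ d)   ≈⟨ R.+-congˡ (R.+-congʳ (R.+-comm b c)) ⟩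
      a R.+ ((c R.+ b) R.+ d)   ≈⟨ R.+-congˡ (R.+-assoc c b d) ⟩
      a R.+ (c R.+ (b R.+ d))   ≈⟨ R.sym (R.+-assoc a c (b R.+ d)) ⟩
      (a R.+ c) R.+ (b R.+ d)   ∎

    -‿+-interchange : ∀ a b c d → (a R.+ c) R.- (b R.+ d) R.≈ (a R.- b) R.+ (c R.- d)
    -‿+-interchange a b c d = R.trans (R.+-congˡ (R.sym (Rₚ.-‿+-comm b d)))
      (+-interchange a c (R.- b) (R.- d))

    difference : ℕ × ℕ → R.Carrier
    difference (m , n) = (m ×ᵣ R.1#) R.- (n ×ᵣ R.1#)

    *-difference : ∀ a b c d →
      ((a R.* c) R.+ (b R.* d)) R.- ((a R.* d) R.+ (b R.* c)) R.≈ (a R.- b) R.* (c R.- d)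
    *-difference a b c d = begin
      ((a R.* c) R.+ (b R.* d)) R.- ((a R.* d) R.+ (b R.* c))
        ≈⟨ -‿+-interchange (a R.* c) (a R.* d) (b R.* d) (b R.* c) ⟩
      ((a R.* c) R.- (a R.* d)) R.+ ((b R.* d) R.- (b R.* c))
        ≈⟨ R.+-congˡ (R.sym (Rₚ.⁻¹-anti-homo‿- (b R.* c) (b R.* d))) ⟩
      ((a R.* c) R.- (a R.* d)) R.- ((b R.* c) R.- (b R.* d))
        ≈⟨ R.+-cong (R.sym (Rₚ.x[y-z]≈xy-xz a c d)) (R.-‿cong (R.sym (Rₚ.x[y-z]≈xy-xz b c d))) ⟩
      (a R.* (c R.- d)) R.- (b R.* (c R.- d))
        ≈⟨ R.sym (Rₚ.[y-z]x≈yx-zx (c R.- d) a b) ⟩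
      (a R.- b) R.* (c R.- d) ∎

    coefficients : RawRing 0ℓ 0ℓ
    coefficients = record
      { Carrier = ℕ × ℕ
      ; _≈_     = _≡_
      ; _+_     = λ (a , b) (c , d) → a + c , b + d
      ; _*_     = λ (a , b) (c , d) → a * c + b * d , a * d + b * c
      ; -_      = λ (a , b) → b , a
      ; 0#      = 0 , 0
      ; 1#      = 1 , 0
      }

    morphism : coefficients -Raw-AlmostCommutative⟶ fromCommutativeRing R
    morphism = record
      { ⟦_⟧    = difference
      ; +-homo = λ (a , b) (c , d) → R.trans
          (R.+-cong (×-homo-+ R.1# a c) (R.-‿cong (×-homo-+ R.1# b d)))
          (-‿+-interchange _ _ _ _)
      ; *-homo = λ (a , b) (c , d) → R.trans
          (R.+-cong
            (R.trans (×-homo-+ R.1# (a * c) (b * d)) (R.+-cong (×1-homo-* a c) (×1-homo-* b d)))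
            (R.-‿cong
              (R.trans (×-homo-+ R.1# (a * d) (b * c)) (R.+-cong (×1-homo-* a d) (×1-homo-* b c)))))
          (*-difference _ _ _ _)
      ; -‿homo = λ (a , b) → R.sym (Rₚ.⁻¹-anti-homo‿- _ _)
      ; 0-homo = R.-‿inverseʳ R.0#
      ; 1-homo = R.trans (R.+-congˡ Rₚ.-0#≈0#) (R.+-identityʳ R.1#)
      }

    -- Pairs are not reduced, so equality of two differences is tested by cross addition; both are
    -- padded with a difference of equal terms until the common sum appears.
    equal? : ∀ p q → Maybe (difference p R.≈ difference q)
    equal? (a , b) (c , d) with a + d ≟ c + b
    ... | no _   = nothing
    ... | yes eq = just (begin
      α R.- β                      ≈⟨ R.sym (R.+-identityʳ _) ⟩
      (α R.- β) R.+ R.0#           ≈⟨ R.+-congˡ (R.sym (R.-‿inverseʳ δ)) ⟩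
      (α R.- β) R.+ (δ R.- δ)      ≈⟨ R.sym (-‿+-interchange α β δ δ) ⟩
      (α R.+ δ) R.- (β R.+ δ)      ≈⟨ R.+-cong (R.trans (R.sym (×-homo-+ R.1# a d))
                                       (R.trans (R.reflexive (cong (_×ᵣ R.1#) eq)) (×-homo-+ R.1# c b)))
                                       (R.-‿cong (R.+-comm β δ)) ⟩
      (γ R.+ β) R.- (δ R.+ β)      ≈⟨ -‿+-interchange γ δ β β ⟩
      (γ R.- δ) R.+ (β R.- β)      ≈⟨ R.+-congˡ (R.-‿inverseʳ β) ⟩
      (γ R.- δ) R.+ R.0#           ≈⟨ R.+-identityʳ _ ⟩
      γ R.- δ                      ∎)
      where
      α β γ δ : R.Carrier
      α = a ×ᵣ R.1#
      β = b ×ᵣ R.1#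
      γ = c ×ᵣ R.1#
      δ = d ×ᵣ R.1#

  open RingSolver coefficients (fromCommutativeRing R) morphism equal? public
    using (solve; con; _:+_; _:*_; _:-_; :-_; _:=_)

module R = CommutativeRing (polyRing Var)
module Rₚ = RingProperties R.ring
module ℤSolver = IntegerCoefficients (polyRing Var)
module ≈ₚ-Reasoning = SetoidReasoning R.setoid

sub : ∀ {V W} → (V → Poly W) → Poly V → Poly W
sub {W = W} = Evaluation.⟦_⟧ (polyRing W)

sub-cong : ∀ {V W} (ρ : V → Poly W) {p q} → p ≈ₚ q → sub ρ p ≈ₚ sub ρ q
sub-cong {W = W} ρ = Evaluation.⟦⟧-cong (polyRing W) ρ

sub-ext : ∀ {V W} {ρ σ : V → Poly W} → (∀ v → ρ v ≈ₚ σ v) → ∀ p → sub ρ p ≈ₚ sub σ p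
sub-ext e (var a)  = e a
sub-ext e 0ₚ       = reflₚ
sub-ext e 1ₚ       = reflₚ
sub-ext e (p +ₚ q) = +-congₚ (sub-ext e p) (sub-ext e q)
sub-ext e (p *ₚ q) = *-congₚ (sub-ext e p) (sub-ext e q)
sub-ext e (-ₚ p)   = -‿congₚ (sub-ext e p)

sub-sub : ∀ {U V W} (σ : V → Poly W) (ρ : U → Poly V) p →
  sub σ (sub ρ p) ≡ sub (sub σ ∘ ρ) p
sub-sub σ ρ (var a)  = refl
sub-sub σ ρ 0ₚ       = refl
sub-sub σ ρ 1ₚ       = refl
sub-sub σ ρ (p +ₚ q) = cong₂ _+ₚ_ (sub-sub σ ρ p) (sub-sub σ ρ q)
sub-sub σ ρ (p *ₚ q) = cong₂ _*ₚ_ (sub-sub σ ρ p) (sub-sub σ ρ q)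
sub-sub σ ρ (-ₚ p)   = cong -ₚ_ (sub-sub σ ρ p)

sub-var : ∀ {V} (p : Poly V) → sub var p ≡ p
sub-var (var a)  = refl
sub-var 0ₚ       = refl
sub-var 1ₚ       = refl
sub-var (p +ₚ q) = cong₂ _+ₚ_ (sub-var p) (sub-var q)
sub-var (p *ₚ q) = cong₂ _*ₚ_ (sub-var p) (sub-var q)
sub-var (-ₚ p)   = cong -ₚ_ (sub-var p)

≡⇒≈ₚ : ∀ {V} {p q : Poly V} → p ≡ q → p ≈ₚ q
≡⇒≈ₚ refl = reflₚ

sub-comp : ∀ {U V W} (σ : V → Poly W) (ρ : U → Poly V) {τ : U → Poly W} →
  (∀ v → sub σ (ρ v) ≈ₚ τ v) → ∀ p → sub σ (sub ρ p) ≈ₚ sub τ p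
sub-comp σ ρ e p = transₚ (≡⇒≈ₚ (sub-sub σ ρ p)) (sub-ext e p)

sub-identity : ∀ {V} {σ : V → Poly V} → (∀ v → σ v ≈ₚ var v) → ∀ p → sub σ p ≈ₚ p
sub-identity {σ = σ} e p = transₚ (sub-ext e p) (≡⇒≈ₚ (sub-var p))

_≟ⱽ_ : DecidableEquality Var
X i ≟ⱽ X j = map′ (cong X) (λ { refl → refl }) (i ≟ j)
Y i ≟ⱽ Y j = map′ (cong Y) (λ { refl → refl }) (i ≟ j)
Z i ≟ⱽ Z j = map′ (cong Z) (λ { refl → refl }) (i ≟ j)
X _ ≟ⱽ Y _ = no λ ()
X _ ≟ⱽ Z _ = no λ ()
Y _ ≟ⱽ X _ = no λ ()
Y _ ≟ⱽ Z _ = no λ ()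
Z _ ≟ⱽ X _ = no λ ()
Z _ ≟ⱽ Y _ = no λ ()

-- The ring R[ε]/(ε² − δε), with (p , q) standing for p + qε.  Sending a to
-- b + ε, where δ = a − b, makes q recoverable from the image of δq.
module _ (δ : ℤ[x,y,z]) where
  open ℤSolver

  infix 4 _≈ₑ_
  _≈ₑ_ : ℤ[x,y,z] × ℤ[x,y,z] → ℤ[x,y,z] × ℤ[x,y,z] → Set
  (p , q) ≈ₑ (p′ , q′) = (p ≈ₚ p′) × (q ≈ₚ q′)

  ε-ring : CommutativeRing 0ℓ 0ℓ
  ε-ring = record
    { Carrier = ℤ[x,y,z] × ℤ[x,y,z]
    ; _≈_     = _≈ₑ_
    ; _+_     = λ (p , q) (p′ , q′) → p +ₚ p′ , q +ₚ q′
    ; _*_     = λ (p , q) (p′ , q′) → p *ₚ p′ , q *ₚ p′ +ₚ p *ₚ q′ +ₚ δ *ₚ (q *ₚ q′)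
    ; -_      = λ (p , q) → -ₚ p , -ₚ q
    ; 0#      = 0ₚ , 0ₚ
    ; 1#      = 1ₚ , 0ₚ
    ; isCommutativeRing = record
      { isRing = record
        { +-isAbelianGroup = record
          { isGroup = record
            { isMonoid = record
              { isSemigroup = record
                { isMagma = record
                  { isEquivalence = record
                    { refl  = reflₚ , reflₚ
                    ; sym   = λ (e , f) → symₚ e , symₚ f
                    ; trans = λ (e , f) (e′ , f′) → transₚ e e′ , transₚ f f′
                    }
                  ; ∙-cong = λ (e , f) (e′ , f′) → +-congₚ e e′ , +-congₚ f f′
                  }
                ; assoc = λ (p , q) (p′ , q′) (p″ , q″) → +-assocₚ p p′ p″ , +-assocₚ q q′ q″
                }
              ; identity = (λ (p , q) → +-identityₚ p , +-identityₚ q)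
                         , (λ (p , q) → R.+-identityʳ p , R.+-identityʳ q)
              }
            ; inverse = (λ (p , q) → +-inverseₚ p , +-inverseₚ q)
                      , (λ (p , q) → R.-‿inverseʳ p , R.-‿inverseʳ q)
            ; ⁻¹-cong = λ (e , f) → -‿congₚ e , -‿congₚ f
            }
          ; comm = λ (p , q) (p′ , q′) → +-commₚ p p′ , +-commₚ q q′
          }
        ; *-cong = λ (e , f) (e′ , f′) → *-congₚ e e′ ,
            +-congₚ (+-congₚ (*-congₚ f e′) (*-congₚ e f′)) (*-congₚ reflₚ (*-congₚ f f′))
        ; *-assoc = λ (p , q) (p′ , q′) (p″ , q″) → *-assocₚ p p′ p″ ,
            solve 7 (λ d a b a′ b′ a″ b″ →
              (b :* a′ :+ a :* b′ :+ d :* (b :* b′)) :* a″ :+ (a :* a′) :* b″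
                :+ d :* ((b :* a′ :+ a :* b′ :+ d :* (b :* b′)) :* b″)
              := b :* (a′ :* a″) :+ a :* (b′ :* a″ :+ a′ :* b″ :+ d :* (b′ :* b″))
                :+ d :* (b :* (b′ :* a″ :+ a′ :* b″ :+ d :* (b′ :* b″))))
              reflₚ δ p q p′ q′ p″ q″
        ; *-identity =
            (λ (p , q) → R.*-identityˡ p ,
              R.trans (R.+-cong (R.trans (R.+-cong (R.zeroˡ p) (R.*-identityˡ q)) (R.+-identityˡ q))
                (R.trans (R.*-congˡ (R.zeroˡ q)) (R.zeroʳ δ))) (R.+-identityʳ q))
          , (λ (p , q) → R.*-identityʳ p ,
              R.trans (R.+-cong (R.trans (R.+-cong (R.*-identityʳ q) (R.zeroʳ p)) (R.+-identityʳ q))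
                (R.trans (R.*-congˡ (R.zeroʳ q)) (R.zeroʳ δ))) (R.+-identityʳ q))
        ; distrib =
            (λ (p , q) (p′ , q′) (p″ , q″) → distribₚ p p′ p″ ,
              solve 7 (λ d a b a′ b′ a″ b″ →
                b :* (a′ :+ a″) :+ a :* (b′ :+ b″) :+ d :* (b :* (b′ :+ b″))
                := (b :* a′ :+ a :* b′ :+ d :* (b :* b′)) :+ (b :* a″ :+ a :* b″ :+ d :* (b :* b″)))
              reflₚ δ p q p′ q′ p″ q″)
          , (λ (p , q) (p′ , q′) (p″ , q″) → R.distribʳ p p′ p″ ,
              solve 7 (λ d a b a′ b′ a″ b″ →
                (b′ :+ b″) :* a :+ (a′ :+ a″) :* b :+ d :* ((b′ :+ b″) :* b)
                := (b′ :* a :+ a′ :* b :+ d :* (b′ :* b)) :+ (b″ :* a :+ a″ :* b :+ d :* (b″ :* b)))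
              reflₚ δ p q p′ q′ p″ q″)
        }
      ; *-comm = λ (p , q) (p′ , q′) → *-commₚ p p′ ,
          solve 5 (λ d a b a′ b′ → b :* a′ :+ a :* b′ :+ d :* (b :* b′)
                                := b′ :* a :+ a′ :* b :+ d :* (b′ :* b))
            reflₚ δ p q p′ q′
      }
    }

module Cancellation {a b : Var} (a≢b : a ≢ b) where
  private
    δ : ℤ[x,y,z]
    δ = var a -ₚ var b

    ρ : Var → ℤ[x,y,z] × ℤ[x,y,z]
    ρ v with v ≟ⱽ a
    ... | yes _ = var b , 1ₚ
    ... | no _  = var v , 0ₚ

    module E = Evaluation (ε-ring δ) ρ

    collapse : ℤ[x,y,z] × ℤ[x,y,z] → ℤ[x,y,z]
    collapse (p , q) = p +ₚ δ *ₚ q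

    open ℤSolver

    -- Setting ε = δ respects ε² = δε and sends the image b + ε of a back to b + δ = a, so it undoes
    -- the evaluation.
    collapse-⟦⟧ : ∀ p → collapse E.⟦ p ⟧ ≈ₚ p
    collapse-⟦⟧ (var v) with v ≟ⱽ a
    ... | yes refl = R.trans (R.+-congˡ (R.*-identityʳ δ))
                       (solve 2 (λ a b → b :+ (a :- b) := a) reflₚ (var a) (var b))
    ... | no _ = R.trans (R.+-congˡ (R.zeroʳ δ)) (R.+-identityʳ (var v))
    collapse-⟦⟧ 0ₚ = R.trans (R.+-congˡ (R.zeroʳ δ)) (R.+-identityʳ 0ₚ)
    collapse-⟦⟧ 1ₚ = R.trans (R.+-congˡ (R.zeroʳ δ)) (R.+-identityʳ 1ₚ)
    collapse-⟦⟧ (p +ₚ q) = R.trans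
      (solve 5 (λ d a b a′ b′ → (a :+ a′) :+ d :* (b :+ b′) := (a :+ d :* b) :+ (a′ :+ d :* b′)) reflₚ
        δ (proj₁ E.⟦ p ⟧) (proj₂ E.⟦ p ⟧) (proj₁ E.⟦ q ⟧) (proj₂ E.⟦ q ⟧))
      (+-congₚ (collapse-⟦⟧ p) (collapse-⟦⟧ q))
    collapse-⟦⟧ (p *ₚ q) = R.trans
      (solve 5 (λ d a b a′ b′ → a :* a′ :+ d :* (b :* a′ :+ a :* b′ :+ d :* (b :* b′))
                             := (a :+ d :* b) :* (a′ :+ d :* b′)) reflₚ
        δ (proj₁ E.⟦ p ⟧) (proj₂ E.⟦ p ⟧) (proj₁ E.⟦ q ⟧) (proj₂ E.⟦ q ⟧))
      (*-congₚ (collapse-⟦⟧ p) (collapse-⟦⟧ q))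
    collapse-⟦⟧ (-ₚ p) = R.trans
      (solve 3 (λ d a b → (:- a) :+ d :* (:- b) := :- (a :+ d :* b)) reflₚ
        δ (proj₁ E.⟦ p ⟧) (proj₂ E.⟦ p ⟧))
      (-‿congₚ (collapse-⟦⟧ p))

    ⟦δ⟧ : _≈ₑ_ δ E.⟦ δ ⟧ (0ₚ , 1ₚ)
    ⟦δ⟧ with a ≟ⱽ a | b ≟ⱽ a
    ... | no a≢a | _        = contradiction refl a≢a
    ... | yes _  | yes b≡a  = contradiction (sym b≡a) a≢b
    ... | yes _  | no _     = R.-‿inverseʳ (var b) ,
                              R.trans (R.+-congˡ Rₚ.-0#≈0#) (R.+-identityʳ 1ₚ)

    -- The image of δ is ε, and ε(c₀ + c₁ε) = (c₀ + δc₁)ε, whose ε-part is the collapse of the image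
    -- of p, that is p itself.
    extract : ∀ p → proj₂ E.⟦ δ *ₚ p ⟧ ≈ₚ p
    extract p = begin
      q *ₚ c₀ +ₚ r *ₚ c₁ +ₚ δ *ₚ (q *ₚ c₁)   ≈⟨ proj₂ (CommutativeRing.*-congʳ (ε-ring δ) {c₀ , c₁} ⟦δ⟧) ⟩
      1ₚ *ₚ c₀ +ₚ 0ₚ *ₚ c₁ +ₚ δ *ₚ (1ₚ *ₚ c₁)
        ≈⟨ +-congₚ (R.trans (R.+-cong (*-identityₚ c₀) (R.zeroˡ c₁)) (R.+-identityʳ c₀))
                   (R.*-congˡ (*-identityₚ c₁)) ⟩
      c₀ +ₚ δ *ₚ c₁                          ≈⟨ collapse-⟦⟧ p ⟩
      p                                    ∎
      where
      open ≈ₚ-Reasoning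
      c₀ c₁ q r : ℤ[x,y,z]
      c₀ = proj₁ E.⟦ p ⟧
      c₁ = proj₂ E.⟦ p ⟧
      q = proj₂ E.⟦ δ ⟧
      r = proj₁ E.⟦ δ ⟧

  cancel : ∀ {p q} → (var a -ₚ var b) *ₚ p ≈ₚ (var a -ₚ var b) *ₚ q → p ≈ₚ q
  cancel {p} {q} e = R.trans (R.sym (extract p)) (R.trans (proj₂ (E.⟦⟧-cong e)) (extract q))

open Cancellation public using (cancel)

-- Divided differences

≡⊎≢ : ∀ (m n : ℕ) → m ≡ n ⊎ m ≢ n
≡⊎≢ m n with m ≟ n
... | yes p = inj₁ p
... | no  p = inj₂ p

s-left : ∀ i → s i ⟨$⟩ i ≡ suc i
s-left i = swap-left i (suc i)

s-right : ∀ i → s i ⟨$⟩ suc i ≡ i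
s-right i = swap-right i (suc i)

s-other : ∀ i {k} → k ≢ i → k ≢ suc i → s i ⟨$⟩ k ≡ k
s-other i = swap-other i (suc i)

s-commute : ∀ {i j} → suc i < j → ∀ k → s i ⟨$⟩ (s j ⟨$⟩ k) ≡ s j ⟨$⟩ (s i ⟨$⟩ k)
s-commute {i} {j} i+1<j k with ≡⊎≢ k i
... | inj₁ refl = trans (cong (s i ⟨$⟩_) (s-other j (<⇒≢ i<j) (<⇒≢ (m<n⇒m<1+n i<j))))
    (trans (s-left i) (sym (trans (cong (s j ⟨$⟩_) (s-left i)) (s-other j (<⇒≢ i+1<j) (<⇒≢ (m<n⇒m<1+n i+1<j))))))
  where
  i<j : i < j
  i<j = <-trans (n<1+n i) i+1<j
... | inj₂ k≢i with ≡⊎≢ k (suc i)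
...   | inj₁ refl = trans (cong (s i ⟨$⟩_) (s-other j (<⇒≢ i+1<j) (<⇒≢ (m<n⇒m<1+n i+1<j))))
    (trans (s-right i) (sym (trans (cong (s j ⟨$⟩_) (s-right i)) (s-other j (<⇒≢ i<j) (<⇒≢ (m<n⇒m<1+n i<j))))))
  where
  i<j : i < j
  i<j = <-trans (n<1+n i) i+1<j
...   | inj₂ k≢1+i = trans (s-other i sk≢i sk≢1+i) (cong (s j ⟨$⟩_) (sym (s-other i k≢i k≢1+i)))
  where
  i<j : i < j
  i<j = <-trans (n<1+n i) i+1<j
  sk≢ : ∀ m → m ≤ suc i → k ≢ m → s j ⟨$⟩ k ≢ m
  sk≢ m m≤ k≢m eq = k≢m (trans (sym (s-involutive j k)) (trans (cong (s j ⟨$⟩_) eq)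
    (s-other j (<⇒≢ (≤-<-trans m≤ i+1<j)) (<⇒≢ (m<n⇒m<1+n (≤-<-trans m≤ i+1<j))))))
  sk≢i : s j ⟨$⟩ k ≢ i
  sk≢i = sk≢ i (n≤1+n i) k≢i
  sk≢1+i : s j ⟨$⟩ k ≢ suc i
  sk≢1+i = sk≢ (suc i) ≤-refl k≢1+i

t-step : ∀ {a b} → a < b → ∀ k → t a (suc b) ⟨$⟩ k ≡ s b ⟨$⟩ (t a b ⟨$⟩ (s b ⟨$⟩ k))
t-step {a} {b} a<b k = cases (≡⊎≢ k a) (≡⊎≢ k (suc b)) (≡⊎≢ k b)
  where
  a≢b : a ≢ b
  a≢b = <⇒≢ a<b
  a≢1+b : a ≢ suc b
  a≢1+b = <⇒≢ (m<n⇒m<1+n a<b)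
  via : ∀ k k′ k″ m → t a (suc b) ⟨$⟩ k ≡ m → s b ⟨$⟩ k ≡ k′ → t a b ⟨$⟩ k′ ≡ k″ → s b ⟨$⟩ k″ ≡ m →
    t a (suc b) ⟨$⟩ k ≡ s b ⟨$⟩ (t a b ⟨$⟩ (s b ⟨$⟩ k))
  via _ _ _ _ e e₁ e₂ e₃ = trans e (sym (trans (cong (λ m → s b ⟨$⟩ (t a b ⟨$⟩ m)) e₁)
    (trans (cong (s b ⟨$⟩_) e₂) e₃)))
  cases : ∀ {k} → k ≡ a ⊎ k ≢ a → k ≡ suc b ⊎ k ≢ suc b → k ≡ b ⊎ k ≢ b →
    t a (suc b) ⟨$⟩ k ≡ s b ⟨$⟩ (t a b ⟨$⟩ (s b ⟨$⟩ k))
  cases (inj₁ refl) _ _ = via a a b (suc b) (swap-left a (suc b)) (s-other b a≢b a≢1+b) (swap-left a b) (s-left b)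
  cases (inj₂ _) (inj₁ refl) _ =
    via (suc b) b a a (swap-right a (suc b)) (s-right b) (swap-right a b) (s-other b a≢b a≢1+b)
  cases (inj₂ k≢a) (inj₂ k≢1+b) (inj₁ refl) =
    via b (suc b) (suc b) b (swap-other a (suc b) k≢a k≢1+b) (s-left b) (swap-other a b (a≢1+b ∘ sym) (<⇒≢ (n<1+n b) ∘ sym)) (s-right b)
  cases {k} (inj₂ k≢a) (inj₂ k≢1+b) (inj₂ k≢b) =
    via k k k k (swap-other a (suc b) k≢a k≢1+b) (s-other b k≢b k≢1+b) (swap-other a b k≢a k≢b) (s-other b k≢b k≢1+b)

s-braid : ∀ i k → s i ⟨$⟩ (s (suc i) ⟨$⟩ (s i ⟨$⟩ k)) ≡ s (suc i) ⟨$⟩ (s i ⟨$⟩ (s (suc i) ⟨$⟩ k))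
s-braid i k = cases (≡⊎≢ k i) (≡⊎≢ k (suc i)) (≡⊎≢ k (2 + i))
  where
  j : ℕ
  j = suc i
  along : ∀ (a b c k k′ k″ m : ℕ) → s c ⟨$⟩ k ≡ k′ → s b ⟨$⟩ k′ ≡ k″ → s a ⟨$⟩ k″ ≡ m →
    s a ⟨$⟩ (s b ⟨$⟩ (s c ⟨$⟩ k)) ≡ m
  along a b c _ _ _ _ e₁ e₂ e₃ = trans (cong (λ m → s a ⟨$⟩ (s b ⟨$⟩ m)) e₁) (trans (cong (s a ⟨$⟩_) e₂) e₃)
  cases : ∀ {k} → k ≡ i ⊎ k ≢ i → k ≡ j ⊎ k ≢ j → k ≡ 2 + i ⊎ k ≢ 2 + i →
    s i ⟨$⟩ (s j ⟨$⟩ (s i ⟨$⟩ k)) ≡ s j ⟨$⟩ (s i ⟨$⟩ (s j ⟨$⟩ k))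
  cases (inj₁ refl) _ _ = trans
    (along i j i i j (2 + i) (2 + i) (s-left i) (s-left j) (s-other i (λ ()) (λ ())))
    (sym (along j i j i i j (2 + i) (s-other j (λ ()) (λ ())) (s-left i) (s-left j)))
  cases (inj₂ _) (inj₁ refl) _ = trans
    (along i j i j i i j (s-right i) (s-other j (λ ()) (λ ())) (s-left i))
    (sym (along j i j j (2 + i) (2 + i) j (s-left j) (s-other i (λ ()) (λ ())) (s-right j)))
  cases (inj₂ _) (inj₂ _) (inj₁ refl) = trans
    (along i j i (2 + i) (2 + i) j i (s-other i (λ ()) (λ ())) (s-right j) (s-right i))
    (sym (along j i j (2 + i) j i i (s-right j) (s-right i) (s-other j (λ ()) (λ ()))))
  cases {k} (inj₂ k≢i) (inj₂ k≢j) (inj₂ k≢2+i) = trans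
    (along i j i k k k k (s-other i k≢i k≢j) (s-other j k≢j k≢2+i) (s-other i k≢i k≢j))
    (sym (along j i j k k k k (s-other j k≢j k≢2+i) (s-other i k≢i k≢j) (s-other j k≢j k≢2+i)))

root : ℕ → ℤ[x,y,z]
root i = x i -ₚ x (suc i)

root-cancel : ∀ i {p q} → root i *ₚ p ≈ₚ root i *ₚ q → p ≈ₚ q
root-cancel i = cancel λ ()

∂-spec : ∀ i p → root i *ₚ ∂ i p ≈ₚ p -ₚ act i p
∂-spec i p = proj₂ (quotient i p)

-- `quotient` recurses on the ring expression, so not even compatibility of `∂` with `≈ₚ` is
-- immediate. All laws of `∂` are derived from this characterisation.
∂-unique : ∀ i {p q} → root i *ₚ q ≈ₚ p -ₚ act i p → ∂ i p ≈ₚ q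
∂-unique i {p} e = root-cancel i (transₚ (∂-spec i p) (symₚ e))

act-cong : ∀ i {p q} → p ≈ₚ q → act i p ≈ₚ act i q
act-cong i = sub-cong (var ∘ sVar i)

act-involutive : ∀ i p → act i (act i p) ≈ₚ p
act-involutive i p = transₚ
  (sub-comp (var ∘ sVar i) (var ∘ sVar i) {var}
    (λ { (X j) → ≡⇒≈ₚ (cong x (s-involutive i j)) ; (Y _) → reflₚ ; (Z _) → reflₚ }) p)
  (≡⇒≈ₚ (sub-var p))

act-commute : ∀ {i j} → suc i < j → ∀ p → act i (act j p) ≈ₚ act j (act i p)
act-commute {i} {j} far p = transₚ
  (sub-comp (var ∘ sVar i) (var ∘ sVar j)
    (λ { (X k) → ≡⇒≈ₚ (cong x (s-commute far k)) ; (Y _) → reflₚ ; (Z _) → reflₚ }) p)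
  (≡⇒≈ₚ (sym (sub-sub (var ∘ sVar j) (var ∘ sVar i) p)))

act-braid : ∀ i p → act i (act (suc i) (act i p)) ≈ₚ act (suc i) (act i (act (suc i) p))
act-braid i p = transₚ (act-cong i (≡⇒≈ₚ (sub-sub _ _ p))) (transₚ
  (sub-comp (var ∘ sVar i) (var ∘ sVar (suc i) ∘ sVar i)
    (λ { (X k) → ≡⇒≈ₚ (cong x (s-braid i k)) ; (Y _) → reflₚ ; (Z _) → reflₚ }) p)
  (≡⇒≈ₚ (sym (trans (cong (act (suc i)) (sub-sub _ _ p)) (sub-sub _ _ p)))))

∂-cong : ∀ i {p q} → p ≈ₚ q → ∂ i p ≈ₚ ∂ i q
∂-cong i {p} {q} e = ∂-unique i (transₚ (∂-spec i q)
  (+-congₚ (symₚ e) (-‿congₚ (act-cong i (symₚ e)))))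

∂-+ : ∀ i p q → ∂ i (p +ₚ q) ≈ₚ ∂ i p +ₚ ∂ i q
∂-+ i p q = ∂-unique i (transₚ (distribₚ _ _ _) (transₚ (+-congₚ (∂-spec i p) (∂-spec i q))
  (solve 4 (λ a b a′ b′ → (a :- b) :+ (a′ :- b′) := (a :+ a′) :- (b :+ b′)) reflₚ
    p (act i p) q (act i q))))
  where open ℤSolver

∂-invariant : ∀ i {p} → act i p ≈ₚ p → ∂ i p ≈ₚ 0ₚ
∂-invariant i {p} e = ∂-unique i (transₚ (R.zeroʳ (root i))
  (symₚ (transₚ (+-congₚ reflₚ (-‿congₚ e)) (R.-‿inverseʳ p))))

∂-0 : ∀ i → ∂ i 0ₚ ≈ₚ 0ₚ
∂-0 i = ∂-invariant i {0ₚ} reflₚ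

act-via-∂ : ∀ i p → act i p ≈ₚ p -ₚ root i *ₚ ∂ i p
act-via-∂ i p = transₚ (solve 2 (λ p q → q := p :- (p :- q)) reflₚ p (act i p))
  (+-congₚ reflₚ (-‿congₚ (symₚ (∂-spec i p))))
  where open ℤSolver

invariant-from-∂ : ∀ i {p} → ∂ i p ≈ₚ 0ₚ → act i p ≈ₚ p
invariant-from-∂ i {p} e = transₚ (act-via-∂ i p)
  (transₚ (+-congₚ reflₚ (-‿congₚ (transₚ (R.*-congˡ e) (R.zeroʳ (root i)))))
    (transₚ (+-congₚ reflₚ Rₚ.-0#≈0#) (R.+-identityʳ p)))

∂-scale : ∀ i {c} → act i c ≈ₚ c → ∀ p → ∂ i (c *ₚ p) ≈ₚ c *ₚ ∂ i p
∂-scale i {c} e p = ∂-unique i (begin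
  root i *ₚ (c *ₚ ∂ i p)        ≈⟨ solve 3 (λ a b c → a :* (b :* c) := b :* (a :* c)) reflₚ (root i) c (∂ i p) ⟩
  c *ₚ (root i *ₚ ∂ i p)        ≈⟨ R.*-congˡ (∂-spec i p) ⟩
  c *ₚ (p -ₚ act i p)           ≈⟨ Rₚ.x[y-z]≈xy-xz c p (act i p) ⟩
  c *ₚ p -ₚ c *ₚ act i p        ≈⟨ R.+-congˡ (-‿congₚ (R.*-congʳ (symₚ e))) ⟩
  c *ₚ p -ₚ act i (c *ₚ p)      ∎)
  where
  open ≈ₚ-Reasoning
  open ℤSolver

act-root : ∀ i → act i (root i) ≈ₚ x (suc i) -ₚ x i
act-root i = +-congₚ (≡⇒≈ₚ (cong x (s-left i))) (-‿congₚ (≡⇒≈ₚ (cong x (s-right i))))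

-- Numerator and denominator of the quotient both change sign under s_i.
act-∂ : ∀ i p → act i (∂ i p) ≈ₚ ∂ i p
act-∂ i p = symₚ (∂-unique i (begin
  root i *ₚ act i (∂ i p)
    ≈⟨ solve 3 (λ a b q → (a :- b) :* q := :- ((b :- a) :* q)) reflₚ (x i) (x (suc i)) (act i (∂ i p)) ⟩
  -ₚ ((x (suc i) -ₚ x i) *ₚ act i (∂ i p))   ≈⟨ -‿congₚ (R.*-congʳ (symₚ (act-root i))) ⟩
  -ₚ act i (root i *ₚ ∂ i p)                 ≈⟨ -‿congₚ (act-cong i (∂-spec i p)) ⟩
  -ₚ (act i p -ₚ act i (act i p))            ≈⟨ -‿congₚ (+-congₚ reflₚ (-‿congₚ (act-involutive i p))) ⟩
  -ₚ (act i p -ₚ p)                          ≈⟨ solve 2 (λ p q → :- (q :- p) := p :- q) reflₚ p (act i p) ⟩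
  p -ₚ act i p                               ∎))
  where
  open ≈ₚ-Reasoning
  open ℤSolver

∂-∂ : ∀ i p → ∂ i (∂ i p) ≈ₚ 0ₚ
∂-∂ i p = ∂-invariant i (act-∂ i p)

act-∂-commute : ∀ {i j} → suc i < j ⊎ suc j < i → ∀ p → act j (∂ i p) ≈ₚ ∂ i (act j p)
act-∂-commute {i} {j} far p = symₚ (∂-unique i (begin
  root i *ₚ act j (∂ i p)          ≈⟨ R.*-congʳ (symₚ root-fixed) ⟩
  act j (root i *ₚ ∂ i p)          ≈⟨ act-cong j (∂-spec i p) ⟩
  act j p -ₚ act j (act i p)       ≈⟨ R.+-congˡ (-‿congₚ (swapped far)) ⟩
  act j p -ₚ act i (act j p)       ∎))
  where
  open ≈ₚ-Reasoning
  swapped : suc i < j ⊎ suc j < i → act j (act i p) ≈ₚ act i (act j p)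
  swapped (inj₁ i<j) = symₚ (act-commute i<j p)
  swapped (inj₂ j<i) = act-commute j<i p
  fixed : suc i < j ⊎ suc j < i → (s j ⟨$⟩ i ≡ i) × (s j ⟨$⟩ suc i ≡ suc i)
  fixed (inj₁ 1+i<j) = s-other j (<⇒≢ i<j) (<⇒≢ (m<n⇒m<1+n i<j)) ,
                       s-other j (<⇒≢ 1+i<j) (<⇒≢ (m<n⇒m<1+n 1+i<j))
    where
    i<j : i < j
    i<j = <-trans (n<1+n i) 1+i<j
  fixed (inj₂ 1+j<i) = s-other j (<⇒≢ (<-trans (n<1+n j) 1+j<i) ∘ sym) (<⇒≢ 1+j<i ∘ sym) ,
                       s-other j (<⇒≢ (<-trans (n<1+n j) (m<n⇒m<1+n 1+j<i)) ∘ sym)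
                                 (<⇒≢ (m<n⇒m<1+n 1+j<i) ∘ sym)
  root-fixed : act j (root i) ≈ₚ root i
  root-fixed = +-congₚ (≡⇒≈ₚ (cong x (proj₁ (fixed far)))) (-‿congₚ (≡⇒≈ₚ (cong x (proj₂ (fixed far)))))

-- Multiplied by both roots, each side becomes p - s_i p - s_j p + s_i s_j p.
∂-commute : ∀ {i j} → suc i < j → ∀ p → ∂ i (∂ j p) ≈ₚ ∂ j (∂ i p)
∂-commute {i} {j} far p = ∂-unique i (root-cancel j (begin
  root j *ₚ (root i *ₚ ∂ j (∂ i p))
    ≈⟨ solve 3 (λ a b c → b :* (a :* c) := a :* (b :* c)) reflₚ (root i) (root j) (∂ j (∂ i p)) ⟩
  root i *ₚ (root j *ₚ ∂ j (∂ i p))            ≈⟨ R.*-congˡ (∂-spec j (∂ i p)) ⟩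
  root i *ₚ (∂ i p -ₚ act j (∂ i p))           ≈⟨ R.*-congˡ (R.+-congˡ (-‿congₚ (act-∂-commute (inj₁ far) p))) ⟩
  root i *ₚ (∂ i p -ₚ ∂ i (act j p))           ≈⟨ Rₚ.x[y-z]≈xy-xz _ _ _ ⟩
  root i *ₚ ∂ i p -ₚ root i *ₚ ∂ i (act j p)   ≈⟨ R.+-cong (∂-spec i p) (-‿congₚ (∂-spec i (act j p))) ⟩
  (p -ₚ act i p) -ₚ (act j p -ₚ act i (act j p))
    ≈⟨ solve 4 (λ a b c e → (a :- b) :- (c :- e) := (a :- c) :- (b :- e)) reflₚ
         p (act i p) (act j p) (act i (act j p)) ⟩
  (p -ₚ act j p) -ₚ (act i p -ₚ act i (act j p))
    ≈⟨ R.+-cong (symₚ (∂-spec j p)) (-‿congₚ (transₚ (R.+-congˡ (-‿congₚ (act-commute far p)))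
         (symₚ (∂-spec j (act i p))))) ⟩
  root j *ₚ ∂ j p -ₚ root j *ₚ ∂ j (act i p)   ≈⟨ symₚ (Rₚ.x[y-z]≈xy-xz _ _ _) ⟩
  root j *ₚ (∂ j p -ₚ ∂ j (act i p))           ≈⟨ R.*-congˡ (R.+-congˡ (-‿congₚ (symₚ (act-∂-commute (inj₂ far) p)))) ⟩
  root j *ₚ (∂ j p -ₚ act i (∂ j p))           ∎))
  where
  open ≈ₚ-Reasoning
  open ℤSolver

-- ∂_i ∂_j ∂_i p is the antisymmetrisation of p over the six products of s_i
-- and s_j, divided by the product of the three roots u, v and u + v.
antisymmetrise : ∀ {u v p p₁ p₂ p₂₁ p₁₂ p₁₂₁ r r₂ r₁₂ q q₁ m} →
  u *ₚ r ≈ₚ p -ₚ p₁ → v *ₚ q ≈ₚ r -ₚ r₂ → u *ₚ m ≈ₚ q -ₚ q₁ →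
  (u +ₚ v) *ₚ r₂ ≈ₚ p₂ -ₚ p₂₁ → (u +ₚ v) *ₚ q₁ ≈ₚ r -ₚ r₁₂ → v *ₚ r₁₂ ≈ₚ p₁₂ -ₚ p₁₂₁ →
  u *ₚ (v *ₚ ((u +ₚ v) *ₚ m)) ≈ₚ (p -ₚ p₁) -ₚ (p₂ -ₚ p₂₁) +ₚ (p₁₂ -ₚ p₁₂₁)
antisymmetrise {u} {v} {p} {p₁} {p₂} {p₂₁} {p₁₂} {p₁₂₁} {r} {r₂} {r₁₂} {q} {q₁} {m} e₁ e₂ e₃ e₄ e₅ e₆ = begin
  u *ₚ (v *ₚ ((u +ₚ v) *ₚ m))
    ≈⟨ solve 3 (λ u v m → u :* (v :* ((u :+ v) :* m)) := (v :* (u :+ v)) :* (u :* m)) reflₚ u v m ⟩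
  (v *ₚ (u +ₚ v)) *ₚ (u *ₚ m)   ≈⟨ R.*-congˡ e₃ ⟩
  (v *ₚ (u +ₚ v)) *ₚ (q -ₚ q₁)
    ≈⟨ solve 4 (λ u v q q₁ → (v :* (u :+ v)) :* (q :- q₁) :=
         (u :+ v) :* (v :* q) :- v :* ((u :+ v) :* q₁)) reflₚ u v q q₁ ⟩
  (u +ₚ v) *ₚ (v *ₚ q) -ₚ v *ₚ ((u +ₚ v) *ₚ q₁)
    ≈⟨ R.+-cong (R.*-congˡ e₂) (-‿congₚ (R.*-congˡ e₅)) ⟩
  (u +ₚ v) *ₚ (r -ₚ r₂) -ₚ v *ₚ (r -ₚ r₁₂)
    ≈⟨ solve 5 (λ u v r r₂ r₁₂ → (u :+ v) :* (r :- r₂) :- v :* (r :- r₁₂) :=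
         u :* r :- (u :+ v) :* r₂ :+ v :* r₁₂) reflₚ u v r r₂ r₁₂ ⟩
  u *ₚ r -ₚ (u +ₚ v) *ₚ r₂ +ₚ v *ₚ r₁₂
    ≈⟨ R.+-cong (R.+-cong e₁ (-‿congₚ e₄)) e₆ ⟩
  (p -ₚ p₁) -ₚ (p₂ -ₚ p₂₁) +ₚ (p₁₂ -ₚ p₁₂₁) ∎
  where
  open ≈ₚ-Reasoning
  open ℤSolver

-- Exchanging the roles of i and i + 1 permutes the six terms of the antisymmetrisation, the longest
-- one by `act-braid`. The three roots are then cancelled; the third is x_i - x_{i+2}, the sum of
-- the other two.
∂-braid : ∀ i p → ∂ i (∂ (suc i) (∂ i p)) ≈ₚ ∂ (suc i) (∂ i (∂ (suc i) p))
∂-braid i p = cancel {X i} {X (2 + i)} (λ ()) (root-cancel j (root-cancel i (begin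
  u *ₚ (v *ₚ (w *ₚ ∂ i (∂ j (∂ i p))))
    ≈⟨ R.*-congˡ (R.*-congˡ (R.*-congʳ w≈)) ⟩
  u *ₚ (v *ₚ ((u +ₚ v) *ₚ ∂ i (∂ j (∂ i p))))
    ≈⟨ antisymmetrise (∂-spec i p) (∂-spec j (∂ i p)) (∂-spec i (∂ j (∂ i p))) e₁ e₂ e₃ ⟩
  (p -ₚ act i p) -ₚ (act j p -ₚ act j (act i p)) +ₚ (act i (act j p) -ₚ act i (act j (act i p)))
    ≈⟨ R.+-congˡ (R.+-congˡ (-‿congₚ (act-braid i p))) ⟩
  (p -ₚ act i p) -ₚ (act j p -ₚ act j (act i p)) +ₚ (act i (act j p) -ₚ act j (act i (act j p)))
    ≈⟨ solve 6 (λ p a b c d f → (p :- a) :- (b :- c) :+ (d :- f) := (p :- b) :- (a :- d) :+ (c :- f)) reflₚ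
         p (act i p) (act j p) (act j (act i p)) (act i (act j p)) (act j (act i (act j p))) ⟩
  (p -ₚ act j p) -ₚ (act i p -ₚ act i (act j p)) +ₚ (act j (act i p) -ₚ act j (act i (act j p)))
    ≈⟨ symₚ (antisymmetrise (∂-spec j p) (∂-spec i (∂ j p)) (∂-spec j (∂ i (∂ j p))) f₁ f₂ f₃) ⟩
  v *ₚ (u *ₚ ((v +ₚ u) *ₚ ∂ j (∂ i (∂ j p))))
    ≈⟨ R.*-congˡ (R.*-congˡ (R.*-congʳ (transₚ (+-commₚ v u) (symₚ w≈)))) ⟩
  v *ₚ (u *ₚ (w *ₚ ∂ j (∂ i (∂ j p))))
    ≈⟨ solve 3 (λ u v m → v :* (u :* m) := u :* (v :* m)) reflₚ u v (w *ₚ ∂ j (∂ i (∂ j p))) ⟩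
  u *ₚ (v *ₚ (w *ₚ ∂ j (∂ i (∂ j p)))) ∎)))
  where
  open ≈ₚ-Reasoning
  open ℤSolver
  j : ℕ
  j = suc i
  u v w : ℤ[x,y,z]
  u = root i
  v = root j
  w = x i -ₚ x (2 + i)
  w≈ : w ≈ₚ u +ₚ v
  w≈ = solve 3 (λ a b c → a :- c := (a :- b) :+ (b :- c)) reflₚ (x i) (x j) (x (2 + i))
  act-jᵘ : act j u ≈ₚ w
  act-jᵘ = +-congₚ (≡⇒≈ₚ (cong x (s-other j (λ ()) (λ ())))) (-‿congₚ (≡⇒≈ₚ (cong x (s-left j))))
  act-iᵛ : act i v ≈ₚ w
  act-iᵛ = +-congₚ (≡⇒≈ₚ (cong x (s-right i))) (-‿congₚ (≡⇒≈ₚ (cong x (s-other i (λ ()) (λ ())))))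
  act-iʷ : act i w ≈ₚ v
  act-iʷ = +-congₚ (≡⇒≈ₚ (cong x (s-left i))) (-‿congₚ (≡⇒≈ₚ (cong x (s-other i (λ ()) (λ ())))))
  act-jʷ : act j w ≈ₚ u
  act-jʷ = +-congₚ (≡⇒≈ₚ (cong x (s-other j (λ ()) (λ ())))) (-‿congₚ (≡⇒≈ₚ (cong x (s-right j))))
  E₁ : w *ₚ act j (∂ i p) ≈ₚ act j p -ₚ act j (act i p)
  E₁ = transₚ (R.*-congʳ (symₚ act-jᵘ)) (act-cong j (∂-spec i p))
  F₁ : w *ₚ act i (∂ j p) ≈ₚ act i p -ₚ act i (act j p)
  F₁ = transₚ (R.*-congʳ (symₚ act-iᵛ)) (act-cong i (∂-spec j p))
  e₁ : (u +ₚ v) *ₚ act j (∂ i p) ≈ₚ act j p -ₚ act j (act i p)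
  e₁ = transₚ (R.*-congʳ (symₚ w≈)) E₁
  f₁ : (v +ₚ u) *ₚ act i (∂ j p) ≈ₚ act i p -ₚ act i (act j p)
  f₁ = transₚ (R.*-congʳ (transₚ (+-commₚ v u) (symₚ w≈))) F₁
  e₂ : (u +ₚ v) *ₚ act i (∂ j (∂ i p)) ≈ₚ ∂ i p -ₚ act i (act j (∂ i p))
  e₂ = transₚ (R.*-congʳ (transₚ (symₚ w≈) (symₚ act-iᵛ))) (transₚ (act-cong i (∂-spec j (∂ i p)))
         (+-congₚ (act-∂ i p) reflₚ))
  f₂ : (v +ₚ u) *ₚ act j (∂ i (∂ j p)) ≈ₚ ∂ j p -ₚ act j (act i (∂ j p))
  f₂ = transₚ (R.*-congʳ (transₚ (+-commₚ v u) (transₚ (symₚ w≈) (symₚ act-jᵘ))))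
         (transₚ (act-cong j (∂-spec i (∂ j p))) (+-congₚ (act-∂ j p) reflₚ))
  e₃ : v *ₚ act i (act j (∂ i p)) ≈ₚ act i (act j p) -ₚ act i (act j (act i p))
  e₃ = transₚ (R.*-congʳ (symₚ act-iʷ)) (act-cong i E₁)
  f₃ : u *ₚ act j (act i (∂ j p)) ≈ₚ act j (act i p) -ₚ act j (act i (act j p))
  f₃ = transₚ (R.*-congʳ (symₚ act-jʷ)) (act-cong j F₁)

-- Symmetric polynomials

update : ∀ {A : Set} → ℕ → A → (ℕ → A) → ℕ → A
update i a f j with j ≟ i
... | yes _ = a
... | no _  = f j

update-≡ : ∀ {A : Set} i (a : A) f → update i a f i ≡ a
update-≡ i a f with i ≟ i
... | yes _  = refl
... | no i≢i = contradiction refl i≢i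

update-≢ : ∀ {A : Set} i (a : A) f {j} → j ≢ i → update i a f j ≡ f j
update-≢ i a f {j} j≢i with j ≟ i
... | yes j≡i = contradiction j≡i j≢i
... | no _    = refl

-- Read off the expression and not invariant under `≈ₚ`; it serves to pick variables that do not
-- occur in the given expression.
xBound : ℤ[x,y,z] → ℕ
xBound (var (X i)) = suc i
xBound (var (Y _)) = 0
xBound (var (Z _)) = 0
xBound 0ₚ          = 0
xBound 1ₚ          = 0
xBound (p +ₚ q)    = xBound p ⊔ xBound q
xBound (p *ₚ q)    = xBound p ⊔ xBound q
xBound (-ₚ p)      = xBound p

sub-local : ∀ {W} {ρ σ : Var → Poly W} n →
  (∀ i → i < n → ρ (X i) ≈ₚ σ (X i)) → (∀ i → ρ (Y i) ≈ₚ σ (Y i)) → (∀ i → ρ (Z i) ≈ₚ σ (Z i)) →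
  ∀ p → xBound p ≤ n → sub ρ p ≈ₚ sub σ p
sub-local n eX eY eZ (var (X i)) b = eX i b
sub-local n eX eY eZ (var (Y i)) b = eY i
sub-local n eX eY eZ (var (Z i)) b = eZ i
sub-local n eX eY eZ 0ₚ b = reflₚ
sub-local n eX eY eZ 1ₚ b = reflₚ
sub-local n eX eY eZ (p +ₚ q) b = +-congₚ
  (sub-local n eX eY eZ p (m⊔n≤o⇒m≤o (xBound p) (xBound q) b))
  (sub-local n eX eY eZ q (m⊔n≤o⇒n≤o (xBound p) (xBound q) b))
sub-local n eX eY eZ (p *ₚ q) b = *-congₚ
  (sub-local n eX eY eZ p (m⊔n≤o⇒m≤o (xBound p) (xBound q) b))
  (sub-local n eX eY eZ q (m⊔n≤o⇒n≤o (xBound p) (xBound q) b))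
sub-local n eX eY eZ (-ₚ p) b = -‿congₚ (sub-local n eX eY eZ p b)

onX : (ℕ → ℕ) → Var → Var
onX f (X i) = X (f i)
onX f (Y i) = Y i
onX f (Z i) = Z i

x↦ : (ℕ → ℤ[x,y,z]) → Var → ℤ[x,y,z]
x↦ f (X i) = f i
x↦ f (Y i) = y i
x↦ f (Z i) = z i

-- If p is symmetric, then exchanging x_j with a variable absent from p shows
-- that p does not depend on x_j.
module _ {p : ℤ[x,y,z]} (symmetric : ∀ i → act i p ≈ₚ p) where

  symmetric-t : ∀ j k → rename (onX (t j (suc (k + j)) ⟨$⟩_)) p ≈ₚ p
  symmetric-t j zero = transₚ
    (sub-ext (λ { (X i) → reflₚ ; (Y i) → reflₚ ; (Z i) → reflₚ }) p) (symmetric j)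
  symmetric-t j (suc k) = begin
    rename (onX (t j (suc N) ⟨$⟩_)) p
      ≈⟨ symₚ (transₚ (act-cong N (sub-comp _ _ {var ∘ onX (λ i → t j N ⟨$⟩ (s N ⟨$⟩ i))} (λ { (X i) → reflₚ ; (Y i) → reflₚ ; (Z i) → reflₚ }) p))
           (sub-comp _ _ (λ { (X i) → ≡⇒≈ₚ (cong x (sym (t-step j<N i))) ; (Y i) → reflₚ ; (Z i) → reflₚ }) p)) ⟩
    act N (rename (onX (t j N ⟨$⟩_)) (act N p)) ≈⟨ act-cong N (sub-cong (var ∘ onX (t j N ⟨$⟩_)) (symmetric N)) ⟩
    act N (rename (onX (t j N ⟨$⟩_)) p)         ≈⟨ act-cong N (symmetric-t j k) ⟩
    act N p                                     ≈⟨ symmetric N ⟩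
    p                                           ∎
    where
    open ≈ₚ-Reasoning
    N : ℕ
    N = suc (k + j)
    j<N : j < N
    j<N = s≤s (m≤n+m j k)

  private
    put : ℕ → ℤ[x,y,z] → ℕ → ℤ[x,y,z]
    put j q = update j q x

    move : ∀ j → sub (x↦ (put j (x (suc (xBound p + j))))) p ≈ₚ p
    move j = transₚ (sub-local (xBound p) (λ i i<b → ≡⇒≈ₚ (agree i i<b (≡⊎≢ i j))) (λ _ → reflₚ) (λ _ → reflₚ)
        p ≤-refl) (symmetric-t j (xBound p))
      where
      -- At least `xBound p`, so x_N is absent from p, and of the form that `symmetric-t` treats, in
      -- particular greater than j.
      N : ℕ
      N = suc (xBound p + j)
      agree : ∀ i → i < xBound p → i ≡ j ⊎ i ≢ j → put j (x N) i ≡ x (t j N ⟨$⟩ i)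
      agree i _ (inj₁ refl) = trans (update-≡ j (x N) x) (cong x (sym (swap-left j N)))
      agree i i<b (inj₂ i≢j) = trans (update-≢ j (x N) x i≢j) (cong x (sym (swap-other j N i≢j
        (<⇒≢ (<-trans i<b (s≤s (m≤m+n (xBound p) j)))))))

    independent : ∀ j q → sub (x↦ (put j q)) p ≈ₚ p
    independent j q = begin
      sub (x↦ (put j q)) p                        ≈⟨ sub-cong (x↦ (put j q)) (symₚ (move j)) ⟩
      sub (x↦ (put j q)) (sub (x↦ (put j (x N))) p)
        ≈⟨ sub-comp _ _ (λ { (X i) → absorb i (≡⊎≢ i j) ; (Y _) → reflₚ ; (Z _) → reflₚ }) p ⟩
      sub (x↦ (put j (x N))) p                    ≈⟨ move j ⟩
      p                                           ∎
      where
      open ≈ₚ-Reasoning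
      N : ℕ
      N = suc (xBound p + j)
      absorb : ∀ i → i ≡ j ⊎ i ≢ j → sub (x↦ (put j q)) (put j (x N) i) ≈ₚ put j (x N) i
      absorb i (inj₁ refl) = transₚ (sub-cong (x↦ (put j q)) (≡⇒≈ₚ (update-≡ j (x N) x)))
        (transₚ (≡⇒≈ₚ (update-≢ j q x (<⇒≢ (s≤s (m≤n+m j (xBound p))) ∘ sym))) (≡⇒≈ₚ (sym (update-≡ j (x N) x))))
      absorb i (inj₂ i≢j) = transₚ (sub-cong (x↦ (put j q)) (≡⇒≈ₚ (update-≢ j (x N) x i≢j)))
        (transₚ (≡⇒≈ₚ (update-≢ j q x i≢j)) (≡⇒≈ₚ (sym (update-≢ j (x N) x i≢j))))

    -- Interpolates between x (m = 0) and y (m large), because `independent` replaces only one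
    -- variable at a time.
    below : ℕ → ℕ → ℤ[x,y,z]
    below m i with i <? m
    ... | yes _ = y i
    ... | no _  = x i

    below-< : ∀ {m i} → i < m → below m i ≡ y i
    below-< {m} {i} i<m with i <? m
    ... | yes _  = refl
    ... | no i≮m = contradiction i<m i≮m

    below-≥ : ∀ {m i} → m ≤ i → below m i ≡ x i
    below-≥ {m} {i} m≤i with i <? m
    ... | yes i<m = contradiction m≤i (<⇒≱ i<m)
    ... | no _    = refl

    below-suc : ∀ m i → sub (x↦ (below m)) (put m (y m) i) ≡ below (suc m) i
    below-suc m i with <-cmp i m
    ... | tri< i<m i≢m _ = trans (cong (sub (x↦ (below m))) (update-≢ m (y m) x i≢m))
                             (trans (below-< i<m) (sym (below-< (m<n⇒m<1+n i<m))))
    ... | tri≈ _ refl _  = trans (cong (sub (x↦ (below m))) (update-≡ m (y m) x)) (sym (below-< (n<1+n m)))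
    ... | tri> _ i≢m m<i = trans (cong (sub (x↦ (below m))) (update-≢ m (y m) x i≢m))
                             (trans (below-≥ (<⇒≤ m<i)) (sym (below-≥ m<i)))

    replaced : ∀ m → sub (x↦ (below m)) p ≈ₚ p
    replaced zero    = sub-identity (λ { (X i) → reflₚ ; (Y _) → reflₚ ; (Z _) → reflₚ }) p
    replaced (suc m) = transₚ
      (symₚ (sub-comp _ _ (λ { (X i) → ≡⇒≈ₚ (below-suc m i) ; (Y _) → reflₚ ; (Z _) → reflₚ }) p))
      (transₚ (sub-cong (x↦ (below m)) (independent m (y m))) (replaced m))

  -- Freeness from x is expressed by the substitution x = y because this is `ev 𝟙`, the value at
  -- which polynomials are compared in `∂-determined`.
  symmetric⇒x-free : sub (x↦ y) p ≈ₚ p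
  symmetric⇒x-free = transₚ
    (sub-local (xBound p) (λ i i<b → ≡⇒≈ₚ (sym (below-< i<b))) (λ _ → reflₚ) (λ _ → reflₚ) p ≤-refl)
    (replaced (xBound p))

actY : ℕ → ℤ[x,y,z] → ℤ[x,y,z]
actY i = rename λ { (X j) → X j ; (Y j) → Y (s i ⟨$⟩ j) ; (Z j) → Z j }

y↦ : (ℕ → ℤ[x,y,z]) → Var → ℤ[x,y,z]
y↦ f (X i) = x i
y↦ f (Y i) = f i
y↦ f (Z i) = z i

-- Conjugation with the exchange of the names x and y reduces this to `symmetric⇒x-free`.
symmetric⇒y-free : ∀ {p} → (∀ i → actY i p ≈ₚ p) → sub (y↦ x) p ≈ₚ p
symmetric⇒y-free {p} symmetric = begin
  sub (y↦ x) p                          ≈⟨ symₚ (sub-comp _ _ (λ { (X _) → reflₚ ; (Y _) → reflₚ ; (Z _) → reflₚ }) p) ⟩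
  rename x↔y (sub (λ { (X i) → y i ; (Y i) → y i ; (Z i) → z i }) p)
    ≈⟨ sub-cong (var ∘ x↔y) (symₚ (sub-comp (x↦ y) (var ∘ x↔y) (λ { (X _) → reflₚ ; (Y _) → reflₚ ; (Z _) → reflₚ }) p)) ⟩
  rename x↔y (sub (x↦ y) (rename x↔y p))  ≈⟨ sub-cong (var ∘ x↔y) (symmetric⇒x-free symmetric′) ⟩
  rename x↔y (rename x↔y p)
    ≈⟨ sub-comp _ _ {var} (λ { (X _) → reflₚ ; (Y _) → reflₚ ; (Z _) → reflₚ }) p ⟩
  sub var p                              ≈⟨ ≡⇒≈ₚ (sub-var p) ⟩
  p                                      ∎
  where
  open ≈ₚ-Reasoning
  x↔y : Var → Var
  x↔y (X i) = Y i
  x↔y (Y i) = X i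
  x↔y (Z i) = Z i
  symmetric′ : ∀ i → act i (rename x↔y p) ≈ₚ rename x↔y p
  symmetric′ i = transₚ
    (sub-comp (var ∘ sVar i) (var ∘ x↔y)
      {λ { (X j) → y j ; (Y j) → x (s i ⟨$⟩ j) ; (Z j) → z j }}
      (λ { (X _) → reflₚ ; (Y _) → reflₚ ; (Z _) → reflₚ }) p)
    (transₚ (symₚ (sub-comp _ _ (λ { (X _) → reflₚ ; (Y _) → reflₚ ; (Z _) → reflₚ }) p))
      (sub-cong (var ∘ x↔y) (symmetric i)))

-- Lengths and reduced words

u⁻¹u : ∀ u i → u ⁻¹ ⟨$⟩ (u ⟨$⟩ i) ≡ i
u⁻¹u u = Inverse.strictlyInverseʳ (perm u)

uu⁻¹ : ∀ u i → u ⟨$⟩ (u ⁻¹ ⟨$⟩ i) ≡ i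
uu⁻¹ u = Inverse.strictlyInverseˡ (perm u)

⁻¹-cong : ∀ {u v} → u ≈ v → u ⁻¹ ≈ v ⁻¹
⁻¹-cong {u} {v} p = pointwise λ i → ⟨$⟩-injective v
  (trans (sym (at p (u ⁻¹ ⟨$⟩ i))) (trans (uu⁻¹ u i) (sym (uu⁻¹ v i))))

∙-congˡ : ∀ u {v v′} → v ≈ v′ → u ∙ v ≈ u ∙ v′
∙-congˡ u p = pointwise λ i → cong (u ⟨$⟩_) (at p i)

ℓ-≗ : ∀ u v → (∀ i → u ⟨$⟩ i ≡ v ⟨$⟩ i) → ℓ u ≡ ℓ v
ℓ-≗ u v e = ℓ-cong {u} {v} (pointwise e)

ℓ-⁻¹-≤ : ∀ u → ℓ u ≤ ℓ (u ⁻¹)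
ℓ-⁻¹-≤ u = size-injection (inversions u) (inversions (u ⁻¹)) (λ (i , j) → u ⟨$⟩ j , u ⟨$⟩ i)
  (λ eq → cong₂ _,_ (⟨$⟩-injective u (,-injectiveʳ eq)) (⟨$⟩-injective u (,-injectiveˡ eq)))
  (λ { {i , j} (i<j , uj<ui) → uj<ui , subst₂ _<_ (sym (u⁻¹u u i)) (sym (u⁻¹u u j)) i<j })

ℓ-⁻¹ : ∀ u → ℓ (u ⁻¹) ≡ ℓ u
ℓ-⁻¹ u = ≤-antisym (≤-trans (ℓ-⁻¹-≤ (u ⁻¹)) (≤-reflexive (ℓ-≗ ((u ⁻¹) ⁻¹) u λ _ → refl))) (ℓ-⁻¹-≤ u)

Ascent Descent : S∞ → ℕ → Set
Ascent u i  = u ⟨$⟩ i < u ⟨$⟩ suc i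
Descent u i = u ⟨$⟩ suc i < u ⟨$⟩ i

ascent⊎descent : ∀ u i → Ascent u i ⊎ Descent u i
ascent⊎descent u i with <-cmp (u ⟨$⟩ i) (u ⟨$⟩ suc i)
... | tri< lt _ _ = inj₁ lt
... | tri≈ _ eq _ = contradiction (⟨$⟩-injective u eq) (<⇒≢ (n<1+n i))
... | tri> _ _ gt = inj₂ gt

ascent-cong : ∀ {u v} i → u ≈ v → Ascent u i → Ascent v i
ascent-cong i p = subst₂ _<_ (at p i) (at p (suc i))

descent-cong : ∀ {u v} i → u ≈ v → Descent u i → Descent v i
descent-cong i p = subst₂ _<_ (at p (suc i)) (at p i)

ascent-∙s : ∀ u i → Ascent u i → Descent (u ∙ s i) i
ascent-∙s u i = subst₂ _<_ (cong (u ⟨$⟩_) (sym (s-right i))) (cong (u ⟨$⟩_) (sym (s-left i)))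

descent-∙s : ∀ u i → Descent u i → Ascent (u ∙ s i) i
descent-∙s u i = subst₂ _<_ (cong (u ⟨$⟩_) (sym (s-left i))) (cong (u ⟨$⟩_) (sym (s-right i)))

∙s∙s : ∀ u i → u ∙ s i ∙ s i ≈ u
∙s∙s u i = pointwise λ k → cong (u ⟨$⟩_) (s-involutive i k)

s∙s∙ : ∀ u i → s i ∙ (s i ∙ u) ≈ u
s∙s∙ u i = pointwise λ k → s-involutive i (u ⟨$⟩ k)

ℓ-s∙ : ∀ u i → ℓ (s i ∙ u) ≡ ℓ (u ⁻¹ ∙ s i)
ℓ-s∙ u i = trans (ℓ-≗ (s i ∙ u) ((u ⁻¹ ∙ s i) ⁻¹) λ _ → refl) (ℓ-⁻¹ (u ⁻¹ ∙ s i))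

ℓ-left-ascent : ∀ u i → Ascent (u ⁻¹) i → ℓ (s i ∙ u) ≡ suc (ℓ u)
ℓ-left-ascent u i asc = trans (ℓ-s∙ u i) (trans (ℓ-ascent (u ⁻¹) i asc) (cong suc (ℓ-⁻¹ u)))

ℓ-left-descent : ∀ u i → Descent (u ⁻¹) i → ℓ u ≡ suc (ℓ (s i ∙ u))
ℓ-left-descent u i des = trans (sym (ℓ-⁻¹ u)) (trans (ℓ-descent (u ⁻¹) i des) (cong suc (sym (ℓ-s∙ u i))))

ℓ-s∙-≤ : ∀ u i → ℓ (s i ∙ u) ≤ suc (ℓ u)
ℓ-s∙-≤ u i with ascent⊎descent (u ⁻¹) i
... | inj₁ asc = ≤-reflexive (ℓ-left-ascent u i asc)
... | inj₂ des = ≤-trans (n≤1+n _) (≤-trans (≤-reflexive (sym (ℓ-left-descent u i des))) (n≤1+n _))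

ℓ-word-≤ : ∀ r → ℓ (wordProduct r) ≤ length r
ℓ-word-≤ []      = ≤-reflexive refl
ℓ-word-≤ (i ∷ r) = ≤-trans (ℓ-s∙-≤ (wordProduct r) i) (s≤s (ℓ-word-≤ r))

ℓ-∙word-≤ : ∀ u r → ℓ (u ∙ wordProduct r) ≤ ℓ u + length r
ℓ-∙word-≤ u []      = ≤-reflexive (trans (ℓ-≗ (u ∙ 𝟙) u λ _ → refl) (sym (+-identityʳ (ℓ u))))
ℓ-∙word-≤ u (i ∷ r) = begin
  ℓ (u ∙ (s i ∙ wordProduct r))  ≡⟨ ℓ-≗ (u ∙ (s i ∙ wordProduct r)) (u ∙ s i ∙ wordProduct r) (λ _ → refl) ⟩
  ℓ (u ∙ s i ∙ wordProduct r)    ≤⟨ ℓ-∙word-≤ (u ∙ s i) r ⟩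
  ℓ (u ∙ s i) + length r         ≤⟨ +-monoˡ-≤ (length r) (ℓ-ascent-≤ u i) ⟩
  suc (ℓ u + length r)           ≡⟨ sym (+-suc (ℓ u) (length r)) ⟩
  ℓ u + suc (length r)           ∎
  where open ≤-Reasoning

ReducedWord-cong : ∀ {u v} → u ≈ v → ReducedWord u → ReducedWord v
ReducedWord-cong p r = record
  { word = word r ; product≈ = ≈-trans (product≈ r) p ; reduced = trans (reduced r) (ℓ-cong p) }

cons : ∀ w i → Descent (w ⁻¹) i → ReducedWord (s i ∙ w) → ReducedWord w
cons w i des r = record
  { word     = i ∷ word r
  ; product≈ = ≈-trans (∙-congˡ (s i) (product≈ r)) (s∙s∙ w i)
  ; reduced  = trans (cong suc (reduced r)) (sym (ℓ-left-descent w i des))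
  }

-- The first letter of a reduced word is a left descent: otherwise the remaining letters would spell
-- s_i w, which has length ℓ(w) + 1, more than their number.
uncons : ∀ w i r → wordProduct (i ∷ r) ≈ w → length (i ∷ r) ≡ ℓ w →
  Descent (w ⁻¹) i × (wordProduct r ≈ s i ∙ w) × (length r ≡ ℓ (s i ∙ w))
uncons w i r p≈ len with ascent⊎descent (w ⁻¹) i
... | inj₁ asc = contradiction too-long (<⇒≱ (n≤1+n _))
  where
  too-long : suc (suc (length r)) ≤ length r
  too-long = begin
    suc (suc (length r))   ≡⟨ cong suc len ⟩
    suc (ℓ w)              ≡⟨ sym (ℓ-left-ascent w i asc) ⟩
    ℓ (s i ∙ w)            ≡⟨ ℓ-cong (≈-trans (∙-congˡ (s i) (≈-sym p≈)) (s∙s∙ (wordProduct r) i)) ⟩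
    ℓ (wordProduct r)      ≤⟨ ℓ-word-≤ r ⟩
    length r               ∎
    where open ≤-Reasoning
... | inj₂ des = des , ≈-trans (≈-sym (s∙s∙ (wordProduct r) i)) (∙-congˡ (s i) p≈) ,
    suc-injective (trans len (ℓ-left-descent w i des))

-- The case of two reduced words of w starting with different letters i < j
-- reduces to shorter words by inserting a reduced word of w that starts with
-- i j or with i j i.
∂-word : ∀ n {w} a b → ℓ w ≡ n → wordProduct a ≈ w → wordProduct b ≈ w → length a ≡ ℓ w → length b ≡ ℓ w →
  ∀ p → foldr ∂ p a ≈ₚ foldr ∂ p b
∂-word n [] [] _ _ _ _ _ p = reflₚ
∂-word n [] (j ∷ b) _ _ _ la lb p = contradiction (trans la (sym lb)) λ ()
∂-word n (i ∷ a) [] _ _ _ la lb p = contradiction (trans lb (sym la)) λ ()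
∂-word zero (i ∷ a) (j ∷ b) ℓ≡ _ _ la _ p = contradiction (trans la ℓ≡) λ ()
∂-word (suc n) {w} (i ∷ a) (j ∷ b) ℓ≡ pa pb la lb p = compare (<-cmp i j) (uncons w i a pa la) (uncons w j b pb lb)
  where
  ordered : ∀ {i j} → i < j → Descent (w ⁻¹) i → Descent (w ⁻¹) j → ∀ a b →
    wordProduct a ≈ s i ∙ w → wordProduct b ≈ s j ∙ w → length a ≡ ℓ (s i ∙ w) → length b ≡ ℓ (s j ∙ w) →
    ∂ i (foldr ∂ p a) ≈ₚ ∂ j (foldr ∂ p b)
  ordered {i} {j} i<j di dj a b pa pb la lb with m≤n⇒m<n∨m≡n i<j
  ... | inj₁ far = begin
      ∂ i (foldr ∂ p a)             ≈⟨ ∂-cong i (∂-word n a (j ∷ word c) ℓi pa (product≈ jc) la (reduced jc) p) ⟩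
      ∂ i (∂ j (foldr ∂ p (word c)))  ≈⟨ ∂-commute far (foldr ∂ p (word c)) ⟩
      ∂ j (∂ i (foldr ∂ p (word c)))  ≈⟨ ∂-cong j (symₚ (∂-word n b (i ∷ word c) ℓj pb (product≈ ic) lb (reduced ic) p)) ⟩
      ∂ j (foldr ∂ p b)             ∎
    where
    open ≈ₚ-Reasoning
    ℓi : ℓ (s i ∙ w) ≡ n
    ℓi = suc-injective (trans (sym (ℓ-left-descent w i di)) ℓ≡)
    ℓj : ℓ (s j ∙ w) ≡ n
    ℓj = suc-injective (trans (sym (ℓ-left-descent w j dj)) ℓ≡)
    c : ReducedWord (s j ∙ (s i ∙ w))
    c = reducedWord _
    jc : ReducedWord (s i ∙ w)
    jc = cons (s i ∙ w) j (subst₂ _<_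
      (cong (w ⁻¹ ⟨$⟩_) (sym (s-other i (<⇒≢ (m<n⇒m<1+n i<j) ∘ sym) (<⇒≢ (m<n⇒m<1+n far) ∘ sym))))
      (cong (w ⁻¹ ⟨$⟩_) (sym (s-other i (<⇒≢ i<j ∘ sym) (<⇒≢ far ∘ sym)))) dj) c
    ic : ReducedWord (s j ∙ w)
    ic = cons (s j ∙ w) i (subst₂ _<_
      (cong (w ⁻¹ ⟨$⟩_) (sym (s-other j (<⇒≢ far) (<⇒≢ (m<n⇒m<1+n far)))))
      (cong (w ⁻¹ ⟨$⟩_) (sym (s-other j (<⇒≢ i<j) (<⇒≢ (m<n⇒m<1+n i<j))))) di)
      (ReducedWord-cong (pointwise λ k → sym (s-commute far (w ⟨$⟩ k))) c)
  ... | inj₂ refl = begin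
      ∂ i (foldr ∂ p a)                     ≈⟨ ∂-cong i (∂-word n a (j ∷ i ∷ word c) ℓi pa (product≈ jic) la (reduced jic) p) ⟩
      ∂ i (∂ j (∂ i (foldr ∂ p (word c))))    ≈⟨ ∂-braid i (foldr ∂ p (word c)) ⟩
      ∂ j (∂ i (∂ j (foldr ∂ p (word c))))    ≈⟨ ∂-cong j (symₚ (∂-word n b (i ∷ j ∷ word c) ℓj pb (product≈ ijc) lb (reduced ijc) p)) ⟩
      ∂ j (foldr ∂ p b)                     ∎
    where
    open ≈ₚ-Reasoning
    v : ℕ → ℕ
    v = w ⁻¹ ⟨$⟩_
    ℓi : ℓ (s i ∙ w) ≡ n
    ℓi = suc-injective (trans (sym (ℓ-left-descent w i di)) ℓ≡)
    ℓj : ℓ (s j ∙ w) ≡ n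
    ℓj = suc-injective (trans (sym (ℓ-left-descent w j dj)) ℓ≡)
    i-fixed : s j ⟨$⟩ i ≡ i
    i-fixed = s-other j (λ ()) (λ ())
    2+i-fixed : s i ⟨$⟩ (2 + i) ≡ 2 + i
    2+i-fixed = s-other i (λ ()) (λ ())
    c : ReducedWord (s i ∙ (s j ∙ (s i ∙ w)))
    c = reducedWord _
    jic : ReducedWord (s i ∙ w)
    jic = cons (s i ∙ w) j (subst₂ _<_ (cong v (sym 2+i-fixed)) (cong v (sym (s-right i))) (<-trans dj di))
      (cons (s j ∙ (s i ∙ w)) i (subst₂ _<_
        (cong v (sym (trans (cong (s i ⟨$⟩_) (s-left j)) 2+i-fixed)))
        (cong v (sym (trans (cong (s i ⟨$⟩_) i-fixed) (s-left i)))) dj) c)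
    ijc : ReducedWord (s j ∙ w)
    ijc = cons (s j ∙ w) i (subst₂ _<_ (cong v (sym (s-left j))) (cong v (sym i-fixed)) (<-trans dj di))
      (cons (s i ∙ (s j ∙ w)) j (subst₂ _<_
        (cong v (sym (trans (cong (s j ⟨$⟩_) 2+i-fixed) (s-right j))))
        (cong v (sym (trans (cong (s j ⟨$⟩_) (s-right i)) i-fixed))) di)
        (ReducedWord-cong (pointwise λ k → s-braid i (w ⟨$⟩ k)) c))
  compare : _ → _ → _ → ∂ i (foldr ∂ p a) ≈ₚ ∂ j (foldr ∂ p b)
  compare (tri< i<j _ _)  (di , pa , la) (dj , pb , lb) = ordered i<j di dj a b pa pb la lb
  compare (tri≈ _ refl _) (di , pa , la) (dj , pb , lb) =
    ∂-cong i (∂-word n a b (suc-injective (trans (sym (ℓ-left-descent w i di)) ℓ≡)) pa pb la lb p)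
  compare (tri> _ _ j<i)  (di , pa , la) (dj , pb , lb) = symₚ (ordered j<i dj di b a pb pa lb la)

-- Lengths under transpositions

Between : S∞ → ℕ → ℕ → ℕ → Set
Between u a b r = (a < r × r < b) × (u ⟨$⟩ a < u ⟨$⟩ r × u ⟨$⟩ r < u ⟨$⟩ b)

-- Together `cover` and `gap` say that the length rises by exactly one if and only if no value lies
-- in between. By parity the bound in `gap` could be 3; 2 is enough to exclude a cover.
record TranspositionLength (u : S∞) (a b : ℕ) : Set where
  field
    longer : suc (ℓ u) ≤ ℓ (u ∙ t a b)
    cover  : (∀ r → ¬ Between u a b r) → ℓ (u ∙ t a b) ≡ suc (ℓ u)
    gap    : ∀ r → Between u a b r → 2 + ℓ u ≤ ℓ (u ∙ t a b)

-- Induction on b − a, by t_{a,b+1} = s_b t_ab s_b.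
transposition-length : ∀ b {a} u → a < b → u ⟨$⟩ a < u ⟨$⟩ b → TranspositionLength u a b
transposition-length (suc b) {a} u (s≤s a≤b) asc with m≤n⇒m<n∨m≡n a≤b
... | inj₂ refl = record
  { longer = ℓ-ascent-< u a asc
  ; cover  = λ _ → ℓ-ascent u a asc
  ; gap    = λ { r ((a<r , s≤s r≤a) , _) → contradiction r≤a (<⇒≱ a<r) }
  }
... | inj₁ a<b = cases (<-cmp (u ⟨$⟩ b) (u ⟨$⟩ a)) (<-cmp (u ⟨$⟩ b) (u ⟨$⟩ suc b))
  where
  v w : S∞
  v = u ∙ s b
  w = v ∙ t a b
  va : v ⟨$⟩ a ≡ u ⟨$⟩ a
  va = cong (u ⟨$⟩_) (s-other b (<⇒≢ a<b) (<⇒≢ (m<n⇒m<1+n a<b)))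
  vb : v ⟨$⟩ b ≡ u ⟨$⟩ suc b
  vb = cong (u ⟨$⟩_) (s-left b)
  v-other : ∀ {r} → r < b → v ⟨$⟩ r ≡ u ⟨$⟩ r
  v-other r<b = cong (u ⟨$⟩_) (s-other b (<⇒≢ r<b) (<⇒≢ (m<n⇒m<1+n r<b)))
  wb : w ⟨$⟩ b ≡ u ⟨$⟩ a
  wb = trans (cong (v ⟨$⟩_) (swap-right a b)) va
  w1+b : w ⟨$⟩ suc b ≡ u ⟨$⟩ b
  w1+b = trans (cong (v ⟨$⟩_) (swap-other a b (<⇒≢ (m<n⇒m<1+n a<b) ∘ sym) (<⇒≢ (n<1+n b) ∘ sym)))
    (cong (u ⟨$⟩_) (s-right b))
  open TranspositionLength (transposition-length b v a<b (subst₂ _<_ (sym va) (sym vb) asc))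
  ℓ≡ : ℓ (u ∙ t a (suc b)) ≡ ℓ (w ∙ s b)
  ℓ≡ = ℓ-≗ (u ∙ t a (suc b)) (w ∙ s b) λ k → cong (u ⟨$⟩_) (t-step a<b k)
  to-v : ∀ {r} → r < b → Between u a (suc b) r → Between v a b r
  to-v r<b ((a<r , _) , (l , h)) = (a<r , r<b) ,
    subst₂ _<_ (sym va) (sym (v-other r<b)) l , subst₂ _<_ (sym (v-other r<b)) (sym vb) h
  from-v : ∀ {r} → Between v a b r → Between u a (suc b) r
  from-v ((a<r , r<b) , (l , h)) = (a<r , m<n⇒m<1+n r<b) ,
    subst₂ _<_ va (v-other r<b) l , subst₂ _<_ (v-other r<b) vb h
  r<b : ∀ {r} → Between u a (suc b) r → (u ⟨$⟩ b < u ⟨$⟩ a ⊎ u ⟨$⟩ suc b < u ⟨$⟩ b) → r < b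
  r<b {r} ((_ , s≤s r≤b) , (l , h)) out with m≤n⇒m<n∨m≡n r≤b
  r<b bt out | inj₁ r<b = r<b
  r<b (_ , (l , h)) (inj₁ lt) | inj₂ refl = contradiction lt (<-asym l)
  r<b (_ , (l , h)) (inj₂ gt) | inj₂ refl = contradiction h (<-asym gt)
  -- The two conjugating factors s_b change the length by +1 and -1, in some order, if u(b) lies
  -- outside the interval from u(a) to u(b+1), and by +1 each if it lies inside.
  cases : _ → _ → TranspositionLength u a (suc b)
  cases (tri< ub<ua _ _) _ = record
    { longer = ≤-trans (≤-pred (subst₂ _≤_ (cong suc v↑) w↓ longer)) (≤-reflexive (sym ℓ≡))
    ; cover  = λ none → trans ℓ≡ (suc-injective (trans (sym w↓)
                 (trans (cover λ r bt → none r (from-v bt)) (cong suc v↑))))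
    ; gap    = λ r bt → ≤-trans (≤-pred (subst₂ _≤_ (cong (2 +_) v↑) w↓
                 (gap r (to-v (r<b bt (inj₁ ub<ua)) bt)))) (≤-reflexive (sym ℓ≡))
    }
    where
    v↑ : ℓ v ≡ suc (ℓ u)
    v↑ = ℓ-ascent u b (<-trans ub<ua asc)
    w↓ : ℓ w ≡ suc (ℓ (w ∙ s b))
    w↓ = ℓ-descent w b (subst₂ _<_ (sym w1+b) (sym wb) ub<ua)
  cases (tri≈ _ ub≡ua _) _ = contradiction (⟨$⟩-injective u (sym ub≡ua)) (<⇒≢ a<b)
  cases _ (tri≈ _ ub≡ _) = contradiction (⟨$⟩-injective u ub≡) (<⇒≢ (n<1+n b))
  cases (tri> _ _ ua<ub) (tri< ub<u1+b _ _) = record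
    { longer = ≤-trans (n≤1+n _) (≤-trans (n≤1+n _) 3+)
    ; cover  = λ none → contradiction ((a<b , ≤-refl) , ua<ub , ub<u1+b) (none b)
    ; gap    = λ _ _ → ≤-trans (n≤1+n _) 3+
    }
    where
    3+ : 3 + ℓ u ≤ ℓ (u ∙ t a (suc b))
    3+ = subst₂ _≤_ (cong (2 +_) (ℓ-ascent u b ub<u1+b))
      (trans (sym (ℓ-ascent w b (subst₂ _<_ (sym wb) (sym w1+b) ua<ub))) (sym ℓ≡)) (s≤s longer)
  cases (tri> _ _ ua<ub) (tri> _ _ u1+b<ub) = record
    { longer = subst₂ _≤_ (cong suc (sym v↓)) (sym (trans ℓ≡ w↑)) (s≤s longer)
    ; cover  = λ none → trans ℓ≡ (trans w↑ (cong suc (trans (cover λ r bt → none r (from-v bt)) (sym v↓))))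
    ; gap    = λ r bt → subst₂ _≤_ (cong (2 +_) (sym v↓)) (sym (trans ℓ≡ w↑))
                 (s≤s (gap r (to-v (r<b bt (inj₂ u1+b<ub)) bt)))
    }
    where
    v↓ : ℓ u ≡ suc (ℓ v)
    v↓ = ℓ-descent u b u1+b<ub
    w↑ : ℓ (w ∙ s b) ≡ suc (ℓ w)
    w↑ = ℓ-ascent w b (subst₂ _<_ (sym wb) (sym w1+b) ua<ub)

∙t∙t : ∀ u a b i → (u ∙ t a b ∙ t a b) ⟨$⟩ i ≡ u ⟨$⟩ i
∙t∙t u a b i = cong (u ⟨$⟩_) (swap-involutive a b i)

cover⇒ : ∀ u {a b} → a < b → ℓ (u ∙ t a b) ≡ suc (ℓ u) →
  u ⟨$⟩ a < u ⟨$⟩ b × (∀ r → ¬ Between u a b r)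
cover⇒ u {a} {b} a<b ℓ↑ with <-cmp (u ⟨$⟩ a) (u ⟨$⟩ b)
... | tri< lt _ _ = lt , λ r bt → <⇒≱ (gap r bt) (≤-reflexive ℓ↑)
  where open TranspositionLength (transposition-length b u a<b lt)
... | tri≈ _ eq _ = contradiction (⟨$⟩-injective u eq) (<⇒≢ a<b)
... | tri> _ _ gt = contradiction (subst (suc (ℓ (u ∙ t a b)) ≤_) (ℓ-≗ (u ∙ t a b ∙ t a b) u (∙t∙t u a b)) longer)
                      (<⇒≱ (s≤s (≤-trans (n≤1+n _) (≤-reflexive (sym ℓ↑)))))
  where
  open TranspositionLength (transposition-length b (u ∙ t a b) a<b
    (subst₂ _<_ (cong (u ⟨$⟩_) (sym (swap-left a b))) (cong (u ⟨$⟩_) (sym (swap-right a b))) gt))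

⇒cover : ∀ u {a b} → a < b → u ⟨$⟩ a < u ⟨$⟩ b → (∀ r → ¬ Between u a b r) → ℓ (u ∙ t a b) ≡ suc (ℓ u)
⇒cover u {b = b} a<b lt = TranspositionLength.cover (transposition-length b u a<b lt)

-- Double Schubert polynomials

Π : ℕ → (ℕ → ℤ[x,y,z]) → ℤ[x,y,z]
Π zero    g = 1ₚ
Π (suc n) g = g 0 *ₚ Π n (g ∘ suc)

∏-applyUpTo : ∀ n (f : ℕ → ℕ) (g : ℕ → ℤ[x,y,z]) → ∏ (applyUpTo f n) g ≡ Π n (g ∘ f)
∏-applyUpTo zero    f g = refl
∏-applyUpTo (suc n) f g = cong (g (f 0) *ₚ_) (∏-applyUpTo n (f ∘ suc) g)

∏-upTo : ∀ n (g : ℕ → ℤ[x,y,z]) → ∏ (upTo n) g ≡ Π n g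
∏-upTo n g = ∏-applyUpTo n id g

Π-cong : ∀ n {f g} → (∀ i → i < n → f i ≈ₚ g i) → Π n f ≈ₚ Π n g
Π-cong zero    e = reflₚ
Π-cong (suc n) e = *-congₚ (e 0 (s≤s z≤n)) (Π-cong n λ i i<n → e (suc i) (s≤s i<n))

Π-last : ∀ n g → Π (suc n) g ≈ₚ g n *ₚ Π n g
Π-last zero    g = reflₚ
Π-last (suc n) g = transₚ (*-congₚ reflₚ (Π-last n (g ∘ suc)))
  (solve 3 (λ a b c → a :* (b :* c) := b :* (a :* c)) reflₚ (g 0) (g (suc n)) (Π n (g ∘ suc)))
  where open ℤSolver

Π-≈1 : ∀ n {g} → (∀ i → i < n → g i ≈ₚ 1ₚ) → Π n g ≈ₚ 1ₚ
Π-≈1 zero    e = reflₚ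
Π-≈1 (suc n) e = transₚ (*-congₚ (e 0 (s≤s z≤n)) (Π-≈1 n λ i i<n → e (suc i) (s≤s i<n))) (*-identityₚ 1ₚ)

Π-extend : ∀ k n {g} → (∀ i → n ≤ i → g i ≈ₚ 1ₚ) → Π (k + n) g ≈ₚ Π n g
Π-extend zero    n e = reflₚ
Π-extend (suc k) n {g} e = transₚ (Π-last (k + n) g)
  (transₚ (*-congₚ (e (k + n) (m≤n+m n k)) (Π-extend k n e)) (*-identityₚ _))

Π-≈0 : ∀ n {g} i → i < n → g i ≈ₚ 0ₚ → Π n g ≈ₚ 0ₚ
Π-≈0 (suc n) zero    _         e = transₚ (*-congₚ e reflₚ) (R.zeroˡ _)
Π-≈0 (suc n) (suc i) (s≤s i<n) e = transₚ (*-congₚ reflₚ (Π-≈0 n i i<n e)) (R.zeroʳ _)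

Π-replace : ∀ n {f g} i {c} → i < n → (∀ j → j < n → j ≢ i → f j ≈ₚ g j) → f i ≈ₚ c *ₚ g i →
  Π n f ≈ₚ c *ₚ Π n g
Π-replace (suc n) zero {c} _ same e = transₚ
  (*-congₚ e (Π-cong n λ j j<n → same (suc j) (s≤s j<n) λ ())) (*-assocₚ c _ _)
Π-replace (suc n) {f} {g} (suc i) {c} (s≤s i<n) same e = transₚ
  (*-congₚ (same 0 (s≤s z≤n) λ ()) (Π-replace n i i<n (λ j j<n j≢i → same (suc j) (s≤s j<n) (j≢i ∘ suc-injective)) e))
  (solve 3 (λ a b c → b :* (a :* c) := a :* (b :* c)) reflₚ c (g 0) (Π n (g ∘ suc)))
  where open ℤSolver

s-suc : ∀ i j → s (suc i) ⟨$⟩ suc j ≡ suc (s i ⟨$⟩ j)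
s-suc i j = cases (≡⊎≢ j i) (≡⊎≢ j (suc i))
  where
  cases : ∀ {j} → j ≡ i ⊎ j ≢ i → j ≡ suc i ⊎ j ≢ suc i → s (suc i) ⟨$⟩ suc j ≡ suc (s i ⟨$⟩ j)
  cases (inj₁ refl) _ = trans (s-left (suc i)) (cong suc (sym (s-left i)))
  cases (inj₂ _) (inj₁ refl) = trans (s-right (suc i)) (cong suc (sym (s-right i)))
  cases (inj₂ p) (inj₂ q) = trans (s-other (suc i) (p ∘ suc-injective) (q ∘ suc-injective))
    (cong suc (sym (s-other i p q)))

Π-swap : ∀ n i g → suc i < n → Π n (g ∘ (s i ⟨$⟩_)) ≈ₚ Π n g
Π-swap (suc (suc n)) zero g _ = begin
  g 1 *ₚ (g 0 *ₚ Π n (λ j → g (s 0 ⟨$⟩ suc (suc j))))   ≈⟨ solve 3 (λ a b c → b :* (a :* c) := a :* (b :* c)) reflₚ (g 0) (g 1) _ ⟩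
  g 0 *ₚ (g 1 *ₚ Π n (λ j → g (s 0 ⟨$⟩ suc (suc j))))   ≈⟨ R.*-congˡ (R.*-congˡ (Π-cong n λ j _ → ≡⇒≈ₚ (cong g (s-other 0 {suc (suc j)} (λ ()) (λ ()))))) ⟩
  g 0 *ₚ (g 1 *ₚ Π n (g ∘ suc ∘ suc))                   ∎
  where
  open ≈ₚ-Reasoning
  open ℤSolver
Π-swap (suc n) (suc i) g (s≤s i<n) = *-congₚ (≡⇒≈ₚ (cong g (s-other (suc i) {0} (λ ()) (λ ()))))
  (transₚ (Π-cong n λ j _ → ≡⇒≈ₚ (cong g (s-suc i j))) (Π-swap n i (g ∘ suc) i<n))

sub-Π : ∀ (ρ : Var → ℤ[x,y,z]) n g → sub ρ (Π n g) ≡ Π n (sub ρ ∘ g)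
sub-Π ρ zero    g = refl
sub-Π ρ (suc n) g = cong (sub ρ (g 0) *ₚ_) (sub-Π ρ n (g ∘ suc))

if-yes : ∀ {A B : Set} (a? : Dec A) {b c : B} → A → (if does a? then b else c) ≡ b
if-yes (yes _) _ = refl
if-yes (no ¬a) a = contradiction a ¬a

if-no : ∀ {A B : Set} (a? : Dec A) {b c : B} → ¬ A → (if does a? then b else c) ≡ c
if-no (yes a) ¬a = contradiction a ¬a
if-no (no _)  _  = refl

-- The product over the boxes of the diagram with row lengths c, the form taken by dominant double
-- Schubert polynomials. Empty rows contribute 1, so N may be enlarged freely beyond the last
-- nonempty row.
shape : ℕ → (ℕ → ℕ) → ℤ[x,y,z]
shape N c = Π N λ i → Π (c i) λ j → x i -ₚ y j

shape-cong : ∀ N {c c′} → (∀ i → i < N → c i ≡ c′ i) → shape N c ≈ₚ shape N c′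
shape-cong N e = Π-cong N λ i i<N → ≡⇒≈ₚ (cong (λ m → Π m (λ j → x i -ₚ y j)) (e i i<N))

shape-extend : ∀ k n {c} → (∀ i → n ≤ i → c i ≡ 0) → shape (k + n) c ≈ₚ shape n c
shape-extend k n e = Π-extend k n λ i n≤i → ≡⇒≈ₚ (cong (λ m → Π m (λ j → x i -ₚ y j)) (e i n≤i))

shape-symmetric : ∀ N i {c} → suc i < N → c i ≡ c (suc i) → act i (shape N c) ≈ₚ shape N c
shape-symmetric N i {c} i<N e = begin
  act i (shape N c)
    ≈⟨ ≡⇒≈ₚ (sub-Π (var ∘ sVar i) N _) ⟩
  Π N (λ r → act i (Π (c r) λ j → x r -ₚ y j))
    ≈⟨ Π-cong N (λ r _ → transₚ (≡⇒≈ₚ (sub-Π (var ∘ sVar i) (c r) _)) (≡⇒≈ₚ (cong (λ m → Π m (λ j → x (s i ⟨$⟩ r) -ₚ y j)) (same r (≡⊎≢ r i) (≡⊎≢ r (suc i)))))) ⟩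
  Π N ((λ r → Π (c r) λ j → x r -ₚ y j) ∘ (s i ⟨$⟩_))
    ≈⟨ Π-swap N i (λ r → Π (c r) λ j → x r -ₚ y j) i<N ⟩
  shape N c ∎
  where
  open ≈ₚ-Reasoning
  same : ∀ r → r ≡ i ⊎ r ≢ i → r ≡ suc i ⊎ r ≢ suc i → c r ≡ c (s i ⟨$⟩ r)
  same r (inj₁ refl) _ = trans e (cong c (sym (s-left i)))
  same r (inj₂ _) (inj₁ refl) = trans (sym e) (cong c (sym (s-right i)))
  same r (inj₂ p) (inj₂ q) = cong c (sym (s-other i p q))

∂-linear-factor : ∀ i a {g} → act i a ≈ₚ a → act i g ≈ₚ g → ∂ i ((x i -ₚ a) *ₚ g) ≈ₚ g
∂-linear-factor i a {g} ea eg = ∂-unique i (begin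
  root i *ₚ g
    ≈⟨ solve 4 (λ u v a g → (u :- v) :* g := (u :- a) :* g :- (v :- a) :* g) reflₚ (x i) (x (suc i)) a g ⟩
  (x i -ₚ a) *ₚ g -ₚ (x (suc i) -ₚ a) *ₚ g
    ≈⟨ R.+-congˡ (-‿congₚ (*-congₚ (+-congₚ (≡⇒≈ₚ (cong x (sym (s-left i)))) (-‿congₚ (symₚ ea))) (symₚ eg))) ⟩
  (x i -ₚ a) *ₚ g -ₚ act i ((x i -ₚ a) *ₚ g) ∎)
  where
  open ≈ₚ-Reasoning
  open ℤSolver

-- The last box of row i contributes x_i - y_m. Without it rows i and i + 1 have equal length, so
-- the remaining product is invariant under s_i and ∂_i replaces the factor by 1.
∂-shape : ∀ N i m {c c′} → suc i < N → c i ≡ suc m → c (suc i) ≡ m → c′ i ≡ m →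
  (∀ j → j ≢ i → c′ j ≡ c j) → ∂ i (shape N c) ≈ₚ shape N c′
∂-shape N i m {c} {c′} i<N ci ci+1 c′i same = transₚ
  (∂-cong i (Π-replace N i (<-trans (n<1+n i) i<N)
    (λ j _ j≢i → ≡⇒≈ₚ (cong (λ k → Π k (λ l → x j -ₚ y l)) (sym (same j j≢i))))
    (transₚ (≡⇒≈ₚ (cong (λ k → Π k (λ l → x i -ₚ y l)) ci))
      (transₚ (Π-last m _) (*-congₚ reflₚ (≡⇒≈ₚ (cong (λ k → Π k (λ l → x i -ₚ y l)) (sym c′i))))))))
  (∂-linear-factor i (y m) reflₚ
    (shape-symmetric N i i<N (trans c′i (sym (trans (same (suc i) (<⇒≢ (n<1+n i) ∘ sym)) ci+1)))))

foldr-∂-cong : ∀ r {p q} → p ≈ₚ q → foldr ∂ p r ≈ₚ foldr ∂ q r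
foldr-∂-cong []      e = e
foldr-∂-cong (i ∷ r) e = ∂-cong i (foldr-∂-cong r e)

∂^-word : ∀ u r p → wordProduct r ≈ u → length r ≡ ℓ u → ∂^ u p ≈ₚ foldr ∂ p r
∂^-word u r p pr len = ∂-word (ℓ u) (word (reducedWord u)) r refl
  (product≈ (reducedWord u)) pr (reduced (reducedWord u)) len p

∂^-cong : ∀ {u v} → u ≈ v → ∀ p → ∂^ u p ≈ₚ ∂^ v p
∂^-cong {u} {v} e p = ∂^-word u (word r) p (≈-trans (product≈ r) (≈-sym e)) (trans (reduced r) (ℓ-cong (≈-sym e)))
  where
  r : ReducedWord v
  r = reducedWord v

∂^-unfold : ∀ u i p → Descent (u ⁻¹) i → ∂^ u p ≈ₚ ∂ i (∂^ (s i ∙ u) p)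
∂^-unfold u i p des = ∂^-word u (i ∷ word (reducedWord (s i ∙ u))) p (product≈ r) (reduced r)
  where
  r : ReducedWord u
  r = cons u i des (reducedWord (s i ∙ u))

∂-∂^-ascent : ∀ u i p → Ascent (u ⁻¹) i → ∂ i (∂^ u p) ≈ₚ ∂^ (s i ∙ u) p
∂-∂^-ascent u i p asc = symₚ (transₚ (∂^-unfold (s i ∙ u) i p (ascent-∙s (u ⁻¹) i asc))
  (∂-cong i (∂^-cong (s∙s∙ u i) p)))

∂-∂^-descent : ∀ u i p → Descent (u ⁻¹) i → ∂ i (∂^ u p) ≈ₚ 0ₚ
∂-∂^-descent u i p des = transₚ (∂-cong i (∂^-unfold u i p des)) (∂-∂ i (∂^ (s i ∙ u) p))

reflect-≤ : ∀ {n i} → i ≤ n → reflect n i ≡ n ∸ i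
reflect-≤ {n} {i} i≤n with i ≤? n
... | yes _ = refl
... | no ≰  = contradiction i≤n ≰

reflect-anti : ∀ n {i j} → i < j → j ≤ n → reflect n j < reflect n i
reflect-anti n i<j j≤n = subst₂ _<_ (sym (reflect-≤ j≤n)) (sym (reflect-≤ (≤-trans (<⇒≤ i<j) j≤n)))
  (∸-monoʳ-< i<j j≤n)

∈S-< : ∀ u n {i} → u ∈S n → i < n → u ⟨$⟩ i < n
∈S-< u n {i} u∈ i<n with u ⟨$⟩ i <? n
... | yes lt = lt
... | no ≮   = contradiction i<n (≤⇒≯ (subst (n ≤_) (⟨$⟩-injective u (u∈ (≮⇒≥ ≮))) (≮⇒≥ ≮)))

∈S-mono : ∀ u {m n} → m ≤ n → u ∈S m → u ∈S n
∈S-mono u m≤n u∈ n≤i = u∈ (≤-trans m≤n n≤i)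

∈S-∙s : ∀ u n {i} → suc i < n → u ∈S n → (u ∙ s i) ∈S n
∈S-∙s u n {i} i<n u∈ n≤j = trans
  (cong (u ⟨$⟩_) (s-other i (<⇒≢ (<-trans (n<1+n i) (<-≤-trans i<n n≤j)) ∘ sym) (<⇒≢ (<-≤-trans i<n n≤j) ∘ sym)))
  (u∈ n≤j)

∈S-⁻¹ : ∀ u n → u ∈S n → (u ⁻¹) ∈S n
∈S-⁻¹ u n u∈ {i} n≤i = ⟨$⟩-injective u (trans (uu⁻¹ u i) (sym (u∈ n≤i)))

module _ (n : ℕ) (u : S∞) (u∈ : u ∈S suc n) {i : ℕ} (i<n : i < n) where

  -- The inverse of u⁻¹ w₀ is w₀ u, and w₀ reverses the order on 0, ..., n, so a descent of u is a
  -- left ascent of u⁻¹ w₀.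
  𝔖[]-descent : Descent u i → ∂ i (𝔖[ n ] u) ≈ₚ 𝔖[ n ] (u ∙ s i)
  𝔖[]-descent des = transₚ
    (∂-∂^-ascent (u ⁻¹ ∙ w₀ n) i (𝔖w₀ n) (reflect-anti n des (≤-pred (∈S-< u (suc n) u∈ (m<n⇒m<1+n i<n)))))
    (∂^-cong {s i ∙ (u ⁻¹ ∙ w₀ n)} {(u ∙ s i) ⁻¹ ∙ w₀ n} (pointwise λ _ → refl) (𝔖w₀ n))

  𝔖[]-ascent : Ascent u i → ∂ i (𝔖[ n ] u) ≈ₚ 0ₚ
  𝔖[]-ascent asc = ∂-∂^-descent (u ⁻¹ ∙ w₀ n) i (𝔖w₀ n)
    (reflect-anti n asc (≤-pred (∈S-< u (suc n) u∈ (s≤s i<n))))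

𝔖[]-cong : ∀ n {u v} → u ≈ v → 𝔖[ n ] u ≈ₚ 𝔖[ n ] v
𝔖[]-cong n p = ∂^-cong (∙-congʳ (w₀ n) (⁻¹-cong p)) (𝔖w₀ n)

-- The word s_{m-1} ⋯ s_0 of the cycle that sends 0 to m and i + 1 to i; for m = n + 1 it takes
-- w₀(n) to w₀(n+1).
down : ℕ → List ℕ
down zero    = []
down (suc m) = m ∷ down m

length-down : ∀ m → length (down m) ≡ m
length-down zero    = refl
length-down (suc m) = cong suc (length-down m)

down-fixes : ∀ m {i} → m < i → wordProduct (down m) ⟨$⟩ i ≡ i
down-fixes zero    _   = refl
down-fixes (suc m) m<i = trans (cong (s m ⟨$⟩_) (down-fixes m (<-trans (n<1+n m) m<i)))
  (s-other m (<⇒≢ (<-trans (n<1+n m) m<i) ∘ sym) (<⇒≢ m<i ∘ sym))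

down-zero : ∀ m → wordProduct (down m) ⟨$⟩ 0 ≡ m
down-zero zero    = refl
down-zero (suc m) = trans (cong (s m ⟨$⟩_) (down-zero m)) (s-left m)

down-suc : ∀ m {i} → i < m → wordProduct (down m) ⟨$⟩ suc i ≡ i
down-suc (suc m) (s≤s i≤m) with m≤n⇒m<n∨m≡n i≤m
... | inj₁ i<m  = trans (cong (s m ⟨$⟩_) (down-suc m i<m)) (s-other m (<⇒≢ i<m) (<⇒≢ (m<n⇒m<1+n i<m)))
... | inj₂ refl = trans (cong (s m ⟨$⟩_) (down-fixes m (n<1+n m))) (s-right m)

-- The value v(m) exceeds all earlier ones, so each letter carries it one place to the left past a
-- smaller value.
ℓ-∙down : ∀ m v → (∀ i → i < m → v ⟨$⟩ i < v ⟨$⟩ m) → ℓ (v ∙ wordProduct (down m)) ≡ ℓ v + m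
ℓ-∙down zero    v _   = trans (ℓ-≗ (v ∙ 𝟙) v λ _ → refl) (sym (+-identityʳ (ℓ v)))
ℓ-∙down (suc m) v max = begin
  ℓ (v ∙ (s m ∙ wordProduct (down m)))   ≡⟨ ℓ-≗ (v ∙ (s m ∙ wordProduct (down m))) (v ∙ s m ∙ wordProduct (down m)) (λ _ → refl) ⟩
  ℓ (v ∙ s m ∙ wordProduct (down m))     ≡⟨ ℓ-∙down m (v ∙ s m) max′ ⟩
  ℓ (v ∙ s m) + m                        ≡⟨ cong (_+ m) (ℓ-ascent v m (max m (n<1+n m))) ⟩
  suc (ℓ v) + m                          ≡⟨ sym (+-suc (ℓ v) m) ⟩
  ℓ v + suc m                            ∎
  where
  open ≡-Reasoning
  max′ : ∀ i → i < m → (v ∙ s m) ⟨$⟩ i < (v ∙ s m) ⟨$⟩ m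
  max′ i i<m = subst₂ _<_
    (cong (v ⟨$⟩_) (sym (s-other m (<⇒≢ i<m) (<⇒≢ (m<n⇒m<1+n i<m)))))
    (cong (v ⟨$⟩_) (sym (s-left m))) (max i (m<n⇒m<1+n i<m))

w₀-suc : ∀ n → w₀ n ∙ wordProduct (down (suc n)) ≈ w₀ (suc n)
w₀-suc n = pointwise λ
  { zero    → trans (cong (reflect n) (down-zero (suc n)))
                (trans (reflect-fixes n (n<1+n n)) (sym (reflect-≤ {suc n} z≤n)))
  ; (suc i) → later i
  }
  where
  later : ∀ i → reflect n (wordProduct (down (suc n)) ⟨$⟩ suc i) ≡ reflect (suc n) (suc i)
  later i with <-≤-connex i (suc n)
  ... | inj₁ i<1+n = trans (cong (reflect n) (down-suc (suc n) i<1+n))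
                      (trans (reflect-≤ (≤-pred i<1+n)) (sym (reflect-≤ i<1+n)))
  ... | inj₂ 1+n≤i = trans (cong (reflect n) (down-fixes (suc n) (s≤s 1+n≤i)))
                      (trans (reflect-fixes n (≤-trans 1+n≤i (n≤1+n i))) (sym (reflect-fixes (suc n) (s≤s 1+n≤i))))

𝔖w₀-shape : ∀ n → 𝔖w₀ n ≈ₚ shape n (n ∸_)
𝔖w₀-shape n = transₚ (≡⇒≈ₚ (∏-upTo n _)) (Π-cong n λ i _ → ≡⇒≈ₚ (∏-upTo (n ∸ i) _))

-- Each of the letters 0, 1, …, n removes the last box of its row.
𝔖w₀-suc : ∀ n → foldr ∂ (𝔖w₀ (suc n)) (down (suc n)) ≈ₚ 𝔖w₀ n
𝔖w₀-suc n = transₚ (go (suc n) ≤-refl) (transₚ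
    (shape-cong (2 + n) λ i i<2+n → final i (≤-pred i<2+n))
    (transₚ (shape-extend 2 n λ i n≤i → m≤n⇒m∸n≡0 n≤i) (symₚ (𝔖w₀-shape n))))
  where
  rows : ℕ → ℕ → ℕ
  rows m i with i <? m
  ... | yes _ = n ∸ i
  ... | no _  = suc n ∸ i
  rows-< : ∀ {m i} → i < m → rows m i ≡ n ∸ i
  rows-< {m} {i} i<m with i <? m
  ... | yes _  = refl
  ... | no i≮m = contradiction i<m i≮m
  rows-≥ : ∀ {m i} → m ≤ i → rows m i ≡ suc n ∸ i
  rows-≥ {m} {i} m≤i with i <? m
  ... | yes i<m = contradiction m≤i (<⇒≱ i<m)
  ... | no _    = refl
  final : ∀ i → i ≤ suc n → rows (suc n) i ≡ n ∸ i
  final i i≤1+n with m≤n⇒m<n∨m≡n i≤1+n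
  ... | inj₁ i<1+n = rows-< i<1+n
  ... | inj₂ refl  = trans (rows-≥ {suc n} {suc n} ≤-refl) (trans (n∸n≡0 (suc n)) (sym (m≤n⇒m∸n≡0 (n≤1+n n))))
  -- There are 2 + n rows so that row n, whose single box goes last, can be compared with the empty
  -- row n + 1.
  go : ∀ m → m ≤ suc n → foldr ∂ (𝔖w₀ (suc n)) (down m) ≈ₚ shape (2 + n) (rows m)
  go zero    _   = transₚ (𝔖w₀-shape (suc n)) (transₚ
    (symₚ (shape-extend 1 (suc n) λ i n<i → m≤n⇒m∸n≡0 n<i))
    (shape-cong (2 + n) λ i _ → sym (rows-≥ {0} {i} z≤n)))
  go (suc m) m<1+n = transₚ (∂-cong m (go m (<⇒≤ m<1+n)))
    (∂-shape (2 + n) m (n ∸ m) (s≤s m<1+n)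
      (trans (rows-≥ {m} ≤-refl) (+-∸-assoc 1 (≤-pred m<1+n))) (rows-≥ {m} {suc m} (n≤1+n m)) (rows-< (n<1+n m)) same)
    where
    same : ∀ j → j ≢ m → rows (suc m) j ≡ rows m j
    same j j≢m with <-cmp j m
    ... | tri< j<m _ _ = trans (rows-< (m<n⇒m<1+n j<m)) (sym (rows-< j<m))
    ... | tri≈ _ j≡m _ = contradiction j≡m j≢m
    ... | tri> _ _ m<j = trans (rows-≥ m<j) (sym (rows-≥ (<⇒≤ m<j)))

wordProduct-++ : ∀ a b → wordProduct (a ++ b) ≈ wordProduct a ∙ wordProduct b
wordProduct-++ []      b = pointwise λ _ → refl
wordProduct-++ (i ∷ a) b = pointwise λ k → cong (s i ⟨$⟩_) (at (wordProduct-++ a b) k)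

-- u⁻¹ w₀(n+1) is the product of u⁻¹ w₀(n) and the letters of `down (suc n)`, which act first and
-- bring 𝔖_{w₀(n+1)} to 𝔖_{w₀(n)}. The lengths add because u⁻¹ w₀(n) fixes n + 1 and keeps all
-- smaller values below it.
𝔖[]-suc : ∀ n u → u ∈S suc n → 𝔖[ suc n ] u ≈ₚ 𝔖[ n ] u
𝔖[]-suc n u u∈ = begin
  ∂^ (u ⁻¹ ∙ w₀ (suc n)) (𝔖w₀ (suc n))
    ≈⟨ ∂^-word _ (r ++ d′) _ product length≡ ⟩
  foldr ∂ (𝔖w₀ (suc n)) (r ++ d′)            ≈⟨ ≡⇒≈ₚ (foldr-++ ∂ (𝔖w₀ (suc n)) r d′) ⟩
  foldr ∂ (foldr ∂ (𝔖w₀ (suc n)) d′) r       ≈⟨ foldr-∂-cong r (𝔖w₀-suc n) ⟩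
  ∂^ v (𝔖w₀ n)                               ∎
  where
  open ≈ₚ-Reasoning
  v : S∞
  v = u ⁻¹ ∙ w₀ n
  v∈ : v ∈S suc n
  v∈ n≤i = trans (cong (u ⁻¹ ⟨$⟩_) (reflect-fixes n n≤i)) (∈S-⁻¹ u (suc n) u∈ n≤i)
  r d′ : List ℕ
  r = word (reducedWord v)
  d′ = down (suc n)
  product : wordProduct (r ++ d′) ≈ u ⁻¹ ∙ w₀ (suc n)
  product = ≈-trans (wordProduct-++ r d′) (≈-trans (∙-congʳ (wordProduct d′) (product≈ (reducedWord v)))
    (pointwise λ k → cong (u ⁻¹ ⟨$⟩_) (at (w₀-suc n) k)))
  length≡ : length (r ++ d′) ≡ ℓ (u ⁻¹ ∙ w₀ (suc n))
  length≡ = trans (length-++ r) (trans (cong₂ _+_ (reduced (reducedWord v)) (length-down (suc n)))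
    (trans (sym (ℓ-∙down (suc n) v λ i i<1+n → subst (v ⟨$⟩ i <_) (sym (v∈ ≤-refl)) (∈S-< v (suc n) v∈ i<1+n)))
      (ℓ-≗ (v ∙ wordProduct d′) (u ⁻¹ ∙ w₀ (suc n)) λ k → cong (u ⁻¹ ⟨$⟩_) (at (w₀-suc n) k))))

𝔖[]-+ : ∀ k n u → u ∈S suc n → 𝔖[ k + n ] u ≈ₚ 𝔖[ n ] u
𝔖[]-+ zero    n u u∈ = reflₚ
𝔖[]-+ (suc k) n u u∈ = transₚ (𝔖[]-suc (k + n) u (∈S-mono u (s≤s (m≤n+m n k)) u∈)) (𝔖[]-+ k n u u∈)

𝔖-level : ∀ n u → u ∈S suc n → 𝔖 u ≈ₚ 𝔖[ n ] u
𝔖-level n u u∈ = transₚ (symₚ (𝔖[]-+ n (bound u) u (∈S-mono u (n≤1+n _) (fixes u))))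
  (transₚ (≡⇒≈ₚ (cong (λ m → 𝔖[ m ] u) (+-comm n (bound u)))) (𝔖[]-+ (bound u) n u u∈))

𝔖-cong : ∀ {u v} → u ≈ v → 𝔖 u ≈ₚ 𝔖 v
𝔖-cong {u} {v} p = transₚ (𝔖[]-cong (bound u) p)
  (symₚ (𝔖-level (bound u) v λ b → trans (sym (at p _)) (fixes u (≤-trans (n≤1+n _) b))))

𝔖-descent : ∀ u i → Descent u i → ∂ i (𝔖 u) ≈ₚ 𝔖 (u ∙ s i)
𝔖-descent u i des = transₚ (∂-cong i (𝔖-level n u u∈))
  (transₚ (𝔖[]-descent n u u∈ (m≤n+m (suc i) (bound u)) des)
    (symₚ (𝔖-level n (u ∙ s i) (∈S-∙s u (suc n) (s≤s (m≤n+m (suc i) (bound u))) u∈))))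
  where
  -- Large enough for u and also for the letter i, which may lie beyond `bound u`.
  n : ℕ
  n = bound u + suc i
  u∈ : u ∈S suc n
  u∈ = ∈S-mono u (≤-trans (m≤m+n (bound u) (suc i)) (n≤1+n n)) (fixes u)

𝔖-ascent : ∀ u i → Ascent u i → ∂ i (𝔖 u) ≈ₚ 0ₚ
𝔖-ascent u i asc = transₚ (∂-cong i (𝔖-level n u u∈)) (𝔖[]-ascent n u u∈ (m≤n+m (suc i) (bound u)) asc)
  where
  n : ℕ
  n = bound u + suc i
  u∈ : u ∈S suc n
  u∈ = ∈S-mono u (≤-trans (m≤m+n (bound u) (suc i)) (n≤1+n n)) (fixes u)

firstAscent : ∀ u n → (∀ i → i < n → Descent u i) ⊎
  (∃[ i ] i < n × Ascent u i × (∀ j → j < i → Descent u j))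
firstAscent u zero = inj₁ λ _ ()
firstAscent u (suc n) with firstAscent u n
... | inj₂ (i , i<n , asc , before) = inj₂ (i , m<n⇒m<1+n i<n , asc , before)
... | inj₁ des with ascent⊎descent u n
...   | inj₁ asc = inj₂ (n , n<1+n n , asc , des)
...   | inj₂ de  = inj₁ λ { i (s≤s i≤n) → [ des i , (λ { refl → de }) ]′ (m≤n⇒m<n∨m≡n i≤n) }

-- Descending induction from w₀(n): lengths on S_{n+1} are bounded by (n+1)², so multiplying by s_i
-- at an ascent must end. The first ascent is chosen because this choice preserves dominance.
w₀-induction : ∀ n (Q : S∞ → Set) →
  (∀ u → u ∈S suc n → (∀ i → i < n → Descent u i) → Q u) →
  (∀ u i → u ∈S suc n → i < n → Ascent u i → (∀ j → j < i → Descent u j) → Q (u ∙ s i) → Q u) →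
  ∀ u → u ∈S suc n → Q u
w₀-induction n Q base climb u u∈ = go (suc n * suc n) u u∈ (m≤n+m _ (ℓ u))
  where
  go : ∀ fuel u → u ∈S suc n → suc n * suc n ≤ ℓ u + fuel → Q u
  go fuel u u∈ enough with firstAscent u n
  ... | inj₁ des = base u u∈ des
  ... | inj₂ (i , i<n , asc , before) = climb u i u∈ i<n asc before (continue fuel enough)
    where
    us∈ : (u ∙ s i) ∈S suc n
    us∈ = ∈S-∙s u (suc n) (s≤s i<n) u∈
    continue : ∀ fuel → suc n * suc n ≤ ℓ u + fuel → Q (u ∙ s i)
    continue zero h = contradiction
      (≤-trans (≤-reflexive (sym (ℓ-ascent u i asc))) (≤-trans (ℓ-bound (u ∙ s i) (suc n) us∈)
        (≤-trans h (≤-reflexive (+-identityʳ (ℓ u)))))) 1+n≰n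
    continue (suc fuel) h = go fuel (u ∙ s i) us∈
      (≤-trans h (≤-reflexive (trans (+-suc (ℓ u) fuel) (cong (_+ fuel) (sym (ℓ-ascent u i asc))))))

decreasing⇒w₀ : ∀ n u → u ∈S suc n → (∀ i → i < n → Descent u i) → u ≈ w₀ n
decreasing⇒w₀ n u u∈ des = pointwise λ i → trans (cong (u ⟨$⟩_) (sym (reflect-involutive n i)))
    (at (increasing⇒𝟙 (u ∙ w₀ n) increasing) (reflect n i))
  where
  increasing : ∀ i → u ⟨$⟩ reflect n i < u ⟨$⟩ reflect n (suc i)
  increasing i with <-cmp i n
  ... | tri< i<n _ _ = subst₂ _<_
      (cong (u ⟨$⟩_) (sym (trans (reflect-≤ (<⇒≤ i<n)) (+-∸-assoc 1 i<n))))
      (cong (u ⟨$⟩_) (sym (reflect-≤ i<n)))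
      (des (n ∸ suc i) (∸-monoʳ-< {n} {suc i} {0} (s≤s z≤n) i<n))
  ... | tri≈ _ refl _ = subst₂ _<_
      (cong (u ⟨$⟩_) (sym (trans (reflect-≤ {n} {n} ≤-refl) (n∸n≡0 n))))
      (sym (trans (cong (u ⟨$⟩_) (reflect-fixes n (n<1+n n))) (u∈ ≤-refl)))
      (∈S-< u (suc n) u∈ (s≤s z≤n))
  ... | tri> _ _ n<i = subst₂ _<_
      (sym (trans (cong (u ⟨$⟩_) (reflect-fixes n n<i)) (u∈ n<i)))
      (sym (trans (cong (u ⟨$⟩_) (reflect-fixes n (m<n⇒m<1+n n<i))) (u∈ (m<n⇒m<1+n n<i))))
      (n<1+n i)

𝔖[]-w₀ : ∀ n → 𝔖[ n ] (w₀ n) ≈ₚ 𝔖w₀ n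
𝔖[]-w₀ n = ∂^-word (w₀ n ⁻¹ ∙ w₀ n) [] (𝔖w₀ n) (pointwise λ i → sym (reflect-involutive n i))
  (sym (ℓ-≗ (w₀ n ⁻¹ ∙ w₀ n) 𝟙 (reflect-involutive n)))

-- Codes and dominant permutations

code-cong : ∀ {u v} → u ≈ v → ∀ i → code u i ≡ code v i
code-cong {u} {v} p i = ≤-antisym (half u v p) (half v u (≈-sym p))
  where
  half : ∀ u v → u ≈ v → code u i ≤ code v i
  half u v p = size-mono (codeSet u i) (codeSet v i) λ { {j} (i<j , lt) → i<j , subst₂ _<_ (at p j) (at p i) lt }

code-w₀ : ∀ n i → i ≤ n → code (w₀ n) i ≡ n ∸ i
code-w₀ n i i≤n = ≤-antisym
  (subst (code (w₀ n) i ≤_) length-interval (length-⊆ (unique C) λ {j} j∈ →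
    let i<j , lt = sound C j∈ ; j≤n = ≤-pred (inversion-bound (w₀ n) (suc n) (reflect-fixes n) (i<j , lt)) in
    subst (_∈ interval) (m+[n∸m]≡n i<j) (∈-map⁺ (suc i +_) (∈-upTo⁺ (∸-monoˡ-< (s≤s j≤n) i<j)))))
  (subst (_≤ code (w₀ n) i) length-interval
    (length-⊆ (Unique≡ₚ.map⁺ (λ eq → +-cancelˡ-≡ (suc i) _ _ eq) (Unique≡ₚ.upTo⁺ (n ∸ i))) λ j∈ → member (∈-map⁻ (suc i +_) j∈)))
  where
  C : Enumeration _ _
  C = codeSet (w₀ n) i
  interval : List ℕ
  interval = map (suc i +_) (upTo (n ∸ i))
  length-interval : length interval ≡ n ∸ i
  length-interval = trans (length-map (suc i +_) (upTo (n ∸ i))) (length-upTo (n ∸ i))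
  member : ∀ {j} → ∃[ k ] k ∈ upTo (n ∸ i) × j ≡ suc i + k → j ∈ elements C
  member (k , k∈ , refl) = complete C (s≤s (m≤m+n i k) ,
    reflect-anti n (s≤s (m≤m+n i k)) (subst (suc i + k ≤_) (m+[n∸m]≡n i≤n)
      (≤-trans (≤-reflexive (sym (+-suc i k))) (+-monoʳ-≤ i (∈-upTo⁻ k∈)))))

s-fixes-< : ∀ i {j k} → j ≢ i → j ≢ suc i → j < k → j < s i ⟨$⟩ k
s-fixes-< i {j} {k} p q j<k = subst (_< s i ⟨$⟩ k) (s-other i p q) (s-monotone i j<k (p ∘ proj₁))

module _ (u : S∞) (i : ℕ) (asc : Ascent u i) where

  code-∙s-other : ∀ j → j ≢ i → j ≢ suc i → code (u ∙ s i) j ≡ code u j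
  code-∙s-other j p q = ≤-antisym
    (size-injection (codeSet (u ∙ s i) j) (codeSet u j) (s i ⟨$⟩_) (⟨$⟩-injective (s i))
      λ { {k} (j<k , lt) → s-fixes-< i p q j<k , subst (u ⟨$⟩ (s i ⟨$⟩ k) <_) (cong (u ⟨$⟩_) (s-other i p q)) lt })
    (size-injection (codeSet u j) (codeSet (u ∙ s i) j) (s i ⟨$⟩_) (⟨$⟩-injective (s i))
      λ { {k} (j<k , lt) → s-fixes-< i p q j<k ,
        subst₂ _<_ (cong (u ⟨$⟩_) (sym (s-involutive i k))) (cong (u ⟨$⟩_) (sym (s-other i p q))) lt })

  code-∙s-suc : code (u ∙ s i) (suc i) ≡ code u i
  code-∙s-suc = ≤-antisym
    (size-mono (codeSet (u ∙ s i) (suc i)) (codeSet u i)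
      λ { {k} (i<k , lt) → <-trans (n<1+n i) i<k , subst₂ _<_ (fixed i<k) us-suc lt })
    (size-mono (codeSet u i) (codeSet (u ∙ s i) (suc i))
      λ { {k} (i<k , lt) → let 1+i<k = ≤∧≢⇒< i<k (λ { refl → <-asym lt asc }) in
        1+i<k , subst₂ _<_ (sym (fixed 1+i<k)) (sym us-suc) lt })
    where
    fixed : ∀ {k} → suc i < k → (u ∙ s i) ⟨$⟩ k ≡ u ⟨$⟩ k
    fixed 1+i<k = cong (u ⟨$⟩_) (s-other i (<⇒≢ (<-trans (n<1+n i) 1+i<k) ∘ sym) (<⇒≢ 1+i<k ∘ sym))
    us-suc : (u ∙ s i) ⟨$⟩ suc i ≡ u ⟨$⟩ i
    us-suc = cong (u ⟨$⟩_) (s-right i)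

  code-∙s-self : code (u ∙ s i) i ≡ suc (code u (suc i))
  code-∙s-self = ≤-antisym
    (length-⊆ {ys = suc i ∷ elements (codeSet u (suc i))} (unique (codeSet (u ∙ s i) i))
      λ {k} k∈ → locate (sound (codeSet (u ∙ s i) i) k∈) (≡⊎≢ k (suc i)))
    (size-injection-< (codeSet u (suc i)) (codeSet (u ∙ s i) i) id id
      (λ { {k} (1+i<k , lt) → <-trans (n<1+n i) 1+i<k , subst₂ _<_ (sym (fixed 1+i<k)) (sym us-self) lt })
      (suc i) (n<1+n i , ascent-∙s u i asc) λ { (1+i<k , _) → <⇒≢ 1+i<k })
    where
    fixed : ∀ {k} → suc i < k → (u ∙ s i) ⟨$⟩ k ≡ u ⟨$⟩ k
    fixed 1+i<k = cong (u ⟨$⟩_) (s-other i (<⇒≢ (<-trans (n<1+n i) 1+i<k) ∘ sym) (<⇒≢ 1+i<k ∘ sym))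
    us-self : (u ∙ s i) ⟨$⟩ i ≡ u ⟨$⟩ suc i
    us-self = cong (u ⟨$⟩_) (s-left i)
    locate : ∀ {k} → i < k × (u ∙ s i) ⟨$⟩ k < (u ∙ s i) ⟨$⟩ i → k ≡ suc i ⊎ k ≢ suc i →
      k ∈ suc i ∷ elements (codeSet u (suc i))
    locate _ (inj₁ refl) = here refl
    locate (i<k , lt) (inj₂ k≢) = there (complete (codeSet u (suc i))
      (1+i<k , subst₂ _<_ (fixed 1+i<k) us-self lt))
      where
      1+i<k : suc i < _
      1+i<k = ≤∧≢⇒< i<k (k≢ ∘ sym)

  code-ascent-≤ : code u i ≤ code u (suc i)
  code-ascent-≤ = size-mono (codeSet u i) (codeSet u (suc i))
    λ { (i<k , lt) → ≤∧≢⇒< i<k (λ { refl → <-asym lt asc }) , <-trans lt asc }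

code-descent-< : ∀ u i → Descent u i → code u (suc i) < code u i
code-descent-< u i des = size-injection-< (codeSet u (suc i)) (codeSet u i) id id
  (λ { (1+i<k , lt) → <-trans (n<1+n i) 1+i<k , <-trans lt des })
  (suc i) (n<1+n i , des) λ { (1+i<k , _) → <⇒≢ 1+i<k }

module _ (u : S∞) (dom : Dominant u) (i : ℕ) (asc : Ascent u i) (before : ∀ j → j < i → Descent u j) where

  first-ascent-codes : code u i ≡ code u (suc i)
  first-ascent-codes = ≤-antisym (code-ascent-≤ u i asc) (dom i)

  -- Rows i and i + 1 of the code of u agree, and u s_i has one more box in row i. If i > 0, then i
  -- - 1 is a descent, so row i - 1 was strictly longer and still dominates.
  first-ascent-dominant : Dominant (u ∙ s i)
  first-ascent-dominant j = cases (≡⊎≢ j i) (≡⊎≢ (suc j) i) (≡⊎≢ j (suc i))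
    where
    open ≤-Reasoning
    c : ℕ → ℕ
    c = code (u ∙ s i)
    cases : ∀ {j} → j ≡ i ⊎ j ≢ i → suc j ≡ i ⊎ suc j ≢ i → j ≡ suc i ⊎ j ≢ suc i → c (suc j) ≤ c j
    cases (inj₁ refl) _ _ = begin
      c (suc i)             ≡⟨ code-∙s-suc u i asc ⟩
      code u i              ≡⟨ first-ascent-codes ⟩
      code u (suc i)        ≤⟨ n≤1+n _ ⟩
      suc (code u (suc i))  ≡⟨ sym (code-∙s-self u i asc) ⟩
      c i                   ∎
    cases {j} (inj₂ j≢i) (inj₁ refl) _ = begin
      c (suc j)                   ≡⟨ code-∙s-self u i asc ⟩
      suc (code u (suc (suc j)))  ≡⟨ cong suc (sym first-ascent-codes) ⟩
      suc (code u (suc j))        ≤⟨ code-descent-< u j (before j (n<1+n j)) ⟩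
      code u j                    ≡⟨ sym (code-∙s-other u i asc j j≢i (<⇒≢ (m<n⇒m<1+n (n<1+n j)))) ⟩
      c j                         ∎
    cases (inj₂ _) (inj₂ _) (inj₁ refl) = begin
      c (2 + i)        ≡⟨ code-∙s-other u i asc (2 + i) (λ ()) (λ ()) ⟩
      code u (2 + i)   ≤⟨ dom (suc i) ⟩
      code u (suc i)   ≡⟨ sym first-ascent-codes ⟩
      code u i         ≡⟨ sym (code-∙s-suc u i asc) ⟩
      c (suc i)        ∎
    cases {j} (inj₂ j≢i) (inj₂ 1+j≢i) (inj₂ j≢1+i) = begin
      c (suc j)        ≡⟨ code-∙s-other u i asc (suc j) 1+j≢i (j≢i ∘ suc-injective) ⟩
      code u (suc j)   ≤⟨ dom j ⟩
      code u j         ≡⟨ sym (code-∙s-other u i asc j j≢i j≢1+i) ⟩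
      c j              ∎

-- Both sides are obtained from u s_i, for the first ascent i, by removing one box.
𝔖[]-dominant : ∀ n u → u ∈S suc n → Dominant u → 𝔖[ n ] u ≈ₚ shape (2 + n) (code u)
𝔖[]-dominant n = w₀-induction n (λ u → Dominant u → 𝔖[ n ] u ≈ₚ shape (2 + n) (code u)) base climb
  where
  base : ∀ u → u ∈S suc n → (∀ i → i < n → Descent u i) → Dominant u → 𝔖[ n ] u ≈ₚ shape (2 + n) (code u)
  base u u∈ des dom = transₚ (𝔖[]-cong n u≈w₀) (transₚ (𝔖[]-w₀ n) (transₚ (𝔖w₀-shape n)
    (transₚ (symₚ (shape-extend 2 n λ i n≤i → m≤n⇒m∸n≡0 n≤i)) (shape-cong (2 + n) λ i _ → codes i))))
    where
    u≈w₀ : u ≈ w₀ n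
    u≈w₀ = decreasing⇒w₀ n u u∈ des
    codes : ∀ i → n ∸ i ≡ code u i
    codes i with <-≤-connex i n
    ... | inj₁ i<n = trans (sym (code-w₀ n i (<⇒≤ i<n))) (code-cong (≈-sym u≈w₀) i)
    ... | inj₂ n≤i with m≤n⇒m<n∨m≡n n≤i
    ...   | inj₁ n<i  = trans (m≤n⇒m∸n≡0 n≤i) (sym (code-zero u (suc n) u∈ i n<i))
    ...   | inj₂ refl = trans (sym (code-w₀ n n ≤-refl)) (code-cong (≈-sym u≈w₀) n)
  climb : ∀ u i → u ∈S suc n → i < n → Ascent u i → (∀ j → j < i → Descent u j) →
    (Dominant (u ∙ s i) → 𝔖[ n ] (u ∙ s i) ≈ₚ shape (2 + n) (code (u ∙ s i))) →
    Dominant u → 𝔖[ n ] u ≈ₚ shape (2 + n) (code u)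
  climb u i u∈ i<n asc before ih dom = transₚ
    (symₚ (transₚ (𝔖[]-descent n (u ∙ s i) (∈S-∙s u (suc n) (s≤s i<n) u∈) i<n (ascent-∙s u i asc)) (𝔖[]-cong n (∙s∙s u i))))
    (transₚ (∂-cong i (ih (first-ascent-dominant u dom i asc before)))
      (∂-shape (2 + n) i (code u (suc i)) (m≤n⇒m≤1+n (s≤s i<n)) (code-∙s-self u i asc)
        (trans (code-∙s-suc u i asc) (first-ascent-codes u dom i asc before)) (first-ascent-codes u dom i asc before)
        λ j j≢i → same j j≢i (≡⊎≢ j (suc i))))
    where
    same : ∀ j → j ≢ i → j ≡ suc i ⊎ j ≢ suc i → code u j ≡ code (u ∙ s i) j
    same j j≢i (inj₁ refl) = trans (sym (first-ascent-codes u dom i asc before)) (sym (code-∙s-suc u i asc))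
    same j j≢i (inj₂ j≢1+i) = sym (code-∙s-other u i asc j j≢i j≢1+i)

𝔖-dominant : ∀ u → Dominant u → 𝔖 u ≈ₚ shape (bound u) (code u)
𝔖-dominant u dom = transₚ (𝔖[]-dominant (bound u) u (∈S-mono u (n≤1+n _) (fixes u)) dom)
  (shape-extend 2 (bound u) (code-zero u (bound u) (fixes u)))

𝔖-𝟙 : ∀ {u} → u ≈ 𝟙 → 𝔖 u ≈ₚ 1ₚ
𝔖-𝟙 u≈𝟙 = transₚ (𝔖-cong u≈𝟙) (𝔖-dominant 𝟙 λ i → ≤-reflexive (trans (codes (suc i)) (sym (codes i))))
  where
  codes : ∀ i → code 𝟙 i ≡ 0
  codes i = code-zero 𝟙 0 (λ _ → refl) i z≤n

-- Localisation at permutations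

ev : S∞ → ℤ[x,y,z] → ℤ[x,y,z]
ev w = sub (x↦ λ i → y (w ⟨$⟩ i))

ev-act : ∀ w i p → ev w (act i p) ≈ₚ ev (w ∙ s i) p
ev-act w i = sub-comp _ _ λ { (X j) → reflₚ ; (Y j) → reflₚ ; (Z j) → reflₚ }

ev-∂ : ∀ w i p → (y (w ⟨$⟩ i) -ₚ y (w ⟨$⟩ suc i)) *ₚ ev w (∂ i p) ≈ₚ ev w p -ₚ ev (w ∙ s i) p
ev-∂ w i p = transₚ (sub-cong _ (∂-spec i p)) (+-congₚ reflₚ (-‿congₚ (ev-act w i p)))

-- g⁻¹(j) ≤ j, and by strong induction every smaller value is already taken by itself, so
-- injectivity leaves only j.
inflationary⇒𝟙 : ∀ g → (∀ i → i ≤ g ⟨$⟩ i) → g ≈ 𝟙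
inflationary⇒𝟙 g inf = pointwise λ j → trans (cong (g ⟨$⟩_) (sym (<-rec _ fixed j))) (uu⁻¹ g j)
  where
  fixed : ∀ j → (∀ {i} → i < j → g ⁻¹ ⟨$⟩ i ≡ i) → g ⁻¹ ⟨$⟩ j ≡ j
  fixed j ih with m≤n⇒m<n∨m≡n (subst (g ⁻¹ ⟨$⟩ j ≤_) (uu⁻¹ g j) (inf (g ⁻¹ ⟨$⟩ j)))
  ... | inj₂ eq = eq
  ... | inj₁ lt = ⟨$⟩-injective (g ⁻¹) (ih lt)

-- For u = w₀(n), a position with w(i) < n - i makes the factor x_i - y_{w(i)} vanish; if there is
-- none, then w ≥ w₀ pointwise and w = w₀. The climb writes 𝔖_u as ∂_i of 𝔖_{u s_i}, whose values at
-- w and at w s_i vanish, since both are shorter than u s_i.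
ev-𝔖[] : ∀ n u → u ∈S suc n → ∀ w → w ∈S suc n → ℓ w < ℓ u → ev w (𝔖[ n ] u) ≈ₚ 0ₚ
ev-𝔖[] n = w₀-induction n (λ u → ∀ w → w ∈S suc n → ℓ w < ℓ u → ev w (𝔖[ n ] u) ≈ₚ 0ₚ) base climb
  where
  base : ∀ u → u ∈S suc n → (∀ i → i < n → Descent u i) → ∀ w → w ∈S suc n → ℓ w < ℓ u → ev w (𝔖[ n ] u) ≈ₚ 0ₚ
  base u u∈ des w w∈ ℓw<ℓu with anyUpTo? (λ i → w ⟨$⟩ i <? n ∸ i) n
  ... | yes (i , i<n , wi<) = transₚ
      (sub-cong _ (transₚ (𝔖[]-cong n (decreasing⇒w₀ n u u∈ des)) (transₚ (𝔖[]-w₀ n) (𝔖w₀-shape n))))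
      (transₚ (≡⇒≈ₚ (sub-Π _ n _)) (Π-≈0 n i i<n (transₚ (≡⇒≈ₚ (sub-Π _ (n ∸ i) _))
        (Π-≈0 (n ∸ i) (w ⟨$⟩ i) wi< (R.-‿inverseʳ (y (w ⟨$⟩ i)))))))
  ... | no none = contradiction (ℓ-cong w≈u) (<⇒≢ ℓw<ℓu)
    where
    inflationary : ∀ i → i ≤ w ⟨$⟩ reflect n i
    inflationary i with <-≤-connex n i
    ... | inj₁ n<i = ≤-reflexive (sym (trans (cong (w ⟨$⟩_) (reflect-fixes n n<i)) (w∈ n<i)))
    inflationary zero | inj₂ _ = z≤n
    inflationary (suc i) | inj₂ i<n = subst (λ k → suc i ≤ w ⟨$⟩ k) (sym (reflect-≤ i<n))
      (subst (_≤ w ⟨$⟩ (n ∸ suc i)) (m∸[m∸n]≡n i<n)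
        (≮⇒≥ λ lt → none (n ∸ suc i , ∸-monoʳ-< {n} {suc i} {0} (s≤s z≤n) i<n , lt)))
    w≈w₀ : w ≈ w₀ n
    w≈w₀ = pointwise λ i → trans (cong (w ⟨$⟩_) (sym (reflect-involutive n i)))
      (at (inflationary⇒𝟙 (w ∙ w₀ n) inflationary) (reflect n i))
    w≈u : w ≈ u
    w≈u = ≈-trans w≈w₀ (≈-sym (decreasing⇒w₀ n u u∈ des))
  climb : ∀ u i → u ∈S suc n → i < n → Ascent u i → (∀ j → j < i → Descent u j) →
    (∀ w → w ∈S suc n → ℓ w < ℓ (u ∙ s i) → ev w (𝔖[ n ] (u ∙ s i)) ≈ₚ 0ₚ) →
    ∀ w → w ∈S suc n → ℓ w < ℓ u → ev w (𝔖[ n ] u) ≈ₚ 0ₚ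
  climb u i u∈ i<n asc _ ih w w∈ ℓw<ℓu = cancel wi≢ (begin
    (y (w ⟨$⟩ i) -ₚ y (w ⟨$⟩ suc i)) *ₚ ev w (𝔖[ n ] u)
      ≈⟨ R.*-congˡ (sub-cong _ (symₚ (transₚ (𝔖[]-descent n (u ∙ s i) (∈S-∙s u (suc n) (s≤s i<n) u∈) i<n (ascent-∙s u i asc)) (𝔖[]-cong n (∙s∙s u i))))) ⟩
    (y (w ⟨$⟩ i) -ₚ y (w ⟨$⟩ suc i)) *ₚ ev w (∂ i (𝔖[ n ] (u ∙ s i)))
      ≈⟨ ev-∂ w i (𝔖[ n ] (u ∙ s i)) ⟩
    ev w (𝔖[ n ] (u ∙ s i)) -ₚ ev (w ∙ s i) (𝔖[ n ] (u ∙ s i))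
      ≈⟨ +-congₚ (ih w w∈ (<-trans ℓw<ℓu ℓu<ℓus)) (-‿congₚ (ih (w ∙ s i) (∈S-∙s w (suc n) (s≤s i<n) w∈)
           (≤-<-trans (≤-trans (ℓ-ascent-≤ w i) ℓw<ℓu) ℓu<ℓus))) ⟩
    0ₚ -ₚ 0ₚ ≈⟨ R.-‿inverseʳ 0ₚ ⟩
    0ₚ       ≈⟨ symₚ (R.zeroʳ _) ⟩
    (y (w ⟨$⟩ i) -ₚ y (w ⟨$⟩ suc i)) *ₚ 0ₚ ∎)
    where
    open ≈ₚ-Reasoning
    ℓu<ℓus : ℓ u < ℓ (u ∙ s i)
    ℓu<ℓus = ℓ-ascent-< u i asc
    wi≢ : Y (w ⟨$⟩ i) ≢ Y (w ⟨$⟩ suc i)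
    wi≢ eq = <⇒≢ (n<1+n i) (⟨$⟩-injective w (Y-injective eq))
      where
      Y-injective : ∀ {a b} → Y a ≡ Y b → a ≡ b
      Y-injective refl = refl

ev-𝔖-≉𝟙 : ∀ u → ¬ u ≈ 𝟙 → ev 𝟙 (𝔖 u) ≈ₚ 0ₚ
ev-𝔖-≉𝟙 u u≉𝟙 = transₚ (sub-cong _ (𝔖-level (bound u) u u∈)) (ev-𝔖[] (bound u) u u∈ 𝟙 (λ _ → refl) 0<ℓ)
  where
  u∈ : u ∈S suc (bound u)
  u∈ = ∈S-mono u (n≤1+n _) (fixes u)
  0<ℓ : 0 < ℓ u
  0<ℓ with descent? u
  ... | inj₁ (i , des) = subst (0 <_) (sym (ℓ-descent u i des)) (s≤s z≤n)
  ... | inj₂ u≈𝟙 = contradiction u≈𝟙 u≉𝟙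

∂-determined : ∀ {p q} → (∀ j → ∂ j p ≈ₚ ∂ j q) → ev 𝟙 p ≈ₚ ev 𝟙 q → p ≈ₚ q
∂-determined {p} {q} e e₀ = begin
  p                ≈⟨ solve 2 (λ p q → p := q :+ (p :- q)) reflₚ p q ⟩
  q +ₚ (p -ₚ q)    ≈⟨ R.+-congˡ zero-difference ⟩
  q +ₚ 0ₚ          ≈⟨ R.+-identityʳ q ⟩
  q                ∎
  where
  open ≈ₚ-Reasoning
  open ℤSolver
  zero-difference : p -ₚ q ≈ₚ 0ₚ
  zero-difference = transₚ
    (symₚ (symmetric⇒x-free λ j → invariant-from-∂ j (∂-unique j (begin
      root j *ₚ 0ₚ                                 ≈⟨ R.zeroʳ (root j) ⟩
      0ₚ                                           ≈⟨ symₚ (R.-‿inverseʳ (root j *ₚ ∂ j p)) ⟩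
      root j *ₚ ∂ j p -ₚ root j *ₚ ∂ j p           ≈⟨ +-congₚ (∂-spec j p) (-‿congₚ (transₚ (*-congₚ reflₚ (e j)) (∂-spec j q))) ⟩
      (p -ₚ act j p) -ₚ (q -ₚ act j q)
        ≈⟨ solve 4 (λ a b c d → (a :- b) :- (c :- d) := (a :- c) :- (b :- d)) reflₚ p (act j p) q (act j q) ⟩
      (p -ₚ q) -ₚ act j (p -ₚ q)                   ∎))))
    (transₚ (+-congₚ e₀ reflₚ) (R.-‿inverseʳ (ev 𝟙 q)))

-- The action of s_i on the y-variables

yroot : ℕ → ℤ[x,y,z]
yroot i = y i -ₚ y (suc i)

actY-cong : ∀ i {p q} → p ≈ₚ q → actY i p ≈ₚ actY i q
actY-cong i = sub-cong _

actY-involutive : ∀ i p → actY i (actY i p) ≈ₚ p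
actY-involutive i p = transₚ
  (sub-comp _ _ {var} (λ { (X _) → reflₚ ; (Y j) → ≡⇒≈ₚ (cong y (s-involutive i j)) ; (Z _) → reflₚ }) p)
  (≡⇒≈ₚ (sub-var p))

actY-yroot : ∀ i → actY i (yroot i) ≈ₚ -ₚ yroot i
actY-yroot i = transₚ (+-congₚ (≡⇒≈ₚ (cong y (s-left i))) (-‿congₚ (≡⇒≈ₚ (cong y (s-right i)))))
  (solve 2 (λ a b → b :- a := :- (a :- b)) reflₚ (y i) (y (suc i)))
  where open ℤSolver

∂-actY : ∀ i j p → ∂ j (actY i p) ≈ₚ actY i (∂ j p)
∂-actY i j p = ∂-unique j (transₚ (actY-cong i (∂-spec j p))
  (+-congₚ reflₚ (-‿congₚ (transₚ
    (sub-comp _ _ {λ { (X k) → x (s j ⟨$⟩ k) ; (Y k) → y (s i ⟨$⟩ k) ; (Z k) → z k }}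
      (λ { (X _) → reflₚ ; (Y _) → reflₚ ; (Z _) → reflₚ }) p)
    (symₚ (sub-comp _ _ (λ { (X _) → reflₚ ; (Y _) → reflₚ ; (Z _) → reflₚ }) p))))))

ev-actY : ∀ i p → ev 𝟙 (actY i p) ≈ₚ actY i (ev (s i) p)
ev-actY i p = transₚ
  (sub-comp _ _ {λ { (X k) → y k ; (Y k) → y (s i ⟨$⟩ k) ; (Z k) → z k }}
    (λ { (X _) → reflₚ ; (Y _) → reflₚ ; (Z _) → reflₚ }) p)
  (symₚ (sub-comp _ _ (λ { (X k) → ≡⇒≈ₚ (cong y (s-involutive i k)) ; (Y _) → reflₚ ; (Z _) → reflₚ }) p))

ev-s : ∀ i p → ev (s i) p ≈ₚ ev 𝟙 p -ₚ yroot i *ₚ ev 𝟙 (∂ i p)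
ev-s i p = begin
  ev (s i) p                                   ≈⟨ solve 2 (λ a b → b := a :- (a :- b)) reflₚ (ev 𝟙 p) (ev (s i) p) ⟩
  ev 𝟙 p -ₚ (ev 𝟙 p -ₚ ev (s i) p)             ≈⟨ +-congₚ reflₚ (-‿congₚ (symₚ (ev-∂ 𝟙 i p))) ⟩
  ev 𝟙 p -ₚ yroot i *ₚ ev 𝟙 (∂ i p)            ∎
  where
  open ≈ₚ-Reasoning
  open ℤSolver

abstract
  -- Extended by 0 to left ascents, so that the y-action is described by one equation, which can be
  -- differentiated without splitting cases.
  𝔖-lower : ℕ → S∞ → ℤ[x,y,z]
  𝔖-lower i u with ascent⊎descent (u ⁻¹) i
  ... | inj₁ _ = 0ₚ
  ... | inj₂ _ = 𝔖 (s i ∙ u)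

  𝔖-lower-ascent : ∀ i u → Ascent (u ⁻¹) i → 𝔖-lower i u ≈ₚ 0ₚ
  𝔖-lower-ascent i u asc with ascent⊎descent (u ⁻¹) i
  ... | inj₁ _   = reflₚ
  ... | inj₂ des = contradiction des (<-asym asc)

  𝔖-lower-descent : ∀ i u → Descent (u ⁻¹) i → 𝔖-lower i u ≈ₚ 𝔖 (s i ∙ u)
  𝔖-lower-descent i u des with ascent⊎descent (u ⁻¹) i
  ... | inj₁ asc = contradiction des (<-asym asc)
  ... | inj₂ _   = reflₚ

≡⁻¹ : ∀ u {i j} → u ⟨$⟩ i ≡ j → u ⁻¹ ⟨$⟩ j ≡ i
≡⁻¹ u {i} eq = trans (cong (u ⁻¹ ⟨$⟩_) (sym eq)) (u⁻¹u u i)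

≈s : ∀ {u} i → s i ∙ u ≈ 𝟙 → u ≈ s i
≈s {u} i e = ≈-trans (≈-sym (s∙s∙ u i)) (≈-trans (∙-congˡ (s i) e) (pointwise λ _ → refl))

∙s≈𝟙 : ∀ {u} i → u ∙ s i ≈ 𝟙 → u ≈ s i
∙s≈𝟙 {u} i e = ≈-trans (≈-sym (∙s∙s u i)) (≈-trans (∙-congʳ (s i) e) (pointwise λ _ → refl))

module _ (i : ℕ) (u : S∞) where

  ev-𝔖 : ev 𝟙 (𝔖 u) ≈ₚ 0ₚ ⊎ ev 𝟙 (𝔖 u) ≈ₚ 1ₚ
  ev-𝔖 with u ≈? 𝟙
  ... | yes u≈𝟙 = inj₂ (sub-cong _ (𝔖-𝟙 u≈𝟙))
  ... | no u≉𝟙  = inj₁ (ev-𝔖-≉𝟙 u u≉𝟙)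

  -- Each of the two polynomials is 0 or a Schubert polynomial, with index u s_i or s_i u; either
  -- index is 𝟙 only for u = s_i, and then both are.
  ev-∂-𝔖 : (ev 𝟙 (∂ i (𝔖 u)) ≈ₚ 0ₚ × ev 𝟙 (𝔖-lower i u) ≈ₚ 0ₚ) ⊎
           (ev 𝟙 (∂ i (𝔖 u)) ≈ₚ 1ₚ × ev 𝟙 (𝔖-lower i u) ≈ₚ 1ₚ)
  ev-∂-𝔖 with u ≈? s i
  ... | yes u≈s = inj₂
      ( sub-cong _ (transₚ (𝔖-descent u i (descent-cong i (≈-sym u≈s) s-descent))
          (𝔖-𝟙 (≈-trans (∙-congʳ (s i) u≈s) (pointwise (s-involutive i)))))
      , sub-cong _ (transₚ (𝔖-lower-descent i u (descent-cong i (≈-sym (⁻¹-cong u≈s)) s-descent))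
          (𝔖-𝟙 (≈-trans (∙-congˡ (s i) u≈s) (pointwise (s-involutive i))))) )
    where
    s-descent : Descent (s i) i
    s-descent = subst₂ _<_ (sym (s-right i)) (sym (s-left i)) (n<1+n i)
  ... | no u≉s = inj₁ (right (ascent⊎descent u i) , left (ascent⊎descent (u ⁻¹) i))
    where
    right : Ascent u i ⊎ Descent u i → ev 𝟙 (∂ i (𝔖 u)) ≈ₚ 0ₚ
    right (inj₁ asc) = sub-cong _ (𝔖-ascent u i asc)
    right (inj₂ des) = transₚ (sub-cong _ (𝔖-descent u i des)) (ev-𝔖-≉𝟙 (u ∙ s i) (u≉s ∘ ∙s≈𝟙 i))
    left : Ascent (u ⁻¹) i ⊎ Descent (u ⁻¹) i → ev 𝟙 (𝔖-lower i u) ≈ₚ 0ₚ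
    left (inj₁ asc) = sub-cong _ (𝔖-lower-ascent i u asc)
    left (inj₂ des) = transₚ (sub-cong _ (𝔖-lower-descent i u des)) (ev-𝔖-≉𝟙 (s i ∙ u) (u≉s ∘ ≈s i))

  -- Exchanging y_i and y_{i+1} before setting x = y amounts to localising at s_i and exchanging
  -- afterwards. By `ev-s` this involves only values at 𝟙, which are 0 or 1 and so are fixed, and
  -- y_i - y_{i+1}, which changes sign.
  ev-actY-𝔖 : ev 𝟙 (actY i (𝔖 u)) ≈ₚ ev 𝟙 (𝔖 u +ₚ yroot i *ₚ 𝔖-lower i u)
  ev-actY-𝔖 = begin
    ev 𝟙 (actY i (𝔖 u))                                  ≈⟨ transₚ (ev-actY i (𝔖 u)) (actY-cong i (ev-s i (𝔖 u))) ⟩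
    actY i (a -ₚ yroot i *ₚ b)                           ≈⟨ +-congₚ (constant ev-𝔖) (-‿congₚ (*-congₚ (actY-yroot i) (constant′ ev-∂-𝔖))) ⟩
    a -ₚ (-ₚ yroot i) *ₚ c                               ≈⟨ solve 3 (λ a r c → a :- (:- r) :* c := a :+ r :* c) reflₚ a (yroot i) c ⟩
    a +ₚ yroot i *ₚ c                                    ∎
    where
    open ≈ₚ-Reasoning
    open ℤSolver
    a b c : ℤ[x,y,z]
    a = ev 𝟙 (𝔖 u)
    b = ev 𝟙 (∂ i (𝔖 u))
    c = ev 𝟙 (𝔖-lower i u)
    constant : ∀ {q} → q ≈ₚ 0ₚ ⊎ q ≈ₚ 1ₚ → actY i q ≈ₚ q
    constant (inj₁ e) = transₚ (actY-cong i e) (symₚ e)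
    constant (inj₂ e) = transₚ (actY-cong i e) (symₚ e)
    constant′ : (b ≈ₚ 0ₚ × c ≈ₚ 0ₚ) ⊎ (b ≈ₚ 1ₚ × c ≈ₚ 1ₚ) → actY i b ≈ₚ c
    constant′ (inj₁ (e , f)) = transₚ (actY-cong i e) (symₚ f)
    constant′ (inj₂ (e , f)) = transₚ (actY-cong i e) (symₚ f)

  ∂-𝔖-lower-ascent : ∀ j → Ascent u j → ∂ j (𝔖-lower i u) ≈ₚ 0ₚ
  ∂-𝔖-lower-ascent j asc = cases (ascent⊎descent (u ⁻¹) i)
    where
    cases : Ascent (u ⁻¹) i ⊎ Descent (u ⁻¹) i → ∂ j (𝔖-lower i u) ≈ₚ 0ₚ
    cases (inj₁ asc′) = transₚ (∂-cong j (𝔖-lower-ascent i u asc′)) (∂-0 j)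
    cases (inj₂ des)  = transₚ (∂-cong j (𝔖-lower-descent i u des)) (𝔖-ascent (s i ∙ u) j
      (s-monotone i asc λ (e , f) → <-asym (subst₂ _<_ (≡⁻¹ u f) (≡⁻¹ u e) des) (n<1+n j)))

  -- u and u s_j differ as to the left descent i only if u(j) = i + 1 and u(j+1) = i, that is s_i u
  -- = u s_j. Then s_i u has an ascent at j and both sides are 0.
  ∂-𝔖-lower-descent : ∀ j → Descent u j → ∂ j (𝔖-lower i u) ≈ₚ 𝔖-lower i (u ∙ s j)
  ∂-𝔖-lower-descent j des = cases (ascent⊎descent (u ⁻¹) i) (ascent⊎descent ((u ∙ s j) ⁻¹) i)
    where
    v : S∞
    v = u ∙ s j
    exchanged : Descent (u ⁻¹) i → Ascent (v ⁻¹) i →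
      Dec (u ⁻¹ ⟨$⟩ suc i ≡ j × u ⁻¹ ⟨$⟩ i ≡ suc j) → Ascent (s i ∙ u) j
    exchanged de asc′ (yes (e , f)) = subst₂ _<_
      (sym (trans (cong (s i ⟨$⟩_) (≡⁻¹ (u ⁻¹) e)) (s-right i)))
      (sym (trans (cong (s i ⟨$⟩_) (≡⁻¹ (u ⁻¹) f)) (s-left i))) (n<1+n i)
    exchanged de asc′ (no ≢) = contradiction (s-monotone j de ≢) (<-asym asc′)
    preserved : Descent (v ⁻¹) i → Descent (s i ∙ u) j
    preserved des′ = s-monotone i des λ (e , f) → <-asym des′ (subst₂ _<_
      (sym (trans (cong (s j ⟨$⟩_) (≡⁻¹ u e)) (s-right j)))
      (sym (trans (cong (s j ⟨$⟩_) (≡⁻¹ u f)) (s-left j))) (n<1+n j))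
    cases : _ → _ → ∂ j (𝔖-lower i u) ≈ₚ 𝔖-lower i v
    cases (inj₁ asc) (inj₁ asc′) = transₚ (∂-cong j (𝔖-lower-ascent i u asc))
      (transₚ (∂-0 j) (symₚ (𝔖-lower-ascent i v asc′)))
    cases (inj₁ asc) (inj₂ des′) = contradiction
      (s-monotone j asc λ (e , f) → <-asym (subst₂ _<_ (≡⁻¹ (u ⁻¹) f) (≡⁻¹ (u ⁻¹) e) des) (n<1+n i))
      (<-asym des′)
    cases (inj₂ de) (inj₁ asc′) = transₚ (∂-cong j (𝔖-lower-descent i u de)) (transₚ
      (𝔖-ascent (s i ∙ u) j (exchanged de asc′ ((u ⁻¹ ⟨$⟩ suc i ≟ j) ×-dec (u ⁻¹ ⟨$⟩ i ≟ suc j))))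
      (symₚ (𝔖-lower-ascent i v asc′)))
    cases (inj₂ de) (inj₂ des′) = transₚ (∂-cong j (𝔖-lower-descent i u de)) (transₚ
      (𝔖-descent (s i ∙ u) j (preserved des′))
      (transₚ (𝔖-cong {s i ∙ u ∙ s j} {s i ∙ v} (pointwise λ _ → refl)) (symₚ (𝔖-lower-descent i v des′))))

-- Both sides agree at x = y, and ∂_j either kills both or turns the equation for u into the one for
-- the shorter u s_j.
actY-𝔖 : ∀ i u → actY i (𝔖 u) ≈ₚ 𝔖 u +ₚ yroot i *ₚ 𝔖-lower i u
actY-𝔖 i u = go (ℓ u) u refl
  where
  open ≈ₚ-Reasoning
  ∂-right : ∀ u j → ∂ j (𝔖 u +ₚ yroot i *ₚ 𝔖-lower i u) ≈ₚ ∂ j (𝔖 u) +ₚ yroot i *ₚ ∂ j (𝔖-lower i u)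
  ∂-right u j = transₚ (∂-+ j (𝔖 u) (yroot i *ₚ 𝔖-lower i u)) (+-congₚ reflₚ (∂-scale j reflₚ (𝔖-lower i u)))
  go : ∀ n u → ℓ u ≡ n → actY i (𝔖 u) ≈ₚ 𝔖 u +ₚ yroot i *ₚ 𝔖-lower i u
  compare : ∀ n u → ℓ u ≡ n → ∀ j → Ascent u j ⊎ Descent u j →
    ∂ j (actY i (𝔖 u)) ≈ₚ ∂ j (𝔖 u +ₚ yroot i *ₚ 𝔖-lower i u)
  go n u ℓ≡ = ∂-determined (λ j → compare n u ℓ≡ j (ascent⊎descent u j)) (ev-actY-𝔖 i u)
  compare n u ℓ≡ j (inj₁ asc) = begin
    ∂ j (actY i (𝔖 u))                        ≈⟨ transₚ (∂-actY i j (𝔖 u)) (actY-cong i {q = 0ₚ} (𝔖-ascent u j asc)) ⟩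
    0ₚ                                        ≈⟨ symₚ (transₚ (+-identityₚ (yroot i *ₚ 0ₚ)) (R.zeroʳ (yroot i))) ⟩
    0ₚ +ₚ yroot i *ₚ 0ₚ                       ≈⟨ +-congₚ (symₚ (𝔖-ascent u j asc)) (*-congₚ reflₚ (symₚ (∂-𝔖-lower-ascent i u j asc))) ⟩
    ∂ j (𝔖 u) +ₚ yroot i *ₚ ∂ j (𝔖-lower i u)  ≈⟨ symₚ (∂-right u j) ⟩
    ∂ j (𝔖 u +ₚ yroot i *ₚ 𝔖-lower i u)       ∎
  compare zero    u ℓ≡ j (inj₂ des) = contradiction (trans (sym (ℓ-descent u j des)) ℓ≡) λ ()
  compare (suc n) u ℓ≡ j (inj₂ des) = begin
    ∂ j (actY i (𝔖 u))                        ≈⟨ transₚ (∂-actY i j (𝔖 u)) (actY-cong i (𝔖-descent u j des)) ⟩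
    actY i (𝔖 (u ∙ s j))                      ≈⟨ go n (u ∙ s j) (suc-injective (trans (sym (ℓ-descent u j des)) ℓ≡)) ⟩
    𝔖 (u ∙ s j) +ₚ yroot i *ₚ 𝔖-lower i (u ∙ s j)
      ≈⟨ +-congₚ (symₚ (𝔖-descent u j des)) (*-congₚ reflₚ (symₚ (∂-𝔖-lower-descent i u j des))) ⟩
    ∂ j (𝔖 u) +ₚ yroot i *ₚ ∂ j (𝔖-lower i u)  ≈⟨ symₚ (∂-right u j) ⟩
    ∂ j (𝔖 u +ₚ yroot i *ₚ 𝔖-lower i u)       ∎

-- The k-Bruhat order

Σℕ : ℕ → (ℕ → ℕ) → ℕ
Σℕ zero    f = 0
Σℕ (suc n) f = f 0 + Σℕ n (f ∘ suc)

Σℕ-mono : ∀ n {f g} → (∀ i → i < n → f i ≤ g i) → Σℕ n f ≤ Σℕ n g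
Σℕ-mono zero    h = z≤n
Σℕ-mono (suc n) h = +-mono-≤ (h 0 (s≤s z≤n)) (Σℕ-mono n λ i i<n → h (suc i) (s≤s i<n))

Σℕ-cong : ∀ n {f g} → (∀ i → i < n → f i ≡ g i) → Σℕ n f ≡ Σℕ n g
Σℕ-cong n h = ≤-antisym (Σℕ-mono n λ i i<n → ≤-reflexive (h i i<n)) (Σℕ-mono n λ i i<n → ≤-reflexive (sym (h i i<n)))

Σℕ-suc : ∀ n {f g} i → i < n → (∀ j → j < n → j ≢ i → f j ≡ g j) → f i ≡ suc (g i) → Σℕ n f ≡ suc (Σℕ n g)
Σℕ-suc (suc n) zero _ same e = cong₂ _+_ e (Σℕ-cong n λ j j<n → same (suc j) (s≤s j<n) λ ())
Σℕ-suc (suc n) {f} {g} (suc i) (s≤s i<n) same e = trans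
  (cong₂ _+_ (same 0 (s≤s z≤n) λ ()) (Σℕ-suc n i i<n (λ j j<n j≢i → same (suc j) (s≤s j<n) (j≢i ∘ suc-injective)) e))
  (+-suc (g 0) (Σℕ n (g ∘ suc)))

Σℕ-const : ∀ n → Σℕ n (λ _ → 1) ≡ n
Σℕ-const zero    = refl
Σℕ-const (suc n) = cong suc (Σℕ-const n)

-- Raising f from 0 to 1 at one listed index increases the sum by one and shortens the list by one;
-- with no index left, the sum is at most n.
Σℕ-zeros : ∀ n f is → Unique≡ is → All (_< n) is → (∀ {i} → i ∈ is → f i ≡ 0) → (∀ i → f i ≤ 1) →
  Σℕ n f + length is ≤ n
Σℕ-zeros n f [] _ _ _ f≤1 = ≤-trans (≤-reflexive (+-identityʳ _))
  (≤-trans (Σℕ-mono n λ i _ → f≤1 i) (≤-reflexive (Σℕ-const n)))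
Σℕ-zeros n f (i ∷ is) (i∉ ∷ uniq) (i<n ∷ is<n) zeros f≤1 = begin
  Σℕ n f + suc (length is)          ≡⟨ +-suc (Σℕ n f) (length is) ⟩
  suc (Σℕ n f) + length is
    ≡⟨ cong (_+ length is) (sym (Σℕ-suc n i i<n (λ _ _ → update-≢ i 1 f) (trans (update-≡ i 1 f) (cong suc (sym (zeros (here refl))))))) ⟩
  Σℕ n (update i 1 f) + length is
    ≤⟨ Σℕ-zeros n (update i 1 f) is uniq is<n
         (λ j∈ → trans (update-≢ i 1 f λ { refl → All.lookup i∉ j∈ refl }) (zeros (there j∈)))
         (λ j → [ (λ { refl → ≤-reflexive (update-≡ i 1 f) }) , (λ j≢i → subst (_≤ 1) (sym (update-≢ i 1 f j≢i)) (f≤1 j)) ]′ (≡⊎≢ j i)) ⟩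
  n                                 ∎
  where open ≤-Reasoning

same? : ℕ → ℕ → ℕ
same? a b = if does (a ≟ b) then 1 else 0

same?-≡ : ∀ {a b} → a ≡ b → same? a b ≡ 1
same?-≡ {a} {b} = if-yes (a ≟ b)

same?-≢ : ∀ {a b} → a ≢ b → same? a b ≡ 0
same?-≢ {a} {b} = if-no (a ≟ b)

same?-≤1 : ∀ a b → same? a b ≤ 1
same?-≤1 a b with a ≟ b
... | yes e = ≤-reflexive (same?-≡ e)
... | no ne = ≤-trans (≤-reflexive (same?-≢ ne)) z≤n

same?-mono : ∀ {a b c d} → (a ≡ b → c ≡ d) → same? a b ≤ same? c d
same?-mono {a} {b} f with a ≟ b
... | yes e = ≤-reflexive (trans (same?-≡ e) (sym (same?-≡ (f e))))
... | no ne = ≤-trans (≤-reflexive (same?-≢ ne)) z≤n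

same?-cong : ∀ {a b c d} → (a ≡ b → c ≡ d) → (c ≡ d → a ≡ b) → same? a b ≡ same? c d
same?-cong f g = ≤-antisym (same?-mono f) (same?-mono g)

-- The size of P_k(u, w); its complement in k counts the positions below k that are moved.
fixedCount : ℕ → S∞ → S∞ → ℕ
fixedCount k u w = Σℕ k λ p → same? (u ⟨$⟩ p) (w ⟨$⟩ p)

-- The criterion of Bergeron and Sottile for u ≤ w in the k-Bruhat order.
record Bruhat (k : ℕ) (u w : S∞) : Set where
  field
    rise : ∀ {p} → p < k → u ⟨$⟩ p ≤ w ⟨$⟩ p
    fall : ∀ {q} → k ≤ q → w ⟨$⟩ q ≤ u ⟨$⟩ q
    keep : ∀ {a b} → a < b → b < k ⊎ k ≤ a → u ⟨$⟩ a < u ⟨$⟩ b → w ⟨$⟩ a < w ⟨$⟩ b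

open Bruhat public

Bruhat-refl : ∀ k {u w} → u ≈ w → Bruhat k u w
Bruhat-refl k u≈w = record
  { rise = λ {p} _ → ≤-reflexive (at u≈w p)
  ; fall = λ {q} _ → ≤-reflexive (sym (at u≈w q))
  ; keep = λ {a} {b} _ _ → subst₂ _<_ (at u≈w a) (at u≈w b)
  }

-- Stated for an arbitrary total preorder because `peel` needs a minimum of u(a) and, with the order
-- reversed, a maximum of u(b).
extremum : (_≼_ : ℕ → ℕ → Set) → (∀ i j → i ≼ j ⊎ j ≼ i) → (∀ {i j k} → i ≼ j → j ≼ k → i ≼ k) →
  {Q : ℕ → Set} → (∀ i → Dec (Q i)) → ∀ n →
  (∀ i → i < n → ¬ Q i) ⊎ (∃[ a ] a < n × Q a × (∀ i → i < n → Q i → a ≼ i))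
extremum _≼_ total tr Q? zero = inj₁ λ _ ()
extremum _≼_ total tr Q? (suc n) with extremum _≼_ total tr Q? n | Q? n
... | inj₁ none | no ¬q = inj₁ λ { i (s≤s i≤n) → [ none i , (λ { refl → ¬q }) ]′ (m≤n⇒m<n∨m≡n i≤n) }
... | inj₁ none | yes q = inj₂ (n , n<1+n n , q ,
    λ { i (s≤s i≤n) qi → [ (λ i<n → contradiction qi (none i i<n)) , (λ { refl → [ id , id ]′ (total n n) }) ]′ (m≤n⇒m<n∨m≡n i≤n) })
... | inj₂ (a , a<n , qa , least) | no ¬q = inj₂ (a , m<n⇒m<1+n a<n , qa ,
    λ { i (s≤s i≤n) qi → [ (λ i<n → least i i<n qi) , (λ { refl → contradiction qi ¬q }) ]′ (m≤n⇒m<n∨m≡n i≤n) })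
... | inj₂ (a , a<n , qa , least) | yes q with total a n
...   | inj₁ a≼n = inj₂ (a , m<n⇒m<1+n a<n , qa ,
    λ { i (s≤s i≤n) qi → [ (λ i<n → least i i<n qi) , (λ { refl → a≼n }) ]′ (m≤n⇒m<n∨m≡n i≤n) })
...   | inj₂ n≼a = inj₂ (n , n<1+n n , q ,
    λ { i (s≤s i≤n) qi → [ (λ i<n → tr n≼a (least i i<n qi)) , (λ { refl → [ id , id ]′ (total n n) }) ]′ (m≤n⇒m<n∨m≡n i≤n) })

record Peel (k : ℕ) (u w : S∞) : Set where
  field
    a b     : ℕ
    a<k     : a < k
    k≤b     : k ≤ b
    drop    : w ⟨$⟩ b < w ⟨$⟩ a
    moved   : u ⟨$⟩ a < w ⟨$⟩ a
    covers  : ℓ w ≡ suc (ℓ (w ∙ t a b))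
    bruhat  : Bruhat k u (w ∙ t a b)

-- Choose a with u(a) minimal among the values that move up, then b with u(b)
-- maximal subject to w(b) < w(a) ≤ u(b).
module _ {k : ℕ} {u w : S∞} (B : Bruhat k u w) where
  private
    module WithA (a : ℕ) (a<k : a < k) (moved : u ⟨$⟩ a < w ⟨$⟩ a)
                 (least : ∀ i → i < k → u ⟨$⟩ i < w ⟨$⟩ i → u ⟨$⟩ a ≤ u ⟨$⟩ i) where

      -- Strong induction on v. Before k the position of v in u cannot rise, by the minimality of
      -- u(a). From k on it could only fall to a smaller value, which w already takes elsewhere by
      -- induction.
      low : ∀ v → v < u ⟨$⟩ a → w ⟨$⟩ (u ⁻¹ ⟨$⟩ v) ≡ v
      low = <-rec _ λ v ih v<ua → settle v ih v<ua (<-≤-connex (u ⁻¹ ⟨$⟩ v) k)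
        where
        settle : ∀ v → (∀ {v′} → v′ < v → v′ < u ⟨$⟩ a → w ⟨$⟩ (u ⁻¹ ⟨$⟩ v′) ≡ v′) → v < u ⟨$⟩ a →
          u ⁻¹ ⟨$⟩ v < k ⊎ k ≤ u ⁻¹ ⟨$⟩ v → w ⟨$⟩ (u ⁻¹ ⟨$⟩ v) ≡ v
        settle v ih v<ua (inj₁ q<k) with m≤n⇒m<n∨m≡n (rise B q<k)
        ... | inj₂ eq = trans (sym eq) (uu⁻¹ u v)
        ... | inj₁ lt = contradiction (≤-trans (least _ q<k lt) (≤-reflexive (uu⁻¹ u v))) (<⇒≱ v<ua)
        settle v ih v<ua (inj₂ k≤q) with m≤n⇒m<n∨m≡n (fall B k≤q)
        ... | inj₂ eq = trans eq (uu⁻¹ u v)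
        ... | inj₁ lt = contradiction
            (trans (cong (u ⟨$⟩_) (⟨$⟩-injective w (sym (ih v′<v (<-trans v′<v v<ua))))) (uu⁻¹ u v′))
            (λ eq → <⇒≢ lt (sym eq))
          where
          v′ : ℕ
          v′ = w ⟨$⟩ (u ⁻¹ ⟨$⟩ v)
          v′<v : v′ < v
          v′<v = subst (v′ <_) (uu⁻¹ u v) lt

      low-fixed : ∀ {c} → u ⟨$⟩ c < u ⟨$⟩ a → w ⟨$⟩ c ≡ u ⟨$⟩ c
      low-fixed {c} lt = trans (cong (w ⟨$⟩_) (sym (u⁻¹u u c))) (low (u ⟨$⟩ c) lt)

      Candidate : ℕ → Set
      Candidate q = k ≤ q × w ⟨$⟩ q < w ⟨$⟩ a × w ⟨$⟩ a ≤ u ⟨$⟩ q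

      candidate? : ∀ q → Dec (Candidate q)
      candidate? q = (k ≤? q) ×-dec (w ⟨$⟩ q <? w ⟨$⟩ a) ×-dec (w ⟨$⟩ a ≤? u ⟨$⟩ q)

      M : ℕ
      M = bound u ⊔ bound w

      candidate-< : ∀ {q} → Candidate q → q < M
      candidate-< {q} (_ , l , h) with <-≤-connex q M
      ... | inj₁ q<M = q<M
      ... | inj₂ M≤q = contradiction (<-≤-trans l h) (≤⇒≯ (≤-reflexive (trans
          (fixes u (m⊔n≤o⇒m≤o (bound u) (bound w) M≤q)) (sym (fixes w (m⊔n≤o⇒n≤o (bound u) (bound w) M≤q))))))

      -- Otherwise u w⁻¹ would map {0, …, w(a)} into {0, …, w(a) − 1}.
      candidate-exists : ¬ (∀ q → q < M → ¬ Candidate q)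
      candidate-exists none = 1+n≰n (subst₂ _≤_
        (trans (length-map h (upTo (suc v))) (length-upTo (suc v))) (length-upTo v)
        (length-⊆ (Unique≡ₚ.map⁺ h-injective (Unique≡ₚ.upTo⁺ (suc v))) λ x∈ → member (∈-map⁻ h x∈)))
        where
        v : ℕ
        v = w ⟨$⟩ a
        h : ℕ → ℕ
        h j = u ⟨$⟩ (w ⁻¹ ⟨$⟩ j)
        h-injective : ∀ {i j} → h i ≡ h j → i ≡ j
        h-injective = ⟨$⟩-injective (w ⁻¹) ∘ ⟨$⟩-injective u
        h-< : ∀ q → w ⟨$⟩ q < v → u ⟨$⟩ q < v
        h-< q wq<v with <-≤-connex (u ⟨$⟩ q) v | <-≤-connex q k
        ... | inj₁ lt | _        = lt
        ... | inj₂ ge | inj₁ q<k = contradiction (≤-trans ge (rise B q<k)) (<⇒≱ wq<v)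
        ... | inj₂ ge | inj₂ k≤q = contradiction (k≤q , wq<v , ge) (none q (candidate-< (k≤q , wq<v , ge)))
        member : ∀ {x} → ∃[ j ] j ∈ upTo (suc v) × x ≡ h j → x ∈ upTo v
        member (j , j∈ , refl) with m≤n⇒m<n∨m≡n (≤-pred (∈-upTo⁻ j∈))
        ... | inj₁ j<v  = ∈-upTo⁺ (h-< (w ⁻¹ ⟨$⟩ j) (subst (_< v) (sym (uu⁻¹ w j)) j<v))
        ... | inj₂ refl = ∈-upTo⁺ (subst (_< v) (cong (u ⟨$⟩_) (sym (u⁻¹u w a))) moved)

      module WithB (b : ℕ) (candidate : Candidate b)
                   (greatest : ∀ q → q < M → Candidate q → u ⟨$⟩ q ≤ u ⟨$⟩ b) where
        k≤b : k ≤ b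
        k≤b = proj₁ candidate
        wb<wa : w ⟨$⟩ b < w ⟨$⟩ a
        wb<wa = proj₁ (proj₂ candidate)
        wa≤ub : w ⟨$⟩ a ≤ u ⟨$⟩ b
        wa≤ub = proj₂ (proj₂ candidate)
        a<b : a < b
        a<b = <-≤-trans a<k k≤b

        -- A value w(b) below u(a) would be unmoved by `low`, giving w(b) = u(b) ≥ w(a).
        ua≤wb : u ⟨$⟩ a ≤ w ⟨$⟩ b
        ua≤wb with <-≤-connex (w ⟨$⟩ b) (u ⟨$⟩ a)
        ... | inj₂ le = le
        ... | inj₁ lt = contradiction
            (trans (sym (uu⁻¹ u (w ⟨$⟩ b))) (cong (u ⟨$⟩_) (⟨$⟩-injective w (low (w ⟨$⟩ b) lt))))
            (<⇒≢ (<-≤-trans wb<wa wa≤ub))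

        v : S∞
        v = w ∙ t a b
        va : v ⟨$⟩ a ≡ w ⟨$⟩ b
        va = cong (w ⟨$⟩_) (swap-left a b)
        vb : v ⟨$⟩ b ≡ w ⟨$⟩ a
        vb = cong (w ⟨$⟩_) (swap-right a b)
        v-other : ∀ {r} → r ≢ a → r ≢ b → v ⟨$⟩ r ≡ w ⟨$⟩ r
        v-other p q = cong (w ⟨$⟩_) (swap-other a b p q)

        -- For r < k the criterion keeps w(r) above w(a) if u(r) > u(a), and `low` keeps it below
        -- w(b) otherwise. For r ≥ k the criterion applies if u(r) < u(b), and otherwise r is a
        -- candidate that contradicts the maximality of u(b).
        none-between : ∀ r → ¬ Between v a b r
        none-between r ((a<r , r<b) , (l , h)) = impossible (<-≤-connex r k)
          where
          vr : v ⟨$⟩ r ≡ w ⟨$⟩ r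
          vr = v-other (<⇒≢ a<r ∘ sym) (<⇒≢ r<b)
          wb<wr : w ⟨$⟩ b < w ⟨$⟩ r
          wb<wr = subst₂ _<_ va vr l
          wr<wa : w ⟨$⟩ r < w ⟨$⟩ a
          wr<wa = subst₂ _<_ vr vb h
          impossible : ¬ (r < k ⊎ k ≤ r)
          impossible (inj₁ r<k) with <-cmp (u ⟨$⟩ a) (u ⟨$⟩ r)
          ... | tri< ua<ur _ _ = <-asym wr<wa (keep B a<r (inj₁ r<k) ua<ur)
          ... | tri≈ _ eq _    = <⇒≢ a<r (⟨$⟩-injective u eq)
          ... | tri> _ _ ur<ua = <⇒≱ wb<wr (≤-trans (≤-reflexive (low-fixed ur<ua)) (≤-trans (<⇒≤ ur<ua) ua≤wb))
          impossible (inj₂ k≤r) with <-cmp (u ⟨$⟩ r) (u ⟨$⟩ b)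
          ... | tri< ur<ub _ _ = <-asym wb<wr (keep B r<b (inj₂ k≤r) ur<ub)
          ... | tri≈ _ eq _    = <⇒≢ r<b (⟨$⟩-injective u eq)
          ... | tri> _ _ ub<ur = <⇒≱ ub<ur (greatest r (candidate-< cr) cr)
            where
            cr : Candidate r
            cr = k≤r , wr<wa , ≤-trans wa≤ub (<⇒≤ ub<ur)

        keep-v : ∀ {c d} → c < d → d < k ⊎ k ≤ c → u ⟨$⟩ c < u ⟨$⟩ d →
          c ≡ a ⊎ c ≢ a → c ≡ b ⊎ c ≢ b → d ≡ a ⊎ d ≢ a → d ≡ b ⊎ d ≢ b → v ⟨$⟩ c < v ⟨$⟩ d
        keep-v c<d (inj₂ k≤a) _ (inj₁ refl) _ _ _ = contradiction a<k (≤⇒≯ k≤a)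
        keep-v c<d (inj₁ b<k) _ (inj₁ refl) _ _ (inj₁ refl) = contradiction b<k (≤⇒≯ k≤b)
        keep-v c<d side lt (inj₁ refl) _ _ (inj₂ d≢b) = subst₂ _<_ (sym va) (sym (v-other (<⇒≢ c<d ∘ sym) d≢b))
          (<-trans wb<wa (keep B c<d side lt))
        keep-v c<d side lt (inj₂ c≢a) (inj₁ refl) (inj₁ refl) _ = contradiction c<d (<-asym a<b)
        keep-v {_} {d} c<d side lt (inj₂ c≢a) (inj₁ refl) (inj₂ d≢a) _ =
          subst₂ _<_ (sym vb) (sym (v-other d≢a (<⇒≢ c<d ∘ sym))) (above (<-cmp (w ⟨$⟩ a) (w ⟨$⟩ d)))
          where
          above : _ → w ⟨$⟩ a < w ⟨$⟩ d
          above (tri< wa<wd _ _) = wa<wd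
          above (tri≈ _ eq _)    = contradiction (⟨$⟩-injective w (sym eq)) d≢a
          above (tri> _ _ wd<wa) = contradiction (greatest d (candidate-< cd) cd) (<⇒≱ lt)
            where
            cd : Candidate d
            cd = ≤-trans k≤b (<⇒≤ c<d) , wd<wa , ≤-trans wa≤ub (<⇒≤ lt)
        keep-v c<d side lt (inj₂ c≢a) (inj₂ c≢b) (inj₁ refl) _ = subst₂ _<_ (sym (v-other c≢a c≢b)) (sym va)
          (<-≤-trans (subst (_< u ⟨$⟩ a) (sym (low-fixed lt)) lt) ua≤wb)
        keep-v c<d side lt (inj₂ c≢a) (inj₂ c≢b) (inj₂ _) (inj₁ refl) = subst₂ _<_ (sym (v-other c≢a c≢b)) (sym vb)
          (<-trans (keep B c<d side lt) wb<wa)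
        keep-v c<d side lt (inj₂ c≢a) (inj₂ c≢b) (inj₂ d≢a) (inj₂ d≢b) =
          subst₂ _<_ (sym (v-other c≢a c≢b)) (sym (v-other d≢a d≢b)) (keep B c<d side lt)

        bruhat-v : Bruhat k u v
        bruhat-v = record
          { rise = λ {p} p<k → [ (λ { refl → subst (u ⟨$⟩ a ≤_) (sym va) ua≤wb })
                               , (λ p≢a → subst (u ⟨$⟩ p ≤_) (sym (v-other p≢a (<⇒≢ (<-≤-trans p<k k≤b)))) (rise B p<k)) ]′ (≡⊎≢ p a)
          ; fall = λ {q} k≤q → [ (λ { refl → subst (_≤ u ⟨$⟩ b) (sym vb) wa≤ub })
                               , (λ q≢b → subst (_≤ u ⟨$⟩ q) (sym (v-other (<⇒≢ (<-≤-trans a<k k≤q) ∘ sym) q≢b)) (fall B k≤q)) ]′ (≡⊎≢ q b)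
          ; keep = λ {c} {d} c<d side lt → keep-v c<d side lt (≡⊎≢ c a) (≡⊎≢ c b) (≡⊎≢ d a) (≡⊎≢ d b)
          }

        peeled : Peel k u w
        peeled = record
          { a = a ; b = b ; a<k = a<k ; k≤b = k≤b ; drop = wb<wa ; moved = moved
          ; covers = trans (ℓ-≗ w (v ∙ t a b) λ i → sym (∙t∙t w a b i))
              (⇒cover v a<b (subst₂ _<_ (sym va) (sym vb) wb<wa) none-between)
          ; bruhat = bruhat-v
          }

  peel : ¬ u ≈ w → Peel k u w
  peel u≉w with extremum (λ i j → u ⟨$⟩ i ≤ u ⟨$⟩ j) (λ i j → ≤-total _ _) ≤-trans (λ i → u ⟨$⟩ i <? w ⟨$⟩ i) k
  -- If no position before k rises, then w is pointwise at most u, so u w⁻¹ is inflationary.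
  ... | inj₁ none = contradiction u≈w u≉w
    where
    deflated : ∀ i → w ⟨$⟩ i ≤ u ⟨$⟩ i
    deflated i with <-≤-connex i k
    ... | inj₁ i<k = ≮⇒≥ (none i i<k)
    ... | inj₂ k≤i = fall B k≤i
    u≈w : u ≈ w
    u≈w = pointwise λ i → trans (cong (u ⟨$⟩_) (sym (u⁻¹u w i)))
      (at (inflationary⇒𝟙 (u ∙ w ⁻¹) λ j → subst (_≤ u ⟨$⟩ (w ⁻¹ ⟨$⟩ j)) (uu⁻¹ w j) (deflated (w ⁻¹ ⟨$⟩ j))) (w ⟨$⟩ i))
  ... | inj₂ (a , a<k , moved , least)
    with extremum (λ i j → u ⟨$⟩ j ≤ u ⟨$⟩ i) (λ i j → ≤-total _ _) (λ p q → ≤-trans q p)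
           (WithA.candidate? a a<k moved least) (WithA.M a a<k moved least)
  ...   | inj₁ none = contradiction none (WithA.candidate-exists a a<k moved least)
  ...   | inj₂ (b , _ , candidate , greatest) = WithA.WithB.peeled a a<k moved least b candidate greatest

fixedCount-≈ : ∀ k {u w} → u ≈ w → fixedCount k u w ≡ k
fixedCount-≈ k e = trans (Σℕ-cong k λ p _ → same?-≡ (at e p)) (Σℕ-const k)

module _ {k : ℕ} {u w : S∞} (P : Peel k u w) where
  open Peel P

  peel-other : ∀ p → p < k → p ≢ a → same? (u ⟨$⟩ p) ((w ∙ t a b) ⟨$⟩ p) ≡ same? (u ⟨$⟩ p) (w ⟨$⟩ p)
  peel-other p p<k p≢a = cong (λ m → same? (u ⟨$⟩ p) (w ⟨$⟩ m)) (swap-other a b p≢a (<⇒≢ (<-≤-trans p<k k≤b)))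

  peel-fixed : u ⟨$⟩ a ≡ (w ∙ t a b) ⟨$⟩ a → fixedCount k u (w ∙ t a b) ≡ suc (fixedCount k u w)
  peel-fixed e = Σℕ-suc k a a<k peel-other (trans (same?-≡ e) (cong suc (sym (same?-≢ (<⇒≢ moved)))))

  peel-moved : u ⟨$⟩ a ≢ (w ∙ t a b) ⟨$⟩ a → fixedCount k u (w ∙ t a b) ≡ fixedCount k u w
  peel-moved ne = Σℕ-cong k λ p p<k → [ (λ { refl → trans (same?-≢ ne) (sym (same?-≢ (<⇒≢ moved))) }) , peel-other p p<k ]′ (≡⊎≢ p a)

  fixedCount-peel : fixedCount k u (w ∙ t a b) ≤ suc (fixedCount k u w)
  fixedCount-peel with ≡⊎≢ (u ⟨$⟩ a) ((w ∙ t a b) ⟨$⟩ a)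
  ... | inj₁ e  = ≤-reflexive (peel-fixed e)
  ... | inj₂ ne = ≤-trans (≤-reflexive (peel-moved ne)) (n≤1+n _)

-- Each peeled step lowers ℓ(w) by one and creates at most one new fixed position. Equivalently,
-- ℓ(w) - ℓ(u) is at least the number of moved positions before k.
Bruhat-length : ∀ {k u w} → Bruhat k u w → ℓ u + k ≤ ℓ w + fixedCount k u w
Bruhat-length {k} {u} {w} B = go (ℓ w) w refl B
  where
  open ≤-Reasoning
  go : ∀ n w → ℓ w ≡ n → Bruhat k u w → ℓ u + k ≤ ℓ w + fixedCount k u w
  go n w ℓ≡ B with u ≈? w
  ... | yes e = ≤-reflexive (cong₂ _+_ (ℓ-cong e) (sym (fixedCount-≈ k e)))
  go zero    w ℓ≡ B | no ne = contradiction (trans (sym (Peel.covers (peel B ne))) ℓ≡) λ ()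
  go (suc n) w ℓ≡ B | no ne = begin
    ℓ u + k                           ≤⟨ go n w₁ (suc-injective (trans (sym covers) ℓ≡)) bruhat ⟩
    ℓ w₁ + fixedCount k u w₁          ≤⟨ +-monoʳ-≤ (ℓ w₁) (fixedCount-peel (peel B ne)) ⟩
    ℓ w₁ + suc (fixedCount k u w)     ≡⟨ +-suc (ℓ w₁) _ ⟩
    suc (ℓ w₁) + fixedCount k u w     ≡⟨ cong (_+ fixedCount k u w) (sym covers) ⟩
    ℓ w + fixedCount k u w            ∎
    where
    open Peel (peel B ne)
    w₁ : S∞
    w₁ = w ∙ t a b

-- `tight` is the equality case of `Bruhat-length`: as many steps as moved positions, which encodes
-- that the a_i of a chain are distinct. The record is shown to be equivalent to →k by `⟶⇒Pieri` and
-- `Pieri⇒⟶`.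
record PieriBruhat (k : ℕ) (u w : S∞) : Set where
  constructor _&_
  field
    bruhat : Bruhat k u w
    tight  : ℓ u + k ≡ ℓ w + fixedCount k u w

open PieriBruhat public

Saturated : S∞ → List (ℕ × ℕ) → Set
Saturated u []             = ⊤
Saturated u ((a , b) ∷ ts) = ℓ (u ∙ t a b) ≡ suc (ℓ u) × Saturated (u ∙ t a b) ts

saturated⇒ : ∀ u ts → (∀ i → i ≤ length ts → ℓ (u ∙ts take i ts) ≡ ℓ u + i) → Saturated u ts
saturated⇒ u []             sat = tt
saturated⇒ u ((a , b) ∷ ts) sat = ℓ↑ , saturated⇒ (u ∙ t a b) ts λ i i≤ →
    trans (sat (suc i) (s≤s i≤)) (trans (+-suc (ℓ u) i) (cong (_+ i) (sym ℓ↑)))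
  where
  ℓ↑ : ℓ (u ∙ t a b) ≡ suc (ℓ u)
  ℓ↑ = trans (sat 1 (s≤s z≤n)) (+-comm (ℓ u) 1)

⇒saturated : ∀ u ts → Saturated u ts → ∀ i → i ≤ length ts → ℓ (u ∙ts take i ts) ≡ ℓ u + i
⇒saturated u ts sat zero i≤ = sym (+-identityʳ (ℓ u))
⇒saturated u ((a , b) ∷ ts) (ℓ↑ , sat) (suc i) (s≤s i≤) =
  trans (⇒saturated (u ∙ t a b) ts sat i i≤) (trans (cong (_+ i) ℓ↑) (sym (+-suc (ℓ u) i)))

saturated-length : ∀ u ts → Saturated u ts → ℓ (u ∙ts ts) ≡ ℓ u + length ts
saturated-length u []             _          = sym (+-identityʳ (ℓ u))
saturated-length u ((a , b) ∷ ts) (ℓ↑ , sat) =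
  trans (saturated-length (u ∙ t a b) ts sat) (trans (cong (_+ length ts) ℓ↑) (sym (+-suc (ℓ u) (length ts))))

saturated-∷ʳ : ∀ u ts {a b} → Saturated u ts → ℓ (u ∙ts ts ∙ t a b) ≡ suc (ℓ (u ∙ts ts)) → Saturated u (ts ∷ʳ (a , b))
saturated-∷ʳ u []       _          ℓ↑′ = ℓ↑′ , tt
saturated-∷ʳ u (_ ∷ ts) (ℓ↑ , sat) ℓ↑′ = ℓ↑ , saturated-∷ʳ _ ts sat ℓ↑′

Straddle : ℕ → List (ℕ × ℕ) → Set
Straddle k = All λ (a , b) → a < k × k ≤ b

module _ {k : ℕ} (u : S∞) {a b : ℕ} (a<k : a < k) (k≤b : k ≤ b) (ℓ↑ : ℓ (u ∙ t a b) ≡ suc (ℓ u)) where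
  private
    a<b : a < b
    a<b = <-≤-trans a<k k≤b
    v : S∞
    v = u ∙ t a b
    ua<ub : u ⟨$⟩ a < u ⟨$⟩ b
    ua<ub = proj₁ (cover⇒ u a<b ℓ↑)
    none : ∀ r → ¬ Between u a b r
    none = proj₂ (cover⇒ u a<b ℓ↑)
    va : v ⟨$⟩ a ≡ u ⟨$⟩ b
    va = cong (u ⟨$⟩_) (swap-left a b)
    vb : v ⟨$⟩ b ≡ u ⟨$⟩ a
    vb = cong (u ⟨$⟩_) (swap-right a b)
    v-other : ∀ {r} → r ≢ a → r ≢ b → v ⟨$⟩ r ≡ u ⟨$⟩ r
    v-other p q = cong (u ⟨$⟩_) (swap-other a b p q)

  cover-rise : ∀ {p} → p < k → u ⟨$⟩ p ≤ v ⟨$⟩ p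
  cover-rise {p} p<k with ≡⊎≢ p a
  ... | inj₁ refl = ≤-trans (<⇒≤ ua<ub) (≤-reflexive (sym va))
  ... | inj₂ p≢a  = ≤-reflexive (sym (v-other p≢a (<⇒≢ (<-≤-trans p<k k≤b))))

  cover-fall : ∀ {q} → k ≤ q → v ⟨$⟩ q ≤ u ⟨$⟩ q
  cover-fall {q} k≤q with ≡⊎≢ q b
  ... | inj₁ refl = ≤-trans (≤-reflexive vb) (<⇒≤ ua<ub)
  ... | inj₂ q≢b  = ≤-reflexive (v-other (<⇒≢ (<-≤-trans a<k k≤q) ∘ sym) q≢b)

  -- Only comparisons of a with later positions before k, and of b with earlier positions from k on,
  -- could be reversed; the third value would then lie between u(a) and u(b) at a position between a
  -- and b.
  cover-keep : ∀ {c d} → c < d → d < k ⊎ k ≤ c → u ⟨$⟩ c < u ⟨$⟩ d → v ⟨$⟩ c < v ⟨$⟩ d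
  cover-keep {c} {d} c<d side lt = cases side (≡⊎≢ c a) (≡⊎≢ c b) (≡⊎≢ d a) (≡⊎≢ d b)
    where
    cases : d < k ⊎ k ≤ c → c ≡ a ⊎ c ≢ a → c ≡ b ⊎ c ≢ b → d ≡ a ⊎ d ≢ a → d ≡ b ⊎ d ≢ b → v ⟨$⟩ c < v ⟨$⟩ d
    cases (inj₂ k≤a) (inj₁ refl) _ _ _ = contradiction a<k (≤⇒≯ k≤a)
    cases (inj₁ b<k) (inj₁ refl) _ _ (inj₁ refl) = contradiction b<k (≤⇒≯ k≤b)
    cases (inj₁ d<k) (inj₁ refl) _ _ (inj₂ d≢b) =
      subst₂ _<_ (sym va) (sym (v-other (<⇒≢ c<d ∘ sym) d≢b)) (beyond (<-cmp (u ⟨$⟩ b) (u ⟨$⟩ d)))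
      where
      beyond : _ → u ⟨$⟩ b < u ⟨$⟩ d
      beyond (tri< ub<ud _ _) = ub<ud
      beyond (tri≈ _ eq _)    = contradiction (⟨$⟩-injective u (sym eq)) d≢b
      beyond (tri> _ _ ud<ub) = contradiction ((c<d , <-≤-trans d<k k≤b) , lt , ud<ub) (none d)
    cases _ (inj₂ _) (inj₁ refl) (inj₁ refl) _ = contradiction c<d (<-asym a<b)
    cases _ (inj₂ _) (inj₁ refl) (inj₂ d≢a) _ = subst₂ _<_ (sym vb) (sym (v-other d≢a (<⇒≢ c<d ∘ sym))) (<-trans ua<ub lt)
    cases _ (inj₂ c≢a) (inj₂ c≢b) (inj₁ refl) _ = subst₂ _<_ (sym (v-other c≢a c≢b)) (sym va) (<-trans lt ua<ub)
    cases (inj₁ b<k) (inj₂ _) (inj₂ _) (inj₂ _) (inj₁ refl) = contradiction b<k (≤⇒≯ k≤b)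
    cases (inj₂ k≤c) (inj₂ c≢a) (inj₂ c≢b) (inj₂ _) (inj₁ refl) =
      subst₂ _<_ (sym (v-other c≢a c≢b)) (sym vb) (beyond (<-cmp (u ⟨$⟩ c) (u ⟨$⟩ a)))
      where
      beyond : _ → u ⟨$⟩ c < u ⟨$⟩ a
      beyond (tri< uc<ua _ _) = uc<ua
      beyond (tri≈ _ eq _)    = contradiction (⟨$⟩-injective u eq) c≢a
      beyond (tri> _ _ ua<uc) = contradiction ((<-≤-trans a<k k≤c , c<d) , ua<uc , lt) (none c)
    cases _ (inj₂ c≢a) (inj₂ c≢b) (inj₂ d≢a) (inj₂ d≢b) =
      subst₂ _<_ (sym (v-other c≢a c≢b)) (sym (v-other d≢a d≢b)) lt

  cover-Bruhat : ∀ {w} → Bruhat k v w → Bruhat k u w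
  cover-Bruhat B = record
    { rise = λ p<k → ≤-trans (cover-rise p<k) (rise B p<k)
    ; fall = λ k≤q → ≤-trans (fall B k≤q) (cover-fall k≤q)
    ; keep = λ c<d side lt → keep B c<d side (cover-keep c<d side lt)
    }

  cover-moves : ∀ {w} → Bruhat k v w → u ⟨$⟩ a < w ⟨$⟩ a
  cover-moves {w} B = <-≤-trans ua<ub (subst (_≤ w ⟨$⟩ a) va (rise B a<k))

chain-Bruhat : ∀ {k} u ts → Straddle k ts → Saturated u ts → Bruhat k u (u ∙ts ts)
chain-Bruhat {k} u [] _ _ = Bruhat-refl k ≈-refl
chain-Bruhat u ((a , b) ∷ ts) ((a<k , k≤b) ∷ st) (ℓ↑ , sat) =
  cover-Bruhat u a<k k≤b ℓ↑ (chain-Bruhat (u ∙ t a b) ts st sat)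

chain-moves : ∀ {k} u ts → Straddle k ts → Saturated u ts → All (λ (a , _) → u ⟨$⟩ a < (u ∙ts ts) ⟨$⟩ a) ts
chain-moves u [] _ _ = []
chain-moves u ((a , b) ∷ ts) ((a<k , k≤b) ∷ st) (ℓ↑ , sat) =
  cover-moves u a<k k≤b ℓ↑ (chain-Bruhat (u ∙ t a b) ts st sat) ∷
  All.zipWith (λ ((a′<k , _) , lt) → ≤-<-trans (cover-rise u a<k k≤b ℓ↑ a′<k) lt)
    (st , chain-moves (u ∙ t a b) ts st sat)

-- A chain of p steps moves p distinct positions before k, so at most k - p are fixed; this is the
-- inequality opposite to `Bruhat-length`.
⟶⇒Pieri : ∀ {k u w} → u ⟶[ k ] w → PieriBruhat k u w
⟶⇒Pieri {k} {u} {w} (ts , c , w≈) = B & ≤-antisym (Bruhat-length B) (begin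
  ℓ w + fixedCount k u w                     ≡⟨ cong₂ _+_ (trans (ℓ-cong w≈) (saturated-length u ts sat)) refl ⟩
  (ℓ u + length ts) + fixedCount k u w       ≡⟨ +-assoc (ℓ u) (length ts) _ ⟩
  ℓ u + (length ts + fixedCount k u w)       ≡⟨ cong (ℓ u +_) (trans (+-comm (length ts) _) (cong (fixedCount k u w +_) (sym (length-map proj₁ ts)))) ⟩
  ℓ u + (fixedCount k u w + length (map proj₁ ts))
    ≤⟨ +-monoʳ-≤ (ℓ u) (Σℕ-zeros k _ (map proj₁ ts) (distinct c) (Allₚ.map⁺ (All.map proj₁ (straddle c)))
         (λ i∈ → moved (∈-map⁻ proj₁ i∈)) (λ p → same?-≤1 (u ⟨$⟩ p) (w ⟨$⟩ p))) ⟩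
  ℓ u + k                                    ∎)
  where
  open ≤-Reasoning
  sat : Saturated u ts
  sat = saturated⇒ u ts (saturated c)
  B : Bruhat k u w
  B = Bruhat-respʳ (≈-sym w≈) (chain-Bruhat u ts (straddle c) sat)
    where
    Bruhat-respʳ : ∀ {v w} → v ≈ w → Bruhat k u v → Bruhat k u w
    Bruhat-respʳ e B = record
      { rise = λ {p} p<k → subst (u ⟨$⟩ p ≤_) (at e p) (rise B p<k)
      ; fall = λ {q} k≤q → subst (_≤ u ⟨$⟩ q) (at e q) (fall B k≤q)
      ; keep = λ {a} {b} a<b side lt → subst₂ _<_ (at e a) (at e b) (keep B a<b side lt)
      }
  moved : ∀ {a} → ∃[ ab ] ab ∈ ts × a ≡ proj₁ ab → same? (u ⟨$⟩ a) (w ⟨$⟩ a) ≡ 0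
  moved ((a , _) , ab∈ , refl) = same?-≢ (<⇒≢ (subst (u ⟨$⟩ a <_) (sym (at w≈ a))
    (All.lookup (chain-moves u ts (straddle c) sat) ab∈)))

-- The last step found by peel moves a position that was not moved before, because
-- the number of moved positions equals the length of the chain.
Pieri⇒⟶ : ∀ {k u w} → PieriBruhat k u w → u ⟶[ k ] w
Pieri⇒⟶ {k} {u} {w} C = go (ℓ w) w refl C
  where
  go : ∀ n w → ℓ w ≡ n → PieriBruhat k u w → u ⟶[ k ] w
  go n w ℓ≡ C with u ≈? w
  ... | yes e = [] , record
      { short = z≤n ; straddle = [] ; distinct = [] ; saturated = λ { zero _ → sym (+-identityʳ (ℓ u)) } } , ≈-sym e
  go zero    w ℓ≡ C | no ne = contradiction (trans (sym (Peel.covers (peel (bruhat C) ne))) ℓ≡) λ ()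
  go (suc n) w ℓ≡ C | no ne = ts′ , record
      { short     = subst₂ _≤_ (length-map proj₁ ts′) (length-upTo k)
                      (length-⊆ distinct′ λ a∈ → below (∈-map⁻ proj₁ a∈))
      ; straddle  = straddle′
      ; distinct  = distinct′
      ; saturated = ⇒saturated u ts′ saturated′
      } , w≈
    where
    open Peel (peel (bruhat C) ne) renaming (bruhat to B₁)
    w₁ : S∞
    w₁ = w ∙ t a b
    grows : suc (fixedCount k u w) ≤ fixedCount k u w₁
    grows = +-cancelˡ-≤ (ℓ w₁) _ _ (≤-trans (≤-reflexive (trans (+-suc (ℓ w₁) _)
      (trans (cong (_+ fixedCount k u w) (sym covers)) (sym (tight C))))) (Bruhat-length B₁))
    ua≡ : u ⟨$⟩ a ≡ w₁ ⟨$⟩ a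
    ua≡ = [ id , (λ ne′ → contradiction (≤-reflexive (peel-moved (peel (bruhat C) ne) ne′)) (<⇒≱ grows)) ]′ (≡⊎≢ (u ⟨$⟩ a) (w₁ ⟨$⟩ a))
    C₁ : PieriBruhat k u w₁
    C₁ = B₁ & trans (tight C) (trans (cong (_+ fixedCount k u w) covers)
      (trans (sym (+-suc (ℓ w₁) _)) (cong (ℓ w₁ +_) (sym (peel-fixed (peel (bruhat C) ne) ua≡)))))
    R₁ : u ⟶[ k ] w₁
    R₁ = go n w₁ (suc-injective (trans (sym covers) ℓ≡)) C₁
    ts ts′ : List (ℕ × ℕ)
    ts = proj₁ R₁
    ts′ = ts ∷ʳ (a , b)
    c : IsChain k u ts
    c = proj₁ (proj₂ R₁)
    w₁≈ : w₁ ≈ u ∙ts ts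
    w₁≈ = proj₂ (proj₂ R₁)
    sat : Saturated u ts
    sat = saturated⇒ u ts (saturated c)
    ts′≈ : u ∙ts ts ∙ t a b ≈ w
    ts′≈ = ≈-trans (∙-congʳ (t a b) (≈-sym w₁≈)) (pointwise (∙t∙t w a b))
    w≈ : w ≈ u ∙ts ts′
    w≈ = subst (w ≈_) (sym (foldl-∷ʳ _∙t_ u (a , b) ts)) (≈-sym ts′≈)
    straddle′ : Straddle k ts′
    straddle′ = Allₚ.∷ʳ⁺ (straddle c) (a<k , k≤b)
    saturated′ : Saturated u ts′
    saturated′ = saturated-∷ʳ u ts sat (trans (ℓ-cong ts′≈) (trans covers (cong suc (ℓ-cong w₁≈))))
    fresh : ∀ {a′} → ∃[ ab ] ab ∈ ts × a′ ≡ proj₁ ab → a′ ≢ a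
    fresh (_ , ab∈ , refl) refl = <⇒≢ (All.lookup (chain-moves u ts (straddle c) sat) ab∈) (trans ua≡ (at w₁≈ a))
    distinct′ : Unique≡ (map proj₁ ts′)
    distinct′ = subst Unique≡ (sym (map-++ proj₁ ts ((a , b) ∷ [])))
      (Unique≡ₚ.++⁺ (distinct c) ([] ∷ []) λ { (a′∈ , here refl) → fresh (∈-map⁻ proj₁ a′∈) refl })
    below : ∀ {a′} → ∃[ ab ] ab ∈ ts′ × a′ ≡ proj₁ ab → a′ ∈ upTo k
    below (_ , ab∈ , refl) = ∈-upTo⁺ (proj₁ (All.lookup straddle′ ab∈))

-- Left multiplication by s_i in the k-Bruhat order

s-≤-s : ∀ i {a b} → a ≤ b → ¬ (a ≡ i × b ≡ suc i) → s i ⟨$⟩ a ≤ s i ⟨$⟩ b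
s-≤-s i a≤b ≢ with m≤n⇒m<n∨m≡n a≤b
... | inj₁ a<b  = <⇒≤ (s-monotone i a<b ≢)
... | inj₂ refl = ≤-refl

≤-s : ∀ i {a b} → a ≤ b → ¬ (a ≡ suc i × b ≡ suc i) → a ≤ s i ⟨$⟩ b
≤-s i {a} {b} a≤b ≢ with ≡⊎≢ b i | ≡⊎≢ b (suc i)
... | inj₁ refl | _         = subst (a ≤_) (sym (s-left b)) (m≤n⇒m≤1+n a≤b)
... | inj₂ _    | inj₁ refl = subst (a ≤_) (sym (s-right i)) (≤-pred (≤∧≢⇒< a≤b λ e → ≢ (e , refl)))
... | inj₂ p    | inj₂ q    = subst (a ≤_) (sym (s-other i p q)) a≤b

s-≤ : ∀ i {a b} → a ≤ b → ¬ (a ≡ i × b ≡ i) → s i ⟨$⟩ a ≤ b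
s-≤ i {a} {b} a≤b ≢ with ≡⊎≢ a i | ≡⊎≢ a (suc i)
... | inj₁ refl | _         = subst (_≤ b) (sym (s-left a)) (≤∧≢⇒< a≤b λ e → ≢ (refl , sym e))
... | inj₂ _    | inj₁ refl = subst (_≤ b) (sym (s-right i)) (≤-trans (n≤1+n i) a≤b)
... | inj₂ p    | inj₂ q    = subst (_≤ b) (sym (s-other i p q)) a≤b

s-≡ˡ : ∀ i {m} → s i ⟨$⟩ m ≡ i → m ≡ suc i
s-≡ˡ i {m} e = trans (sym (s-involutive i m)) (trans (cong (s i ⟨$⟩_) e) (s-left i))

s-≡ʳ : ∀ i {m} → s i ⟨$⟩ m ≡ suc i → m ≡ i
s-≡ʳ i {m} e = trans (sym (s-involutive i m)) (trans (cong (s i ⟨$⟩_) e) (s-right i))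

position : ∀ u {p v} → u ⟨$⟩ p ≡ v → p ≡ u ⁻¹ ⟨$⟩ v
position u e = sym (≡⁻¹ u e)

module Exchange (k i : ℕ) (u w : S∞) (w↑ : Ascent (w ⁻¹) i) where

  u′ w′ : S∞
  u′ = s i ∙ u
  w′ = s i ∙ w

  -- The positions of i and i + 1 in w (α and β) and in u (γ and δ). Left multiplication by s_i
  -- exchanges the values at these positions only, so all case distinctions are coincidences among
  -- them; `w↑` says α < β.
  α β γ δ : ℕ
  α = w ⁻¹ ⟨$⟩ i
  β = w ⁻¹ ⟨$⟩ suc i
  γ = u ⁻¹ ⟨$⟩ i
  δ = u ⁻¹ ⟨$⟩ suc i

  wα : w ⟨$⟩ α ≡ i
  wα = uu⁻¹ w i
  wβ : w ⟨$⟩ β ≡ suc i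
  wβ = uu⁻¹ w (suc i)
  uγ : u ⟨$⟩ γ ≡ i
  uγ = uu⁻¹ u i
  uδ : u ⟨$⟩ δ ≡ suc i
  uδ = uu⁻¹ u (suc i)
  w′α : w′ ⟨$⟩ α ≡ suc i
  w′α = trans (cong (s i ⟨$⟩_) wα) (s-left i)
  w′β : w′ ⟨$⟩ β ≡ i
  w′β = trans (cong (s i ⟨$⟩_) wβ) (s-right i)
  γ≢δ : γ ≢ δ
  γ≢δ e = <⇒≢ (n<1+n i) (⟨$⟩-injective (u ⁻¹) e)
  α≢β : α ≢ β
  α≢β = <⇒≢ w↑
  i≢1+i : i ≢ suc i
  i≢1+i = <⇒≢ (n<1+n i)

  w-other : ∀ {p} → p ≢ α → p ≢ β → w′ ⟨$⟩ p ≡ w ⟨$⟩ p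
  w-other p≢α p≢β = s-other i (λ e → p≢α (position w e)) (λ e → p≢β (position w e))

  u-other : ∀ {p} → p ≢ γ → p ≢ δ → u′ ⟨$⟩ p ≡ u ⟨$⟩ p
  u-other p≢γ p≢δ = s-other i (λ e → p≢γ (position u e)) (λ e → p≢δ (position u e))

  ℓw′ : ℓ w′ ≡ suc (ℓ w)
  ℓw′ = ℓ-left-ascent w i w↑

  w-monotone : ∀ {c d} → c < d → w′ ⟨$⟩ c < w′ ⟨$⟩ d → w ⟨$⟩ c < w ⟨$⟩ d
  w-monotone {c} {d} c<d lt = subst₂ _<_ (s-involutive i (w ⟨$⟩ c)) (s-involutive i (w ⟨$⟩ d))
    (s-monotone i lt λ (e , f) → <-asym w↑ (subst₂ _<_ (position w (s-≡ˡ i e)) (position w (s-≡ʳ i f)) c<d))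

  -- Passing to w lowers i + 1 to i at α and raises i to i + 1 at β. The two hypotheses exclude
  -- exactly u(α) = i + 1 before k and u(β) = i from k on, where `rise` or `fall` would break.
  lower : Bruhat k u w′ → (α < k → δ ≢ α) → (k ≤ β → γ ≢ β) → Bruhat k u w
  lower B δ≢α γ≢β = record
    { rise = λ {p} p<k → subst (u ⟨$⟩ p ≤_) (s-involutive i (w ⟨$⟩ p)) (≤-s i (rise B p<k)
        λ (e , f) → let p≡α = position w (s-≡ʳ i f) in
          δ≢α (subst (_< k) p≡α p<k) (trans (sym (position u e)) p≡α))
    ; fall = λ {q} k≤q → subst (_≤ u ⟨$⟩ q) (s-involutive i (w ⟨$⟩ q)) (s-≤ i (fall B k≤q)
        λ (e , f) → let q≡β = position w (s-≡ˡ i e) in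
          γ≢β (subst (k ≤_) q≡β k≤q) (trans (sym (position u f)) q≡β))
    ; keep = λ c<d side lt → w-monotone c<d (keep B c<d side lt)
    }

  agree : ∀ p → p ≢ α → (p ≡ β → u ⟨$⟩ p ≢ suc i × u ⟨$⟩ p ≢ i) →
    (u ⟨$⟩ p ≡ w ⟨$⟩ p → u ⟨$⟩ p ≡ w′ ⟨$⟩ p) × (u ⟨$⟩ p ≡ w′ ⟨$⟩ p → u ⟨$⟩ p ≡ w ⟨$⟩ p)
  agree p p≢α atβ with ≡⊎≢ p β
  ... | inj₁ refl = (λ e → contradiction (trans e wβ) (proj₁ (atβ refl))) ,
                    (λ e → contradiction (trans e w′β) (proj₂ (atβ refl)))
  ... | inj₂ p≢β  = (λ e → trans e (sym (w-other p≢α p≢β))) , (λ e → trans e (w-other p≢α p≢β))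

  module _ (γ≡α : γ ≡ α) where
    uα : u ⟨$⟩ α ≡ i
    uα = trans (cong (u ⟨$⟩_) (sym γ≡α)) uγ

    agree-off-α : ¬ (δ ≡ β × β < k) → ∀ p → p < k → p ≢ α →
      (u ⟨$⟩ p ≡ w ⟨$⟩ p → u ⟨$⟩ p ≡ w′ ⟨$⟩ p) × (u ⟨$⟩ p ≡ w′ ⟨$⟩ p → u ⟨$⟩ p ≡ w ⟨$⟩ p)
    agree-off-α not p p<k p≢α = agree p p≢α λ { refl →
      (λ e → not (sym (position u e) , p<k)) , (λ e → α≢β (trans (sym γ≡α) (sym (position u e)))) }

    count : α < k → ¬ (δ ≡ β × β < k) → fixedCount k u w ≡ suc (fixedCount k u w′)
    count α<k not = Σℕ-suc k α α<k
      (λ p p<k p≢α → let f , g = agree-off-α not p p<k p≢α in same?-cong f g)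
      (trans (same?-≡ (trans uα (sym wα)))
        (cong suc (sym (same?-≢ λ e → i≢1+i (trans (sym uα) (trans e w′α))))))

    -- Position α is fixed in (u, w) and moved in (u, w′), so one fixed position is traded for one
    -- unit of length. The excluded case would give w′(β) = i < i + 1 = u(β).
    raise : PieriBruhat k u w → α < k → ¬ (δ ≡ β × β < k) → PieriBruhat k u w′
    raise (B & tight) α<k not = B′ &
      trans tight (trans (cong (ℓ w +_) (count α<k not)) (trans (+-suc (ℓ w) _) (cong (_+ fixedCount k u w′) (sym ℓw′))))
      where
      B′ : Bruhat k u w′
      B′ = record
        { rise = λ {p} p<k → ≤-s i (rise B p<k) λ (e , f) →
            not (trans (sym (position u e)) (position w f) , subst (_< k) (position w f) p<k)
        ; fall = λ {q} k≤q → s-≤ i (fall B k≤q) λ (e , _) → <⇒≱ α<k (subst (k ≤_) (position w e) k≤q)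
        ; keep = λ {c} {d} c<d side lt → s-monotone i (keep B c<d side lt) λ (e , f) →
            crossed (subst₂ _<_ (cong (u ⟨$⟩_) (position w e)) (cong (u ⟨$⟩_) (position w f)) lt)
              ([ subst (_< k) (position w f) , (λ k≤c → contradiction (subst (k ≤_) (position w e) k≤c) (<⇒≱ α<k)) ]′ side)
        }
        where
        crossed : u ⟨$⟩ α < u ⟨$⟩ β → ¬ (β < k)
        crossed lt β<k = not (sym (position u (≤-antisym (subst (u ⟨$⟩ β ≤_) wβ (rise B β<k))
          (subst (_< u ⟨$⟩ β) uα lt))) , β<k)

    unraise : PieriBruhat k u w′ → α < k → PieriBruhat k u w
    unraise (B & tight) α<k = lower B (λ _ e → γ≢δ (trans γ≡α (sym e))) (λ _ e → α≢β (trans (sym γ≡α) e)) &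
      trans tight (trans (cong (_+ fixedCount k u w′) ℓw′) (trans (sym (+-suc (ℓ w) _)) (cong (ℓ w +_) (sym (count α<k not)))))
      where
      not : ¬ (δ ≡ β × β < k)
      not (e , β<k) = 1+n≰n (subst₂ _≤_ (trans (cong (u ⟨$⟩_) (sym e)) uδ) w′β (rise B β<k))

  not-both : Bruhat k u w′ → ¬ (δ ≡ β × β < k)
  not-both B (e , β<k) = 1+n≰n (subst₂ _≤_ (trans (cong (u ⟨$⟩_) (sym e)) uδ) w′β (rise B β<k))

  -- Otherwise u ≤ w in the k-Bruhat order would contradict Bruhat-length.
  forced : PieriBruhat k u w′ → (α < k → δ ≢ α) → (k ≤ β → γ ≢ β) → γ ≡ α × α < k
  forced (B & tight) δ≢α γ≢β with (γ ≟ α) ×-dec (α <? k)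
  ... | yes p = p
  ... | no ¬p = contradiction (Σℕ-mono k λ p p<k → same?-mono (still p p<k)) (<⇒≱ grows)
    where
    grows : fixedCount k u w′ < fixedCount k u w
    grows = +-cancelˡ-≤ (ℓ w) _ _ (≤-trans (≤-reflexive (trans (+-suc (ℓ w) _)
      (trans (cong (_+ fixedCount k u w′) (sym ℓw′)) (sym tight)))) (Bruhat-length (lower B δ≢α γ≢β)))
    still : ∀ p → p < k → u ⟨$⟩ p ≡ w ⟨$⟩ p → u ⟨$⟩ p ≡ w′ ⟨$⟩ p
    still p p<k e with ≡⊎≢ p α | ≡⊎≢ p β
    ... | inj₁ refl | _         = contradiction (sym (position u (trans e wα)) , p<k) ¬p
    ... | inj₂ _    | inj₁ refl = contradiction (sym (position u (trans e wβ)) , p<k) (not-both B)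
    ... | inj₂ p≢α  | inj₂ p≢β  = trans e (sym (w-other p≢α p≢β))

module ExchangeBoth (k i : ℕ) (u w : S∞) (u↑ : Ascent (u ⁻¹) i) (w↑ : Ascent (w ⁻¹) i) where

  open Exchange k i u w w↑ public
  private
    module E′ = Exchange k i (s i ∙ u) w w↑

    γ′ : E′.γ ≡ δ
    γ′ = cong (u ⁻¹ ⟨$⟩_) (s-left i)
    δ′ : E′.δ ≡ γ
    δ′ = cong (u ⁻¹ ⟨$⟩_) (s-right i)

  ℓu′ : ℓ u′ ≡ suc (ℓ u)
  ℓu′ = ℓ-left-ascent u i u↑
  u′γ : u′ ⟨$⟩ γ ≡ suc i
  u′γ = trans (cong (s i ⟨$⟩_) uγ) (s-left i)
  u′δ : u′ ⟨$⟩ δ ≡ i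
  u′δ = trans (cong (s i ⟨$⟩_) uδ) (s-right i)

  u-monotone : ∀ {c d} → c < d → u′ ⟨$⟩ c < u′ ⟨$⟩ d → u ⟨$⟩ c < u ⟨$⟩ d
  u-monotone {c} {d} c<d lt = subst₂ _<_ (s-involutive i (u ⟨$⟩ c)) (s-involutive i (u ⟨$⟩ d))
    (s-monotone i lt λ (e , f) → <-asym u↑ (subst₂ _<_ (position u (s-≡ˡ i e)) (position u (s-≡ʳ i f)) c<d))

  -- By `forced`, once both of its exceptional cases are refuted: either would give γ = β and δ = α,
  -- against γ < δ and α < β.
  raised⇒ : PieriBruhat k u w′ → γ ≡ α × α < k
  raised⇒ (B & tight) = forced (B & tight) δ≢α γ≢β
    where
    δ≢α : α < k → δ ≢ α
    δ≢α α<k δ≡α = <-asym w↑ (subst₂ _<_ γ≡β δ≡α u↑)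
      where
      δ<k : δ < k
      δ<k = subst (_< k) (sym δ≡α) α<k
      γ≡β : γ ≡ β
      γ≡β = position w (s-≡ˡ i (≤-antisym
        (≤-pred (subst (w′ ⟨$⟩ γ <_) (trans (cong (w′ ⟨$⟩_) δ≡α) w′α)
          (keep B u↑ (inj₁ δ<k) (subst₂ _<_ (sym uγ) (sym uδ) (n<1+n i)))))
        (subst (_≤ w′ ⟨$⟩ γ) uγ (rise B (<-trans u↑ δ<k)))))
    γ≢β : k ≤ β → γ ≢ β
    γ≢β k≤β γ≡β = <-asym w↑ (subst₂ _<_ γ≡β δ≡α u↑)
      where
      k≤γ : k ≤ γ
      k≤γ = subst (k ≤_) (sym γ≡β) k≤β
      δ≡α : δ ≡ α
      δ≡α = position w (s-≡ʳ i (≤-antisym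
        (subst (w′ ⟨$⟩ δ ≤_) uδ (fall B (≤-trans k≤γ (<⇒≤ u↑))))
        (subst (_< w′ ⟨$⟩ δ) (trans (cong (w′ ⟨$⟩_) γ≡β) w′β)
          (keep B u↑ (inj₂ k≤γ) (subst₂ _<_ (sym uγ) (sym uδ) (n<1+n i))))))

  δβ⇒γα : PieriBruhat k u w → δ ≡ β → β < k → γ ≡ α
  δβ⇒γα (B & _) δ≡β β<k = position w (≤-antisym
      (≤-pred (subst (w ⟨$⟩ γ <_) (trans (cong (w ⟨$⟩_) δ≡β) wβ)
        (keep B u↑ (inj₁ δ<k) (subst₂ _<_ (sym uγ) (sym uδ) (n<1+n i)))))
      (subst (_≤ w ⟨$⟩ γ) uγ (rise B (<-trans u↑ δ<k))))
    where
    δ<k : δ < k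
    δ<k = subst (_< k) (sym δ≡β) β<k

  unraise-u′ : PieriBruhat k u′ w′ → δ ≡ α → α < k → PieriBruhat k u′ w
  unraise-u′ C δ≡α α<k = E′.unraise (trans γ′ δ≡α) C α<k

  module _ (γ≡β : γ ≡ β) where
    private
      δ≢α : δ ≢ α
      δ≢α δ≡α = <-asym w↑ (subst₂ _<_ γ≡β δ≡α u↑)
      δ≢β : δ ≢ β
      δ≢β e = γ≢δ (trans γ≡β (sym e))

    agree-off-γ : ∀ p → p ≢ γ →
      (u′ ⟨$⟩ p ≡ w ⟨$⟩ p → u ⟨$⟩ p ≡ w ⟨$⟩ p) × (u ⟨$⟩ p ≡ w ⟨$⟩ p → u′ ⟨$⟩ p ≡ w ⟨$⟩ p)
    agree-off-γ p p≢γ with ≡⊎≢ p δ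
    ... | inj₁ refl = (λ e → contradiction (position w (trans (sym e) u′δ)) δ≢α) ,
                      (λ e → contradiction (position w (trans (sym e) uδ)) δ≢β)
    ... | inj₂ p≢δ  = trans (sym (u-other p≢γ p≢δ)) , trans (u-other p≢γ p≢δ)

    wγ : w ⟨$⟩ γ ≡ suc i
    wγ = trans (cong (w ⟨$⟩_) γ≡β) wβ

    -- Position γ holds i + 1 in both u′ and w, but i in u. This extra fixed position balances ℓ(u′)
    -- = ℓ(u) + 1, so that `tight` passes between (u, w) and (u′, w).
    count-u : β < k → fixedCount k u′ w ≡ suc (fixedCount k u w)
    count-u β<k = Σℕ-suc k γ (subst (_< k) (sym γ≡β) β<k)
      (λ p _ p≢γ → let f , g = agree-off-γ p p≢γ in same?-cong f g)
      (trans (same?-≡ (trans u′γ (sym wγ))) (cong suc (sym (same?-≢ λ e → i≢1+i (trans (sym uγ) (trans e wγ))))))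

    lower-u : PieriBruhat k u′ w → β < k → PieriBruhat k u w
    lower-u (B & tight) β<k = B₀ & suc-injective (begin
      suc (ℓ u + k)                     ≡⟨ cong (_+ k) (sym ℓu′) ⟩
      ℓ u′ + k                          ≡⟨ tight ⟩
      ℓ w + fixedCount k u′ w           ≡⟨ cong (ℓ w +_) (count-u β<k) ⟩
      ℓ w + suc (fixedCount k u w)      ≡⟨ +-suc (ℓ w) _ ⟩
      suc (ℓ w + fixedCount k u w)      ∎)
      where
      open ≡-Reasoning
      γ<k : γ < k
      γ<k = subst (_< k) (sym γ≡β) β<k
      outer : ∀ {c d} → c < d → d < k ⊎ k ≤ c → u ⟨$⟩ c < u ⟨$⟩ d → Dec (u ⟨$⟩ c ≡ i × u ⟨$⟩ d ≡ suc i) → w ⟨$⟩ c < w ⟨$⟩ d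
      outer {c} {d} c<d side lt (no ≢) = keep B c<d side (s-monotone i lt ≢)
      outer {c} {d} c<d side lt (yes (e , f)) = subst₂ (λ c d → w ⟨$⟩ c < w ⟨$⟩ d) (sym (position u e)) (sym (position u f))
        (subst (_< w ⟨$⟩ δ) (sym wγ) (≤∧≢⇒< (≤∧≢⇒< i≤wδ λ e → δ≢α (position w (sym e))) λ e → δ≢β (position w (sym e))))
        where
        i≤wδ : i ≤ w ⟨$⟩ δ
        i≤wδ = subst (_≤ w ⟨$⟩ δ) u′δ (rise B ([ subst (_< k) (position u f)
          , (λ k≤c → contradiction (subst (k ≤_) (position u e) k≤c) (<⇒≱ γ<k)) ]′ side))
      B₀ : Bruhat k u w
      B₀ = record
        { rise = λ {p} p<k → subst (_≤ w ⟨$⟩ p) (s-involutive i (u ⟨$⟩ p)) (s-≤ i (rise B p<k)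
            λ (e , f) → δ≢α (trans (sym (position u (s-≡ˡ i e))) (position w f)))
        ; fall = λ {q} k≤q → subst (w ⟨$⟩ q ≤_) (s-involutive i (u ⟨$⟩ q)) (≤-s i (fall B k≤q)
            λ (e , f) → <⇒≱ β<k (subst (k ≤_) (position w e) k≤q))
        ; keep = λ {c} {d} c<d side lt → outer c<d side lt ((u ⟨$⟩ c ≟ i) ×-dec (u ⟨$⟩ d ≟ suc i))
        }

    raise-u : PieriBruhat k u w → β < k → PieriBruhat k u′ w
    raise-u (B & tight) β<k = record
      { rise = λ p<k → s-≤ i (rise B p<k) λ (e , f) →
          α≢β (trans (sym (position w f)) (trans (position u e) γ≡β))
      ; fall = λ {q} k≤q → ≤-s i (fall B k≤q) λ (e , f) → <⇒≱ β<k (subst (k ≤_) (position w e) k≤q)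
      ; keep = λ c<d side lt → keep B c<d side (u-monotone c<d lt)
      } & (begin
      ℓ u′ + k                          ≡⟨ cong (_+ k) ℓu′ ⟩
      suc (ℓ u + k)                     ≡⟨ cong suc tight ⟩
      suc (ℓ w + fixedCount k u w)      ≡⟨ sym (+-suc (ℓ w) _) ⟩
      ℓ w + suc (fixedCount k u w)      ≡⟨ cong (ℓ w +_) (sym (count-u β<k)) ⟩
      ℓ w + fixedCount k u′ w           ∎)
      where open ≡-Reasoning

  -- Either i keeps its position before k, or i + 1 keeps its position from k on. In this situation
  -- (u, w) is related if and only if (u′, w′) is.
  Parallel : Set
  Parallel = (γ ≡ α × α < k) ⊎ (δ ≡ β × k ≤ β)

  γ≢β : Parallel → γ ≢ β
  γ≢β (inj₁ (γ≡α , _)) e = α≢β (trans (sym γ≡α) e)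
  γ≢β (inj₂ (δ≡β , _)) e = γ≢δ (trans e (sym δ≡β))

  δ≢α : Parallel → δ ≢ α
  δ≢α (inj₁ (γ≡α , _)) e = γ≢δ (trans γ≡α (sym e))
  δ≢α (inj₂ (δ≡β , _)) e = α≢β (trans (sym e) δ≡β)

  -- If all three alternatives failed, `Bruhat k u′ w` would hold and, u′ being longer,
  -- `Bruhat-length` would demand a position fixed in (u′, w) but not in (u, w). Only γ = β < k
  -- could supply one.
  lower-cases : PieriBruhat k u w → Parallel ⊎ (γ ≡ β × β < k)
  lower-cases (B & tight) with (γ ≟ α) ×-dec (α <? k) | (δ ≟ β) ×-dec (k ≤? β) | (γ ≟ β) ×-dec (β <? k)
  ... | yes p | _     | _     = inj₁ (inj₁ p)
  ... | no _  | yes p | _     = inj₁ (inj₂ p)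
  ... | no _  | no _  | yes p = inj₂ p
  ... | no ¬γα | no ¬δβ | no ¬γβ = contradiction (Σℕ-mono k λ p p<k → same?-mono (still p p<k)) (<⇒≱ grows)
    where
    B′ : Bruhat k u′ w
    B′ = record
      { rise = λ p<k → s-≤ i (rise B p<k) λ (e , f) →
          ¬γα (trans (sym (position u e)) (position w f) , subst (_< k) (position w f) p<k)
      ; fall = λ {q} k≤q → ≤-s i (fall B k≤q) λ (e , f) →
          ¬δβ (trans (sym (position u f)) (position w e) , subst (k ≤_) (position w e) k≤q)
      ; keep = λ c<d side lt → keep B c<d side (u-monotone c<d lt)
      }
    grows : fixedCount k u w < fixedCount k u′ w
    grows = +-cancelˡ-≤ (ℓ w) _ _ (≤-trans (≤-reflexive (trans (+-suc (ℓ w) _) (trans (cong suc (sym tight))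
      (cong (_+ k) (sym ℓu′))))) (Bruhat-length B′))
    still : ∀ p → p < k → u′ ⟨$⟩ p ≡ w ⟨$⟩ p → u ⟨$⟩ p ≡ w ⟨$⟩ p
    still p p<k e with ≡⊎≢ p γ | ≡⊎≢ p δ
    ... | inj₁ refl | _ = let γ≡β = position w (trans (sym e) u′γ) in
                          contradiction (γ≡β , subst (_< k) γ≡β p<k) ¬γβ
    ... | inj₂ _ | inj₁ refl = contradiction (subst₂ _≤_ uδ (trans (sym e) u′δ) (rise B p<k)) 1+n≰n
    ... | inj₂ p≢γ | inj₂ p≢δ = trans (sym (u-other p≢γ p≢δ)) e

  upper-cases : PieriBruhat k u′ w′ → Parallel ⊎ (δ ≡ α × α < k)
  upper-cases C with (γ ≟ α) ×-dec (α <? k) | (δ ≟ β) ×-dec (k ≤? β)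
  ... | yes p | _     = inj₁ (inj₁ p)
  ... | no _  | yes p = inj₁ (inj₂ p)
  ... | no ¬γα | no ¬δβ = let γ′≡α , α<k = E′.forced C
                                (λ α<k e → ¬γα (trans (sym δ′) e , α<k)) (λ k≤β e → ¬δβ (trans (sym γ′) e , k≤β)) in
      inj₂ (trans (sym γ′) γ′≡α , α<k)

  fixedCount-s : fixedCount k u′ w′ ≡ fixedCount k u w
  fixedCount-s = Σℕ-cong k λ p _ → same?-cong {u′ ⟨$⟩ p} {w′ ⟨$⟩ p} {u ⟨$⟩ p} {w ⟨$⟩ p} (⟨$⟩-injective (s i)) (cong (s i ⟨$⟩_))

  -- Both lengths rise by one and the fixed positions stay the same, so only the order conditions
  -- need an argument. In `rise` and `fall`, s_i could reverse an inequality only for γ = β or δ =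
  -- α, which `Parallel` excludes.
  raise-both : Parallel → PieriBruhat k u w → PieriBruhat k u′ w′
  raise-both par (B & tight) = record
    { rise = λ p<k → s-≤-s i (rise B p<k) λ (e , f) → γ≢β par (trans (sym (position u e)) (position w f))
    ; fall = λ k≤q → s-≤-s i (fall B k≤q) λ (e , f) → δ≢α par (trans (sym (position u f)) (position w e))
    ; keep = λ {c} {d} c<d side lt → s-monotone i (keep B c<d side (u-monotone c<d lt)) λ (e , f) →
        crossed par (subst₂ (λ c d → d < k ⊎ k ≤ c) (position w e) (position w f) side)
          (subst₂ (λ c d → u′ ⟨$⟩ c < u′ ⟨$⟩ d) (position w e) (position w f) lt)
    } & trans (cong (_+ k) ℓu′) (trans (cong suc tight) (cong₂ _+_ (sym ℓw′) (sym fixedCount-s)))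
    where
    crossed : Parallel → β < k ⊎ k ≤ α → ¬ (u′ ⟨$⟩ α < u′ ⟨$⟩ β)
    crossed (inj₁ (γ≡α , α<k)) (inj₂ k≤α) _  = <⇒≱ α<k k≤α
    crossed (inj₁ (γ≡α , α<k)) (inj₁ β<k) lt = <⇒≱ (subst (_< u′ ⟨$⟩ β) (trans (cong (u′ ⟨$⟩_) (sym γ≡α)) u′γ) lt)
      (subst (u′ ⟨$⟩ β ≤_) wβ (s-≤ i (rise B β<k) λ (_ , f) → i≢1+i (trans (sym f) wβ)))
    crossed (inj₂ (δ≡β , k≤β)) (inj₁ β<k) _  = <⇒≱ β<k k≤β
    crossed (inj₂ (δ≡β , k≤β)) (inj₂ k≤α) lt = <⇒≱ (subst (u′ ⟨$⟩ α <_) (trans (cong (u′ ⟨$⟩_) (sym δ≡β)) u′δ) lt)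
      (subst (_≤ u′ ⟨$⟩ α) wα (≤-s i (fall B k≤α) λ (e , _) → i≢1+i (trans (sym wα) e)))

  lower-both : Parallel → PieriBruhat k u′ w′ → PieriBruhat k u w
  lower-both par (B & tight) = record
    { rise = λ {p} p<k → subst₂ _≤_ (s-involutive i (u ⟨$⟩ p)) (s-involutive i (w ⟨$⟩ p)) (s-≤-s i (rise B p<k)
        λ (e , f) → δ≢α par (trans (sym (position u (s-≡ˡ i e))) (position w (s-≡ʳ i f))))
    ; fall = λ {q} k≤q → subst₂ _≤_ (s-involutive i (w ⟨$⟩ q)) (s-involutive i (u ⟨$⟩ q)) (s-≤-s i (fall B k≤q)
        λ (e , f) → γ≢β par (trans (sym (position u (s-≡ʳ i f))) (position w (s-≡ˡ i e))))
    ; keep = λ {c} {d} c<d side lt → outer c<d side lt ((u ⟨$⟩ c ≟ i) ×-dec (u ⟨$⟩ d ≟ suc i))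
    } & suc-injective (trans (cong (_+ k) (sym ℓu′)) (trans tight (cong₂ _+_ ℓw′ fixedCount-s)))
    where
    inner : Parallel → δ < k ⊎ k ≤ γ → w ⟨$⟩ γ < w ⟨$⟩ δ
    inner (inj₁ (γ≡α , α<k)) (inj₂ k≤γ) = contradiction (subst (k ≤_) γ≡α k≤γ) (<⇒≱ α<k)
    inner (inj₁ (γ≡α , α<k)) (inj₁ δ<k) = subst (_< w ⟨$⟩ δ) (sym (trans (cong (w ⟨$⟩_) γ≡α) wα))
      (≤∧≢⇒< (subst₂ _≤_ u′δ (s-involutive i (w ⟨$⟩ δ)) (≤-s i (rise B δ<k) λ (e , _) → i≢1+i (trans (sym u′δ) e)))
        λ e → γ≢δ (trans γ≡α (sym (position w (sym e)))))
    inner (inj₂ (δ≡β , k≤β)) (inj₁ δ<k) = contradiction (subst (_< k) δ≡β δ<k) (≤⇒≯ k≤β)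
    inner (inj₂ (δ≡β , k≤β)) (inj₂ k≤γ) = subst (w ⟨$⟩ γ <_) (sym (trans (cong (w ⟨$⟩_) δ≡β) wβ))
      (≤∧≢⇒< (subst₂ _≤_ (s-involutive i (w ⟨$⟩ γ)) u′γ (s-≤ i (fall B k≤γ) λ (_ , f) → i≢1+i (trans (sym f) u′γ)))
        λ e → γ≢δ (trans (position w e) (sym δ≡β)))
    outer : ∀ {c d} → c < d → d < k ⊎ k ≤ c → u ⟨$⟩ c < u ⟨$⟩ d → Dec (u ⟨$⟩ c ≡ i × u ⟨$⟩ d ≡ suc i) → w ⟨$⟩ c < w ⟨$⟩ d
    outer c<d side lt (no ≢) = w-monotone c<d (keep B c<d side (s-monotone i lt ≢))
    outer c<d side lt (yes (e , f)) = subst₂ (λ c d → w ⟨$⟩ c < w ⟨$⟩ d) (sym (position u e)) (sym (position u f))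
      (inner par (subst₂ (λ c d → d < k ⊎ k ≤ c) (position u e) (position u f) side))

  γβ⇒¬raised : γ ≡ β → β < k → ¬ PieriBruhat k u′ w′
  γβ⇒¬raised γ≡β β<k (B & _) = 1+n≰n (subst₂ _≤_ (trans (cong (u′ ⟨$⟩_) (sym γ≡β)) u′γ) w′β (rise B β<k))

  δα⇒¬lowered : δ ≡ α → α < k → ¬ PieriBruhat k u w
  δα⇒¬lowered δ≡α α<k (B & _) = 1+n≰n (subst₂ _≤_ (trans (cong (u ⟨$⟩_) (sym δ≡α)) uδ) wα (rise B α<k))

-- Pieri coefficients

factor : ℕ → ℕ → ℕ → ℤ[x,y,z]
factor j a b = if does (a ≟ b) then y a -ₚ z j else 1ₚ

factor-≡ : ∀ j {a b} → a ≡ b → factor j a b ≡ y a -ₚ z j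
factor-≡ j {a} {b} = if-yes (a ≟ b)

factor-≢ : ∀ j {a b} → a ≢ b → factor j a b ≡ 1ₚ
factor-≢ j {a} {b} = if-no (a ≟ b)

factor-cong : ∀ j {a b c d} → a ≡ c ⊎ (a ≢ b × c ≢ d) → (a ≡ b → c ≡ d) → (c ≡ d → a ≡ b) →
  factor j a b ≡ factor j c d
factor-cong j (inj₂ (p , q)) _ _ = trans (factor-≢ j p) (sym (factor-≢ j q))
factor-cong j {a} {b} (inj₁ refl) f g with ≡⊎≢ a b
... | inj₁ e  = trans (factor-≡ j e) (sym (factor-≡ j (f e)))
... | inj₂ ne = trans (factor-≢ j ne) (sym (factor-≢ j (ne ∘ g)))

-- The weight as a product over all positions before k, with factor 1 at moved ones, so that two
-- pairs can be compared position by position.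
W : ℕ → ℕ → S∞ → S∞ → ℤ[x,y,z]
W k j u w = Π k λ p → factor j (u ⟨$⟩ p) (w ⟨$⟩ p)

∏-map-filter : ∀ {Q : ℕ → Set} (Q? : ∀ i → Dec (Q i)) (f : ℕ → ℕ) (g : ℕ → ℤ[x,y,z]) is →
  ∏ (map f (filter Q? is)) g ≈ₚ ∏ is (λ i → if does (Q? i) then g (f i) else 1ₚ)
∏-map-filter Q? f g []       = reflₚ
∏-map-filter Q? f g (i ∷ is) with Q? i
... | yes _ = *-congₚ reflₚ (∏-map-filter Q? f g is)
... | no _  = transₚ (∏-map-filter Q? f g is) (symₚ (*-identityₚ _))

weight-W : ∀ k u w j → weight k u w j ≈ₚ W k j u w
weight-W k u w j = transₚ
  (∏-map-filter (λ i → u ⟨$⟩ i ≟ w ⟨$⟩ i) (u ⟨$⟩_) (λ i → y i -ₚ z j) (upTo k))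
  (≡⇒≈ₚ (∏-upTo k _))

_⟶[_]?_ : ∀ u k w → Dec (u ⟶[ k ] w)
u ⟶[ k ]? w = map′ (sound (successors k u)) (complete (successors k u)) (Any.any? (w ≈?_) (elements (successors k u)))

abstract
  -- Zero for unrelated pairs, so that the exchange identities hold for all pairs and can be read as
  -- identities between coefficients of 𝔖_w.
  D : ℕ → ℕ → S∞ → S∞ → ℤ[x,y,z]
  D k j u w = if does (u ⟶[ k ]? w) then W k j u w else 0ₚ

  D-yes : ∀ {k} j {u w} → PieriBruhat k u w → D k j u w ≡ W k j u w
  D-yes {k} j {u} {w} C = if-yes (u ⟶[ k ]? w) (Pieri⇒⟶ C)

  D-no : ∀ {k} j {u w} → ¬ PieriBruhat k u w → D k j u w ≡ 0ₚ
  D-no {k} j {u} {w} ¬C = if-no (u ⟶[ k ]? w) (¬C ∘ ⟶⇒Pieri)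

pieri? : ∀ k u w → Dec (PieriBruhat k u w)
pieri? k u w = map′ ⟶⇒Pieri Pieri⇒⟶ (u ⟶[ k ]? w)

W-cong : ∀ k j {u u′ w w′} → u ≈ u′ → w ≈ w′ → W k j u w ≈ₚ W k j u′ w′
W-cong k j e f = Π-cong k λ p _ → ≡⇒≈ₚ (cong₂ (factor j) (at e p) (at f p))

Pieri-resp : ∀ {k u u′ w w′} → u ≈ u′ → w ≈ w′ → PieriBruhat k u w → PieriBruhat k u′ w′
Pieri-resp e f C = ⟶⇒Pieri (⟶-resp e f (Pieri⇒⟶ C))

D-cong : ∀ k j {u u′ w w′} → u ≈ u′ → w ≈ w′ → D k j u w ≈ₚ D k j u′ w′
D-cong k j {u} {u′} {w} {w′} e f = cases (pieri? k u w)
  where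
  cases : Dec (PieriBruhat k u w) → D k j u w ≈ₚ D k j u′ w′
  cases (yes C) = transₚ (≡⇒≈ₚ (D-yes j C)) (transₚ (W-cong k j e f) (≡⇒≈ₚ (sym (D-yes j (Pieri-resp e f C)))))
  cases (no ¬C) = transₚ (≡⇒≈ₚ (D-no j ¬C)) (≡⇒≈ₚ (sym (D-no j (¬C ∘ Pieri-resp (≈-sym e) (≈-sym f)))))

W-invariant : ∀ k j i u w → (∀ p → p < k → u ⟨$⟩ p ≡ w ⟨$⟩ p → u ⟨$⟩ p ≢ i × u ⟨$⟩ p ≢ suc i) →
  actY i (W k j u w) ≈ₚ W k j u w
W-invariant k j i u w avoid = transₚ (≡⇒≈ₚ (sub-Π _ k _)) (Π-cong k λ p p<k → cases p p<k (≡⊎≢ (u ⟨$⟩ p) (w ⟨$⟩ p)))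
  where
  cases : ∀ p → p < k → u ⟨$⟩ p ≡ w ⟨$⟩ p ⊎ u ⟨$⟩ p ≢ w ⟨$⟩ p →
    actY i (factor j (u ⟨$⟩ p) (w ⟨$⟩ p)) ≈ₚ factor j (u ⟨$⟩ p) (w ⟨$⟩ p)
  cases p p<k (inj₁ e) = transₚ (actY-cong i (≡⇒≈ₚ (factor-≡ j e)))
    (transₚ (≡⇒≈ₚ (cong (λ m → y m -ₚ z j) (let q , r = avoid p p<k e in s-other i q r))) (≡⇒≈ₚ (sym (factor-≡ j e))))
  cases p p<k (inj₂ ne) = transₚ (actY-cong i (≡⇒≈ₚ (factor-≢ j ne))) (≡⇒≈ₚ (sym (factor-≢ j ne)))

Π-split : ∀ n i f → i < n → Π n f ≈ₚ f i *ₚ Π n (update i 1ₚ f)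
Π-split n i f i<n = Π-replace n i i<n (λ m _ m≢i → ≡⇒≈ₚ (sym (update-≢ i 1ₚ f m≢i)))
  (symₚ (transₚ (*-congₚ reflₚ (≡⇒≈ₚ (update-≡ i 1ₚ f))) (R.*-identityʳ (f i))))

actY-left : ∀ i j → actY i (y i -ₚ z j) ≈ₚ y (suc i) -ₚ z j
actY-left i j = +-congₚ (≡⇒≈ₚ (cong y (s-left i))) reflₚ

actY-right : ∀ i j → actY i (y (suc i) -ₚ z j) ≈ₚ y i -ₚ z j
actY-right i j = +-congₚ (≡⇒≈ₚ (cong y (s-right i))) reflₚ

module ExchangeWeight (k j i : ℕ) (u w : S∞) (w↑ : Ascent (w ⁻¹) i) where
  open Exchange k i u w w↑

  W-raise : γ ≡ α → α < k → ¬ (δ ≡ β × β < k) → W k j u w ≈ₚ (y i -ₚ z j) *ₚ W k j u w′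
  W-raise γ≡α α<k not = Π-replace k α α<k
    (λ p p<k p≢α → let f , g = agree-off-α γ≡α not p p<k p≢α in ≡⇒≈ₚ (factor-cong j (inj₁ refl) f g))
    (transₚ (≡⇒≈ₚ (trans (factor-≡ j (trans (uα γ≡α) (sym wα))) (cong (λ m → y m -ₚ z j) (uα γ≡α))))
      (symₚ (transₚ (*-congₚ reflₚ (≡⇒≈ₚ (factor-≢ j λ e → i≢1+i (trans (sym (uα γ≡α)) (trans e w′α)))))
        (R.*-identityʳ (y i -ₚ z j)))))

  W-raised-invariant : γ ≡ α → actY i (W k j u w′) ≈ₚ W k j u w′
  W-raised-invariant γ≡α = W-invariant k j i u w′ λ p _ e →
    (λ f → i≢1+i (trans (sym (trans (sym e) f)) (trans (cong (w′ ⟨$⟩_) (trans (position u f) γ≡α)) w′α))) ,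
    (λ f → i≢1+i (trans (sym (trans (cong (u ⟨$⟩_) (position w (s-≡ʳ i (trans (sym e) f)))) (uα γ≡α))) f))

  -- s_i ((y_i − z_j) Q) + (y_i − y_{i+1}) s_i Q = (y_i − z_j) Q for s_i-invariant Q.
  raise-identity : PieriBruhat k u w → γ ≡ α → α < k → ¬ (δ ≡ β × β < k) →
    actY i (D k j u w) +ₚ yroot i *ₚ actY i (D k j u w′) ≈ₚ D k j u w
  raise-identity C γ≡α α<k not = begin
    actY i (D k j u w) +ₚ yroot i *ₚ actY i (D k j u w′)
      ≈⟨ +-congₚ (actY-cong i D≈) (*-congₚ reflₚ (transₚ (actY-cong i D′≈) (W-raised-invariant γ≡α))) ⟩
    actY i (y i -ₚ z j) *ₚ actY i Q +ₚ yroot i *ₚ Q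
      ≈⟨ +-congₚ (*-congₚ (actY-left i j) (W-raised-invariant γ≡α)) reflₚ ⟩
    (y (suc i) -ₚ z j) *ₚ Q +ₚ yroot i *ₚ Q
      ≈⟨ solve 4 (λ a b c q → (b :- c) :* q :+ (a :- b) :* q := (a :- c) :* q) reflₚ (y i) (y (suc i)) (z j) Q ⟩
    (y i -ₚ z j) *ₚ Q
      ≈⟨ symₚ D≈ ⟩
    D k j u w ∎
    where
    open ≈ₚ-Reasoning
    open ℤSolver
    Q : ℤ[x,y,z]
    Q = W k j u w′
    D≈ : D k j u w ≈ₚ (y i -ₚ z j) *ₚ Q
    D≈ = transₚ (≡⇒≈ₚ (D-yes j C)) (W-raise γ≡α α<k not)
    D′≈ : D k j u w′ ≈ₚ Q
    D′≈ = ≡⇒≈ₚ (D-yes j (raise γ≡α C α<k not))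

module AscentIdentities (k j i : ℕ) (u w : S∞) (u↑ : Ascent (u ⁻¹) i) (w↑ : Ascent (w ⁻¹) i) where
  open ExchangeBoth k i u w u↑ w↑
  open ℤSolver
  private
    module EW = ExchangeWeight k j i u w w↑
    module EW′ = ExchangeWeight k j i (s i ∙ u) w w↑
    η : ℤ[x,y,z]
    η = yroot i

    add-zero : ∀ {a b} → b ≈ₚ 0ₚ → a +ₚ η *ₚ b ≈ₚ a
    add-zero {a} e = transₚ (+-congₚ reflₚ (transₚ (*-congₚ reflₚ e) (R.zeroʳ η))) (R.+-identityʳ a)

    actY-zero : ∀ {a} → a ≈ₚ 0ₚ → actY i a ≈ₚ 0ₚ
    actY-zero e = actY-cong i e

    zero-D : ∀ {u w} → ¬ PieriBruhat k u w → D k j u w ≈ₚ 0ₚ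
    zero-D ¬C = ≡⇒≈ₚ (D-no j ¬C)

    through : ∀ {p q} → p ≡ q → actY i q ≈ₚ q → actY i p ≈ₚ p
    through refl e = e

    -- Both i and i + 1 are fixed before k, so the weight contains y_i - z_j and y_{i+1} - z_j,
    -- which s_i exchanges; the other factors avoid both variables.
    W-both : γ ≡ α → δ ≡ β → β < k → actY i (W k j u w) ≈ₚ W k j u w
    W-both γ≡α δ≡β β<k = begin
      actY i (Π k f)                                     ≈⟨ actY-cong i split ⟩
      actY i (y i -ₚ z j) *ₚ (actY i (y (suc i) -ₚ z j) *ₚ actY i (Π k g))
        ≈⟨ *-congₚ (actY-left i j) (*-congₚ (actY-right i j) invariant) ⟩
      (y (suc i) -ₚ z j) *ₚ ((y i -ₚ z j) *ₚ Π k g)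
        ≈⟨ solve 3 (λ a b q → a :* (b :* q) := b :* (a :* q)) reflₚ (y (suc i) -ₚ z j) (y i -ₚ z j) (Π k g) ⟩
      (y i -ₚ z j) *ₚ ((y (suc i) -ₚ z j) *ₚ Π k g)     ≈⟨ symₚ split ⟩
      Π k f                                              ∎
      where
      open ≈ₚ-Reasoning
      f g : ℕ → ℤ[x,y,z]
      f p = factor j (u ⟨$⟩ p) (w ⟨$⟩ p)
      g = update β 1ₚ (update α 1ₚ f)
      uα≡ : u ⟨$⟩ α ≡ i
      uα≡ = uα γ≡α
      uβ : u ⟨$⟩ β ≡ suc i
      uβ = trans (cong (u ⟨$⟩_) (sym δ≡β)) uδ
      fα : f α ≡ y i -ₚ z j
      fα = trans (factor-≡ j (trans uα≡ (sym wα))) (cong (λ m → y m -ₚ z j) uα≡)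
      fβ : update α 1ₚ f β ≡ y (suc i) -ₚ z j
      fβ = trans (update-≢ α 1ₚ f (α≢β ∘ sym)) (trans (factor-≡ j (trans uβ (sym wβ))) (cong (λ m → y m -ₚ z j) uβ))
      split : Π k f ≈ₚ (y i -ₚ z j) *ₚ ((y (suc i) -ₚ z j) *ₚ Π k g)
      split = transₚ (Π-split k α f (<-trans w↑ β<k)) (*-congₚ (≡⇒≈ₚ fα)
        (transₚ (Π-split k β (update α 1ₚ f) β<k) (*-congₚ (≡⇒≈ₚ fβ) reflₚ)))
      invariant : actY i (Π k g) ≈ₚ Π k g
      invariant = transₚ (≡⇒≈ₚ (sub-Π _ k _)) (Π-cong k λ p _ → at-p p (≡⊎≢ p β) (≡⊎≢ p α) (≡⊎≢ (u ⟨$⟩ p) (w ⟨$⟩ p)))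
        where
        at-p : ∀ p → p ≡ β ⊎ p ≢ β → p ≡ α ⊎ p ≢ α → u ⟨$⟩ p ≡ w ⟨$⟩ p ⊎ u ⟨$⟩ p ≢ w ⟨$⟩ p → actY i (g p) ≈ₚ g p
        at-p p (inj₁ refl) _ _ = through (update-≡ β 1ₚ (update α 1ₚ f)) reflₚ
        at-p p (inj₂ p≢β) (inj₁ refl) _ =
          through (trans (update-≢ β 1ₚ (update α 1ₚ f) p≢β) (update-≡ α 1ₚ f)) reflₚ
        at-p p (inj₂ p≢β) (inj₂ p≢α) fixed? =
          through (trans (update-≢ β 1ₚ (update α 1ₚ f) p≢β) (update-≢ α 1ₚ f p≢α)) (settle fixed?)
          where
          settle : u ⟨$⟩ p ≡ w ⟨$⟩ p ⊎ u ⟨$⟩ p ≢ w ⟨$⟩ p → actY i (f p) ≈ₚ f p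
          settle (inj₁ e) = through (factor-≡ j e) (≡⇒≈ₚ (cong (λ m → y m -ₚ z j) (s-other i
            (λ q → p≢α (position w (trans (sym e) q))) (λ q → p≢β (position w (trans (sym e) q))))))
          settle (inj₂ ne) = through (factor-≢ j ne) reflₚ

  -- The left side is the coefficient of 𝔖_w in the image of the Pieri sum under s_i. If i is fixed
  -- before k and i + 1 is not, `raise-identity` applies. Otherwise (u, w′) is unrelated and the
  -- weight is invariant: both values are fixed or neither is, because `δβ⇒γα` excludes i + 1 alone.
  identity-↑↑ : actY i (D k j u w) +ₚ η *ₚ actY i (D k j u w′) ≈ₚ D k j u w
  identity-↑↑ = cases (pieri? k u w) ((γ ≟ α) ×-dec (α <? k)) ((δ ≟ β) ×-dec (β <? k))
    where
    unchanged : PieriBruhat k u w → ¬ PieriBruhat k u w′ → actY i (W k j u w) ≈ₚ W k j u w →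
      actY i (D k j u w) +ₚ η *ₚ actY i (D k j u w′) ≈ₚ D k j u w
    unchanged C ¬C′ e = transₚ (add-zero (actY-zero (zero-D ¬C′)))
      (transₚ (actY-cong i (≡⇒≈ₚ (D-yes j C))) (transₚ e (≡⇒≈ₚ (sym (D-yes j C)))))
    cases : Dec (PieriBruhat k u w) → Dec (γ ≡ α × α < k) → Dec (δ ≡ β × β < k) →
      actY i (D k j u w) +ₚ η *ₚ actY i (D k j u w′) ≈ₚ D k j u w
    cases (no ¬C) _ _ = transₚ (add-zero (actY-zero (zero-D λ C′ → let e , α<k = raised⇒ C′ in ¬C (unraise e C′ α<k))))
      (transₚ (actY-zero (zero-D ¬C)) (symₚ (zero-D ¬C)))
    cases (yes C) (yes (e , α<k)) (no not) = EW.raise-identity C e α<k not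
    cases (yes C) (yes (e , α<k)) (yes (f , β<k)) = unchanged C (λ C′ → not-both (bruhat C′) (f , β<k)) (W-both e f β<k)
    cases (yes C) (no ¬γα) _ = unchanged C (¬γα ∘ raised⇒) (W-invariant k j i u w λ p p<k e →
      (λ q → let p≡α = position w (trans (sym e) q) in
        ¬γα (trans (sym (position u q)) p≡α , subst (_< k) p≡α p<k)) ,
      (λ q → let p≡β = position w (trans (sym e) q) ; β<k = subst (_< k) p≡β p<k in
        ¬γα (δβ⇒γα C (trans (sym (position u q)) p≡β) β<k , <-trans w↑ β<k)))

  W-s : actY i (W k j u′ w′) ≈ₚ W k j u w
  W-s = transₚ (≡⇒≈ₚ (sub-Π _ k _)) (Π-cong k λ p _ → cases p (≡⊎≢ (u ⟨$⟩ p) (w ⟨$⟩ p)))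
    where
    cases : ∀ p → u ⟨$⟩ p ≡ w ⟨$⟩ p ⊎ u ⟨$⟩ p ≢ w ⟨$⟩ p →
      actY i (factor j (u′ ⟨$⟩ p) (w′ ⟨$⟩ p)) ≈ₚ factor j (u ⟨$⟩ p) (w ⟨$⟩ p)
    cases p (inj₁ e) = transₚ (actY-cong i (≡⇒≈ₚ (factor-≡ j (cong (s i ⟨$⟩_) e))))
      (transₚ (≡⇒≈ₚ (cong (λ m → y m -ₚ z j) (s-involutive i (u ⟨$⟩ p)))) (≡⇒≈ₚ (sym (factor-≡ j e))))
    cases p (inj₂ ne) = transₚ (actY-cong i (≡⇒≈ₚ (factor-≢ j (ne ∘ ⟨$⟩-injective (s i))))) (≡⇒≈ₚ (sym (factor-≢ j ne)))

  -- The extra term on the right comes from the factor 𝔖_{s_i u′} = 𝔖_u in the y-action. Usually the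
  -- terms match one by one, (u′, w′) with (u, w) by `W-s`. The exceptions are δ = α < k, where (u,
  -- w) is unrelated, and γ = β < k, where (u′, w′) is.
  identity-↓↑ : actY i (D k j u′ w) +ₚ η *ₚ actY i (D k j u′ w′) ≈ₚ D k j u′ w +ₚ η *ₚ D k j u w
  identity-↓↑ = cases (pieri? k u′ w) ((γ ≟ β) ×-dec (β <? k)) ((δ ≟ α) ×-dec (α <? k))
    where
    open ≈ₚ-Reasoning
    parallel : (PieriBruhat k u w → PieriBruhat k u′ w′) → (PieriBruhat k u′ w′ → PieriBruhat k u w) →
      actY i (D k j u′ w′) ≈ₚ D k j u w
    parallel f g with pieri? k u w
    ... | yes C = transₚ (actY-cong i (≡⇒≈ₚ (D-yes j (f C)))) (transₚ W-s (≡⇒≈ₚ (sym (D-yes j C))))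
    ... | no ¬C = transₚ (actY-zero (zero-D (¬C ∘ g))) (symₚ (zero-D ¬C))
    cases : Dec (PieriBruhat k u′ w) → Dec (γ ≡ β × β < k) → Dec (δ ≡ α × α < k) →
      actY i (D k j u′ w) +ₚ η *ₚ actY i (D k j u′ w′) ≈ₚ D k j u′ w +ₚ η *ₚ D k j u w
    cases (no ¬C) _ _ = +-congₚ (transₚ (actY-zero (zero-D ¬C)) (symₚ (zero-D ¬C))) (*-congₚ reflₚ (parallel
      (λ C → [ (λ par → raise-both par C) , (λ (e , β<k) → contradiction (raise-u e C β<k) ¬C) ]′ (lower-cases C))
      (λ C → [ (λ par → lower-both par C) , (λ (e , α<k) → contradiction (unraise-u′ C e α<k) ¬C) ]′ (upper-cases C))))
    cases (yes C) (no ¬γβ) (no ¬δα) = +-congₚ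
      (transₚ (actY-cong i (≡⇒≈ₚ (D-yes j C))) (transₚ (W-invariant k j i u′ w λ p p<k e →
          (λ q → let p≡α = position w (trans (sym e) q) in
            ¬δα (trans (sym (position u (s-≡ˡ i q))) p≡α , subst (_< k) p≡α p<k)) ,
          (λ q → let p≡β = position w (trans (sym e) q) in
            ¬γβ (trans (sym (position u (s-≡ʳ i q))) p≡β , subst (_< k) p≡β p<k)))
        (≡⇒≈ₚ (sym (D-yes j C)))))
      (*-congₚ reflₚ (parallel
        (λ C → [ (λ par → raise-both par C) , (λ p → contradiction p ¬γβ) ]′ (lower-cases C))
        (λ C → [ (λ par → lower-both par C) , (λ p → contradiction p ¬δα) ]′ (upper-cases C))))
    cases (yes C) _ (yes (δ≡α , α<k)) = transₚ
      (EW′.raise-identity C (trans (cong (u ⁻¹ ⟨$⟩_) (s-left i)) δ≡α) α<k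
        λ (e , _) → <-asym w↑ (subst₂ _<_ (trans (sym (cong (u ⁻¹ ⟨$⟩_) (s-right i))) e) δ≡α u↑))
      (symₚ (add-zero (zero-D (δα⇒¬lowered δ≡α α<k))))
    -- Here s_i turns the factor y_{i+1} - z_j at position γ into y_i - z_j = (y_{i+1} - z_j) + (y_i
    -- - y_{i+1}); the second summand produces the term of (u, w).
    cases (yes C) (yes (γ≡β , β<k)) (no _) = begin
      actY i (D k j u′ w) +ₚ η *ₚ actY i (D k j u′ w′)
        ≈⟨ add-zero (actY-zero (zero-D (γβ⇒¬raised γ≡β β<k))) ⟩
      actY i (D k j u′ w)                              ≈⟨ actY-cong i D≈ ⟩
      actY i (y (suc i) -ₚ z j) *ₚ actY i Q            ≈⟨ *-congₚ (actY-right i j) Q-invariant ⟩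
      (y i -ₚ z j) *ₚ Q
        ≈⟨ solve 4 (λ a b c q → (a :- c) :* q := (b :- c) :* q :+ (a :- b) :* q) reflₚ (y i) (y (suc i)) (z j) Q ⟩
      (y (suc i) -ₚ z j) *ₚ Q +ₚ η *ₚ Q                ≈⟨ +-congₚ (symₚ D≈) (*-congₚ reflₚ (≡⇒≈ₚ (sym (D-yes j (lower-u γ≡β C β<k))))) ⟩
      D k j u′ w +ₚ η *ₚ D k j u w                     ∎
      where
      Q : ℤ[x,y,z]
      Q = W k j u w
      u′γ≡wγ : u′ ⟨$⟩ γ ≡ w ⟨$⟩ γ
      u′γ≡wγ = trans u′γ (sym (wγ γ≡β))
      uγ≢wγ : u ⟨$⟩ γ ≢ w ⟨$⟩ γ
      uγ≢wγ e = i≢1+i (trans (sym uγ) (trans e (wγ γ≡β)))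
      D≈ : D k j u′ w ≈ₚ (y (suc i) -ₚ z j) *ₚ Q
      D≈ = transₚ (≡⇒≈ₚ (D-yes j C)) (Π-replace k γ (subst (_< k) (sym γ≡β) β<k)
        (λ p _ p≢γ → let f , g = agree-off-γ γ≡β p p≢γ in ≡⇒≈ₚ (factor-cong j (same-value p p≢γ (≡⊎≢ p δ)) f g))
        (transₚ (≡⇒≈ₚ (trans (factor-≡ j u′γ≡wγ) (cong (λ m → y m -ₚ z j) u′γ)))
          (symₚ (transₚ (*-congₚ reflₚ (≡⇒≈ₚ (factor-≢ j uγ≢wγ))) (R.*-identityʳ (y (suc i) -ₚ z j))))))
        where
        same-value : ∀ p → p ≢ γ → p ≡ δ ⊎ p ≢ δ →
          u′ ⟨$⟩ p ≡ u ⟨$⟩ p ⊎ (u′ ⟨$⟩ p ≢ w ⟨$⟩ p × u ⟨$⟩ p ≢ w ⟨$⟩ p)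
        same-value p p≢γ (inj₂ p≢δ) = inj₁ (u-other p≢γ p≢δ)
        same-value p p≢γ (inj₁ refl) = inj₂ (different ∘ proj₁ (agree-off-γ γ≡β p p≢γ) , different)
          where
          different : u ⟨$⟩ δ ≢ w ⟨$⟩ δ
          different e = γ≢δ (trans γ≡β (sym (position w (trans (sym e) uδ))))
      Q-invariant : actY i Q ≈ₚ Q
      Q-invariant = W-invariant k j i u w λ p _ e →
        (λ q → uγ≢wγ (subst (λ p → u ⟨$⟩ p ≡ w ⟨$⟩ p) (position u q) e)) ,
        (λ q → uγ≢wγ (subst (λ p → u ⟨$⟩ p ≡ w ⟨$⟩ p) (trans (position w (trans (sym e) q)) (sym γ≡β)) e))

module _ (k j i : ℕ) where
  open ≈ₚ-Reasoning
  open ℤSolver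
  private
    η : ℤ[x,y,z]
    η = yroot i

    η-cancel : ∀ {p q} → η *ₚ p ≈ₚ η *ₚ q → p ≈ₚ q
    η-cancel = cancel λ ()

    actY-η* : ∀ p → actY i (η *ₚ actY i p) ≈ₚ -ₚ (η *ₚ p)
    actY-η* p = transₚ (*-congₚ (actY-yroot i) (actY-involutive i p))
      (solve 2 (λ a p → (:- a) :* p := :- (a :* p)) reflₚ η p)

    s∙-ascent : ∀ {w} → Descent (w ⁻¹) i → Ascent ((s i ∙ w) ⁻¹) i
    s∙-ascent {w} = descent-∙s (w ⁻¹) i

  -- The two cases in which w has a left descent follow from the other two by
  -- applying s_i and cancelling y_i − y_{i+1}.
  D-↑↑ : ∀ u w → Ascent (u ⁻¹) i → Ascent (w ⁻¹) i →
    actY i (D k j u w) +ₚ η *ₚ actY i (D k j u (s i ∙ w)) ≈ₚ D k j u w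
  D-↑↑ u w u↑ w↑ = AscentIdentities.identity-↑↑ k j i u w u↑ w↑

  D-↓↑ : ∀ u w → Descent (u ⁻¹) i → Ascent (w ⁻¹) i →
    actY i (D k j u w) +ₚ η *ₚ actY i (D k j u (s i ∙ w)) ≈ₚ D k j u w +ₚ η *ₚ D k j (s i ∙ u) w
  D-↓↑ u w u↓ w↑ = begin
    actY i (D k j u w) +ₚ η *ₚ actY i (D k j u (s i ∙ w))
      ≈⟨ +-congₚ (actY-cong i (D-cong k j (≈-sym (s∙s∙ u i)) ≈-refl))
                 (*-congₚ reflₚ (actY-cong i (D-cong k j (≈-sym (s∙s∙ u i)) ≈-refl))) ⟩
    actY i (D k j (s i ∙ (s i ∙ u)) w) +ₚ η *ₚ actY i (D k j (s i ∙ (s i ∙ u)) (s i ∙ w))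
      ≈⟨ AscentIdentities.identity-↓↑ k j i (s i ∙ u) w (s∙-ascent {u} u↓) w↑ ⟩
    D k j (s i ∙ (s i ∙ u)) w +ₚ η *ₚ D k j (s i ∙ u) w
      ≈⟨ +-congₚ (D-cong k j (s∙s∙ u i) ≈-refl) reflₚ ⟩
    D k j u w +ₚ η *ₚ D k j (s i ∙ u) w ∎

  D-↑↓ : ∀ u w → Ascent (u ⁻¹) i → Descent (w ⁻¹) i → actY i (D k j u w) ≈ₚ D k j u w
  D-↑↓ u w u↑ w↓ = η-cancel (begin
    η *ₚ sB
      ≈⟨ solve 2 (λ m A → m := (A :+ m) :- A) reflₚ (η *ₚ sB) sA ⟩
    (sA +ₚ η *ₚ sB) -ₚ sA                    ≈⟨ +-congₚ e₁ (-‿congₚ (symₚ e₂)) ⟩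
    A -ₚ (A -ₚ η *ₚ B)
      ≈⟨ solve 2 (λ a m → a :- (a :- m) := m) reflₚ A (η *ₚ B) ⟩
    η *ₚ B                                   ∎)
    where
    A B sA sB : ℤ[x,y,z]
    A = D k j u (s i ∙ w)
    B = D k j u w
    sA = actY i A
    sB = actY i B
    e₁ : sA +ₚ η *ₚ sB ≈ₚ A
    e₁ = transₚ (+-congₚ reflₚ (*-congₚ reflₚ (actY-cong i (D-cong k j ≈-refl (≈-sym (s∙s∙ w i))))))
      (D-↑↑ u (s i ∙ w) u↑ (s∙-ascent {w} w↓))
    -- The image of `e₁` under s_i, which changes the sign of η. The two equations determine η times
    -- the exchanged B.
    e₂ : A -ₚ η *ₚ B ≈ₚ sA
    e₂ = transₚ (+-congₚ (symₚ (actY-involutive i A)) (symₚ (actY-η* B))) (actY-cong i e₁)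

  D-↓↓ : ∀ u w → Descent (u ⁻¹) i → Descent (w ⁻¹) i →
    actY i (D k j u w) ≈ₚ D k j u w +ₚ η *ₚ D k j (s i ∙ u) w
  D-↓↓ u w u↓ w↓ = η-cancel (begin
    η *ₚ sB
      ≈⟨ solve 2 (λ m A → m := (A :+ m) :- A) reflₚ (η *ₚ sB) sA ⟩
    (sA +ₚ η *ₚ sB) -ₚ sA                              ≈⟨ +-congₚ e₁ (-‿congₚ sA≈) ⟩
    (A +ₚ η *ₚ C) -ₚ ((A -ₚ η *ₚ B) +ₚ η *ₚ sC)
      ≈⟨ solve 5 (λ h a b c d → (a :+ h :* c) :- ((a :- h :* b) :+ h :* d) := h :* (b :+ (c :- d))) reflₚ η A B C sC ⟩
    η *ₚ (B +ₚ (C -ₚ sC))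
      ≈⟨ *-congₚ reflₚ (+-congₚ reflₚ C-sC) ⟩
    η *ₚ (B +ₚ η *ₚ E)                                 ∎)
    where
    A B C E sA sB sC : ℤ[x,y,z]
    A = D k j u (s i ∙ w)
    B = D k j u w
    C = D k j (s i ∙ u) (s i ∙ w)
    E = D k j (s i ∙ u) w
    sA = actY i A
    sB = actY i B
    sC = actY i C
    w₀↑ : Ascent ((s i ∙ w) ⁻¹) i
    w₀↑ = s∙-ascent {w} w↓
    e₁ : sA +ₚ η *ₚ sB ≈ₚ A +ₚ η *ₚ C
    e₁ = transₚ (+-congₚ reflₚ (*-congₚ reflₚ (actY-cong i (D-cong k j ≈-refl (≈-sym (s∙s∙ w i))))))
      (D-↓↑ u (s i ∙ w) u↓ w₀↑)
    e₂ : A -ₚ η *ₚ B ≈ₚ sA -ₚ η *ₚ sC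
    e₂ = transₚ (+-congₚ (symₚ (actY-involutive i A)) (symₚ (actY-η* B)))
      (transₚ (actY-cong i e₁) (+-congₚ reflₚ (transₚ (*-congₚ (actY-yroot i) reflₚ)
        (solve 2 (λ a p → (:- a) :* p := :- (a :* p)) reflₚ η sC))))
    sA≈ : sA ≈ₚ (A -ₚ η *ₚ B) +ₚ η *ₚ sC
    sA≈ = transₚ (solve 2 (λ a m → a := (a :- m) :+ m) reflₚ sA (η *ₚ sC)) (+-congₚ (symₚ e₂) reflₚ)
    -- s_i u has a left ascent, so `D-↑↓` removes the exchange from E; this eliminates the last
    -- exchanged term.
    e₃ : sC +ₚ η *ₚ E ≈ₚ C
    e₃ = transₚ (+-congₚ reflₚ (*-congₚ reflₚ (symₚ (transₚ (actY-cong i (D-cong k j ≈-refl (s∙s∙ w i)))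
        (D-↑↓ (s i ∙ u) w (s∙-ascent {u} u↓) w↓)))))
      (D-↑↑ (s i ∙ u) (s i ∙ w) (s∙-ascent {u} u↓) w₀↑)
    C-sC : C -ₚ sC ≈ₚ η *ₚ E
    C-sC = transₚ (+-congₚ (symₚ e₃) reflₚ) (solve 2 (λ a m → (a :+ m) :- a := m) reflₚ sC (η *ₚ E))

-- Finite sums

∑-cong : ∀ {A : Set} (as : List A) {f g : A → ℤ[x,y,z]} → (∀ {a} → a ∈ as → f a ≈ₚ g a) → ∑ as f ≈ₚ ∑ as g
∑-cong []       e = reflₚ
∑-cong (a ∷ as) e = +-congₚ (e (here refl)) (∑-cong as (e ∘ there))

∑-zero : ∀ {A : Set} (as : List A) {f : A → ℤ[x,y,z]} → (∀ {a} → a ∈ as → f a ≈ₚ 0ₚ) → ∑ as f ≈ₚ 0ₚ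
∑-zero []       e = reflₚ
∑-zero (a ∷ as) e = transₚ (+-congₚ (e (here refl)) (∑-zero as (e ∘ there))) (+-identityₚ 0ₚ)

∑-+ : ∀ {A : Set} (as : List A) (f g : A → ℤ[x,y,z]) → ∑ as (λ a → f a +ₚ g a) ≈ₚ ∑ as f +ₚ ∑ as g
∑-+ []       f g = symₚ (+-identityₚ 0ₚ)
∑-+ (a ∷ as) f g = transₚ (+-congₚ reflₚ (∑-+ as f g))
  (solve 4 (λ a b c d → (a :+ b) :+ (c :+ d) := (a :+ c) :+ (b :+ d)) reflₚ (f a) (g a) (∑ as f) (∑ as g))
  where open ℤSolver

∑-* : ∀ {A : Set} (as : List A) (c : ℤ[x,y,z]) (f : A → ℤ[x,y,z]) → ∑ as (λ a → c *ₚ f a) ≈ₚ c *ₚ ∑ as f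
∑-* []       c f = symₚ (R.zeroʳ c)
∑-* (a ∷ as) c f = transₚ (+-congₚ reflₚ (∑-* as c f)) (symₚ (distribₚ c (f a) (∑ as f)))

∑-swap : ∀ {A B : Set} (as : List A) (bs : List B) (f : A → B → ℤ[x,y,z]) →
  ∑ as (λ a → ∑ bs (f a)) ≈ₚ ∑ bs (λ b → ∑ as (λ a → f a b))
∑-swap []       bs f = symₚ (∑-zero bs λ _ → reflₚ)
∑-swap (a ∷ as) bs f = transₚ (+-congₚ reflₚ (∑-swap as bs f)) (symₚ (∑-+ bs (f a) _))

∑-++ : ∀ {A : Set} (as bs : List A) (f : A → ℤ[x,y,z]) → ∑ (as ++ bs) f ≈ₚ ∑ as f +ₚ ∑ bs f
∑-++ []       bs f = symₚ (+-identityₚ _)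
∑-++ (a ∷ as) bs f = transₚ (+-congₚ reflₚ (∑-++ as bs f)) (symₚ (+-assocₚ (f a) (∑ as f) (∑ bs f)))

∑-map : ∀ {A B : Set} (h : A → B) (as : List A) (f : B → ℤ[x,y,z]) → ∑ (map h as) f ≡ ∑ as (f ∘ h)
∑-map h []       f = refl
∑-map h (a ∷ as) f = cong (f (h a) +ₚ_) (∑-map h as f)

sub-∑ : ∀ {A : Set} (ρ : Var → ℤ[x,y,z]) (as : List A) (f : A → ℤ[x,y,z]) → sub ρ (∑ as f) ≡ ∑ as (sub ρ ∘ f)
sub-∑ ρ []       f = refl
sub-∑ ρ (a ∷ as) f = cong (sub ρ (f a) +ₚ_) (sub-∑ ρ as f)

module FiniteSum (A : DecSetoid 0ℓ 0ℓ) where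
  private module A = DecSetoid A
  open SetoidMembership A.setoid using () renaming (_∈_ to _∈ₐ_)
  open SetoidUnique A.setoid using (Unique)

  Respects : (A.Carrier → ℤ[x,y,z]) → Set
  Respects f = ∀ {a b} → a A.≈ b → f a ≈ₚ f b

  remove : ∀ {a as} → a ∈ₐ as → List A.Carrier
  remove {as = _ ∷ as} (here _)   = as
  remove {as = b ∷ _}  (there a∈) = b ∷ remove a∈

  ∑-remove : ∀ {f} → Respects f → ∀ {a as} (a∈ : a ∈ₐ as) → ∑ as f ≈ₚ f a +ₚ ∑ (remove a∈) f
  ∑-remove resp (here e) = +-congₚ (resp (A.sym e)) reflₚ
  ∑-remove {f} resp {a} {b ∷ as} (there a∈) = transₚ (+-congₚ reflₚ (∑-remove resp a∈))
    (solve 3 (λ a b c → b :+ (a :+ c) := a :+ (b :+ c)) reflₚ (f a) (f b) (∑ (remove a∈) f))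
    where open ℤSolver

  remove-⊆ : ∀ {a as} (a∈ : a ∈ₐ as) {b} → b ∈ₐ remove a∈ → b ∈ₐ as
  remove-⊆ (here _)   b∈         = there b∈
  remove-⊆ (there a∈) (here e)   = here e
  remove-⊆ (there a∈) (there b∈) = there (remove-⊆ a∈ b∈)

  remove-⊇ : ∀ {a as} (a∈ : a ∈ₐ as) {b} → b ∈ₐ as → b A.≈ a ⊎ b ∈ₐ remove a∈
  remove-⊇ (here e)   (here f)   = inj₁ (A.trans f (A.sym e))
  remove-⊇ (here e)   (there b∈) = inj₂ b∈
  remove-⊇ (there a∈) (here f)   = inj₂ (here f)
  remove-⊇ (there a∈) (there b∈) with remove-⊇ a∈ b∈
  ... | inj₁ e  = inj₁ e
  ... | inj₂ b∈′ = inj₂ (there b∈′)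

  All-≉⇒∉ : ∀ {a as} → All (λ b → ¬ a A.≈ b) as → ∀ {b} → b ∈ₐ as → ¬ b A.≈ a
  All-≉⇒∉ (ne ∷ _)   (here e)   e′ = ne (A.trans (A.sym e′) e)
  All-≉⇒∉ (_ ∷ a∉)   (there b∈) e′ = All-≉⇒∉ a∉ b∈ e′

  remove-All : ∀ {Q : A.Carrier → Set} {a as} (a∈ : a ∈ₐ as) → All Q as → All Q (remove a∈)
  remove-All (here _)   (_ ∷ q)  = q
  remove-All (there a∈) (q ∷ qs) = q ∷ remove-All a∈ qs

  remove-unique : ∀ {a as} (a∈ : a ∈ₐ as) → Unique as → Unique (remove a∈)
  remove-unique (here _)   (_ ∷ u)  = u
  remove-unique (there a∈) (b∉ ∷ u) = remove-All a∈ b∉ ∷ remove-unique a∈ u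

  remove-≉ : ∀ {a as} (a∈ : a ∈ₐ as) → Unique as → ∀ {b} → b ∈ₐ remove a∈ → ¬ b A.≈ a
  remove-≉ (here e)   (c∉ ∷ _) b∈       b≈a = All-≉⇒∉ c∉ b∈ (A.trans b≈a e)
  remove-≉ (there a∈) (c∉ ∷ _) (here e) b≈a = All-≉⇒∉ c∉ a∈ (A.trans (A.sym b≈a) e)
  remove-≉ (there a∈) (_ ∷ u) (there b∈) = remove-≉ a∈ u b∈

  -- Makes a sum over a setoid independent of the listing and of extra zero terms: each element of
  -- the first list either is removed from the second or contributes 0.
  ∑-independent : ∀ {f} → Respects f → ∀ {as bs} → Unique as → Unique bs →
    (∀ {a} → a ∈ₐ as → a ∈ₐ bs ⊎ f a ≈ₚ 0ₚ) → (∀ {a} → a ∈ₐ bs → a ∈ₐ as ⊎ f a ≈ₚ 0ₚ) →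
    ∑ as f ≈ₚ ∑ bs f
  ∑-independent resp {[]} {bs} _ _ _ back = symₚ (∑-zero bs λ a∈ → [ (λ ()) , id ]′ (back (Any.map (λ { refl → A.refl }) a∈)))
  ∑-independent {f} resp {a ∷ as} {bs} (a∉ ∷ u) v to back with Any.any? (a A.≟_) bs
  ... | yes a∈ = transₚ (+-congₚ reflₚ (∑-independent resp u (remove-unique a∈ v) to′ back′)) (symₚ (∑-remove resp a∈))
    where
    to′ : ∀ {b} → b ∈ₐ as → b ∈ₐ remove a∈ ⊎ f b ≈ₚ 0ₚ
    to′ b∈ with to (there b∈)
    ... | inj₂ e = inj₂ e
    ... | inj₁ b∈bs with remove-⊇ a∈ b∈bs
    ...   | inj₁ b≈a = contradiction b≈a (All-≉⇒∉ a∉ b∈)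
    ...   | inj₂ b∈′ = inj₁ b∈′
    back′ : ∀ {b} → b ∈ₐ remove a∈ → b ∈ₐ as ⊎ f b ≈ₚ 0ₚ
    back′ b∈ with back (remove-⊆ a∈ b∈)
    ... | inj₂ e            = inj₂ e
    ... | inj₁ (here b≈a)   = contradiction b≈a (remove-≉ a∈ v b∈)
    ... | inj₁ (there b∈as) = inj₁ b∈as
  ... | no a∉bs = transₚ (+-congₚ vanish (∑-independent resp u v (to ∘ there) back′)) (+-identityₚ _)
    where
    vanish : f a ≈ₚ 0ₚ
    vanish = [ (λ a∈ → contradiction a∈ a∉bs) , id ]′ (to (here A.refl))
    back′ : ∀ {b} → b ∈ₐ bs → b ∈ₐ as ⊎ f b ≈ₚ 0ₚ
    back′ b∈ with back b∈
    ... | inj₂ e            = inj₂ e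
    ... | inj₁ (here b≈a)   = contradiction (SetoidMembershipₚ.∈-resp-≈ A.setoid b≈a b∈) a∉bs
    ... | inj₁ (there b∈as) = inj₁ b∈as

open FiniteSum S∞-decSetoid public
  using () renaming (Respects to Respects-S∞; ∑-independent to ∑-independent-S∞)
open SetoidUnique S∞-setoid public using () renaming (Unique to Unique-S∞)
open _IsSumOver-S∞_ public

∑-IsSum : ∀ {L f} → Unique-S∞ L → (∀ w → ¬ w Perm.∈ L → f w ≈ₚ 0ₚ) → (∑ L f) IsSumOver-S∞ f
∑-IsSum {L} u v = record { support = L ; distinct-ws = u ; vanishes = v ; equals = reflₚ }

IsSum-resp : ∀ {p q f} → p ≈ₚ q → p IsSumOver-S∞ f → q IsSumOver-S∞ f
IsSum-resp e S = record
  { support = support S ; distinct-ws = distinct-ws S ; vanishes = vanishes S ; equals = transₚ (symₚ e) (equals S) }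

IsSum-cong : ∀ {p f g} → (∀ w → f w ≈ₚ g w) → p IsSumOver-S∞ f → p IsSumOver-S∞ g
IsSum-cong e S = record
  { support = support S ; distinct-ws = distinct-ws S
  ; vanishes = λ w w∉ → transₚ (symₚ (e w)) (vanishes S w w∉)
  ; equals = transₚ (equals S) (∑-cong (support S) λ {w} _ → e w) }

member? : ∀ w L → Dec (w Perm.∈ L)
member? w L = Any.any? (w ≈?_) L

IsSum-∑ : ∀ {p f} → Respects-S∞ f → p IsSumOver-S∞ f → ∀ {L} → Unique-S∞ L → (∀ w → ¬ w Perm.∈ L → f w ≈ₚ 0ₚ) →
  p ≈ₚ ∑ L f
IsSum-∑ {p} {f} resp S {L} u v = transₚ (equals S) (∑-independent-S∞ resp (distinct-ws S) u
  (λ {w} _ → decide (member? w L) (v w)) (λ {w} _ → decide (member? w (support S)) (vanishes S w)))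
  where
  decide : ∀ {w L} → Dec (w Perm.∈ L) → (¬ w Perm.∈ L → f w ≈ₚ 0ₚ) → w Perm.∈ L ⊎ f w ≈ₚ 0ₚ
  decide (yes w∈) _ = inj₁ w∈
  decide (no w∉)  h = inj₂ (h w∉)

-- Turns a termwise identity of families into an equality of polynomials although the supports are
-- listed differently; the images of Pieri sums under s_i are identified in this way.
IsSum-unique : ∀ {p q f} → Respects-S∞ f → p IsSumOver-S∞ f → q IsSumOver-S∞ f → p ≈ₚ q
IsSum-unique resp S T = transₚ (IsSum-∑ resp S (distinct-ws T) (vanishes T)) (symₚ (equals T))

IsSum-+ : ∀ {p q f g} → Respects-S∞ f → Respects-S∞ g → p IsSumOver-S∞ f → q IsSumOver-S∞ g →
  (p +ₚ q) IsSumOver-S∞ (λ w → f w +ₚ g w)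
IsSum-+ {p} {q} {f} {g} rf rg S T = IsSum-resp
  (transₚ (∑-+ L f g) (+-congₚ (symₚ (IsSum-∑ rf S unique-L (λ w w∉ → vanishes S w (w∉ ∘ inˡ))))
                               (symₚ (IsSum-∑ rg T unique-L (λ w w∉ → vanishes T w (w∉ ∘ inʳ))))))
  (∑-IsSum unique-L λ w w∉ → transₚ (+-congₚ (vanishes S w (w∉ ∘ inˡ)) (vanishes T w (w∉ ∘ inʳ))) (+-identityₚ 0ₚ))
  where
  L : List S∞
  L = deduplicate _≈?_ (support S ++ support T)
  unique-L : Unique-S∞ L
  unique-L = deduplicate-! S∞-decSetoid (support S ++ support T)
  dedup : ∀ {w} → w Perm.∈ support S ++ support T → w Perm.∈ L
  dedup = SetoidMembershipₚ.∈-deduplicate⁺ S∞-setoid _≈?_ (λ b≈c a≈b → ≈-trans a≈b (≈-sym b≈c))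
  inˡ : ∀ {w} → w Perm.∈ support S → w Perm.∈ L
  inˡ = dedup ∘ SetoidMembershipₚ.∈-++⁺ˡ S∞-setoid
  inʳ : ∀ {w} → w Perm.∈ support T → w Perm.∈ L
  inʳ = dedup ∘ SetoidMembershipₚ.∈-++⁺ʳ S∞-setoid (support S)

IsSum-* : ∀ {p f} c → p IsSumOver-S∞ f → (c *ₚ p) IsSumOver-S∞ (λ w → c *ₚ f w)
IsSum-* {p} {f} c S = record
  { support = support S ; distinct-ws = distinct-ws S
  ; vanishes = λ w w∉ → transₚ (*-congₚ reflₚ (vanishes S w w∉)) (R.zeroʳ c)
  ; equals = transₚ (*-congₚ reflₚ (equals S)) (symₚ (∑-* (support S) c f)) }

IsSum-sub : ∀ {p f} ρ → p IsSumOver-S∞ f → (sub ρ p) IsSumOver-S∞ (sub ρ ∘ f)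
IsSum-sub {p} {f} ρ S = record
  { support = support S ; distinct-ws = distinct-ws S
  ; vanishes = λ w w∉ → sub-cong ρ (vanishes S w w∉)
  ; equals = transₚ (sub-cong ρ (equals S)) (≡⇒≈ₚ (sub-∑ ρ (support S) f)) }

IsSum-reindex : ∀ {p f} (g h : S∞ → S∞) → (∀ {u v} → u ≈ v → g u ≈ g v) → (∀ {u v} → u ≈ v → h u ≈ h v) →
  (∀ w → g (h w) ≈ w) → (∀ w → h (g w) ≈ w) → Respects-S∞ f → p IsSumOver-S∞ f → p IsSumOver-S∞ (f ∘ g)
IsSum-reindex {p} {f} g h g-cong h-cong gh hg resp S = record
  { support = map h (support S)
  ; distinct-ws = SetoidUniqueₚ.map⁺ S∞-setoid S∞-setoid h-injective (distinct-ws S)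
  ; vanishes = λ w w∉ → vanishes S (g w) λ gw∈ → w∉
      (SetoidMembershipₚ.∈-resp-≈ S∞-setoid (hg w) (SetoidMembershipₚ.∈-map⁺ S∞-setoid S∞-setoid h-cong gw∈))
  ; equals = transₚ (equals S) (transₚ (∑-cong (support S) λ {w} _ → resp (≈-sym (gh w)))
      (≡⇒≈ₚ (sym (∑-map h (support S) (f ∘ g)))))
  }
  where
  h-injective : ∀ {u v} → h u ≈ h v → u ≈ v
  h-injective {u} {v} e = ≈-trans (≈-sym (gh u)) (≈-trans (g-cong e) (gh v))

-- The Pieri formula

𝔖-lower-cong : ∀ i {u v} → u ≈ v → 𝔖-lower i u ≈ₚ 𝔖-lower i v
𝔖-lower-cong i {u} {v} e = cases (ascent⊎descent (u ⁻¹) i)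
  where
  cases : Ascent (u ⁻¹) i ⊎ Descent (u ⁻¹) i → 𝔖-lower i u ≈ₚ 𝔖-lower i v
  cases (inj₁ asc) = transₚ (𝔖-lower-ascent i u asc)
    (symₚ (𝔖-lower-ascent i v (ascent-cong i (⁻¹-cong e) asc)))
  cases (inj₂ des) = transₚ (𝔖-lower-descent i u des) (transₚ (𝔖-cong {s i ∙ u} {s i ∙ v} (∙-congˡ (s i) e))
    (symₚ (𝔖-lower-descent i v (descent-cong i (⁻¹-cong e) des))))

regroup : ∀ a b h q → a *ₚ q +ₚ b *ₚ (h *ₚ q) ≈ₚ (a +ₚ h *ₚ b) *ₚ q
regroup = solve 4 (λ a b h q → a :* q :+ b :* (h :* q) := (a :+ h :* b) :* q) reflₚ
  where open ℤSolver

distribute : ∀ a b h q → (a +ₚ h *ₚ b) *ₚ q ≈ₚ a *ₚ q +ₚ h *ₚ (b *ₚ q)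
distribute = solve 4 (λ a b h q → (a :+ h :* b) :* q := a :* q :+ h :* (b :* q)) reflₚ
  where open ℤSolver

-- The contribution of column j, of height k, to a dominant Schubert polynomial in x and z.
elementary : ℕ → ℕ → ℤ[x,y,z]
elementary k j = Π k λ i → x i -ₚ z j

pieriTerm : ℕ → ℕ → S∞ → S∞ → ℤ[x,y,z]
pieriTerm k j u w = D k j u w *ₚ 𝔖 w

pieriSum : ℕ → ℕ → S∞ → ℤ[x,y,z]
pieriSum k j u = ∑ (elements (successors k u)) (pieriTerm k j u)

D-outside : ∀ k j u w → ¬ w Perm.∈ elements (successors k u) → D k j u w ≈ₚ 0ₚ
D-outside k j u w w∉ = ≡⇒≈ₚ (D-no j (w∉ ∘ complete (successors k u) ∘ Pieri⇒⟶))

pieriSum-IsSum : ∀ k j u → pieriSum k j u IsSumOver-S∞ pieriTerm k j u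
pieriSum-IsSum k j u = ∑-IsSum (unique (successors k u))
  λ w w∉ → transₚ (*-congₚ (D-outside k j u w w∉) reflₚ) (R.zeroˡ (𝔖 w))

pieriTerm-respects : ∀ k j u → Respects-S∞ (pieriTerm k j u)
pieriTerm-respects k j u e = *-congₚ (D-cong k j (≈-refl {u}) e) (𝔖-cong e)

module _ (k j i : ℕ) (u : S∞) where
  private
    η : ℤ[x,y,z]
    η = yroot i
    h₁ h₂ h₂′ : S∞ → ℤ[x,y,z]
    h₁ w  = actY i (D k j u w) *ₚ 𝔖 w
    h₂ w  = actY i (D k j u w) *ₚ (η *ₚ 𝔖-lower i w)
    h₂′ w = h₂ (s i ∙ w)

    actY-D-cong : ∀ {w w′} → w ≈ w′ → actY i (D k j u w) ≈ₚ actY i (D k j u w′)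
    actY-D-cong e = actY-cong i (D-cong k j (≈-refl {u}) e)

    h₁-respects : Respects-S∞ h₁
    h₁-respects e = *-congₚ (actY-D-cong e) (𝔖-cong e)

    h₂-respects : Respects-S∞ h₂
    h₂-respects e = *-congₚ (actY-D-cong e) (*-congₚ reflₚ (𝔖-lower-cong i e))

    outside : ∀ w q → ¬ w Perm.∈ elements (successors k u) → actY i (D k j u w) *ₚ q ≈ₚ 0ₚ
    outside w q w∉ = transₚ (*-congₚ (actY-cong i (D-outside k j u w w∉)) reflₚ) (R.zeroˡ q)

    L : List S∞
    L = elements (successors k u)

  -- The family on the right is regrouped: the second part of the term at w is
  -- moved to s_i w, whose Schubert polynomial it multiplies.
  actY-pieriSum : actY i (pieriSum k j u) IsSumOver-S∞ (λ w → h₁ w +ₚ h₂′ w)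
  actY-pieriSum = IsSum-resp
    (symₚ (transₚ (≡⇒≈ₚ (sub-∑ _ L (pieriTerm k j u))) (transₚ
      (∑-cong L λ {w} _ → transₚ (*-congₚ reflₚ (actY-𝔖 i w)) (distribₚ (actY i (D k j u w)) (𝔖 w) (η *ₚ 𝔖-lower i w)))
      (∑-+ L h₁ h₂))))
    (IsSum-+ h₁-respects (λ e → h₂-respects (∙-congˡ (s i) e))
      (∑-IsSum {L} {h₁} (unique (successors k u)) λ w → outside w (𝔖 w))
      (IsSum-reindex {∑ L h₂} (s i ∙_) (s i ∙_) (∙-congˡ (s i)) (∙-congˡ (s i)) (λ w → s∙s∙ w i) (λ w → s∙s∙ w i) h₂-respects
        (∑-IsSum {L} {h₂} (unique (successors k u)) λ w → outside w (η *ₚ 𝔖-lower i w))))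

  h₂′-ascent : ∀ w → Ascent (w ⁻¹) i → h₁ w +ₚ h₂′ w ≈ₚ (actY i (D k j u w) +ₚ η *ₚ actY i (D k j u (s i ∙ w))) *ₚ 𝔖 w
  h₂′-ascent w asc = transₚ (+-congₚ reflₚ (*-congₚ reflₚ (*-congₚ reflₚ
      (transₚ (𝔖-lower-descent i (s i ∙ w) (ascent-∙s (w ⁻¹) i asc)) (𝔖-cong {s i ∙ (s i ∙ w)} {w} (s∙s∙ w i))))))
    (regroup (actY i (D k j u w)) (actY i (D k j u (s i ∙ w))) η (𝔖 w))

  h₂′-descent : ∀ w → Descent (w ⁻¹) i → h₁ w +ₚ h₂′ w ≈ₚ actY i (D k j u w) *ₚ 𝔖 w
  h₂′-descent w des = transₚ (+-congₚ reflₚ (transₚ (*-congₚ reflₚ (transₚ (*-congₚ reflₚ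
      (𝔖-lower-ascent i (s i ∙ w) (descent-∙s (w ⁻¹) i des))) (R.zeroʳ η))) (R.zeroʳ (actY i (D k j u (s i ∙ w))))))
    (R.+-identityʳ (h₁ w))

  actY-pieriSum-ascent : Ascent (u ⁻¹) i → actY i (pieriSum k j u) ≈ₚ pieriSum k j u
  actY-pieriSum-ascent u↑ = IsSum-unique (pieriTerm-respects k j u)
    (IsSum-cong (λ w → cases w (ascent⊎descent (w ⁻¹) i)) actY-pieriSum) (pieriSum-IsSum k j u)
    where
    cases : ∀ w → Ascent (w ⁻¹) i ⊎ Descent (w ⁻¹) i → h₁ w +ₚ h₂′ w ≈ₚ pieriTerm k j u w
    cases w (inj₁ w↑) = transₚ (h₂′-ascent w w↑) (*-congₚ (D-↑↑ k j i u w u↑ w↑) reflₚ)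
    cases w (inj₂ w↓) = transₚ (h₂′-descent w w↓) (*-congₚ (D-↑↓ k j i u w u↑ w↓) reflₚ)

  actY-pieriSum-descent : Descent (u ⁻¹) i →
    actY i (pieriSum k j u) ≈ₚ pieriSum k j u +ₚ η *ₚ pieriSum k j (s i ∙ u)
  actY-pieriSum-descent u↓ = IsSum-unique
    (λ e → +-congₚ (pieriTerm-respects k j u e) (*-congₚ reflₚ (pieriTerm-respects k j (s i ∙ u) e)))
    (IsSum-cong (λ w → cases w (ascent⊎descent (w ⁻¹) i)) actY-pieriSum)
    (IsSum-+ (pieriTerm-respects k j u) (λ e → *-congₚ reflₚ (pieriTerm-respects k j (s i ∙ u) e))
      (pieriSum-IsSum k j u) (IsSum-* η (pieriSum-IsSum k j (s i ∙ u))))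
    where
    spread : ∀ w → (D k j u w +ₚ η *ₚ D k j (s i ∙ u) w) *ₚ 𝔖 w ≈ₚ
      pieriTerm k j u w +ₚ η *ₚ pieriTerm k j (s i ∙ u) w
    spread w = distribute (D k j u w) (D k j (s i ∙ u) w) η (𝔖 w)
    cases : ∀ w → Ascent (w ⁻¹) i ⊎ Descent (w ⁻¹) i →
      h₁ w +ₚ h₂′ w ≈ₚ pieriTerm k j u w +ₚ η *ₚ pieriTerm k j (s i ∙ u) w
    cases w (inj₁ w↑) = transₚ (h₂′-ascent w w↑) (transₚ (*-congₚ (D-↓↑ k j i u w u↓ w↑) reflₚ) (spread w))
    cases w (inj₂ w↓) = transₚ (h₂′-descent w w↓) (transₚ (*-congₚ (D-↓↓ k j i u w u↓ w↓) reflₚ) (spread w))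

-- Reduces the specialisation y = x to localisation at 𝟙, where the vanishing of 𝔖_u is known.
sub-y↦x : ∀ p → sub (y↦ x) p ≈ₚ sub (y↦ x) (ev 𝟙 p)
sub-y↦x p = symₚ (sub-comp _ _ (λ { (X _) → reflₚ ; (Y _) → reflₚ ; (Z _) → reflₚ }) p)

y↦x-𝔖-≉𝟙 : ∀ u → ¬ u ≈ 𝟙 → sub (y↦ x) (𝔖 u) ≈ₚ 0ₚ
y↦x-𝔖-≉𝟙 u u≉𝟙 = transₚ (sub-y↦x (𝔖 u)) (sub-cong (y↦ x) (ev-𝔖-≉𝟙 u u≉𝟙))

-- `tight` gives ℓ(u) + k = fixedCount ≤ k, which leaves no room for a descent.
Pieri-𝟙 : ∀ {k u} → PieriBruhat k u 𝟙 → u ≈ 𝟙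
Pieri-𝟙 {k} {u} C with descent? u
... | inj₂ u≈𝟙      = u≈𝟙
... | inj₁ (i , des) = contradiction (begin
  suc k                       ≤⟨ s≤s (m≤n+m k (ℓ (u ∙ s i))) ⟩
  suc (ℓ (u ∙ s i)) + k       ≡⟨ cong (_+ k) (sym (ℓ-descent u i des)) ⟩
  ℓ u + k                     ≡⟨ tight C ⟩
  fixedCount k u 𝟙            ≤⟨ Σℕ-mono k (λ p _ → same?-≤1 (u ⟨$⟩ p) p) ⟩
  Σℕ k (λ _ → 1)              ≡⟨ Σℕ-const k ⟩
  k                           ∎) 1+n≰n
  where open ≤-Reasoning

-- At y = x only the term of 𝔖_𝟙 can survive. It occurs only for u = 𝟙, where all positions are
-- fixed and the weight ∏ (y_p - z_j) becomes ∏ (x_p - z_j).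
y↦x-pieri : ∀ k j u → sub (y↦ x) (𝔖 u *ₚ elementary k j) ≈ₚ sub (y↦ x) (pieriSum k j u)
y↦x-pieri k j u with u ≈? 𝟙
... | no u≉𝟙 = transₚ (*-congₚ (y↦x-𝔖-≉𝟙 u u≉𝟙) reflₚ) (transₚ (R.zeroˡ _) (symₚ
    (transₚ (≡⇒≈ₚ (sub-∑ (y↦ x) L (pieriTerm k j u))) (∑-zero L λ {w} _ → term w))))
  where
  L : List S∞
  L = elements (successors k u)
  term : ∀ w → sub (y↦ x) (pieriTerm k j u w) ≈ₚ 0ₚ
  term w with w ≈? 𝟙
  ... | no w≉𝟙  = transₚ (*-congₚ reflₚ (y↦x-𝔖-≉𝟙 w w≉𝟙)) (R.zeroʳ _)
  ... | yes w≈𝟙 = transₚ (*-congₚ (sub-cong (y↦ x) (≡⇒≈ₚ (D-no {k} j {u} {w} λ C → u≉𝟙 (Pieri-𝟙 (Pieri-resp ≈-refl w≈𝟙 C))))) reflₚ) (R.zeroˡ _)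
... | yes u≈𝟙 = transₚ (*-congₚ (sub-cong (y↦ x) (𝔖-𝟙 {u} u≈𝟙)) elementary-fixed) (transₚ (*-identityₚ _)
    (IsSum-unique respects single (IsSum-sub (y↦ x) (pieriSum-IsSum k j u))))
  where
  elementary-fixed : sub (y↦ x) (elementary k j) ≈ₚ elementary k j
  elementary-fixed = ≡⇒≈ₚ (sub-Π (y↦ x) k _)
  respects : Respects-S∞ (sub (y↦ x) ∘ pieriTerm k j u)
  respects e = sub-cong (y↦ x) (pieriTerm-respects k j u e)
  C : ∀ {w} → w ≈ 𝟙 → PieriBruhat k u w
  C {w} e = Bruhat-refl k u≈w & cong₂ _+_ (ℓ-cong u≈w) (sym (fixedCount-≈ k u≈w))
    where
    u≈w : u ≈ w
    u≈w = ≈-trans u≈𝟙 (≈-sym e)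
  D-𝟙 : sub (y↦ x) (D k j u 𝟙) ≈ₚ elementary k j
  D-𝟙 = transₚ (sub-cong (y↦ x) (≡⇒≈ₚ (D-yes {k} j {u} {𝟙} (C ≈-refl)))) (transₚ (≡⇒≈ₚ (sub-Π (y↦ x) k _))
    (Π-cong k λ p _ → sub-cong (y↦ x) (≡⇒≈ₚ (trans (factor-≡ j (at u≈𝟙 p)) (cong (λ m → y m -ₚ z j) (at u≈𝟙 p))))))
  single : elementary k j IsSumOver-S∞ (sub (y↦ x) ∘ pieriTerm k j u)
  single = record
    { support = 𝟙 ∷ []
    ; distinct-ws = [] ∷ []
    ; vanishes = λ w w∉ → transₚ (*-congₚ reflₚ (y↦x-𝔖-≉𝟙 w (w∉ ∘ here))) (R.zeroʳ (sub (y↦ x) (D k j u w)))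
    ; equals = symₚ (transₚ (R.+-identityʳ _) (transₚ (*-congₚ D-𝟙 (sub-cong (y↦ x) (𝔖-𝟙 (≈-refl {𝟙})))) (R.*-identityʳ (elementary k j))))
    }

-- The difference of the two sides is symmetric in the y_i by induction on ℓ u,
-- and it vanishes under y = x.
pieri : ∀ k j u → 𝔖 u *ₚ elementary k j ≈ₚ pieriSum k j u
pieri k j u = go (ℓ u) u refl
  where
  open ≈ₚ-Reasoning
  open ℤSolver
  E : ℤ[x,y,z]
  E = elementary k j
  actY-E : ∀ i → actY i E ≈ₚ E
  actY-E i = ≡⇒≈ₚ (sub-Π _ k _)
  go : ∀ n u → ℓ u ≡ n → 𝔖 u *ₚ E ≈ₚ pieriSum k j u
  symmetric : ∀ n u → ℓ u ≡ n → ∀ i → Ascent (u ⁻¹) i ⊎ Descent (u ⁻¹) i →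
    actY i (𝔖 u *ₚ E -ₚ pieriSum k j u) ≈ₚ 𝔖 u *ₚ E -ₚ pieriSum k j u
  symmetric n u ℓ≡ i (inj₁ asc) = +-congₚ
    (*-congₚ (transₚ (actY-𝔖 i u) (transₚ (+-congₚ reflₚ (transₚ (*-congₚ reflₚ (𝔖-lower-ascent i u asc)) (R.zeroʳ (yroot i))))
      (R.+-identityʳ (𝔖 u)))) (actY-E i))
    (-‿congₚ (actY-pieriSum-ascent k j i u asc))
  symmetric zero    u ℓ≡ i (inj₂ des) = contradiction (trans (sym (ℓ-left-descent u i des)) ℓ≡) λ ()
  symmetric (suc n) u ℓ≡ i (inj₂ des) = begin
    actY i (𝔖 u) *ₚ actY i E -ₚ actY i (pieriSum k j u)
      ≈⟨ +-congₚ (*-congₚ (transₚ (actY-𝔖 i u) (+-congₚ reflₚ (*-congₚ reflₚ (𝔖-lower-descent i u des)))) (actY-E i))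
                 (-‿congₚ (actY-pieriSum-descent k j i u des)) ⟩
    (𝔖 u +ₚ yroot i *ₚ 𝔖 (s i ∙ u)) *ₚ E -ₚ (pieriSum k j u +ₚ yroot i *ₚ pieriSum k j (s i ∙ u))
      ≈⟨ +-congₚ reflₚ (-‿congₚ (+-congₚ reflₚ (*-congₚ reflₚ
           (symₚ (go n (s i ∙ u) (suc-injective (trans (sym (ℓ-left-descent u i des)) ℓ≡))))))) ⟩
    (𝔖 u +ₚ yroot i *ₚ 𝔖 (s i ∙ u)) *ₚ E -ₚ (pieriSum k j u +ₚ yroot i *ₚ (𝔖 (s i ∙ u) *ₚ E))
      ≈⟨ solve 5 (λ a b h q c → (a :+ h :* b) :* q :- (c :+ h :* (b :* q)) := a :* q :- c) reflₚ
           (𝔖 u) (𝔖 (s i ∙ u)) (yroot i) E (pieriSum k j u) ⟩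
    𝔖 u *ₚ E -ₚ pieriSum k j u ∎
  go n u ℓ≡ = begin
    𝔖 u *ₚ E
      ≈⟨ solve 2 (λ a b → a := (a :- b) :+ b) reflₚ (𝔖 u *ₚ E) (pieriSum k j u) ⟩
    (𝔖 u *ₚ E -ₚ pieriSum k j u) +ₚ pieriSum k j u
      ≈⟨ +-congₚ (symₚ (symmetric⇒y-free λ i → symmetric n u ℓ≡ i (ascent⊎descent (u ⁻¹) i))) reflₚ ⟩
    sub (y↦ x) (𝔖 u *ₚ E -ₚ pieriSum k j u) +ₚ pieriSum k j u
      ≈⟨ +-congₚ (transₚ (+-congₚ (y↦x-pieri k j u) reflₚ) (R.-‿inverseʳ (sub (y↦ x) (pieriSum k j u)))) reflₚ ⟩
    0ₚ +ₚ pieriSum k j u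
      ≈⟨ +-identityₚ (pieriSum k j u) ⟩
    pieriSum k j u ∎

-- Sums over paths

module ≋ = DecSetoid path-decSetoid
open FiniteSum path-decSetoid using () renaming (∑-independent to ∑-independent-paths)
open SetoidUnique path-setoid using () renaming (Unique to Unique-paths)

weight-cong : ∀ k j {u u′ w w′} → u ≈ u′ → w ≈ w′ → weight k u w j ≈ₚ weight k u′ w′ j
weight-cong k j {u} {u′} {w} {w′} e f = transₚ (weight-W k u w j) (transₚ (W-cong k j e f) (symₚ (weight-W k u′ w′ j)))

pathWeight-cong : ∀ j ks {us us′} → Pointwise _≈_ us us′ → pathWeight j ks us ≈ₚ pathWeight j ks us′
pathWeight-cong j []       es           = reflₚ
pathWeight-cong j (k ∷ ks) []           = reflₚ
pathWeight-cong j (k ∷ ks) (e ∷ [])     = reflₚ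
pathWeight-cong j (k ∷ ks) (e ∷ f ∷ es) = *-congₚ (weight-cong k j e f) (pathWeight-cong (suc j) ks (f ∷ es))

-- `d` with the index of the first z as a parameter, so that removing the first step stays within
-- the family; `d` is the case j = 0.
dFrom : ℕ → List ℕ → S∞ → S∞ → ℤ[x,y,z]
dFrom j ks u w = ∑ (elements (paths ks u w)) (pathWeight j ks)

IsPath-respʳ : ∀ {w w′ ks u us} → w ≈ w′ → IsPath w ks u us → IsPath w′ ks u us
IsPath-respʳ e (stop a b)   = stop a (≈-trans b e)
IsPath-respʳ e (step a r P) = step a r (IsPath-respʳ e P)

dFrom-cong : ∀ j ks {u u′ w w′} → u ≈ u′ → w ≈ w′ → dFrom j ks u w ≈ₚ dFrom j ks u′ w′
dFrom-cong j ks {u} {u′} {w} {w′} e f = ∑-independent-paths (pathWeight-cong j ks)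
  (unique (paths ks u w)) (unique (paths ks u′ w′))
  (λ us∈ → inj₁ (complete (paths ks u′ w′) (IsPath-respʳ f (IsPath-resp e ≋.refl (sound (paths ks u w) us∈)))))
  (λ us∈ → inj₁ (complete (paths ks u w)
    (IsPath-respʳ (≈-sym f) (IsPath-resp (≈-sym e) ≋.refl (sound (paths ks u′ w′) us∈)))))

dFrom-[]-≈ : ∀ j {u w} → u ≈ w → dFrom j [] u w ≈ₚ 1ₚ
dFrom-[]-≈ j {u} {w} e with u ≈? w
... | yes _ = R.+-identityʳ 1ₚ
... | no ¬e = contradiction e ¬e

path-head : ∀ {w ks u us} → IsPath w ks u us → ∃[ v ] ∃[ vs ] us ≡ v ∷ vs × u ≈ v
path-head (stop a _)   = _ , _ , refl , a
path-head (step a _ _) = _ , _ , refl , a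

∑-concat : ∀ {A : Set} (ass : List (List A)) (f : A → ℤ[x,y,z]) → ∑ (concat ass) f ≈ₚ ∑ ass (λ as → ∑ as f)
∑-concat []         f = reflₚ
∑-concat (as ∷ ass) f = transₚ (∑-++ as (concat ass) f) (+-congₚ reflₚ (∑-concat ass f))

module _ (j k : ℕ) (ks : List ℕ) (u w : S∞) where
  private
    L : List S∞
    L = elements (successors k u)

    extend : S∞ → List (List S∞)
    extend u₁ = map (u ∷_) (elements (paths ks u₁ w))

    path-sound : ∀ {u₁ us} → us ∈ elements (paths ks u₁ w) → IsPath w ks u₁ us
    path-sound {u₁} us∈ = sound (paths ks u₁ w) (Any.map (λ { refl → ≋.refl }) us∈)

    second : ∀ {u₁ us} → us PathMembership.∈ extend u₁ → ∃[ v ] ∃[ vs ] Pointwise _≈_ us (u ∷ v ∷ vs) × u₁ ≈ v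
    second us∈ with find us∈
    ... | _ , p∈ , e with ∈-map⁻ (u ∷_) p∈
    ...   | _ , q∈ , refl with path-head (path-sound q∈)
    ...     | v , vs , refl , a = v , vs , e , a

    disjoint : ∀ {u₁ u₂} → ¬ u₁ ≈ u₂ → Disjoint (extend u₁) (extend u₂)
    disjoint ne (p∈ , q∈) with second p∈ | second q∈
    ... | _ , _ , (_ ∷ e ∷ _) , a | _ , _ , (_ ∷ f ∷ _) , b =
      ne (≈-trans a (≈-trans (≈-sym e) (≈-trans f (≈-sym b))))

    unique-extend : ∀ u₁ → Unique-paths (extend u₁)
    unique-extend u₁ = SetoidUniqueₚ.map⁺ path-setoid path-setoid (λ { (_ ∷ es) → es }) (unique (paths ks u₁ w))

    unique-all : Unique-paths (concatMap extend L)
    unique-all = SetoidUniqueₚ.concat⁺ path-setoid (Allₚ.map⁺ (All.tabulate λ {u₁} _ → unique-extend u₁))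
      (AllPairsₚ.map⁺ (AllPairs.map disjoint (unique (successors k u))))

    first-step : ∀ {u₁ us} → us ∈ elements (paths ks u₁ w) →
      pathWeight j (k ∷ ks) (u ∷ us) ≈ₚ weight k u u₁ j *ₚ pathWeight (suc j) ks us
    first-step {u₁} us∈ with path-head (path-sound us∈)
    ... | v , vs , refl , a = *-congₚ (weight-cong k j {u} {u} {v} {u₁} ≈-refl (≈-sym a)) reflₚ

  -- A path determines its second permutation up to `≈`, so the extensions of distinct successors
  -- are disjoint and the deduplication in `paths` loses no term.
  dFrom-∷ : dFrom j (k ∷ ks) u w ≈ₚ ∑ L (λ u₁ → weight k u u₁ j *ₚ dFrom (suc j) ks u₁ w)
  dFrom-∷ = begin
    dFrom j (k ∷ ks) u w
      ≈⟨ ∑-independent-paths (pathWeight-cong j (k ∷ ks)) (unique (paths (k ∷ ks) u w)) unique-all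
           (λ us∈ → inj₁ (SetoidMembershipₚ.∈-deduplicate⁻ path-setoid ≋._≟_ (concatMap extend L) us∈))
           (λ us∈ → inj₁ (SetoidMembershipₚ.∈-deduplicate⁺ path-setoid ≋._≟_ (λ b≈c a≈b → ≋.trans a≈b (≋.sym b≈c)) us∈)) ⟩
    ∑ (concatMap extend L) (pathWeight j (k ∷ ks))
      ≈⟨ ∑-concat (map extend L) (pathWeight j (k ∷ ks)) ⟩
    ∑ (map extend L) (λ as → ∑ as (pathWeight j (k ∷ ks)))
      ≈⟨ ≡⇒≈ₚ (∑-map extend L (λ as → ∑ as (pathWeight j (k ∷ ks)))) ⟩
    ∑ L (λ u₁ → ∑ (extend u₁) (pathWeight j (k ∷ ks)))
      ≈⟨ ∑-cong L (λ {u₁} _ → transₚ (≡⇒≈ₚ (∑-map (u ∷_) (elements (paths ks u₁ w)) (pathWeight j (k ∷ ks))))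
           (transₚ (∑-cong (elements (paths ks u₁ w)) first-step)
             (∑-* (elements (paths ks u₁ w)) (weight k u u₁ j) (pathWeight (suc j) ks)))) ⟩
    ∑ L (λ u₁ → weight k u u₁ j *ₚ dFrom (suc j) ks u₁ w) ∎
    where open ≈ₚ-Reasoning

eProduct : ℕ → List ℕ → ℤ[x,y,z]
eProduct j []       = 1ₚ
eProduct j (k ∷ ks) = elementary k j *ₚ eProduct (suc j) ks

attach : ∀ {w k ks u u₁ us} → u ⟶[ k ] u₁ → IsPath w ks u₁ us → IsPath w (k ∷ ks) u (u ∷ us)
attach r P@(stop a _)   = step ≈-refl (⟶-resp ≈-refl a r) (IsPath-resp a ≋.refl P)
attach r P@(step a _ _) = step ≈-refl (⟶-resp ≈-refl a r) (IsPath-resp a ≋.refl P)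

successor-sound : ∀ {k u u₁} → u₁ ∈ elements (successors k u) → u ⟶[ k ] u₁
successor-sound {k} {u} u₁∈ = sound (successors k u) (Any.map (λ { refl → ≈-refl }) u₁∈)

-- The list L is fixed throughout the recursion, so that all inner sums run over the same w and the
-- two summations can be interchanged. It only has to contain every endpoint.
pieri-paths : ∀ ks j u {L} → Unique-S∞ L → (∀ {w us} → IsPath w ks u us → w Perm.∈ L) →
  𝔖 u *ₚ eProduct j ks ≈ₚ ∑ L (λ w → dFrom j ks u w *ₚ 𝔖 w)
pieri-paths [] j u {L} uniq covers = begin
  𝔖 u *ₚ 1ₚ                      ≈⟨ *-commₚ (𝔖 u) 1ₚ ⟩
  1ₚ *ₚ 𝔖 u                      ≈⟨ *-congₚ (symₚ (dFrom-[]-≈ j {u} {u} ≈-refl)) reflₚ ⟩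
  dFrom j [] u u *ₚ 𝔖 u          ≈⟨ symₚ (R.+-identityʳ (dFrom j [] u u *ₚ 𝔖 u)) ⟩
  ∑ (u ∷ []) f                   ≈⟨ ∑-independent-S∞ {f} (λ {a} {b} e → *-congₚ (dFrom-cong j [] (≈-refl {u}) e) (𝔖-cong {a} {b} e)) ([] ∷ []) uniq to back ⟩
  ∑ L f                          ∎
  where
  open ≈ₚ-Reasoning hiding (stop)
  f : S∞ → ℤ[x,y,z]
  f w = dFrom j [] u w *ₚ 𝔖 w
  to : ∀ {a} → a Perm.∈ u ∷ [] → a Perm.∈ L ⊎ f a ≈ₚ 0ₚ
  to (here e) = inj₁ (covers (stop ≈-refl (≈-sym e)))
  back : ∀ {a} → a Perm.∈ L → a Perm.∈ u ∷ [] ⊎ f a ≈ₚ 0ₚ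
  back {a} _ with u ≈? a
  ... | yes e = inj₁ (here (≈-sym e))
  ... | no ¬e = inj₂ (R.zeroˡ (𝔖 a))
pieri-paths (k ∷ ks) j u {L} uniq covers = begin
  𝔖 u *ₚ (elementary k j *ₚ E)                             ≈⟨ symₚ (*-assocₚ (𝔖 u) (elementary k j) E) ⟩
  (𝔖 u *ₚ elementary k j) *ₚ E                             ≈⟨ *-congₚ (pieri k j u) reflₚ ⟩
  ∑ S (pieriTerm k j u) *ₚ E                               ≈⟨ transₚ (*-commₚ _ E) (symₚ (∑-* S E (pieriTerm k j u))) ⟩
  ∑ S (λ u₁ → E *ₚ pieriTerm k j u u₁)                     ≈⟨ ∑-cong S inner ⟩
  ∑ S (λ u₁ → ∑ L (λ w → c u₁ w *ₚ 𝔖 w))                   ≈⟨ ∑-swap S L (λ u₁ w → c u₁ w *ₚ 𝔖 w) ⟩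
  ∑ L (λ w → ∑ S (λ u₁ → c u₁ w *ₚ 𝔖 w))                   ≈⟨ ∑-cong L (λ {w} _ → outer w) ⟩
  ∑ L (λ w → dFrom j (k ∷ ks) u w *ₚ 𝔖 w)                  ∎
  where
  open ≈ₚ-Reasoning
  E : ℤ[x,y,z]
  E = eProduct (suc j) ks
  S : List S∞
  S = elements (successors k u)
  c : S∞ → S∞ → ℤ[x,y,z]
  c u₁ w = weight k u u₁ j *ₚ dFrom (suc j) ks u₁ w
  rotate : ∀ a b e → e *ₚ (a *ₚ b) ≈ₚ a *ₚ (b *ₚ e)
  rotate = solve 3 (λ a b e → e :* (a :* b) := a :* (b :* e)) reflₚ
    where open ℤSolver
  D-weight : ∀ {u₁} → u₁ ∈ S → D k j u u₁ ≈ₚ weight k u u₁ j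
  D-weight {u₁} u₁∈ = transₚ (≡⇒≈ₚ (D-yes {k} j {u} {u₁} (⟶⇒Pieri (successor-sound u₁∈)))) (symₚ (weight-W k u u₁ j))
  inner : ∀ {u₁} → u₁ ∈ S → E *ₚ pieriTerm k j u u₁ ≈ₚ ∑ L (λ w → c u₁ w *ₚ 𝔖 w)
  inner {u₁} u₁∈ = begin
    E *ₚ (D k j u u₁ *ₚ 𝔖 u₁)                                           ≈⟨ rotate (D k j u u₁) (𝔖 u₁) E ⟩
    D k j u u₁ *ₚ (𝔖 u₁ *ₚ E)
      ≈⟨ *-congₚ (D-weight u₁∈) (pieri-paths ks (suc j) u₁ uniq λ P → covers (attach (successor-sound u₁∈) P)) ⟩
    weight k u u₁ j *ₚ ∑ L (λ w → dFrom (suc j) ks u₁ w *ₚ 𝔖 w)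
      ≈⟨ symₚ (∑-* L (weight k u u₁ j) (λ w → dFrom (suc j) ks u₁ w *ₚ 𝔖 w)) ⟩
    ∑ L (λ w → weight k u u₁ j *ₚ (dFrom (suc j) ks u₁ w *ₚ 𝔖 w))
      ≈⟨ ∑-cong L (λ {w} _ → symₚ (*-assocₚ (weight k u u₁ j) (dFrom (suc j) ks u₁ w) (𝔖 w))) ⟩
    ∑ L (λ w → c u₁ w *ₚ 𝔖 w) ∎
  outer : ∀ w → ∑ S (λ u₁ → c u₁ w *ₚ 𝔖 w) ≈ₚ dFrom j (k ∷ ks) u w *ₚ 𝔖 w
  outer w = begin
    ∑ S (λ u₁ → c u₁ w *ₚ 𝔖 w)   ≈⟨ ∑-cong S (λ {u₁} _ → *-commₚ (c u₁ w) (𝔖 w)) ⟩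
    ∑ S (λ u₁ → 𝔖 w *ₚ c u₁ w)   ≈⟨ ∑-* S (𝔖 w) (λ u₁ → c u₁ w) ⟩
    𝔖 w *ₚ ∑ S (λ u₁ → c u₁ w)   ≈⟨ *-congₚ reflₚ (symₚ (dFrom-∷ j k ks u w)) ⟩
    𝔖 w *ₚ dFrom j (k ∷ ks) u w  ≈⟨ *-commₚ (𝔖 w) (dFrom j (k ∷ ks) u w) ⟩
    dFrom j (k ∷ ks) u w *ₚ 𝔖 w  ∎

endpoints : List ℕ → S∞ → List S∞
endpoints []       u = u ∷ []
endpoints (k ∷ ks) u = concatMap (endpoints ks) (elements (successors k u))

endpoints-complete : ∀ ks u {w us} → IsPath w ks u us → w Perm.∈ endpoints ks u
endpoints-complete []       u (stop a b)   = here (≈-sym (≈-trans a b))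
endpoints-complete (k ∷ ks) u (step a r P) with find (complete (successors k u) (⟶-resp (≈-sym a) ≈-refl r))
... | v , v∈ , u₁≈v with find (endpoints-complete ks v (IsPath-resp u₁≈v ≋.refl P))
...   | w′ , w′∈ , w≈w′ = Any.map (λ { refl → w≈w′ }) (∈-concatMap⁺ (endpoints ks) (lose v∈ w′∈))

module _ (ks : List ℕ) (u : S∞) where
  private
    L : List S∞
    L = deduplicate _≈?_ (endpoints ks u)

    covers : ∀ {w us} → IsPath w ks u us → w Perm.∈ L
    covers P = SetoidMembershipₚ.∈-deduplicate⁺ S∞-setoid _≈?_ (λ b≈c a≈b → ≈-trans a≈b (≈-sym b≈c))
      (endpoints-complete ks u P)

  d-outside : ∀ w → ¬ w Perm.∈ L → d u ks w ≈ₚ 0ₚ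
  d-outside w w∉ = ∑-zero (elements (paths ks u w)) λ us∈ →
    contradiction (covers (sound (paths ks u w) (Any.map (λ { refl → ≋.refl }) us∈))) w∉

  product-IsSum : (𝔖 u *ₚ eProduct 0 ks) IsSumOver-S∞ (λ w → d u ks w *ₚ 𝔖 w)
  product-IsSum = record
    { support     = L
    ; distinct-ws = deduplicate-! S∞-decSetoid (endpoints ks u)
    ; vanishes    = λ w w∉ → transₚ (*-congₚ (d-outside w w∉) reflₚ) (R.zeroˡ (𝔖 w))
    ; equals      = pieri-paths ks 0 u (deduplicate-! S∞-decSetoid (endpoints ks u)) covers
    }

-- The product formula

foldr-∂-0 : ∀ r → foldr ∂ 0ₚ r ≈ₚ 0ₚ
foldr-∂-0 []      = reflₚ
foldr-∂-0 (i ∷ r) = transₚ (∂-cong i (foldr-∂-0 r)) (∂-0 i)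

foldr-∂-+ : ∀ r p q → foldr ∂ (p +ₚ q) r ≈ₚ foldr ∂ p r +ₚ foldr ∂ q r
foldr-∂-+ []      p q = reflₚ
foldr-∂-+ (i ∷ r) p q = transₚ (∂-cong i (foldr-∂-+ r p q)) (∂-+ i (foldr ∂ p r) (foldr ∂ q r))

foldr-∂-∑ : ∀ {A : Set} r (as : List A) (f : A → ℤ[x,y,z]) → foldr ∂ (∑ as f) r ≈ₚ ∑ as (λ a → foldr ∂ (f a) r)
foldr-∂-∑ r []       f = foldr-∂-0 r
foldr-∂-∑ r (a ∷ as) f = transₚ (foldr-∂-+ r (f a) (∑ as f)) (+-congₚ reflₚ (foldr-∂-∑ r as f))

foldr-∂-scale : ∀ {c} r → All (λ i → act i c ≈ₚ c) r → ∀ p → foldr ∂ (c *ₚ p) r ≈ₚ c *ₚ foldr ∂ p r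
foldr-∂-scale []      _        p = reflₚ
foldr-∂-scale (i ∷ r) (e ∷ es) p = transₚ (∂-cong i (foldr-∂-scale r es p)) (∂-scale i e (foldr ∂ p r))

foldr-∂-IsSum : ∀ {p f} r → p IsSumOver-S∞ f → foldr ∂ p r IsSumOver-S∞ (λ w → foldr ∂ (f w) r)
foldr-∂-IsSum {p} {f} r S = record
  { support     = support S
  ; distinct-ws = distinct-ws S
  ; vanishes    = λ w w∉ → transₚ (foldr-∂-cong r (vanishes S w w∉)) (foldr-∂-0 r)
  ; equals      = transₚ (foldr-∂-cong r (equals S)) (foldr-∂-∑ r (support S) f)
  }

∂-rename-z : ∀ j p → ∂ j (rename y↦z p) ≈ₚ rename y↦z (∂ j p)
∂-rename-z j p = ∂-unique j (transₚ (sub-cong (var ∘ y↦z) (∂-spec j p))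
  (+-congₚ reflₚ (-‿congₚ (transₚ
    (sub-comp (var ∘ y↦z) (var ∘ sVar j) {λ { (X k) → x (s j ⟨$⟩ k) ; (Y k) → z k ; (Z k) → z k }}
      (λ { (X _) → reflₚ ; (Y _) → reflₚ ; (Z _) → reflₚ }) p)
    (symₚ (sub-comp (var ∘ sVar j) (var ∘ y↦z) (λ { (X _) → reflₚ ; (Y _) → reflₚ ; (Z _) → reflₚ }) p))))))

foldr-∂-rename-z : ∀ r p → rename y↦z (foldr ∂ p r) ≈ₚ foldr ∂ (rename y↦z p) r
foldr-∂-rename-z []      p = reflₚ
foldr-∂-rename-z (i ∷ r) p = transₚ (symₚ (∂-rename-z i (foldr ∂ p r))) (∂-cong i (foldr-∂-rename-z r p))

-- A letter that raises the length is undone by its divided difference, and one that lowers it gives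
-- 0. The resulting dichotomy is the case distinction in the definition of `e`.
word-𝔖 : ∀ r w → (ℓ (w ∙ wordProduct r) ≡ ℓ w + length r × foldr ∂ (𝔖 (w ∙ wordProduct r)) r ≈ₚ 𝔖 w) ⊎
                  (ℓ (w ∙ wordProduct r) ≢ ℓ w + length r × foldr ∂ (𝔖 (w ∙ wordProduct r)) r ≈ₚ 0ₚ)
word-𝔖 [] w = inj₁ (trans (ℓ-≗ (w ∙ 𝟙) w λ _ → refl) (sym (+-identityʳ (ℓ w))) ,
  𝔖-cong {w ∙ 𝟙} {w} (pointwise λ _ → refl))
word-𝔖 (i ∷ r) w = cases (ascent⊎descent w i) (word-𝔖 r ws)
  where
  ws wsr wr : S∞
  ws  = w ∙ s i
  wsr = ws ∙ wordProduct r
  wr  = w ∙ (s i ∙ wordProduct r)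
  ℓ≡ : ℓ wr ≡ ℓ wsr
  ℓ≡ = ℓ-≗ wr wsr λ _ → refl
  unfold : ∀ {q} → foldr ∂ (𝔖 wsr) r ≈ₚ q → foldr ∂ (𝔖 wr) (i ∷ r) ≈ₚ ∂ i q
  unfold e = ∂-cong i (transₚ (foldr-∂-cong r (𝔖-cong {wr} {wsr} (pointwise λ _ → refl))) e)
  cases : Ascent w i ⊎ Descent w i → _ → (ℓ wr ≡ ℓ w + suc (length r) × foldr ∂ (𝔖 wr) (i ∷ r) ≈ₚ 𝔖 w) ⊎
                  (ℓ wr ≢ ℓ w + suc (length r) × foldr ∂ (𝔖 wr) (i ∷ r) ≈ₚ 0ₚ)
  cases (inj₁ asc) (inj₁ (e , f)) = inj₁
    ( trans ℓ≡ (trans e (trans (cong (_+ length r) (ℓ-ascent w i asc)) (sym (+-suc (ℓ w) (length r)))))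
    , transₚ (unfold f) (transₚ (𝔖-descent ws i (ascent-∙s w i asc)) (𝔖-cong {ws ∙ s i} {w} (∙s∙s w i))) )
  cases (inj₁ asc) (inj₂ (ne , f)) = inj₂
    ( (λ e → ne (trans (sym ℓ≡) (trans e (trans (+-suc (ℓ w) (length r)) (cong (_+ length r) (sym (ℓ-ascent w i asc)))))))
    , transₚ (unfold f) (∂-0 i) )
  cases (inj₂ des) ih = inj₂ (too-short ,
      [ (λ (_ , f) → transₚ (unfold f) (𝔖-ascent ws i (descent-∙s w i des)))
      , (λ (_ , f) → transₚ (unfold f) (∂-0 i)) ]′ ih)
    where
    too-short : ℓ wr ≢ ℓ w + suc (length r)
    too-short e = <⇒≢ (begin-strict
      ℓ wr                       ≡⟨ ℓ≡ ⟩
      ℓ wsr                      ≤⟨ ℓ-∙word-≤ ws r ⟩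
      ℓ ws + length r            <⟨ s≤s (+-monoʳ-≤ (ℓ ws) (n≤1+n (length r))) ⟩
      suc (ℓ ws) + suc (length r) ≡⟨ cong (_+ suc (length r)) (sym (ℓ-descent w i des)) ⟩
      ℓ w + suc (length r)       ∎) e
      where open ≤-Reasoning

ℓ-∙-≤ : ∀ u w → ℓ (u ∙ w) ≤ ℓ u + ℓ w
ℓ-∙-≤ u w = begin
  ℓ (u ∙ w)                    ≡⟨ ℓ-cong (∙-congˡ u (≈-sym (product≈ r))) ⟩
  ℓ (u ∙ wordProduct (word r)) ≤⟨ ℓ-∙word-≤ u (word r) ⟩
  ℓ u + length (word r)        ≡⟨ cong (ℓ u +_) (reduced r) ⟩
  ℓ u + ℓ w                    ∎
  where
  open ≤-Reasoning
  r : ReducedWord w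
  r = reducedWord w

-- From v to its dominant approximation

record Climb (p : ℕ) (v m : S∞) : Set where
  field
    letters   : List ℕ
    below     : All (_< p) letters
    product   : m ≈ v ∙ wordProduct letters
    additive  : ℓ m ≡ ℓ v + length letters
    reached   : 𝔖 v ≈ₚ foldr ∂ (𝔖 m) letters
    dominated : Dominant m

increasing-after : ∀ v {p} → (∀ i → p < i → Ascent v i) → ∀ {a b} → p < a → a < b → v ⟨$⟩ a < v ⟨$⟩ b
increasing-after v inc {a} {suc b} p<a (s≤s a≤b) with m≤n⇒m<n∨m≡n a≤b
... | inj₁ a<b  = <-trans (increasing-after v inc p<a a<b) (inc b (<-trans p<a a<b))
... | inj₂ refl = inc a p<a

code-after : ∀ v {p} → (∀ i → p < i → Ascent v i) → ∀ {i} → p < i → code v i ≡ 0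
code-after v inc {i} p<i with elements (codeSet v i) in eq
... | []    = refl
... | j ∷ _ with sound (codeSet v i) (subst (j ∈_) (sym eq) (here refl))
...   | i<j , lt = contradiction lt (<-asym (increasing-after v inc p<i i<j))

-- Positions after p have code 0, so c_i < c_{i+1} forces i + 1 ≤ p. Multiplication by s_i then
-- leaves the values after p alone, and the hypothesis persists.
climb : ∀ {p v m} → (∀ i → p < i → Ascent v i) → v ⇝ m → Climb p v m
climb {v = v} inc (dominant dom) = record
  { letters = [] ; below = [] ; product = pointwise λ _ → refl ; additive = sym (+-identityʳ (ℓ v))
  ; reached = reflₚ ; dominated = dom }
climb {p} {v} {m} inc (step {i = i} (c< , _) v⇝m) = record
  { letters   = i ∷ letters
  ; below     = i<p ∷ below
  ; product   = ≈-trans product (pointwise λ _ → refl)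
  ; additive  = trans additive (trans (cong (_+ length letters) (ℓ-ascent v i asc)) (sym (+-suc (ℓ v) (length letters))))
  ; reached   = transₚ (symₚ (transₚ (𝔖-descent (v ∙ s i) i (ascent-∙s v i asc)) (𝔖-cong {v ∙ s i ∙ s i} {v} (∙s∙s v i))))
                  (∂-cong i reached)
  ; dominated = dominated
  }
  where
  asc : Ascent v i
  asc = code-ascent v i c<
  i<p : i < p
  i<p with <-≤-connex i p
  ... | inj₁ lt  = lt
  ... | inj₂ p≤i = contradiction (subst (code v i <_) (code-after v inc (s≤s p≤i)) c<) λ ()
  inc′ : ∀ j → p < j → Ascent (v ∙ s i) j
  inc′ j p<j = subst₂ _<_
    (cong (v ⟨$⟩_) (sym (s-other i (<⇒≢ i<j ∘ sym) (<⇒≢ (≤-<-trans i<p p<j) ∘ sym))))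
    (cong (v ⟨$⟩_) (sym (s-other i (<⇒≢ (m<n⇒m<1+n i<j) ∘ sym) (<⇒≢ (s≤s i<j) ∘ sym))))
    (inc j p<j)
    where
    i<j : i < j
    i<j = <-trans i<p p<j
  open Climb (climb inc′ v⇝m)

-- Rows and columns of a dominant code

Π-* : ∀ n f g → Π n (λ i → f i *ₚ g i) ≈ₚ Π n f *ₚ Π n g
Π-* zero    f g = symₚ (*-identityₚ 1ₚ)
Π-* (suc n) f g = transₚ (*-congₚ reflₚ (Π-* n (f ∘ suc) (g ∘ suc)))
  (solve 4 (λ a b c d → (a :* b) :* (c :* d) := (a :* c) :* (b :* d)) reflₚ
    (f 0) (g 0) (Π n (f ∘ suc)) (Π n (g ∘ suc)))
  where open ℤSolver

Π-exchange : ∀ n m (f : ℕ → ℕ → ℤ[x,y,z]) → Π n (λ i → Π m (f i)) ≈ₚ Π m (λ j → Π n (λ i → f i j))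
Π-exchange zero    m f = symₚ (Π-≈1 m λ _ _ → reflₚ)
Π-exchange (suc n) m f = transₚ (*-congₚ reflₚ (Π-exchange n m (f ∘ suc)))
  (symₚ (Π-* m (f 0) (λ j → Π n (λ i → f (suc i) j))))

guard : ∀ {A : Set} → Dec A → ℤ[x,y,z] → ℤ[x,y,z]
guard a? p = if does a? then p else 1ₚ

guard-⇔ : ∀ {A B : Set} (a? : Dec A) (b? : Dec B) → (A → B) → (B → A) → ∀ p → guard a? p ≡ guard b? p
guard-⇔ (yes a) b? f _ p = sym (if-yes b? (f a))
guard-⇔ (no ¬a) b? _ g p = sym (if-no b? (¬a ∘ g))

Π-guard : ∀ {n m} → n ≤ m → ∀ f → Π m (λ i → guard (i <? n) (f i)) ≈ₚ Π n f
Π-guard {n} {m} n≤m f = transₚ (≡⇒≈ₚ (cong (λ k → Π k g) (sym (m∸n+n≡m n≤m)))) (transₚ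
  (Π-extend (m ∸ n) n λ i n≤i → ≡⇒≈ₚ (if-no (i <? n) (≤⇒≯ n≤i)))
  (Π-cong n λ i i<n → ≡⇒≈ₚ (if-yes (i <? n) i<n)))
  where
  g : ℕ → ℤ[x,y,z]
  g i = guard (i <? n) (f i)

module _ (m : S∞) (dom : Dominant m) where

  code-antitone : ∀ {i j} → i ≤ j → code m j ≤ code m i
  code-antitone {i} {zero}  z≤n = ≤-refl
  code-antitone {i} {suc j} i≤1+j with m≤n⇒m<n∨m≡n i≤1+j
  ... | inj₁ (s≤s i≤j) = ≤-trans (dom j) (code-antitone i≤j)
  ... | inj₂ refl      = ≤-refl

  column : ℕ → ℕ
  column j = size (columnSet m j)

  -- The code is weakly decreasing, so the rows longer than j form an initial segment, of size
  -- `column j`. With `column-sound` this is conjugation of partitions.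
  column-complete : ∀ {i j} → j < code m i → i < column j
  column-complete {i} {j} j<c = subst (_≤ column j) (length-upTo (suc i))
    (length-⊆ (Unique≡ₚ.upTo⁺ (suc i)) λ i′∈ →
      complete (columnSet m j) (<-≤-trans j<c (code-antitone (≤-pred (∈-upTo⁻ i′∈)))))

  column-sound : ∀ {i j} → i < column j → j < code m i
  column-sound {i} {j} i< = ≰⇒> λ c≤j → <⇒≱ i< (subst (column j ≤_) (length-upTo i)
    (length-⊆ (unique (columnSet m j)) λ {i′} i′∈ →
      ∈-upTo⁺ (≰⇒> λ i≤i′ → <⇒≱ (sound (columnSet m j) i′∈) (≤-trans (code-antitone i≤i′) c≤j))))

  column-≤ : ∀ j → column j ≤ bound m
  column-≤ j = ≮⇒≥ λ lt → contradiction (column-sound lt)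
    (≤⇒≯ (≤-trans (≤-reflexive (code-zero m (bound m) (fixes m) (bound m) ≤-refl)) z≤n))

  -- Both products are padded by ones to a full rectangle, where the order of multiplication can be
  -- exchanged.
  transpose : ∀ (f : ℕ → ℕ → ℤ[x,y,z]) →
    Π (bound m) (λ i → Π (code m i) (f i)) ≈ₚ Π (code m 0) (λ j → Π (column j) (λ i → f i j))
  transpose f = begin
    Π (bound m) (λ i → Π (code m i) (f i))
      ≈⟨ Π-cong (bound m) (λ i _ → symₚ (Π-guard (code-antitone z≤n) (f i))) ⟩
    Π (bound m) (λ i → Π (code m 0) (λ j → guard (j <? code m i) (f i j)))
      ≈⟨ Π-exchange (bound m) (code m 0) (λ i j → guard (j <? code m i) (f i j)) ⟩
    Π (code m 0) (λ j → Π (bound m) (λ i → guard (j <? code m i) (f i j)))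
      ≈⟨ Π-cong (code m 0) (λ j _ → transₚ
           (Π-cong (bound m) λ i _ → ≡⇒≈ₚ (guard-⇔ (j <? code m i) (i <? column j) column-complete column-sound (f i j)))
           (Π-guard (column-≤ j) (λ i → f i j))) ⟩
    Π (code m 0) (λ j → Π (column j) (λ i → f i j)) ∎
    where open ≈ₚ-Reasoning

eProduct-applyUpTo : ∀ n (f g : ℕ → ℕ) j →
  eProduct j (map f (applyUpTo g n)) ≈ₚ Π n (λ m → elementary (f (g m)) (m + j))
eProduct-applyUpTo zero    f g j = reflₚ
eProduct-applyUpTo (suc n) f g j = *-congₚ reflₚ (transₚ (eProduct-applyUpTo n f (g ∘ suc) (suc j))
  (Π-cong n λ m _ → ≡⇒≈ₚ (cong (elementary (f (g (suc m)))) (+-suc m j))))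

-- The same boxes are read by rows in `𝔖-dominant` and by columns in `eProduct`, which pairs the
-- j-th part of λ(v) with z_j.
𝔖-dominant-z : ∀ v → Dominant (μ v) → rename y↦z (𝔖 (μ v)) ≈ₚ eProduct 0 λ[ v ]
𝔖-dominant-z v dom = begin
  rename y↦z (𝔖 m)                                        ≈⟨ sub-cong (var ∘ y↦z) (𝔖-dominant m dom) ⟩
  rename y↦z (shape (bound m) (code m))
    ≈⟨ transₚ (≡⇒≈ₚ (sub-Π (var ∘ y↦z) (bound m) _)) (Π-cong (bound m) λ i _ → ≡⇒≈ₚ (sub-Π (var ∘ y↦z) (code m i) _)) ⟩
  Π (bound m) (λ i → Π (code m i) (λ j → x i -ₚ z j))      ≈⟨ transpose m dom (λ i j → x i -ₚ z j) ⟩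
  Π (code m 0) (λ j → elementary (column m dom j) j)
    ≈⟨ Π-cong (code m 0) (λ j _ → ≡⇒≈ₚ (cong (elementary (column m dom j)) (sym (+-identityʳ j)))) ⟩
  Π (code m 0) (λ j → elementary (column m dom j) (j + 0)) ≈⟨ symₚ (eProduct-applyUpTo (code m 0) (column m dom) id 0) ⟩
  eProduct 0 λ[ v ]                                        ∎
  where
  open ≈ₚ-Reasoning
  m : S∞
  m = μ v

longer⇒ascent : ∀ u i → ℓ u < ℓ (u ∙ s i) → Ascent u i
longer⇒ascent u i lt with ascent⊎descent u i
... | inj₁ asc = asc
... | inj₂ des = contradiction (≤-trans (n≤1+n _) (≤-reflexive (sym (ℓ-descent u i des)))) (<⇒≱ lt)

e-additive : ∀ u v w → ℓ (w ∙ v ⁻¹ ∙ μ v) ≡ ℓ w + ℓ (v ⁻¹ ∙ μ v) → e u v w ≡ d u λ[ v ] (w ∙ v ⁻¹ ∙ μ v)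
e-additive u v w = if-yes (ℓ (w ∙ v ⁻¹ ∙ μ v) ≟ ℓ w + ℓ (v ⁻¹ ∙ μ v))

e-nonadditive : ∀ u v w → ℓ (w ∙ v ⁻¹ ∙ μ v) ≢ ℓ w + ℓ (v ⁻¹ ∙ μ v) → e u v w ≡ 0ₚ
e-nonadditive u v w = if-no (ℓ (w ∙ v ⁻¹ ∙ μ v) ≟ ℓ w + ℓ (v ⁻¹ ∙ μ v))

theorem3p1 : (u v : S∞) →
    (∃[ p ] ((∀ i → i < p → ℓ u < ℓ (u ∙ s i)) × (∀ i → p < i → ℓ v < ℓ (v ∙ s i)))) →
    (𝔖 u *ₚ 𝔖xz v) IsSumOver-S∞ (λ w → e u v w *ₚ 𝔖 w)
theorem3p1 u v (p , u-long , v-long) = IsSum-resp (symₚ product≈sum) (IsSum-cong matches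
    (IsSum-reindex g h (λ e → ∙-congʳ (μ v) (∙-congʳ (v ⁻¹) e)) (∙-congʳ (q ⁻¹))
      (λ w → pointwise λ k → cong (w ⟨$⟩_) (u⁻¹u q k)) (λ w → pointwise λ k → cong (w ⟨$⟩_) (uu⁻¹ q k))
      F-respects (IsSum-cong scaled (foldr-∂-IsSum r (product-IsSum λ[ v ] u)))))
  where
  open Climb (climb (λ i p<i → longer⇒ascent v i (v-long i p<i)) (proj₂ (dominantApproximation v)))
    renaming (letters to r)
  q : S∞
  q = v ⁻¹ ∙ μ v
  -- The divided differences along r carry the term at `g w` of the expansion of 𝔖_u 𝔖_{μ_v} to a
  -- multiple of 𝔖_w, so the sum is reindexed by g.
  g h : S∞ → S∞
  g w = w ∙ v ⁻¹ ∙ μ v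
  h w = w ∙ q ⁻¹
  F : S∞ → ℤ[x,y,z]
  F w = d u λ[ v ] w *ₚ foldr ∂ (𝔖 w) r
  F-respects : Respects-S∞ F
  F-respects {a} {b} eq = *-congₚ (dFrom-cong 0 λ[ v ] (≈-refl {u}) eq) (foldr-∂-cong r (𝔖-cong {a} {b} eq))
  -- Path weights contain no x, so the coefficients pass through the divided differences.
  d-invariant : ∀ i w → act i (d u λ[ v ] w) ≈ₚ d u λ[ v ] w
  d-invariant i w = transₚ (≡⇒≈ₚ (sub-∑ (var ∘ sVar i) (elements (paths λ[ v ] u w)) (pathWeight 0 λ[ v ])))
    (∑-cong (elements (paths λ[ v ] u w)) λ {us} _ → invariant 0 λ[ v ] us)
    where
    invariant-∏ : ∀ j as → act i (∏ as (λ a → y a -ₚ z j)) ≈ₚ ∏ as (λ a → y a -ₚ z j)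
    invariant-∏ j []       = reflₚ
    invariant-∏ j (a ∷ as) = *-congₚ reflₚ (invariant-∏ j as)
    invariant : ∀ j ks us → act i (pathWeight j ks us) ≈ₚ pathWeight j ks us
    invariant j []       us            = reflₚ
    invariant j (k ∷ ks) []            = reflₚ
    invariant j (k ∷ ks) (_ ∷ [])      = reflₚ
    invariant j (k ∷ ks) (a ∷ b ∷ us)  = *-congₚ (invariant-∏ j (P k a b)) (invariant (suc j) ks (b ∷ us))
  scaled : ∀ w → foldr ∂ (d u λ[ v ] w *ₚ 𝔖 w) r ≈ₚ F w
  scaled w = foldr-∂-scale r (All.tabulate λ {i} _ → d-invariant i w) (𝔖 w)
  q≈ : q ≈ wordProduct r
  q≈ = pointwise λ k → trans (cong (v ⁻¹ ⟨$⟩_) (at product k)) (u⁻¹u v (wordProduct r ⟨$⟩ k))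
  -- The letters form a reduced word of q: ℓ(v) + |r| = ℓ(μ_v) = ℓ(v q) ≤ ℓ(v) + ℓ(q), and |r| ≥
  -- ℓ(q) for any word of q.
  length-r : length r ≡ ℓ q
  length-r = ≤-antisym
    (+-cancelˡ-≤ (ℓ v) _ _ (≤-trans (≤-reflexive (trans (sym additive)
      (ℓ-≗ (μ v) (v ∙ q) λ k → sym (uu⁻¹ v (μ v ⟨$⟩ k))))) (ℓ-∙-≤ v q)))
    (≤-trans (≤-reflexive (ℓ-cong q≈)) (ℓ-word-≤ r))
  g≈ : ∀ w → g w ≈ w ∙ wordProduct r
  g≈ w = pointwise λ k → cong (w ⟨$⟩_) (at q≈ k)
  𝔖-g : ∀ w → foldr ∂ (𝔖 (g w)) r ≈ₚ foldr ∂ (𝔖 (w ∙ wordProduct r)) r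
  𝔖-g w = foldr-∂-cong r (𝔖-cong {g w} {w ∙ wordProduct r} (g≈ w))
  ℓ-g : ∀ w → ℓ (g w) ≡ ℓ (w ∙ wordProduct r)
  ℓ-g w = ℓ-cong (g≈ w)
  matches : ∀ w → F (g w) ≈ₚ e u v w *ₚ 𝔖 w
  matches w = cases (word-𝔖 r w)
    where
    cases : _ → F (g w) ≈ₚ e u v w *ₚ 𝔖 w
    cases (inj₁ (eq , f)) = *-congₚ
      (≡⇒≈ₚ (sym (e-additive u v w (trans (ℓ-g w) (trans eq (cong (ℓ w +_) length-r))))))
      (transₚ (𝔖-g w) f)
    cases (inj₂ (ne , f)) = transₚ (*-congₚ reflₚ (transₚ (𝔖-g w) f)) (transₚ (R.zeroʳ (d u λ[ v ] (g w)))
      (symₚ (transₚ (*-congₚ (≡⇒≈ₚ (e-nonadditive u v w λ eq →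
        ne (trans (sym (ℓ-g w)) (trans eq (cong (ℓ w +_) (sym length-r)))))) reflₚ) (R.zeroˡ (𝔖 w)))))
  product≈sum : 𝔖 u *ₚ 𝔖xz v ≈ₚ foldr ∂ (𝔖 u *ₚ eProduct 0 λ[ v ]) r
  product≈sum = transₚ
    (*-congₚ reflₚ (transₚ (sub-cong (var ∘ y↦z) reached) (transₚ (foldr-∂-rename-z r (𝔖 (μ v)))
      (foldr-∂-cong r (𝔖-dominant-z v dominated)))))
    (symₚ (foldr-∂-scale r
      (All.map (λ {i} i<p → invariant-from-∂ i (𝔖-ascent u i (longer⇒ascent u i (u-long i i<p)))) below)
      (eProduct 0 λ[ v ])))
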